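{- Let $\lambda=(r^s)$ be a rectangular partition and let $\mu,\nu$ be partitions. Then $\langle J_\mu J_\nu,J_\lambda\rangle\neq0$ if and only if $\nu\subset\lambda$ and $\mu=\overline{\nu}:=(r^s)-'\nu$. Furthermore, in this case $$\langle J_\mu J_\nu,J_\lambda\rangle=h_*^\mu(\mu)\,h^*_\nu(\nu)\,h_1^\lambda(\mu)\,h_2^\lambda(\nu),$$ where $$h_1^\lambda(\mu)=\prod_{(i,j)\in\mu}\big[(\mu'_j-i)+\alpha(r-j+1)\big],\qquad h_2^\lambda(\nu)=\prod_{(i,j)\in\nu}\big[(s-i+1)+\alpha(j-1)\big].$$
   Context: Work in $\Lambda_F$, $F=\mathbb{Q}(\alpha)$, with scalar product $\langle p_\lambda,p_\mu\rangle=\delta_{\lambda\mu}z_\lambda\alpha^{l(\lambda)}$. The Jack functions $P_\lambda$ (parameter $\alpha$) are unitriangular in the monomial basis with respect to dominance order and pairwise orthogonal. For a box $s=(i,j)$ of $\lambda$, let $a(s)=\lambda_i-j$ (arm) and $l(s)=\lambda'_j-i$ (leg). Define the lower hook length $h_*^\lambda(s)=\alpha a(s)+l(s)+1$ and the upper hook length $h^*_\lambda(s)=\alpha(a(s)+1)+l(s)$. For a set $S$ of boxes write $h_*^\lambda(S)=\prod_{s\in S}h_*^\lambda(s)$, and similarly for $h^*_\lambda(S)$. The integral Jack function is $J_\lambda=h_*^\lambda(\lambda)P_\lambda$. Boxes of $\mu$ are $(i,j)$ with $1\le j\le\mu_i$, and $\mu'$ is the conjugate partition. For $\nu\subset(r^s)$,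 pad $\nu$ to $(\nu_1,\dots,\nu_s)$ with zeros and set $(r^s)-'\nu=(r-\nu_s,\dots,r-\nu_1)$, with zero parts dropped. -}

module Defs where

open import Data.Nat as ℕ using (ℕ; zero; suc; _∸_; _≤ᵇ_; _≡ᵇ_; _^_; _!)
open import Data.Integer as ℤ using (ℤ; +_)
open import Data.Bool using (Bool; true; false; T; if_then_else_; _∧_)
open import Data.List using (List; []; _∷_; _++_; map; concatMap; foldr; upTo; length; replicate; reverse; take)
open import Data.Bool.ListAction using (and)
open import Data.Nat.ListAction using (sum; product)
open import Data.List.Relation.Unary.All using (All)
open import Data.Product using (_×_; _,_; proj₁; proj₂)
open import Relation.Binary.PropositionalEquality using (_≡_; _≢_)
open import Relation.Nullary using (¬_)

-- The field F = ℚ(α), realised as Frac(ℤ[α]) (same field).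
-- Polynomials in α: lists of integer coefficients, lowest degree first.

Poly : Set
Poly = List ℤ

infixl 6 _+P_
infixl 7 _*P_

_+P_ : Poly → Poly → Poly
[] +P q = q
(a ∷ p) +P [] = a ∷ p
(a ∷ p) +P (b ∷ q) = (a ℤ.+ b) ∷ (p +P q)

negP : Poly → Poly
negP = map (λ x → ℤ.- x)

scaleP : ℤ → Poly → Poly
scaleP c = map (c ℤ.*_)

_*P_ : Poly → Poly → Poly
[] *P q = []
(a ∷ p) *P q = scaleP a q +P ((+ 0) ∷ (p *P q))

IsZeroP : Poly → Set
IsZeroP p = All (_≡ + 0) p

_≈P_ : Poly → Poly → Set
p ≈P q = IsZeroP (p +P negP q)

oneP : Poly
oneP = + 1 ∷ []

linP : ℕ → ℕ → Poly
linP a b = + a ∷ + b ∷ []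

productP : List Poly → Poly
productP = foldr _*P_ oneP

record RF : Set where
  constructor _/_
  field
    num : Poly
    den : Poly
open RF public

ValidRF : RF → Set
ValidRF x = ¬ IsZeroP (den x)

infixl 6 _+F_
infixl 7 _*F_
infix 4 _≈F_

_+F_ : RF → RF → RF
(a / b) +F (c / d) = (a *P d +P c *P b) / (b *P d)

_*F_ : RF → RF → RF
(a / b) *F (c / d) = (a *P c) / (b *P d)

_≈F_ : RF → RF → Set
x ≈F y = (num x *P den y) ≈P (num y *P den x)

fromP : Poly → RF
fromP p = p / oneP

0F 1F αF : RF
0F = [] / oneP
1F = oneP / oneP
αF = fromP (+ 0 ∷ + 1 ∷ [])

fromℕF : ℕ → RF
fromℕF n = fromP (+ n ∷ [])

powF : RF → ℕ → RF
powF x zero = 1F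
powF x (suc n) = x *F powF x n

sumF : List RF → RF
sumF = foldr _+F_ 0F

isPartitionᵇ : List ℕ → Bool
isPartitionᵇ [] = true
isPartitionᵇ (x ∷ []) = 1 ≤ᵇ x
isPartitionᵇ (x ∷ y ∷ xs) = (y ≤ᵇ x) ∧ isPartitionᵇ (y ∷ xs)

record Partition : Set where
  constructor mkPartition
  field
    parts : List ℕ
    valid : T (isPartitionᵇ parts)
open Partition public

-- λ_i (1-indexed; λ_i = 0 for i > ℓ(λ); the value at i = 0 is unused)
part : List ℕ → ℕ → ℕ
part [] _ = 0
part (x ∷ xs) zero = 0
part (x ∷ xs) (suc zero) = x
part (x ∷ xs) (suc (suc i)) = part xs (suc i)

conjPart : List ℕ → ℕ → ℕ
conjPart [] j = 0
conjPart (x ∷ xs) j = if j ≤ᵇ x then suc (conjPart xs j) else conjPart xs j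

boxesFrom : ℕ → List ℕ → List (ℕ × ℕ)
boxesFrom i [] = []
boxesFrom i (x ∷ xs) = map (λ j → (i , suc j)) (upTo x) ++ boxesFrom (suc i) xs

boxes : List ℕ → List (ℕ × ℕ)
boxes = boxesFrom 1

arm leg : List ℕ → ℕ × ℕ → ℕ
arm l (i , j) = part l i ∸ j
leg l (i , j) = conjPart l j ∸ i

hookLower : List ℕ → Poly
hookLower l = productP (map (λ b → linP (suc (leg l b)) (arm l b)) (boxes l))

hookUpper : List ℕ → Poly
hookUpper l = productP (map (λ b → linP (leg l b) (suc (arm l b))) (boxes l))

h₁ : ℕ → List ℕ → Poly
h₁ r l = productP (map (λ { (i , j) → linP (conjPart l j ∸ i) (suc r ∸ j) }) (boxes l))

h₂ : ℕ → List ℕ → Poly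
h₂ s l = productP (map (λ { (i , j) → linP (suc s ∸ i) (j ∸ 1) }) (boxes l))

dropZeros : List ℕ → List ℕ
dropZeros [] = []
dropZeros (zero ∷ xs) = dropZeros xs
dropZeros (suc x ∷ xs) = suc x ∷ dropZeros xs

rect : ℕ → ℕ → List ℕ
rect r s = dropZeros (replicate s r)

complement : ℕ → ℕ → List ℕ → List ℕ
complement r s ν = dropZeros (map (r ∸_) (reverse (ν ++ replicate (s ∸ length ν) 0)))

_⊆ᴾ_ : Partition → Partition → Set
ν ⊆ᴾ κ = ∀ i → part (parts ν) i ℕ.≤ part (parts κ) i

_⊴_ : Partition → Partition → Set
μ ⊴ κ = (sum (parts μ) ≡ sum (parts κ)) × (∀ k → sum (take k (parts μ)) ℕ.≤ sum (take k (parts κ)))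

-- Λ_F: finite F-linear combinations of power sums p_a
-- (a term (c , a) stands for c · p_a, a a list of positive integers
--  read as a multiset, i.e. a partition in some order).

Sym : Set
Sym = List (RF × List ℕ)

WellFormed : Sym → Set
WellFormed f = All (λ t → ValidRF (proj₁ t) × All (1 ℕ.≤_) (proj₂ t)) f

_⊙_ : Sym → Sym → Sym
f ⊙ g = concatMap (λ t → map (λ u → (proj₁ t *F proj₁ u , proj₂ t ++ proj₂ u)) g) f

scaleS : RF → Sym → Sym
scaleS k = map (λ t → (k *F proj₁ t , proj₂ t))

occ : ℕ → List ℕ → ℕ
occ i [] = 0
occ i (x ∷ xs) = if i ≡ᵇ x then suc (occ i xs) else occ i xs

sameMultisetᵇ : List ℕ → List ℕ → Bool
sameMultisetᵇ a b = and (map (λ i → occ i a ≡ᵇ occ i b) (upTo (suc (sum a ℕ.+ sum b))))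

zee : List ℕ → ℕ
zee a = product (map (λ i → (suc i ^ occ (suc i) a) ℕ.* (occ (suc i) a) !) (upTo (sum a)))

⟪_,_⟫ : Sym → Sym → RF
⟪ f , g ⟫ = sumF (concatMap (λ t → map (λ u →
   if sameMultisetᵇ (proj₂ t) (proj₂ u)
   then proj₁ t *F proj₁ u *F fromℕF (zee (proj₂ t)) *F powF αF (length (proj₂ t))
   else 0F) g) f)

-- coefficient of x^v (v an exponent vector) in p_a:
-- number of ways to send each part of a to a variable so that exponents add up to v
placements : ℕ → List ℕ → List (List ℕ)
placements x [] = []
placements x (y ∷ ys) =
  (if x ≤ᵇ y then ((y ∸ x) ∷ ys) ∷ [] else []) ++ map (y ∷_) (placements x ys)

countAssign : List ℕ → List ℕ → ℕ
countAssign [] v = if and (map (_≡ᵇ 0) v) then 1 else 0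
countAssign (x ∷ xs) v = sum (map (countAssign xs) (placements x v))

monoCoeff : Partition → Sym → RF
monoCoeff μ f = sumF (map (λ t → proj₁ t *F fromℕF (countAssign (proj₂ t) (parts μ))) f)

record IsJackFamily (P : Partition → Sym) : Set where
  field
    wellFormed : ∀ κ → WellFormed (P κ)
    leading    : ∀ κ → monoCoeff κ (P κ) ≈F 1F
    triangular : ∀ κ μ → ¬ (μ ⊴ κ) → monoCoeff μ (P κ) ≈F 0F
    orthogonal : ∀ κ μ → parts κ ≢ parts μ → ⟪ P κ , P μ ⟫ ≈F 0F

Jint : (Partition → Sym) → Partition → Sym
Jint P κ = scaleS (fromP (hookLower (parts κ))) (P κ)

{-# OPTIONS --safe #-}
-- Let g_v = ∏ g_{v_i} be the basis dual to the monomials.  The Laplace–Beltrami operator D is self-adjoint and acts on the g_v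
-- triangularly, so the Jack functions are its eigenfunctions.  This gives two reductions: g_m^⊥ P_κ = P_σ if σ is κ without its first
-- row m, and e_n P_σ = P_κ modulo functions vanishing in n variables if σ is κ without its first column, of length n.  With the
-- commutators U and V of D with p_1 and its adjoint they yield the support of the Pieri rule for p_1, and evaluation at p_k = X then
-- gives the norm of P_κ as a quotient of hook products.
--
-- For a rectangle, suppose ⟨P_μ P_ν, P_λ⟩ ≠ 0.  If μ or ν fills the first row or the first column of λ, the coefficient is reduced to
-- a smaller rectangle; its value follows by the same induction.  Otherwise let w be the part of P_μ^⊥ P_λ spanned by the P_κ strictly
-- inside λ.  As λ has only one removable corner, V P_λ is a multiple of p_1^⊥ P_λ, whence p_1^⊥ w = 0 and V w = 0; then every
-- p_k^⊥ annihilates w, and w = 0.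
module Submission where

open import Defs
open import Level using (0ℓ)
open import Algebra.Bundles using (CommutativeRing; RawRing)
open import Data.Bool using (Bool; true; false; T; if_then_else_)
open import Data.Bool.ListAction using (and)
open import Data.Bool.Properties using (T-irrelevant)
open import Data.Empty using (⊥; ⊥-elim)
open import Data.Integer as ℤ using (ℤ)
import Data.Integer.Properties as ℤP
open import Data.List using (List; []; _∷_; map; concatMap; length; take; replicate; reverse; applyUpTo; upTo; _++_; _∷ʳ_)
open import Data.List.Membership.Propositional using (_∈_)
open import Data.List.Membership.Propositional.Properties using (∈-++⁺ˡ; ∈-++⁺ʳ; ∈-++⁻; ∈-map⁺; ∈-map⁻)
import Data.List.Properties as ListP
open import Data.List.Relation.Unary.All as All using (All; []; _∷_)
open import Data.List.Relation.Unary.All.Properties using (++⁺)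
open import Data.List.Relation.Unary.Any using (here; there)
open import Data.Nat as ℕ using (ℕ; zero; suc; z≤n; s≤s; _∸_; _≤ᵇ_; _≡ᵇ_)
open import Data.Nat.ListAction using (sum; product)
import Data.Nat.Properties as ℕP
open import Data.Product using (Σ; _×_; _,_; proj₁; proj₂)
open import Data.Sum using (_⊎_; inj₁; inj₂)
open import Data.Unit using (⊤; tt)
open import Function.Bundles using (_⇔_; mk⇔)
open import Relation.Nullary using (¬_; Dec; yes; no)
open import Relation.Nullary.Decidable using (T?)
open import Relation.Binary using (tri<; tri≈; tri>)
import Relation.Binary.PropositionalEquality as ≡
open ≡ using (_≡_; _≢_)
import Relation.Binary.Reasoning.Setoid as SetoidReasoning

-- Two difficulties shape the proof. Incomparable partitions can share an eigenvalue of D, so an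
-- eigenvalue equation never identifies a function alone; it always comes with a bound on the
-- support, whence the down-closed sets of partitions throughout. And no Pieri coefficient is
-- computed. Between P_σ and P_κ the operator U equals p_1 times the content of the added box, so
-- pairing with p_1^d and evaluating at p_k = X obey recursions that differ by this factor alone.
-- That w vanishes rests on shape: the complement of a partition strictly inside λ fills the first
-- row and the first column of λ, and one box cannot complete both unless λ is a single box. So the
-- edge terms of P_μ^⊥ P_λ do not meet p_1 P_ν or U P_ν for ν inside, and w inherits the vanishing
-- of the whole. The step to every p_k^⊥ is the commutator of p_k^⊥ with V, a multiple of p_(k+1)^⊥.
-- Raw fractions may have denominator zero and formal sums have no normal form, so the theory lives
-- over an abstract field and algebra and is transferred at the end.

-- A ring solver with integer coefficients

module IntegerSolver (R : CommutativeRing 0ℓ 0ℓ) where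
  open import Data.Integer using (+_; -[1+_])
  open import Data.Maybe using (Maybe; just; nothing)
  open CommutativeRing R
  open import Algebra.Properties.Ring ring using (-‿distribˡ-*; -‿distribʳ-*; -‿involutive; -0#≈0#)
  open import Algebra.Properties.AbelianGroup +-abelianGroup using (⁻¹-∙-comm)
  open import Algebra.Properties.Semiring.Mult.TCOptimised semiring using (×-homo-+; ×1-homo-*; 1+×) renaming (_×_ to _··_)
  open import Algebra.Solver.Ring.AlmostCommutativeRing using (_-Raw-AlmostCommutative⟶_; fromCommutativeRing)
  open import Relation.Binary.Reasoning.Setoid setoid

  private
    fromℤ : ℤ → Carrier
    fromℤ (+ n)    = n ·· 1#
    fromℤ -[1+ n ] = - (suc n ·· 1#)

    cancel : ∀ a b c → (a + b) + - (a + c) ≈ b + - c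
    cancel a b c = begin
      (a + b) + - (a + c)     ≈⟨ +-cong (+-comm a b) (sym (⁻¹-∙-comm a c)) ⟩
      (b + a) + (- a + - c)   ≈⟨ +-assoc b a _ ⟩
      b + (a + (- a + - c))   ≈⟨ +-congˡ (sym (+-assoc a (- a) (- c))) ⟩
      b + ((a + - a) + - c)   ≈⟨ +-congˡ (+-congʳ (-‿inverseʳ a)) ⟩
      b + (0# + - c)          ≈⟨ +-congˡ (+-identityˡ _) ⟩
      b + - c                 ∎

    fromℤ-⊖ : ∀ m n → fromℤ (m ℤ.⊖ n) ≈ m ·· 1# + - (n ·· 1#)
    fromℤ-⊖ m zero = sym (trans (+-congˡ -0#≈0#) (+-identityʳ _))
    fromℤ-⊖ zero (suc n) = sym (+-identityˡ _)
    fromℤ-⊖ (suc m) (suc n) = begin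
      fromℤ (suc m ℤ.⊖ suc n)          ≡⟨ ≡.cong fromℤ (ℤP.[1+m]⊖[1+n]≡m⊖n m n) ⟩
      fromℤ (m ℤ.⊖ n)                  ≈⟨ fromℤ-⊖ m n ⟩
      m ·· 1# + - (n ·· 1#)              ≈⟨ sym (cancel 1# _ _) ⟩
      (1# + m ·· 1#) + - (1# + n ·· 1#)  ≈⟨ sym (+-cong (1+× m 1#) (-‿cong (1+× n 1#))) ⟩
      suc m ·· 1# + - (suc n ·· 1#)      ∎

    fromℤ-+ : ∀ i j → fromℤ (i ℤ.+ j) ≈ fromℤ i + fromℤ j
    fromℤ-+ (+ m) (+ n) = ×-homo-+ 1# m n
    fromℤ-+ (+ m) -[1+ n ] = fromℤ-⊖ m (suc n)
    fromℤ-+ -[1+ m ] (+ n) = trans (fromℤ-⊖ n (suc m)) (+-comm _ _)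
    fromℤ-+ -[1+ m ] -[1+ n ] = begin
      - (suc (suc (m ℕ.+ n)) ·· 1#)         ≡⟨ ≡.cong (λ k → - (k ·· 1#)) (≡.sym (ℕP.+-suc (suc m) n)) ⟩
      - ((suc m ℕ.+ suc n) ·· 1#)           ≈⟨ -‿cong (×-homo-+ 1# (suc m) (suc n)) ⟩
      - (suc m ·· 1# + suc n ·· 1#)          ≈⟨ sym (⁻¹-∙-comm _ _) ⟩
      - (suc m ·· 1#) + - (suc n ·· 1#)      ∎

    fromℤ-neg : ∀ i → fromℤ (ℤ.- i) ≈ - fromℤ i
    fromℤ-neg (+ zero) = sym -0#≈0#
    fromℤ-neg (+ suc n) = refl
    fromℤ-neg -[1+ n ] = sym (-‿involutive _)

    fromℤ-*ℕ : ∀ m j → fromℤ (+ m ℤ.* j) ≈ m ·· 1# * fromℤ j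
    fromℤ-*ℕ m (+ n) = trans (reflexive (≡.cong fromℤ (≡.sym (ℤP.pos-* m n)))) (×1-homo-* m n)
    fromℤ-*ℕ m -[1+ n ] = begin
      fromℤ (+ m ℤ.* -[1+ n ])      ≡⟨ ≡.cong fromℤ (≡.sym (ℤP.neg-distribʳ-* (+ m) (+ suc n))) ⟩
      fromℤ (ℤ.- (+ m ℤ.* + suc n)) ≈⟨ fromℤ-neg (+ m ℤ.* + suc n) ⟩
      - fromℤ (+ m ℤ.* + suc n)     ≈⟨ -‿cong (fromℤ-*ℕ m (+ suc n)) ⟩
      - (m ·· 1# * (suc n ·· 1#))     ≈⟨ -‿distribʳ-* _ _ ⟩
      m ·· 1# * - (suc n ·· 1#)       ∎

    fromℤ-* : ∀ i j → fromℤ (i ℤ.* j) ≈ fromℤ i * fromℤ j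
    fromℤ-* (+ m) j = fromℤ-*ℕ m j
    fromℤ-* -[1+ m ] j = begin
      fromℤ (-[1+ m ] ℤ.* j)      ≡⟨ ≡.cong fromℤ (≡.sym (ℤP.neg-distribˡ-* (+ suc m) j)) ⟩
      fromℤ (ℤ.- (+ suc m ℤ.* j)) ≈⟨ fromℤ-neg (+ suc m ℤ.* j) ⟩
      - fromℤ (+ suc m ℤ.* j)     ≈⟨ -‿cong (fromℤ-*ℕ (suc m) j) ⟩
      - (suc m ·· 1# * fromℤ j)    ≈⟨ -‿distribˡ-* _ _ ⟩
      - (suc m ·· 1#) * fromℤ j    ∎

    integers : RawRing 0ℓ 0ℓ
    integers = record { Carrier = ℤ ; _≈_ = _≡_ ; _+_ = ℤ._+_ ; _*_ = ℤ._*_ ; -_ = ℤ.-_ ; 0# = + 0 ; 1# = + 1 }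

    morphism : integers -Raw-AlmostCommutative⟶ fromCommutativeRing R
    morphism = record { ⟦_⟧ = fromℤ ; +-homo = fromℤ-+ ; *-homo = fromℤ-* ; -‿homo = fromℤ-neg ; 0-homo = refl ; 1-homo = refl }

    -- Constants are compared as integers, so cancellation is recognised in every commutative ring
    -- without deciding its equality; distinct integers that agree in the ring are merely not
    -- identified.
    _≟′_ : ∀ i j → Maybe (fromℤ i ≈ fromℤ j)
    i ≟′ j with i ℤ.≟ j
    ... | yes i≡j = just (reflexive (≡.cong fromℤ i≡j))
    ... | no _    = nothing

  open import Algebra.Solver.Ring integers (fromCommutativeRing R) morphism _≟′_ public
    using (solve; _:=_; _:+_; _:*_; :-_; Polynomial)
  open import Algebra.Solver.Ring integers (fromCommutativeRing R) morphism _≟′_ using (con)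

  :0 :1 : ∀ {n} → Polynomial n
  :0 = con (+ 0)
  :1 = con (+ 1)

-- Coefficient fields with a parameter α

module Naturals (R : CommutativeRing 0ℓ 0ℓ) where
  open CommutativeRing R
  ι : ℕ → Carrier
  ι zero    = 0#
  ι (suc n) = 1# + ι n

-- All that is asked of α is `independent`, a statement on linear forms with natural coefficients.
-- It yields characteristic zero and α ≠ 0, keeps hook factors from vanishing, and separates the two
-- statistics in the eigenvalues of the Laplace-Beltrami operator.
record CoeffField : Set₁ where
  field
    commutativeRing : CommutativeRing 0ℓ 0ℓ
  open CommutativeRing commutativeRing public hiding (zero)
  open Naturals commutativeRing public
  infix 4 _≈?_
  infix 9 _⁻¹
  field
    _≈?_        : ∀ x y → Dec (x ≈ y)
    _⁻¹         : Carrier → Carrier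
    inverse     : ∀ x → ¬ x ≈ 0# → x * x ⁻¹ ≈ 1#
    α           : Carrier
    independent : ∀ a b c d → ι a + ι b * α ≈ ι c + ι d * α → a ≡ c × b ≡ d

module FieldFacts (K : CoeffField) where
  open CoeffField K
  open IntegerSolver commutativeRing public
  module FR = SetoidReasoning setoid

  ι-+ : ∀ m n → ι (m ℕ.+ n) ≈ ι m + ι n
  ι-+ zero n = sym (+-identityˡ _)
  ι-+ (suc m) n = trans (+-congˡ (ι-+ m n)) (sym (+-assoc _ _ _))

  ι-* : ∀ m n → ι (m ℕ.* n) ≈ ι m * ι n
  ι-* zero n = sym (zeroˡ _)
  ι-* (suc m) n = trans (ι-+ n (m ℕ.* n)) (trans (+-congˡ (ι-* m n)) (solve 2 (λ a b → b :+ a :* b := (:1 :+ a) :* b) refl (ι m) (ι n)))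

  linear : ℕ → ℕ → Carrier
  linear a b = ι a + ι b * α

  -- The content of the box in row i and column j, counted from 0.
  content : ℕ → ℕ → Carrier
  content i j = α * ι j + - ι i

  ι-linear : ∀ n → linear n 0 ≈ ι n
  ι-linear n = solve 2 (λ a x → a :+ :0 :* x := a) refl (ι n) α

  ι-injective : ∀ m n → ι m ≈ ι n → m ≡ n
  ι-injective m n e = proj₁ (independent m 0 n 0 (trans (ι-linear m) (trans e (sym (ι-linear n)))))

  0≉ι-suc : ∀ n → ¬ ι (suc n) ≈ 0#
  0≉ι-suc n e with ι-injective (suc n) 0 e
  ... | ()

  1≉0 : ¬ 1# ≈ 0#
  1≉0 e = 0≉ι-suc 0 (trans (+-identityʳ 1#) e)

  α≉0 : ¬ α ≈ 0#
  α≉0 e with independent 0 1 0 0 (trans (+-congˡ (trans (*-congˡ e) (zeroʳ _))) (sym (+-congˡ (zeroˡ _))))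
  ... | _ , ()

  *-cancelˡ : ∀ x {y z} → ¬ x ≈ 0# → x * y ≈ x * z → y ≈ z
  *-cancelˡ x {y} {z} x≉0 e = begin
    y               ≈⟨ sym (*-identityˡ y) ⟩
    1# * y          ≈⟨ *-congʳ (sym (inverse x x≉0)) ⟩
    x * x ⁻¹ * y    ≈⟨ solve 3 (λ a b c → a :* b :* c := b :* (a :* c)) refl x (x ⁻¹) y ⟩
    x ⁻¹ * (x * y)  ≈⟨ *-congˡ e ⟩
    x ⁻¹ * (x * z)  ≈⟨ solve 3 (λ a b c → b :* (a :* c) := a :* b :* c) refl x (x ⁻¹) z ⟩
    x * x ⁻¹ * z    ≈⟨ *-congʳ (inverse x x≉0) ⟩
    1# * z          ≈⟨ *-identityˡ z ⟩
    z               ∎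
    where open FR

  product≉0 : ∀ {x y} → ¬ x ≈ 0# → ¬ y ≈ 0# → ¬ x * y ≈ 0#
  product≉0 {x} x≉0 y≉0 e = y≉0 (*-cancelˡ x x≉0 (trans e (sym (zeroʳ x))))

  factor≈0 : ∀ {x y} → ¬ x ≈ 0# → x * y ≈ 0# → y ≈ 0#
  factor≈0 {x} x≉0 e = *-cancelˡ x x≉0 (trans e (sym (zeroʳ x)))

  difference≈0 : ∀ {x y} → x + - y ≈ 0# → x ≈ y
  difference≈0 {x} {y} e = trans (solve 2 (λ a b → a := (a :+ :- b) :+ b) refl x y) (trans (+-congʳ e) (+-identityˡ y))

-- Symmetric functions and the Jack scalar product

-- The ring of symmetric functions as polynomials in the power sums; q k stands for p_{k+1}.
module SymmetricFunctions (K : CoeffField) where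
  open CoeffField K
  open FieldFacts K

  infixl 6 _⊕_
  infixl 7 _⊗_
  infix 4 _≋_ _≐_

  -- Terms stay unnormalised. Maps out of them are defined by recursion on terms and shown to
  -- respect the ring axioms collected in `_≋_`, which takes the place of a normal form for
  -- monomials.
  data Λ : Set where
    con′ : Carrier → Λ
    q    : ℕ → Λ
    _⊕_ _⊗_ : Λ → Λ → Λ

  data _≋_ : Λ → Λ → Set where
    ≋-refl   : ∀ {x} → x ≋ x
    ≋-sym    : ∀ {x y} → x ≋ y → y ≋ x
    ≋-trans  : ∀ {x y z} → x ≋ y → y ≋ z → x ≋ z
    con-cong : ∀ {c d} → c ≈ d → con′ c ≋ con′ d
    con-⊕    : ∀ c d → con′ (c + d) ≋ con′ c ⊕ con′ d
    con-⊗    : ∀ c d → con′ (c * d) ≋ con′ c ⊗ con′ d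
    ⊕-cong   : ∀ {x x′ y y′} → x ≋ x′ → y ≋ y′ → x ⊕ y ≋ x′ ⊕ y′
    ⊗-cong   : ∀ {x x′ y y′} → x ≋ x′ → y ≋ y′ → x ⊗ y ≋ x′ ⊗ y′
    ⊕-assoc  : ∀ x y z → (x ⊕ y) ⊕ z ≋ x ⊕ (y ⊕ z)
    ⊕-comm   : ∀ x y → x ⊕ y ≋ y ⊕ x
    ⊕-identity : ∀ x → con′ 0# ⊕ x ≋ x
    ⊗-assoc  : ∀ x y z → (x ⊗ y) ⊗ z ≋ x ⊗ (y ⊗ z)
    ⊗-comm   : ∀ x y → x ⊗ y ≋ y ⊗ x
    ⊗-identity : ∀ x → con′ 1# ⊗ x ≋ x
    ⊗-zero   : ∀ x → con′ 0# ⊗ x ≋ con′ 0#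
    ⊗-distrib : ∀ x y z → x ⊗ (y ⊕ z) ≋ x ⊗ y ⊕ x ⊗ z

  ⊝_ : Λ → Λ
  ⊝ x = con′ (- 1#) ⊗ x

  syntacticRing : CommutativeRing 0ℓ 0ℓ
  syntacticRing = record
    { Carrier = Λ ; _≈_ = _≋_ ; _+_ = _⊕_ ; _*_ = _⊗_ ; -_ = ⊝_ ; 0# = con′ 0# ; 1# = con′ 1#
    ; isCommutativeRing = record
      { isRing = record
        { +-isAbelianGroup = record
          { isGroup = record
            { isMonoid = record
              { isSemigroup = record
                { isMagma = record { isEquivalence = record { refl = ≋-refl ; sym = ≋-sym ; trans = ≋-trans } ; ∙-cong = ⊕-cong }
                ; assoc = ⊕-assoc }
              ; identity = ⊕-identity , λ x → ≋-trans (⊕-comm _ _) (⊕-identity x) }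
            ; inverse = negˡ , λ x → ≋-trans (⊕-comm _ _) (negˡ x)
            ; ⁻¹-cong = ⊗-cong ≋-refl }
          ; comm = ⊕-comm }
        ; *-cong = ⊗-cong
        ; *-assoc = ⊗-assoc
        ; *-identity = ⊗-identity , λ x → ≋-trans (⊗-comm _ _) (⊗-identity x)
        ; distrib = ⊗-distrib , λ x y z → ≋-trans (⊗-comm _ _) (≋-trans (⊗-distrib _ _ _) (⊕-cong (⊗-comm _ _) (⊗-comm _ _))) }
      ; *-comm = ⊗-comm } }
    where
    negˡ : ∀ x → ⊝ x ⊕ x ≋ con′ 0#
    negˡ x = ≋-trans (⊕-cong (⊗-comm _ _) (≋-trans (≋-sym (⊗-identity x)) (⊗-comm _ _)))
      (≋-trans (≋-sym (⊗-distrib _ _ _)) (≋-trans (⊗-cong ≋-refl (≋-trans (≋-sym (con-⊕ _ _)) (con-cong (-‿inverseˡ 1#))))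
        (≋-trans (⊗-comm _ _) (⊗-zero x))))

  module S = IntegerSolver syntacticRing
  open S using () renaming (solve to solve≋; _:=_ to _:≋_; _:+_ to _:⊕_; _:*_ to _:⊗_; :0 to :𝟘; :1 to :𝟙)
  module SR = SetoidReasoning (CommutativeRing.setoid syntacticRing)

  derivation : (ℕ → Λ) → Λ → Λ
  derivation δ (con′ c) = con′ 0#
  derivation δ (q k)   = δ k
  derivation δ (x ⊕ y) = derivation δ x ⊕ derivation δ y
  derivation δ (x ⊗ y) = derivation δ x ⊗ y ⊕ x ⊗ derivation δ y

  derivation-cong : ∀ δ {x y} → x ≋ y → derivation δ x ≋ derivation δ y
  derivation-cong δ ≋-refl = ≋-refl
  derivation-cong δ (≋-sym e) = ≋-sym (derivation-cong δ e)
  derivation-cong δ (≋-trans e f) = ≋-trans (derivation-cong δ e) (derivation-cong δ f)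
  derivation-cong δ (con-cong e) = ≋-refl
  derivation-cong δ (con-⊕ c d) = ≋-sym (⊕-identity _)
  derivation-cong δ (con-⊗ c d) = solve≋ 2 (λ c d → :𝟘 :≋ :𝟘 :⊗ d :⊕ c :⊗ :𝟘) ≋-refl (con′ c) (con′ d)
  derivation-cong δ (⊕-cong e f) = ⊕-cong (derivation-cong δ e) (derivation-cong δ f)
  derivation-cong δ (⊗-cong e f) = ⊕-cong (⊗-cong (derivation-cong δ e) f) (⊗-cong e (derivation-cong δ f))
  derivation-cong δ (⊕-assoc x y z) = ⊕-assoc _ _ _
  derivation-cong δ (⊕-comm x y) = ⊕-comm _ _
  derivation-cong δ (⊕-identity x) = ⊕-identity _
  derivation-cong δ (⊗-assoc x y z) =
    solve≋ 6 (λ x y z dx dy dz → (dx :⊗ y :⊕ x :⊗ dy) :⊗ z :⊕ (x :⊗ y) :⊗ dz :≋ dx :⊗ (y :⊗ z) :⊕ x :⊗ (dy :⊗ z :⊕ y :⊗ dz))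
      ≋-refl x y z (derivation δ x) (derivation δ y) (derivation δ z)
  derivation-cong δ (⊗-comm x y) =
    solve≋ 4 (λ x y dx dy → dx :⊗ y :⊕ x :⊗ dy :≋ dy :⊗ x :⊕ y :⊗ dx) ≋-refl x y (derivation δ x) (derivation δ y)
  derivation-cong δ (⊗-identity x) = solve≋ 2 (λ x dx → :𝟘 :⊗ x :⊕ :𝟙 :⊗ dx :≋ dx) ≋-refl x (derivation δ x)
  derivation-cong δ (⊗-zero x) = solve≋ 2 (λ x dx → :𝟘 :⊗ x :⊕ :𝟘 :⊗ dx :≋ :𝟘) ≋-refl x (derivation δ x)
  derivation-cong δ (⊗-distrib x y z) =
    solve≋ 6 (λ x y z dx dy dz → dx :⊗ (y :⊕ z) :⊕ x :⊗ (dy :⊕ dz) :≋ (dx :⊗ y :⊕ x :⊗ dy) :⊕ (dx :⊗ z :⊕ x :⊗ dz))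
      ≋-refl x y z (derivation δ x) (derivation δ y) (derivation δ z)

  -- A commutator of derivations is again a derivation, so it is determined by its values `ε` on the
  -- generators.
  commutator : ∀ δ δ′ ε → (∀ k → derivation δ (δ′ k) ≋ derivation δ′ (δ k) ⊕ ε k) →
    ∀ x → derivation δ (derivation δ′ x) ≋ derivation δ′ (derivation δ x) ⊕ derivation ε x
  commutator δ δ′ ε h (con′ c) = ≋-sym (⊕-identity _)
  commutator δ δ′ ε h (q k) = h k
  commutator δ δ′ ε h (x ⊕ y) = ≋-trans (⊕-cong (commutator δ δ′ ε h x) (commutator δ δ′ ε h y))
    (solve≋ 4 (λ a b c d → a :⊕ b :⊕ (c :⊕ d) :≋ a :⊕ c :⊕ (b :⊕ d)) ≋-refl _ _ _ _)
  commutator δ δ′ ε h (x ⊗ y) = ≋-trans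
    (⊕-cong (⊕-cong (⊗-cong (commutator δ δ′ ε h x) ≋-refl) ≋-refl) (⊕-cong ≋-refl (⊗-cong ≋-refl (commutator δ δ′ ε h y))))
    (solve≋ 10 (λ x y dx dy d′x d′y d′dx d′dy ex ey →
       (d′dx :⊕ ex) :⊗ y :⊕ d′x :⊗ dy :⊕ (dx :⊗ d′y :⊕ x :⊗ (d′dy :⊕ ey))
       :≋ d′dx :⊗ y :⊕ dx :⊗ d′y :⊕ (d′x :⊗ dy :⊕ x :⊗ d′dy) :⊕ (ex :⊗ y :⊕ x :⊗ ey)) ≋-refl
       x y (derivation δ x) (derivation δ y) (derivation δ′ x) (derivation δ′ y)
       (derivation δ′ (derivation δ x)) (derivation δ′ (derivation δ y)) (derivation ε x) (derivation ε y))

  δ : ℕ → ℕ → Carrier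
  δ zero zero = 1#
  δ zero (suc j) = 0#
  δ (suc i) zero = 0#
  δ (suc i) (suc j) = δ i j

  δ-sym : ∀ i j → δ i j ≡ δ j i
  δ-sym zero zero = ≡.refl
  δ-sym zero (suc j) = ≡.refl
  δ-sym (suc i) zero = ≡.refl
  δ-sym (suc i) (suc j) = δ-sym i j

  δ-ι : ∀ i j → ι i * δ i j ≈ ι j * δ i j
  δ-ι zero zero = refl
  δ-ι zero (suc j) = trans (zeroʳ _) (sym (zeroʳ _))
  δ-ι (suc i) zero = trans (zeroʳ _) (sym (zeroʳ _))
  δ-ι (suc i) (suc j) = trans (distribʳ _ _ _) (trans (+-congˡ (δ-ι i j)) (sym (distribʳ _ _ _)))

  ∂ : ℕ → Λ → Λ
  ∂ k = derivation (λ j → con′ (δ k j))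

  weight : ℕ → Carrier
  weight k = α * ι (suc k)

  -- The adjoint of multiplication by x: p_{k+1} acts as α(k+1)∂/∂p_{k+1}.
  perp : Λ → Λ → Λ
  perp (con′ c) z = con′ c ⊗ z
  perp (q k) z   = con′ (weight k) ⊗ ∂ k z
  perp (x ⊕ y) z = perp x z ⊕ perp y z
  perp (x ⊗ y) z = perp x (perp y z)

  constantTerm : Λ → Carrier
  constantTerm (con′ c) = c
  constantTerm (q k)   = 0#
  constantTerm (x ⊕ y) = constantTerm x + constantTerm y
  constantTerm (x ⊗ y) = constantTerm x * constantTerm y

  constantTerm-cong : ∀ {x y} → x ≋ y → constantTerm x ≈ constantTerm y
  constantTerm-cong ≋-refl = refl
  constantTerm-cong (≋-sym e) = sym (constantTerm-cong e)
  constantTerm-cong (≋-trans e f) = trans (constantTerm-cong e) (constantTerm-cong f)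
  constantTerm-cong (con-cong e) = e
  constantTerm-cong (con-⊕ c d) = refl
  constantTerm-cong (con-⊗ c d) = refl
  constantTerm-cong (⊕-cong e f) = +-cong (constantTerm-cong e) (constantTerm-cong f)
  constantTerm-cong (⊗-cong e f) = *-cong (constantTerm-cong e) (constantTerm-cong f)
  constantTerm-cong (⊕-assoc x y z) = +-assoc _ _ _
  constantTerm-cong (⊕-comm x y) = +-comm _ _
  constantTerm-cong (⊕-identity x) = +-identityˡ _
  constantTerm-cong (⊗-assoc x y z) = *-assoc _ _ _
  constantTerm-cong (⊗-comm x y) = *-comm _ _
  constantTerm-cong (⊗-identity x) = *-identityˡ _
  constantTerm-cong (⊗-zero x) = zeroˡ _
  constantTerm-cong (⊗-distrib x y z) = distribˡ _ _ _

  ⟨_,_⟩ : Λ → Λ → Carrier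
  ⟨ x , y ⟩ = constantTerm (perp x y)

  perp-congʳ : ∀ x {y z} → y ≋ z → perp x y ≋ perp x z
  perp-congʳ (con′ c) e = ⊗-cong ≋-refl e
  perp-congʳ (q k) e = ⊗-cong ≋-refl (derivation-cong _ e)
  perp-congʳ (x ⊕ y) e = ⊕-cong (perp-congʳ x e) (perp-congʳ y e)
  perp-congʳ (x ⊗ y) e = perp-congʳ x (perp-congʳ y e)

  perp-⊕ : ∀ x y z → perp x (y ⊕ z) ≋ perp x y ⊕ perp x z
  perp-⊕ (con′ c) y z = ⊗-distrib _ _ _
  perp-⊕ (q k) y z = ⊗-distrib _ _ _
  perp-⊕ (x ⊕ x′) y z = ≋-trans (⊕-cong (perp-⊕ x y z) (perp-⊕ x′ y z))
    (solve≋ 4 (λ a b c d → a :⊕ b :⊕ (c :⊕ d) :≋ a :⊕ c :⊕ (b :⊕ d)) ≋-refl _ _ _ _)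
  perp-⊕ (x ⊗ x′) y z = ≋-trans (perp-congʳ x (perp-⊕ x′ y z)) (perp-⊕ x _ _)

  ∂-scale : ∀ k c x → ∂ k (con′ c ⊗ x) ≋ con′ c ⊗ ∂ k x
  ∂-scale k c x = solve≋ 3 (λ c x dx → :𝟘 :⊗ x :⊕ c :⊗ dx :≋ c :⊗ dx) ≋-refl (con′ c) x (∂ k x)

  perp-scale : ∀ x c y → perp x (con′ c ⊗ y) ≋ con′ c ⊗ perp x y
  perp-scale (con′ d) c y = solve≋ 3 (λ d c y → d :⊗ (c :⊗ y) :≋ c :⊗ (d :⊗ y)) ≋-refl (con′ d) (con′ c) y
  perp-scale (q k) c y = ≋-trans (⊗-cong ≋-refl (∂-scale k c y))
    (solve≋ 3 (λ d c y → d :⊗ (c :⊗ y) :≋ c :⊗ (d :⊗ y)) ≋-refl _ (con′ c) _)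
  perp-scale (x ⊕ x′) c y = ≋-trans (⊕-cong (perp-scale x c y) (perp-scale x′ c y)) (≋-sym (⊗-distrib _ _ _))
  perp-scale (x ⊗ x′) c y = ≋-trans (perp-congʳ x (perp-scale x′ c y)) (perp-scale x c _)

  derivation-0 : ∀ x → derivation (λ _ → con′ 0#) x ≋ con′ 0#
  derivation-0 (con′ c) = ≋-refl
  derivation-0 (q k) = ≋-refl
  derivation-0 (x ⊕ y) = ≋-trans (⊕-cong (derivation-0 x) (derivation-0 y)) (⊕-identity _)
  derivation-0 (x ⊗ y) = ≋-trans (⊕-cong (⊗-cong (derivation-0 x) ≋-refl) (⊗-cong ≋-refl (derivation-0 y)))
    (solve≋ 2 (λ x y → :𝟘 :⊗ y :⊕ x :⊗ :𝟘 :≋ :𝟘) ≋-refl x y)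

  ∂-comm : ∀ i j x → ∂ i (∂ j x) ≋ ∂ j (∂ i x)
  ∂-comm i j x = ≋-trans (commutator _ _ (λ _ → con′ 0#) (λ k → ≋-sym (⊕-identity _)) x)
    (≋-trans (⊕-cong ≋-refl (derivation-0 x)) (≋-trans (⊕-comm _ _) (⊕-identity _)))

  -- `perp` of a product is a composition, so its respect for commutativity of the product rests on
  -- this: differential operators with constant coefficients commute.
  perp-comm : ∀ x y z → perp x (perp y z) ≋ perp y (perp x z)
  perp-comm (con′ c) y z = ≋-sym (perp-scale y c z)
  perp-comm (q i) (con′ c) z = perp-scale (q i) c z
  perp-comm (q i) (q j) z = ≋-trans (perp-scale (q i) _ _) (≋-trans (⊗-cong ≋-refl (⊗-cong ≋-refl (∂-comm i j z))) (≋-trans (perp-scale (con′ (weight j)) (weight i) _) (≋-sym (perp-scale (q j) _ _))))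
  perp-comm (q i) (y ⊕ y′) z = ≋-trans (perp-⊕ (q i) (perp y z) (perp y′ z)) (⊕-cong (perp-comm (q i) y z) (perp-comm (q i) y′ z))
  perp-comm (q i) (y ⊗ y′) z = ≋-trans (perp-comm (q i) y _) (perp-congʳ y (perp-comm (q i) y′ z))
  perp-comm (x ⊕ x′) y z = ≋-trans (⊕-cong (perp-comm x y z) (perp-comm x′ y z)) (≋-sym (perp-⊕ y _ _))
  perp-comm (x ⊗ x′) y z = ≋-trans (perp-congʳ x (perp-comm x′ y z)) (perp-comm x y _)

  perp-congˡ : ∀ {x y} → x ≋ y → ∀ z → perp x z ≋ perp y z
  perp-congˡ ≋-refl z = ≋-refl
  perp-congˡ (≋-sym e) z = ≋-sym (perp-congˡ e z)
  perp-congˡ (≋-trans e f) z = ≋-trans (perp-congˡ e z) (perp-congˡ f z)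
  perp-congˡ (con-cong e) z = ⊗-cong (con-cong e) ≋-refl
  perp-congˡ (con-⊕ c d) z = ≋-trans (⊗-cong (con-⊕ c d) ≋-refl) (solve≋ 3 (λ a b c → (a :⊕ b) :⊗ c :≋ a :⊗ c :⊕ b :⊗ c) ≋-refl _ _ _)
  perp-congˡ (con-⊗ c d) z = ≋-trans (⊗-cong (con-⊗ c d) ≋-refl) (⊗-assoc _ _ _)
  perp-congˡ (⊕-cong e f) z = ⊕-cong (perp-congˡ e z) (perp-congˡ f z)
  perp-congˡ (⊗-cong {x} e f) z = ≋-trans (perp-congʳ x (perp-congˡ f z)) (perp-congˡ e _)
  perp-congˡ (⊕-assoc x y w) z = ⊕-assoc _ _ _
  perp-congˡ (⊕-comm x y) z = ⊕-comm _ _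
  perp-congˡ (⊕-identity x) z = ≋-trans (⊕-cong (⊗-zero _) ≋-refl) (⊕-identity _)
  perp-congˡ (⊗-assoc x y w) z = ≋-refl
  perp-congˡ (⊗-comm x y) z = perp-comm x y z
  perp-congˡ (⊗-identity x) z = ⊗-identity _
  perp-congˡ (⊗-zero x) z = ≋-trans (⊗-zero _) (≋-sym (⊗-zero _))
  perp-congˡ (⊗-distrib x y w) z = perp-⊕ x _ _

  perp-leibniz : ∀ k x y → perp (q k) (x ⊗ y) ≋ perp (q k) x ⊗ y ⊕ x ⊗ perp (q k) y
  perp-leibniz k x y = solve≋ 5 (λ c x y dx dy → c :⊗ (dx :⊗ y :⊕ x :⊗ dy) :≋ c :⊗ dx :⊗ y :⊕ x :⊗ (c :⊗ dy)) ≋-refl (con′ (weight k)) x y (∂ k x) (∂ k y)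

  -- The Heisenberg relation, extended from generators to every `x` by the Leibniz rule. The case
  -- `x = q j` uses that the weighted pairing of the generators is symmetric.
  perp-q : ∀ k x w → perp x (q k ⊗ w) ≋ q k ⊗ perp x w ⊕ perp (perp (q k) x) w
  perp-q k (con′ c) w = solve≋ 4 (λ d c q w → c :⊗ (q :⊗ w) :≋ q :⊗ (c :⊗ w) :⊕ d :⊗ (:𝟘 :⊗ w)) ≋-refl (con′ (weight k)) (con′ c) (q k) w
  perp-q k (q j) w = ≋-trans (solve≋ 5 (λ c q w d dw → c :⊗ (d :⊗ w :⊕ q :⊗ dw) :≋ q :⊗ (c :⊗ dw) :⊕ c :⊗ d :⊗ w)
      ≋-refl (con′ (weight j)) (q k) w (con′ (δ j k)) (∂ j w))
    (⊕-cong ≋-refl (≋-trans (⊗-cong (≋-trans (≋-sym (con-⊗ _ _)) (≋-trans (con-cong lemma) (con-⊗ _ _))) ≋-refl) (⊗-assoc _ _ _)))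
    where
    lemma : weight j * δ j k ≈ weight k * δ k j
    lemma = begin
      α * ι (suc j) * δ j k    ≈⟨ *-assoc _ _ _ ⟩
      α * (ι (suc j) * δ j k)  ≈⟨ *-congˡ (δ-ι (suc j) (suc k)) ⟩
      α * (ι (suc k) * δ j k)  ≈⟨ sym (*-assoc _ _ _) ⟩
      weight k * δ j k         ≡⟨ ≡.cong (weight k *_) (δ-sym j k) ⟩
      weight k * δ k j         ∎
      where open FR
  perp-q k (x ⊕ y) w = ≋-trans (⊕-cong (perp-q k x w) (perp-q k y w))
    (≋-trans (solve≋ 5 (λ q a b c d → q :⊗ a :⊕ b :⊕ (q :⊗ c :⊕ d) :≋ q :⊗ (a :⊕ c) :⊕ (b :⊕ d)) ≋-refl (q k) _ _ _ _)
      (⊕-cong ≋-refl (≋-sym (perp-congˡ (perp-⊕ (q k) x y) w))))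
  perp-q k (x ⊗ y) w = ≋-trans (perp-congʳ x (perp-q k y w)) (≋-trans (perp-⊕ x _ _)
    (≋-trans (⊕-cong (perp-q k x _) ≋-refl) (≋-trans (⊕-assoc _ _ _) (⊕-cong ≋-refl (≋-sym (perp-congˡ (perp-leibniz k x y) w))))))

  ⟨⟩-congˡ : ∀ {x y} z → x ≋ y → ⟨ x , z ⟩ ≈ ⟨ y , z ⟩
  ⟨⟩-congˡ z e = constantTerm-cong (perp-congˡ e z)

  ⟨⟩-congʳ : ∀ {x y} z → x ≋ y → ⟨ z , x ⟩ ≈ ⟨ z , y ⟩
  ⟨⟩-congʳ z e = constantTerm-cong (perp-congʳ z e)

  -- In `perp-q` the constant term annihilates the summand with the factor `q k`; the other summand
  -- is the adjoint. Products follow because adjoints commute.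
  ⟨⟩-perp : ∀ x y w → ⟨ x , y ⊗ w ⟩ ≈ ⟨ perp y x , w ⟩
  ⟨⟩-perp x (con′ c) w = constantTerm-cong (perp-scale x c w)
  ⟨⟩-perp x (q k) w = trans (constantTerm-cong (perp-q k x w)) (trans (+-congʳ (zeroˡ _)) (+-identityˡ _))
  ⟨⟩-perp x (y ⊕ y′) w = trans (⟨⟩-congʳ x (≋-trans (⊗-comm _ _) (≋-trans (⊗-distrib _ _ _) (⊕-cong (⊗-comm _ _) (⊗-comm _ _)))))
    (trans (constantTerm-cong (perp-⊕ x _ _)) (+-cong (⟨⟩-perp x y w) (⟨⟩-perp x y′ w)))
  ⟨⟩-perp x (y ⊗ y′) w = trans (⟨⟩-congʳ x (⊗-assoc _ _ _)) (trans (⟨⟩-perp x y _) (trans (⟨⟩-perp (perp y x) y′ w)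
    (⟨⟩-congˡ w (perp-comm y′ y x))))

  perp-con : ∀ x c → perp x (con′ c) ≋ con′ (constantTerm x * c)
  perp-con (con′ d) c = ≋-sym (con-⊗ _ _)
  perp-con (q k) c = ≋-trans (⊗-comm _ _) (≋-trans (⊗-zero _) (con-cong (sym (zeroˡ c))))
  perp-con (x ⊕ y) c = ≋-trans (⊕-cong (perp-con x c) (perp-con y c)) (≋-trans (≋-sym (con-⊕ _ _)) (con-cong (sym (distribʳ _ _ _))))
  perp-con (x ⊗ y) c = ≋-trans (perp-congʳ x (perp-con y c)) (≋-trans (perp-con x _) (con-cong (sym (*-assoc _ _ _))))

  ⟨⟩-1 : ∀ x → ⟨ x , con′ 1# ⟩ ≈ constantTerm x
  ⟨⟩-1 x = trans (constantTerm-cong (perp-con x 1#)) (*-identityʳ _)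

  -- The form is defined asymmetrically, through an operator. Adjointness applied to `y ⊗ con′ 1#`
  -- exchanges the roles, because pairing with 1 is taking the constant term.
  ⟨⟩-comm : ∀ x y → ⟨ x , y ⟩ ≈ ⟨ y , x ⟩
  ⟨⟩-comm x y = trans (⟨⟩-congʳ x (≋-sym (≋-trans (⊗-comm _ _) (⊗-identity y)))) (trans (⟨⟩-perp x y _) (⟨⟩-1 (perp y x)))

  -- Identifying expressions that pair equally makes the form nondegenerate without choosing normal forms.
  record _≐_ (x y : Λ) : Set where
    constructor equal
    field pairing : ∀ z → ⟨ x , z ⟩ ≈ ⟨ y , z ⟩
  open _≐_ public

  ≋⇒≐ : ∀ {x y} → x ≋ y → x ≐ y
  ≋⇒≐ e = equal λ z → ⟨⟩-congˡ z e

  ≐-refl : ∀ {x} → x ≐ x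
  ≐-refl = equal λ z → refl

  ≐-sym : ∀ {x y} → x ≐ y → y ≐ x
  ≐-sym e = equal λ z → sym (pairing e z)

  ≐-trans : ∀ {x y z} → x ≐ y → y ≐ z → x ≐ z
  ≐-trans e f = equal λ w → trans (pairing e w) (pairing f w)

  ⊗-congʳ-≐ : ∀ {x x′} y → x ≐ x′ → x ⊗ y ≐ x′ ⊗ y
  ⊗-congʳ-≐ y e = equal λ z → pairing e (perp y z)

  ⊗-cong-≐ : ∀ {x x′ y y′} → x ≐ x′ → y ≐ y′ → x ⊗ y ≐ x′ ⊗ y′
  ⊗-cong-≐ {x} {x′} {y} {y′} e f = ≐-trans (⊗-congʳ-≐ y e)
    (≐-trans (≋⇒≐ (⊗-comm _ _)) (≐-trans (⊗-congʳ-≐ x′ f) (≋⇒≐ (⊗-comm _ _))))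

  symmetricRing : CommutativeRing 0ℓ 0ℓ
  symmetricRing = record
    { Carrier = Λ ; _≈_ = _≐_ ; _+_ = _⊕_ ; _*_ = _⊗_ ; -_ = ⊝_ ; 0# = con′ 0# ; 1# = con′ 1#
    ; isCommutativeRing = record
      { isRing = record
        { +-isAbelianGroup = record
          { isGroup = record
            { isMonoid = record
              { isSemigroup = record
                { isMagma = record
                  { isEquivalence = record { refl = ≐-refl ; sym = ≐-sym ; trans = ≐-trans }
                  ; ∙-cong = λ e f → equal λ z → +-cong (pairing e z) (pairing f z) }
                ; assoc = λ x y z → ≋⇒≐ (⊕-assoc x y z) }
              ; identity = (λ x → ≋⇒≐ (Q.+-identityˡ x)) , λ x → ≋⇒≐ (Q.+-identityʳ x) }
            ; inverse = (λ x → ≋⇒≐ (Q.-‿inverseˡ x)) , λ x → ≋⇒≐ (Q.-‿inverseʳ x)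
            ; ⁻¹-cong = ⊗-cong-≐ ≐-refl }
          ; comm = λ x y → ≋⇒≐ (⊕-comm x y) }
        ; *-cong = ⊗-cong-≐
        ; *-assoc = λ x y z → ≋⇒≐ (⊗-assoc x y z)
        ; *-identity = (λ x → ≋⇒≐ (Q.*-identityˡ x)) , λ x → ≋⇒≐ (Q.*-identityʳ x)
        ; distrib = (λ x y z → ≋⇒≐ (Q.distribˡ x y z)) , λ x y z → ≋⇒≐ (Q.distribʳ x y z) }
      ; *-comm = λ x y → ≋⇒≐ (⊗-comm x y) } }
    where module Q = CommutativeRing syntacticRing

  -- The degree operator. Homogeneity becomes an eigenvalue equation for it, which replaces a
  -- grading of terms and makes the orthogonality of different degrees a consequence of
  -- self-adjointness.
  euler : Λ → Λ
  euler = derivation (λ k → con′ (ι (suc k)) ⊗ q k)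

  euler-∂ : ∀ k y → ∂ k (euler y) ≋ euler (∂ k y) ⊕ con′ (ι (suc k)) ⊗ ∂ k y
  euler-∂ k y = ≋-trans (commutator _ _ (λ j → con′ (ι (suc k)) ⊗ con′ (δ k j)) generator y) (⊕-cong ≋-refl (scaled y))
    where
    generator : ∀ j → ∂ k (con′ (ι (suc j)) ⊗ q j) ≋ con′ 0# ⊕ con′ (ι (suc k)) ⊗ con′ (δ k j)
    generator j = ≋-trans (∂-scale k _ _) (≋-trans (≋-sym (con-⊗ _ _)) (≋-trans (con-cong (sym (δ-ι (suc k) (suc j)))) (≋-trans (con-⊗ _ _) (≋-sym (⊕-identity _)))))
    scaled : ∀ x → derivation (λ j → con′ (ι (suc k)) ⊗ con′ (δ k j)) x ≋ con′ (ι (suc k)) ⊗ ∂ k x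
    scaled (con′ c) = solve≋ 1 (λ a → :𝟘 :≋ a :⊗ :𝟘) ≋-refl _
    scaled (q j) = ≋-refl
    scaled (x ⊕ y) = ≋-trans (⊕-cong (scaled x) (scaled y)) (≋-sym (⊗-distrib _ _ _))
    scaled (x ⊗ y) = ≋-trans (⊕-cong (⊗-cong (scaled x) ≋-refl) (⊗-cong ≋-refl (scaled y)))
      (solve≋ 5 (λ a x y dx dy → (a :⊗ dx) :⊗ y :⊕ x :⊗ (a :⊗ dy) :≋ a :⊗ (dx :⊗ y :⊕ x :⊗ dy)) ≋-refl _ x y _ _)

  euler-perp : ∀ x y → perp (euler x) y ⊕ euler (perp x y) ≋ perp x (euler y)
  euler-perp (con′ c) y = solve≋ 3 (λ c y ey → :𝟘 :⊗ y :⊕ (:𝟘 :⊗ y :⊕ c :⊗ ey) :≋ c :⊗ ey) ≋-refl (con′ c) y (euler y)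
  euler-perp (q k) y = ≋-trans
    (solve≋ 5 (λ a w dy z e → a :⊗ (w :⊗ dy) :⊕ (:𝟘 :⊗ dy :⊕ w :⊗ e) :≋ w :⊗ (e :⊕ a :⊗ dy)) ≋-refl
      (con′ (ι (suc k))) (con′ (weight k)) (∂ k y) y (euler (∂ k y)))
    (⊗-cong ≋-refl (≋-sym (euler-∂ k y)))
  euler-perp (x ⊕ x′) y = ≋-trans (solve≋ 4 (λ a b c d → a :⊕ b :⊕ (c :⊕ d) :≋ a :⊕ c :⊕ (b :⊕ d)) ≋-refl _ _ _ _)
    (⊕-cong (euler-perp x y) (euler-perp x′ y))
  euler-perp (x ⊗ x′) y = ≋-trans (solve≋ 3 (λ a b c → a :⊕ b :⊕ c :≋ b :⊕ (a :⊕ c)) ≋-refl _ _ _)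
    (≋-trans (⊕-cong ≋-refl (euler-perp x (perp x′ y))) (≋-trans (≋-sym (perp-⊕ x _ _)) (perp-congʳ x (euler-perp x′ y))))

  constantTerm-euler : ∀ y → constantTerm (euler y) ≈ 0#
  constantTerm-euler (con′ c) = refl
  constantTerm-euler (q k) = zeroʳ _
  constantTerm-euler (x ⊕ y) = trans (+-cong (constantTerm-euler x) (constantTerm-euler y)) (+-identityˡ _)
  constantTerm-euler (x ⊗ y) = trans (+-cong (trans (*-congʳ (constantTerm-euler x)) (zeroˡ _)) (trans (*-congˡ (constantTerm-euler y)) (zeroʳ _))) (+-identityˡ _)

  -- By `euler-perp` the two sides differ by the constant term of an image of `euler`, and such
  -- images have none.
  euler-selfadjoint : ∀ x y → ⟨ euler x , y ⟩ ≈ ⟨ x , euler y ⟩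
  euler-selfadjoint x y = trans (sym (trans (+-congˡ (constantTerm-euler (perp x y))) (+-identityʳ _))) (constantTerm-cong (euler-perp x y))

-- The algebra of symmetric functions in axiomatic form

-- The properties on which the theory rests. `generated` is induction over the algebra generators.
-- `extensional` is nondegeneracy of the form; it also makes adjoints unique, from which the
-- algebraic rules for `perp` are derived.
record SymmetricAlgebra (K : CoeffField) : Set₁ where
  open CoeffField K using (Carrier; _≈_; _+_; _*_; 0#; 1#; ι; α)
  open SymmetricFunctions K using (δ; weight)
  field
    symmetricRing : CommutativeRing 0ℓ 0ℓ
  open CommutativeRing symmetricRing public
    renaming ( Carrier to Λ; _≈_ to _≐_; _+_ to _⊕_; _*_ to _⊗_; -_ to ⊝_; 0# to 𝟘; 1# to 𝟙; refl to ≐-refl; sym to ≐-sym; trans to ≐-trans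
             ; +-cong to ⊕-cong; *-cong to ⊗-cong; setoid to Λ-setoid)
    using ()
  field
    con : Carrier → Λ
    con-cong : ∀ {c d} → c ≈ d → con c ≐ con d
    con-⊕ : ∀ c d → con (c + d) ≐ con c ⊕ con d
    con-⊗ : ∀ c d → con (c * d) ≐ con c ⊗ con d
    con-0 : con 0# ≐ 𝟘
    con-1 : con 1# ≐ 𝟙
    q : ℕ → Λ
    generated : (Q : Λ → Set) → (∀ c → Q (con c)) → (∀ k → Q (q k)) →
      (∀ {x y} → Q x → Q y → Q (x ⊕ y)) → (∀ {x y} → Q x → Q y → Q (x ⊗ y)) → ∀ x → Q x
    ⟨_,_⟩ : Λ → Λ → Carrier
    ⟨⟩-congˡ : ∀ {x y} z → x ≐ y → ⟨ x , z ⟩ ≈ ⟨ y , z ⟩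
    ⟨⟩-comm : ∀ x y → ⟨ x , y ⟩ ≈ ⟨ y , x ⟩
    ⟨⟩-⊕ : ∀ x y z → ⟨ x ⊕ y , z ⟩ ≈ ⟨ x , z ⟩ + ⟨ y , z ⟩
    ⟨⟩-con : ∀ c x z → ⟨ con c ⊗ x , z ⟩ ≈ c * ⟨ x , z ⟩
    ⟨𝟙,𝟙⟩ : ⟨ 𝟙 , 𝟙 ⟩ ≈ 1#
    extensional : ∀ {x y} → (∀ z → ⟨ x , z ⟩ ≈ ⟨ y , z ⟩) → x ≐ y
    perp : Λ → Λ → Λ
    ⟨⟩-perp : ∀ x y z → ⟨ x , y ⊗ z ⟩ ≈ ⟨ perp y x , z ⟩
    perp-q-⊗ : ∀ k x y → perp (q k) (x ⊗ y) ≐ perp (q k) x ⊗ y ⊕ x ⊗ perp (q k) y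
    perp-q-con : ∀ k c → perp (q k) (con c) ≐ 𝟘
    perp-q-q : ∀ k j → perp (q k) (q j) ≐ con (weight k * δ k j)
    euler : Λ → Λ
    euler-⊗ : ∀ x y → euler (x ⊗ y) ≐ euler x ⊗ y ⊕ x ⊗ euler y
    euler-⊕ : ∀ x y → euler (x ⊕ y) ≐ euler x ⊕ euler y
    euler-con : ∀ c → euler (con c) ≐ 𝟘
    euler-q : ∀ k → euler (q k) ≐ con (ι (suc k)) ⊗ q k
    euler-selfadjoint : ∀ x y → ⟨ euler x , y ⟩ ≈ ⟨ x , euler y ⟩

symmetricFunctions : ∀ K → SymmetricAlgebra K
symmetricFunctions K = record
  { symmetricRing = symmetricRing ; con = con′ ; con-cong = λ e → ≋⇒≐ (con-cong e) ; con-⊕ = λ c d → ≋⇒≐ (con-⊕ c d)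
  ; con-⊗ = λ c d → ≋⇒≐ (con-⊗ c d) ; con-0 = ≐-refl ; con-1 = ≐-refl ; q = q ; generated = generated
  ; ⟨_,_⟩ = ⟨_,_⟩ ; ⟨⟩-congˡ = λ z e → pairing e z ; ⟨⟩-comm = ⟨⟩-comm ; ⟨⟩-⊕ = λ _ _ _ → refl ; ⟨⟩-con = λ _ _ _ → refl
  ; ⟨𝟙,𝟙⟩ = *-identityˡ 1# ; extensional = equal ; perp = perp ; ⟨⟩-perp = ⟨⟩-perp
  ; perp-q-⊗ = λ k x y → ≋⇒≐ (perp-leibniz k x y)
  ; perp-q-con = λ k c → ≋⇒≐ (≋-trans (⊗-comm _ _) (⊗-zero _)) ; perp-q-q = λ k j → ≋⇒≐ (≋-sym (con-⊗ _ _))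
  ; euler = euler ; euler-⊗ = λ x y → ≐-refl ; euler-⊕ = λ x y → ≐-refl ; euler-con = λ c → ≐-refl ; euler-q = λ k → ≐-refl
  ; euler-selfadjoint = euler-selfadjoint }
  where
  open CoeffField K
  open SymmetricFunctions K
  generated : (Q : Λ → Set) → (∀ c → Q (con′ c)) → (∀ k → Q (q k)) →
    (∀ {x y} → Q x → Q y → Q (x ⊕ y)) → (∀ {x y} → Q x → Q y → Q (x ⊗ y)) → ∀ x → Q x
  generated Q a b c d (con′ x) = a x
  generated Q a b c d (q k) = b k
  generated Q a b c d (x ⊕ y) = c (generated Q a b c d x) (generated Q a b c d y)
  generated Q a b c d (x ⊗ y) = d (generated Q a b c d x) (generated Q a b c d y)

-- Adjoint operators and finite sums

module AlgebraFacts (K : CoeffField) (A : SymmetricAlgebra K) where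
  open CoeffField K
  open FieldFacts K
  open SymmetricFunctions K using (δ; weight)
  open SymmetricAlgebra A
  module SL = IntegerSolver symmetricRing
  open SL public using () renaming (solve to solveΛ; _:=_ to _:≐_; _:+_ to _:⊕_; _:*_ to _:⊗_; :-_ to :⊝_; :0 to :𝟘; :1 to :𝟙)
  module ΛR = SetoidReasoning Λ-setoid
  module L = CommutativeRing symmetricRing

  ≡⇒≐ : ∀ {x y} → x ≡ y → x ≐ y
  ≡⇒≐ = L.reflexive

  ⟨⟩-congʳ : ∀ {x y} z → x ≐ y → ⟨ z , x ⟩ ≈ ⟨ z , y ⟩
  ⟨⟩-congʳ z e = trans (⟨⟩-comm _ _) (trans (⟨⟩-congˡ z e) (⟨⟩-comm _ _))

  ⟨⟩-⊕ʳ : ∀ z x y → ⟨ z , x ⊕ y ⟩ ≈ ⟨ z , x ⟩ + ⟨ z , y ⟩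
  ⟨⟩-⊕ʳ z x y = trans (⟨⟩-comm _ _) (trans (⟨⟩-⊕ x y z) (+-cong (⟨⟩-comm _ _) (⟨⟩-comm _ _)))

  ⟨⟩-conʳ : ∀ z c x → ⟨ z , con c ⊗ x ⟩ ≈ c * ⟨ z , x ⟩
  ⟨⟩-conʳ z c x = trans (⟨⟩-comm _ _) (trans (⟨⟩-con c x z) (*-congˡ (⟨⟩-comm _ _)))

  con-0⊗ : ∀ x → con 0# ⊗ x ≐ 𝟘
  con-0⊗ x = ≐-trans (⊗-cong con-0 ≐-refl) (L.zeroˡ x)

  con-1⊗ : ∀ x → con 1# ⊗ x ≐ x
  con-1⊗ x = ≐-trans (⊗-cong con-1 ≐-refl) (L.*-identityˡ x)

  ⟨⟩-𝟘ˡ : ∀ z → ⟨ 𝟘 , z ⟩ ≈ 0#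
  ⟨⟩-𝟘ˡ z = trans (⟨⟩-congˡ z (≐-sym (con-0⊗ 𝟘))) (trans (⟨⟩-con _ _ _) (zeroˡ _))

  ⟨⟩-𝟘ʳ : ∀ z → ⟨ z , 𝟘 ⟩ ≈ 0#
  ⟨⟩-𝟘ʳ z = trans (⟨⟩-comm _ _) (⟨⟩-𝟘ˡ z)

  ⟨⟩-conʳ-cong : ∀ z {c x y} → x ≐ con c ⊗ y → ⟨ z , x ⟩ ≈ c * ⟨ z , y ⟩
  ⟨⟩-conʳ-cong z e = trans (⟨⟩-congʳ z e) (⟨⟩-conʳ z _ _)

  con-cancel : ∀ {c x y} → ¬ c ≈ 0# → con c ⊗ x ≐ con c ⊗ y → x ≐ y
  con-cancel {c} {x} {y} c≉0 e = extensional λ z →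
    *-cancelˡ c c≉0 (trans (sym (⟨⟩-con c x z)) (trans (⟨⟩-congˡ z e) (⟨⟩-con c y z)))

  perp-cong : ∀ {x x′ y y′} → x ≐ x′ → y ≐ y′ → perp x y ≐ perp x′ y′
  perp-cong {x} {x′} {y} {y′} e f = extensional λ z →
    trans (sym (⟨⟩-perp y x z)) (trans (⟨⟩-congʳ y (⊗-cong e ≐-refl)) (trans (⟨⟩-congˡ _ f) (⟨⟩-perp y′ x′ z)))

  perp-⊗ : ∀ x y z → perp (x ⊗ y) z ≐ perp x (perp y z)
  perp-⊗ x y z = extensional λ w → trans (sym (⟨⟩-perp z (x ⊗ y) w))
    (trans (⟨⟩-congʳ z (solveΛ 3 (λ x y w → x :⊗ y :⊗ w :≐ y :⊗ (x :⊗ w)) ≐-refl x y w)) (trans (⟨⟩-perp z y _) (⟨⟩-perp _ x w)))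

  perp-comm : ∀ x y z → perp x (perp y z) ≐ perp y (perp x z)
  perp-comm x y z = ≐-trans (≐-sym (perp-⊗ x y z)) (≐-trans (perp-cong (L.*-comm x y) ≐-refl) (perp-⊗ y x z))

  perp-⊕ˡ : ∀ x y z → perp (x ⊕ y) z ≐ perp x z ⊕ perp y z
  perp-⊕ˡ x y z = extensional λ w → trans (sym (⟨⟩-perp z _ w)) (trans (⟨⟩-congʳ z (L.distribʳ w x y)) (trans (⟨⟩-⊕ʳ z _ _)
    (trans (+-cong (⟨⟩-perp z x w) (⟨⟩-perp z y w)) (sym (⟨⟩-⊕ _ _ w)))))

  perp-⊕ʳ : ∀ x y z → perp x (y ⊕ z) ≐ perp x y ⊕ perp x z
  perp-⊕ʳ x y z = extensional λ w → trans (sym (⟨⟩-perp _ x w)) (trans (⟨⟩-⊕ y z _) (trans (+-cong (⟨⟩-perp y x w) (⟨⟩-perp z x w)) (sym (⟨⟩-⊕ _ _ w))))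

  perp-con : ∀ c z → perp (con c) z ≐ con c ⊗ z
  perp-con c z = extensional λ w → trans (sym (⟨⟩-perp z _ w)) (trans (⟨⟩-conʳ z c w) (sym (⟨⟩-con c z w)))

  perp-scale : ∀ x c z → perp x (con c ⊗ z) ≐ con c ⊗ perp x z
  perp-scale x c z = ≐-trans (perp-cong ≐-refl (≐-sym (perp-con c z))) (≐-trans (perp-comm x (con c) z) (perp-con c _))

  perp-𝟘 : ∀ x → perp x 𝟘 ≐ 𝟘
  perp-𝟘 x = ≐-trans (perp-cong ≐-refl (≐-sym (con-0⊗ 𝟘))) (≐-trans (perp-scale x 0# 𝟘) (con-0⊗ _))

  ⟨⟩-perpˡ : ∀ x y z → ⟨ x ⊗ y , z ⟩ ≈ ⟨ y , perp x z ⟩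
  ⟨⟩-perpˡ x y z = trans (⟨⟩-comm _ _) (trans (⟨⟩-perp z x y) (⟨⟩-comm _ _))

  ⟨⟩-move : ∀ u v x y → ⟨ u ⊗ perp v x , y ⟩ ≈ ⟨ x , v ⊗ perp u y ⟩
  ⟨⟩-move u v x y = trans (⟨⟩-perpˡ u _ y) (sym (⟨⟩-perp x v (perp u y)))

  euler-cong : ∀ {x y} → x ≐ y → euler x ≐ euler y
  euler-cong {x} {y} e = extensional λ z → trans (euler-selfadjoint x z) (trans (⟨⟩-congˡ _ e) (sym (euler-selfadjoint y z)))

  euler-scale : ∀ c x → euler (con c ⊗ x) ≐ con c ⊗ euler x
  euler-scale c x = ≐-trans (euler-⊗ _ _) (≐-trans (⊕-cong (≐-trans (⊗-cong (euler-con c) ≐-refl) (L.zeroˡ _)) ≐-refl) (L.+-identityˡ _))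

  euler-𝟘 : euler 𝟘 ≐ 𝟘
  euler-𝟘 = ≐-trans (euler-cong (≐-sym con-0)) (euler-con 0#)

  euler-𝟙 : euler 𝟙 ≐ 𝟘
  euler-𝟙 = ≐-trans (euler-cong (≐-sym con-1)) (euler-con 1#)

  -- If every p_k^⊥ kills `y`, then z^⊥ multiplies `y` by a scalar for every `z`, by induction over
  -- generators. So ⟨y, z⟩ is a multiple of ⟨y, 1⟩.
  taylor : ∀ y → (∀ k → perp (q k) y ≐ 𝟘) → ⟨ y , 𝟙 ⟩ ≈ 0# → y ≐ 𝟘
  taylor y killed e = extensional λ z → begin
    ⟨ y , z ⟩                    ≈⟨ ⟨⟩-congʳ y (≐-sym (L.*-identityʳ z)) ⟩
    ⟨ y , z ⊗ 𝟙 ⟩                ≈⟨ ⟨⟩-perp y z 𝟙 ⟩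
    ⟨ perp z y , 𝟙 ⟩             ≈⟨ ⟨⟩-congˡ 𝟙 (proj₂ (scalar z)) ⟩
    ⟨ con (proj₁ (scalar z)) ⊗ y , 𝟙 ⟩ ≈⟨ ⟨⟩-con _ y 𝟙 ⟩
    proj₁ (scalar z) * ⟨ y , 𝟙 ⟩ ≈⟨ trans (*-congˡ e) (zeroʳ _) ⟩
    0#                           ≈⟨ sym (⟨⟩-𝟘ˡ z) ⟩
    ⟨ 𝟘 , z ⟩                    ∎
    where
    open FR
    open import Data.Product using (Σ)
    scalar : ∀ z → Σ Carrier λ c → perp z y ≐ con c ⊗ y
    scalar = generated (λ z → Σ Carrier λ c → perp z y ≐ con c ⊗ y)
      (λ c → c , perp-con c y)
      (λ k → 0# , ≐-trans (killed k) (≐-sym (con-0⊗ y)))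
      (λ { {u} {v} (c , p) (d , r) → c + d , ≐-trans (perp-⊕ˡ u v y) (≐-trans (⊕-cong p r) (≐-trans (≐-sym (L.distribʳ y _ _)) (⊗-cong (≐-sym (con-⊕ c d)) ≐-refl))) })
      (λ { {u} {v} (c , p) (d , r) → c * d , ≐-trans (perp-⊗ u v y) (≐-trans (perp-cong ≐-refl r) (≐-trans (perp-scale u d y)
        (≐-trans (⊗-cong ≐-refl p) (≐-trans (solveΛ 3 (λ c d y → d :⊗ (c :⊗ y) :≐ c :⊗ d :⊗ y) ≐-refl (con c) (con d) y) (⊗-cong (≐-sym (con-⊗ c d)) ≐-refl))))) })

  opaque
    Σ< : ℕ → (ℕ → Λ) → Λ
    Σ< zero f    = 𝟘
    Σ< (suc n) f = f 0 ⊕ Σ< n (λ i → f (suc i))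

    Σ-zero : ∀ f → Σ< 0 f ≐ 𝟘
    Σ-zero f = ≐-refl

    Σ-suc : ∀ n f → Σ< (suc n) f ≐ f 0 ⊕ Σ< n (λ i → f (suc i))
    Σ-suc n f = ≐-refl

    Σ-cong : ∀ n {f g} → (∀ i → i ℕ.< n → f i ≐ g i) → Σ< n f ≐ Σ< n g
    Σ-cong zero e = ≐-refl
    Σ-cong (suc n) e = ⊕-cong (e 0 (s≤s z≤n)) (Σ-cong n λ i i<n → e (suc i) (s≤s i<n))

    Σ-cong′ : ∀ n {f g} → (∀ i → f i ≐ g i) → Σ< n f ≐ Σ< n g
    Σ-cong′ n e = Σ-cong n λ i _ → e i

    Σ-0 : ∀ n {f} → (∀ i → i ℕ.< n → f i ≐ 𝟘) → Σ< n f ≐ 𝟘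
    Σ-0 zero e = ≐-refl
    Σ-0 (suc n) e = ≐-trans (⊕-cong (e 0 (s≤s z≤n)) (Σ-0 n λ i i<n → e (suc i) (s≤s i<n))) (L.+-identityˡ _)

    Σ-⊕ : ∀ n f g → Σ< n (λ i → f i ⊕ g i) ≐ Σ< n f ⊕ Σ< n g
    Σ-⊕ zero f g = ≐-sym (L.+-identityˡ _)
    Σ-⊕ (suc n) f g = ≐-trans (⊕-cong ≐-refl (Σ-⊕ n _ _)) (solveΛ 4 (λ a b c d → a :⊕ b :⊕ (c :⊕ d) :≐ a :⊕ c :⊕ (b :⊕ d)) ≐-refl _ _ _ _)

    Σ-⊗ : ∀ n y f → y ⊗ Σ< n f ≐ Σ< n (λ i → y ⊗ f i)
    Σ-⊗ zero y f = L.zeroʳ y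
    Σ-⊗ (suc n) y f = ≐-trans (L.distribˡ y _ _) (⊕-cong ≐-refl (Σ-⊗ n y _))

    Σ-last : ∀ n f → Σ< (suc n) f ≐ Σ< n f ⊕ f n
    Σ-last zero f = L.+-comm _ _
    Σ-last (suc n) f = ≐-trans (⊕-cong ≐-refl (Σ-last n _)) (≐-sym (L.+-assoc _ _ _))

    Σ-extend : ∀ {n m f} → n ℕ.≤ m → (∀ i → n ℕ.≤ i → f i ≐ 𝟘) → Σ< m f ≐ Σ< n f
    Σ-extend {m = m} z≤n e = Σ-0 m λ i _ → e i z≤n
    Σ-extend (s≤s n≤m) e = ⊕-cong ≐-refl (Σ-extend n≤m λ i n≤i → e (suc i) (s≤s n≤i))

    Σ-swap : ∀ n m (f : ℕ → ℕ → Λ) → Σ< n (λ i → Σ< m (λ j → f i j)) ≐ Σ< m (λ j → Σ< n (λ i → f i j))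
    Σ-swap zero m f = ≐-sym (Σ-0 m λ _ _ → ≐-refl)
    Σ-swap (suc n) m f = ≐-trans (⊕-cong ≐-refl (Σ-swap n m (λ i → f (suc i)))) (≐-sym (Σ-⊕ m (f 0) _))

    -- An index `i` outside the range does no harm: there `f i` vanishes by hypothesis, in agreement
    -- with the sum.
    Σ-δ : ∀ n i c (f : ℕ → Λ) → (∀ j → n ℕ.≤ j → f j ≐ 𝟘) → Σ< n (λ j → con (c * δ i j) ⊗ f j) ≐ con c ⊗ f i
    Σ-δ zero i c f e = ≐-sym (≐-trans (⊗-cong ≐-refl (e i z≤n)) (L.zeroʳ _))
    Σ-δ (suc n) zero c f e = ≐-trans (⊕-cong (⊗-cong (con-cong (*-identityʳ c)) ≐-refl)
      (Σ-0 n λ j _ → ≐-trans (⊗-cong (con-cong (zeroʳ c)) ≐-refl) (con-0⊗ _))) (L.+-identityʳ _)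
    Σ-δ (suc n) (suc i) c f e = ≐-trans (⊕-cong (≐-trans (⊗-cong (con-cong (zeroʳ c)) ≐-refl) (con-0⊗ _))
      (Σ-δ n i c (λ j → f (suc j)) λ j n≤j → e (suc j) (s≤s n≤j))) (L.+-identityˡ _)

    Σ-perp : ∀ n x f → perp x (Σ< n f) ≐ Σ< n (λ i → perp x (f i))
    Σ-perp zero x f = perp-𝟘 x
    Σ-perp (suc n) x f = ≐-trans (perp-⊕ʳ x _ _) (⊕-cong ≐-refl (Σ-perp n x _))

    Σ-euler : ∀ n f → euler (Σ< n f) ≐ Σ< n (λ i → euler (f i))
    Σ-euler zero f = euler-𝟘
    Σ-euler (suc n) f = ≐-trans (euler-⊕ _ _) (⊕-cong ≐-refl (Σ-euler n _))

    Σ-adjoint : ∀ n x y {f g} → (∀ i → ⟨ f i , y ⟩ ≈ ⟨ x , g i ⟩) → ⟨ Σ< n f , y ⟩ ≈ ⟨ x , Σ< n g ⟩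
    Σ-adjoint zero x y e = trans (⟨⟩-𝟘ˡ y) (sym (⟨⟩-𝟘ʳ x))
    Σ-adjoint (suc n) x y e = trans (⟨⟩-⊕ _ _ y) (trans (+-cong (e 0) (Σ-adjoint n x y λ i → e (suc i))) (sym (⟨⟩-⊕ʳ x _ _)))

-- The exponential generating series

-- g X k j is the coefficient of t^(k−j) in exp (X Σ p_i t^i / (i α)), and 0 when j > k.
module Generating (K : CoeffField) (A : SymmetricAlgebra K) where
  open CoeffField K
  open FieldFacts K
  open SymmetricFunctions K using (δ; weight)
  open SymmetricAlgebra A
  open AlgebraFacts K A

  g : Carrier → ℕ → ℕ → Λ
  g X zero zero       = 𝟙
  g X zero (suc j)    = 𝟘
  g X (suc k) zero    = con (X * (weight k) ⁻¹) ⊗ Σ< (suc k) (λ a → q a ⊗ g X k a)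
  g X (suc k) (suc j) = g X k j

  weight≉0 : ∀ k → ¬ weight k ≈ 0#
  weight≉0 k = product≉0 α≉0 (0≉ι-suc k)

  g-outside : ∀ X {k j} → k ℕ.< j → g X k j ≡ 𝟘
  g-outside X {zero} {suc j} _ = ≡.refl
  g-outside X {suc k} {suc j} (s≤s k<j) = g-outside X k<j

  g-inside : ∀ X {k j} → j ℕ.≤ k → g X k j ≡ g X (k ∸ j) 0
  g-inside X {k} z≤n = ≡.refl
  g-inside X (s≤s j≤k) = g-inside X j≤k

  -- Newton's identity, from the logarithmic derivative in t of the exponential; the scalar in the
  -- definition of `g` is chosen for it.
  recursion : ∀ X k → con X ⊗ Σ< (suc k) (λ a → q a ⊗ g X k a) ≐ con (weight k) ⊗ g X (suc k) 0
  recursion X k = begin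
    con X ⊗ s                                  ≈⟨ ⊗-cong (con-cong (sym (trans (solve 3 (λ w x i → w :* (x :* i) := x :* (w :* i)) refl (weight k) X _)
                                                    (trans (*-congˡ (inverse _ (weight≉0 k))) (*-identityʳ X))))) ≐-refl ⟩
    con (weight k * (X * (weight k) ⁻¹)) ⊗ s   ≈⟨ ⊗-cong (con-⊗ _ _) ≐-refl ⟩
    con (weight k) ⊗ con (X * (weight k) ⁻¹) ⊗ s ≈⟨ L.*-assoc _ _ _ ⟩
    con (weight k) ⊗ g X (suc k) 0             ∎
    where
    open ΛR
    s = Σ< (suc k) (λ a → q a ⊗ g X k a)

  truncated : ∀ X {k M} → k ℕ.< M → con X ⊗ Σ< M (λ a → q a ⊗ g X k a) ≐ con (weight k) ⊗ g X (suc k) 0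
  truncated X {k} k<M = ≐-trans (⊗-cong ≐-refl (Σ-extend k<M λ i k<i → ≐-trans (⊗-cong ≐-refl (≡⇒≐ (g-outside X k<i))) (L.zeroʳ _))) (recursion X k)

  -- Newton's identity for the coefficient of t^(k-n). For k at most n every term on the left
  -- vanishes, and truncated subtraction makes the scalar on the right zero.
  shifted : ∀ X k n {M} → k ℕ.≤ M → con X ⊗ Σ< M (λ a → q a ⊗ g X k (suc n ℕ.+ a)) ≐ con (α * ι (k ∸ n)) ⊗ g X k n
  shifted X zero n {M} _ = ≐-trans (≐-trans (⊗-cong ≐-refl (Σ-0 M λ a _ → L.zeroʳ _)) (L.zeroʳ _))
    (≐-sym (≐-trans (⊗-cong (con-cong (trans (*-congˡ (reflexive (≡.cong ι (ℕP.0∸n≡0 n)))) (zeroʳ α))) ≐-refl) (con-0⊗ _)))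
  shifted X (suc k) zero k<M = truncated X k<M
  shifted X (suc k) (suc n) k<M = shifted X k n (ℕP.<⇒≤ k<M)

  -- On the exponential series p_(i+1)^⊥, being α(i+1) times a derivative, acts as multiplication by
  -- X t^(i+1), and multiplying by a power of t is a shift of the second index.
  perp-q-g : ∀ X i k j → perp (q i) (g X k j) ≐ con X ⊗ g X k (suc i ℕ.+ j)
  perp-q-g X i zero zero = ≐-trans (≐-trans (perp-cong ≐-refl (≐-sym con-1)) (perp-q-con i 1#)) (≐-sym (L.zeroʳ _))
  perp-q-g X i zero (suc j) = ≐-trans (perp-𝟘 _) (≐-sym (L.zeroʳ _))
  perp-q-g X i (suc k) zero = con-cancel (weight≉0 k) (begin
    con (weight k) ⊗ perp (q i) (g X (suc k) 0)    ≈⟨ ≐-sym (perp-scale _ _ _) ⟩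
    perp (q i) (con (weight k) ⊗ g X (suc k) 0)    ≈⟨ perp-cong ≐-refl (≐-sym (recursion X k)) ⟩
    perp (q i) (con X ⊗ Σ< (suc k) _)              ≈⟨ perp-scale _ _ _ ⟩
    con X ⊗ perp (q i) (Σ< (suc k) _)              ≈⟨ ⊗-cong ≐-refl (Σ-perp (suc k) (q i) _) ⟩
    con X ⊗ Σ< (suc k) (λ a → perp (q i) (q a ⊗ g X k a))
      ≈⟨ ⊗-cong ≐-refl (Σ-cong′ (suc k) λ a → ≐-trans (perp-q-⊗ i _ _) (⊕-cong (⊗-cong (perp-q-q i a) ≐-refl)
           (≐-trans (⊗-cong ≐-refl (perp-q-g X i k a)) (solveΛ 3 (λ q x g → q :⊗ (x :⊗ g) :≐ x :⊗ (q :⊗ g)) ≐-refl _ _ _)))) ⟩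
    con X ⊗ Σ< (suc k) (λ a → con (weight i * δ i a) ⊗ g X k a ⊕ con X ⊗ (q a ⊗ g X k (suc i ℕ.+ a)))
      ≈⟨ ⊗-cong ≐-refl (≐-trans (Σ-⊕ (suc k) _ _) (⊕-cong (Σ-δ (suc k) i _ (g X k) λ j k<j → ≡⇒≐ (g-outside X k<j))
           (≐-trans (≐-sym (Σ-⊗ (suc k) _ _)) (shifted X k i (ℕP.n≤1+n k))))) ⟩
    con X ⊗ (con (weight i) ⊗ g X k i ⊕ con (α * ι (k ∸ i)) ⊗ g X k i) ≈⟨ ⊗-cong ≐-refl combine ⟩
    con X ⊗ (con (weight k) ⊗ g X k i)             ≈⟨ solveΛ 3 (λ x w g → x :⊗ (w :⊗ g) :≐ w :⊗ (x :⊗ g)) ≐-refl _ _ _ ⟩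
    con (weight k) ⊗ (con X ⊗ g X k i)             ≡⟨ ≡.cong (λ j → con (weight k) ⊗ (con X ⊗ g X k j)) (≡.sym (ℕP.+-identityʳ i)) ⟩
    con (weight k) ⊗ (con X ⊗ g X (suc k) (suc i ℕ.+ 0)) ∎)
    where
    open ΛR
    combine : con (weight i) ⊗ g X k i ⊕ con (α * ι (k ∸ i)) ⊗ g X k i ≐ con (weight k) ⊗ g X k i
    combine with ℕP.≤-<-connex i k
    ... | inj₁ i≤k = ≐-trans (≐-sym (L.distribʳ _ _ _)) (⊗-cong (≐-trans (≐-sym (con-⊕ _ _)) (con-cong (trans (sym (distribˡ _ _ _))
      (*-congˡ (trans (sym (ι-+ (suc i) (k ∸ i))) (reflexive (≡.cong (λ m → ι (suc m)) (ℕP.m+[n∸m]≡n i≤k)))))))) ≐-refl)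
    ... | inj₂ k<i rewrite g-outside X k<i = solveΛ 3 (λ a b c → a :⊗ :𝟘 :⊕ b :⊗ :𝟘 :≐ c :⊗ :𝟘) ≐-refl _ _ _
  perp-q-g X i (suc k) (suc j) = ≐-trans (perp-q-g X i k j) (≡⇒≐ (≡.cong (λ n → con X ⊗ g X (suc k) n) (≡.sym (ℕP.+-suc (suc i) j))))

  euler-g : ∀ X k j → euler (g X k j) ⊕ con (ι j) ⊗ g X k j ≐ con (ι k) ⊗ g X k j
  euler-g X zero zero = ≐-trans (⊕-cong euler-𝟙 ≐-refl) (L.+-identityˡ _)
  euler-g X zero (suc j) = ≐-trans (⊕-cong euler-𝟘 (L.zeroʳ _)) (≐-trans (L.+-identityˡ _) (≐-sym (L.zeroʳ _)))
  euler-g X (suc k) zero = ≐-trans (⊕-cong ≐-refl (con-0⊗ _)) (≐-trans (L.+-identityʳ _) (con-cancel (weight≉0 k) (begin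
    con (weight k) ⊗ euler (g X (suc k) 0)   ≈⟨ ≐-sym (euler-scale _ _) ⟩
    euler (con (weight k) ⊗ g X (suc k) 0)   ≈⟨ euler-cong (≐-sym (recursion X k)) ⟩
    euler (con X ⊗ Σ< (suc k) _)             ≈⟨ ≐-trans (euler-scale _ _) (⊗-cong ≐-refl (Σ-euler (suc k) _)) ⟩
    con X ⊗ Σ< (suc k) (λ a → euler (q a ⊗ g X k a)) ≈⟨ ⊗-cong ≐-refl (Σ-cong′ (suc k) step) ⟩
    con X ⊗ Σ< (suc k) (λ a → con (ι (suc k)) ⊗ (q a ⊗ g X k a)) ≈⟨ ⊗-cong ≐-refl (≐-sym (Σ-⊗ (suc k) _ _)) ⟩
    con X ⊗ (con (ι (suc k)) ⊗ Σ< (suc k) _) ≈⟨ solveΛ 3 (λ x i s → x :⊗ (i :⊗ s) :≐ i :⊗ (x :⊗ s)) ≐-refl _ _ _ ⟩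
    con (ι (suc k)) ⊗ (con X ⊗ Σ< (suc k) _) ≈⟨ ⊗-cong ≐-refl (recursion X k) ⟩
    con (ι (suc k)) ⊗ (con (weight k) ⊗ g X (suc k) 0) ≈⟨ solveΛ 3 (λ x i s → x :⊗ (i :⊗ s) :≐ i :⊗ (x :⊗ s)) ≐-refl _ _ _ ⟩
    con (weight k) ⊗ (con (ι (suc k)) ⊗ g X (suc k) 0) ∎)))
    where
    open ΛR
    step : ∀ a → euler (q a ⊗ g X k a) ≐ con (ι (suc k)) ⊗ (q a ⊗ g X k a)
    step a = ≐-trans (euler-⊗ _ _) (≐-trans (⊕-cong (⊗-cong (≐-trans (euler-q a) (⊗-cong (≐-trans (con-⊕ _ _) (⊕-cong con-1 ≐-refl)) ≐-refl)) ≐-refl) ≐-refl)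
      (≐-trans (solveΛ 4 (λ q i x e → (:𝟙 :⊕ i) :⊗ q :⊗ x :⊕ q :⊗ e :≐ q :⊗ x :⊕ q :⊗ (e :⊕ i :⊗ x)) ≐-refl (q a) (con (ι a)) (g X k a) (euler (g X k a)))
      (≐-trans (⊕-cong ≐-refl (⊗-cong ≐-refl (euler-g X k a)))
      (≐-trans (solveΛ 3 (λ q x i → q :⊗ x :⊕ q :⊗ (i :⊗ x) :≐ (:𝟙 :⊕ i) :⊗ (q :⊗ x)) ≐-refl (q a) (g X k a) (con (ι k)))
        (⊗-cong (≐-trans (⊕-cong (≐-sym con-1) ≐-refl) (≐-sym (con-⊕ _ _))) ≐-refl)))))
  euler-g X (suc k) (suc j) = ≐-trans (⊕-cong ≐-refl (split j)) (≐-trans (solveΛ 3 (λ e i x → e :⊕ (x :⊕ i) :≐ x :⊕ (e :⊕ i)) ≐-refl _ _ _)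
    (≐-trans (⊕-cong ≐-refl (euler-g X k j)) (≐-sym (split k))))
    where
    split : ∀ n → con (ι (suc n)) ⊗ g X k j ≐ g X k j ⊕ con (ι n) ⊗ g X k j
    split n = ≐-trans (⊗-cong (≐-trans (con-⊕ _ _) (⊕-cong con-1 ≐-refl)) ≐-refl) (≐-trans (L.distribʳ _ _ _) (⊕-cong (L.*-identityˡ _) ≐-refl))

  -- At X = 1 these are the factors of the products dual to the monomials: p_(i+1)^⊥ lowers the
  -- index by i + 1, just as p_(i+1) raises one exponent of a monomial.
  γ : ℕ → Λ
  γ k = g 1# k 0

  perp-γ : ∀ i k → perp (q i) (γ k) ≐ g 1# k (suc i)
  perp-γ i k = ≐-trans (perp-q-g 1# i k 0) (≐-trans (con-1⊗ _) (≡⇒≐ (≡.cong (g 1# k) (ℕP.+-identityʳ (suc i)))))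

  perp-perp-γ : ∀ i j k → perp (q i) (perp (q j) (γ k)) ≐ g 1# k (suc (suc (i ℕ.+ j)))
  perp-perp-γ i j k = ≐-trans (perp-cong ≐-refl (perp-γ j k)) (≐-trans (perp-q-g 1# i k (suc j)) (≐-trans (con-1⊗ _) (≡⇒≐ (≡.cong (g 1# k) (ℕP.+-suc (suc i) j)))))

-- The Laplace-Beltrami operator and its symbol

-- The Laplace–Beltrami operator and its commutators with p_1, cut off at p_N so that they are finite sums.
module Operators (K : CoeffField) (A : SymmetricAlgebra K) (N : ℕ) where
  open CoeffField K
  open FieldFacts K
  open SymmetricFunctions K using (δ; weight)
  open SymmetricAlgebra A
  open AlgebraFacts K A
  open Generating K A

  vectorField : (ℕ → Λ) → (ℕ → ℕ) → Λ → Λ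
  vectorField m s x = Σ< N (λ a → m a ⊗ perp (q (s a)) x)

  vectorField-⊗ : ∀ m s x y → vectorField m s (x ⊗ y) ≐ vectorField m s x ⊗ y ⊕ x ⊗ vectorField m s y
  vectorField-⊗ m s x y = begin
    Σ< N (λ a → m a ⊗ perp (q (s a)) (x ⊗ y))
      ≈⟨ Σ-cong′ N (λ a → ≐-trans (⊗-cong ≐-refl (perp-q-⊗ (s a) x y))
           (solveΛ 5 (λ m x y dx dy → m :⊗ (dx :⊗ y :⊕ x :⊗ dy) :≐ y :⊗ (m :⊗ dx) :⊕ x :⊗ (m :⊗ dy)) ≐-refl _ x y _ _)) ⟩
    Σ< N (λ a → y ⊗ (m a ⊗ perp (q (s a)) x) ⊕ x ⊗ (m a ⊗ perp (q (s a)) y)) ≈⟨ Σ-⊕ N _ _ ⟩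
    _ ⊕ _ ≈⟨ ⊕-cong (≐-trans (≐-sym (Σ-⊗ N y _)) (L.*-comm _ _)) (≐-sym (Σ-⊗ N x _)) ⟩
    vectorField m s x ⊗ y ⊕ x ⊗ vectorField m s y ∎
    where open ΛR

  -- By `D-q₀` the operator U is, up to 2α, the commutator of `D` with multiplication by p_1. Being
  -- of first order it is a derivation, which `D` is not; products P_μ P_ν are later handled through
  -- this.
  U V : Λ → Λ
  U = vectorField (λ a → q (suc a)) (λ a → a)
  V = vectorField q suc

  U-adjoint : ∀ x y → ⟨ U x , y ⟩ ≈ ⟨ x , V y ⟩
  U-adjoint x y = Σ-adjoint N x y λ a → ⟨⟩-move (q (suc a)) (q a) x y

  -- Newton's identity with its term a = 0 split off; U supplies all the others.
  U-g : ∀ X k → k ℕ.≤ N → U (g X k 0) ⊕ con X ⊗ (q 0 ⊗ g X k 0) ≐ con (weight k) ⊗ g X (suc k) 0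
  U-g X k k≤N = begin
    U (g X k 0) ⊕ con X ⊗ (q 0 ⊗ g X k 0)
      ≈⟨ ⊕-cong (≐-trans (Σ-cong′ N λ a → ≐-trans (⊗-cong ≐-refl (≐-trans (perp-q-g X a k 0) (≡⇒≐ (≡.cong (λ n → con X ⊗ g X k n) (ℕP.+-identityʳ (suc a))))))
           (solveΛ 3 (λ q x g → q :⊗ (x :⊗ g) :≐ x :⊗ (q :⊗ g)) ≐-refl _ _ _)) (≐-sym (Σ-⊗ N (con X) _))) ≐-refl ⟩
    con X ⊗ Σ< N (λ a → q (suc a) ⊗ g X k (suc a)) ⊕ con X ⊗ (q 0 ⊗ g X k 0)
      ≈⟨ solveΛ 3 (λ x a b → x :⊗ a :⊕ x :⊗ b :≐ x :⊗ (b :⊕ a)) ≐-refl _ _ _ ⟩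
    con X ⊗ (q 0 ⊗ g X k 0 ⊕ Σ< N (λ a → q (suc a) ⊗ g X k (suc a))) ≈⟨ ⊗-cong ≐-refl (≐-sym (Σ-suc N _)) ⟩
    con X ⊗ Σ< (suc N) (λ a → q a ⊗ g X k a) ≈⟨ truncated X (s≤s k≤N) ⟩
    con (weight k) ⊗ g X (suc k) 0 ∎
    where open ΛR

  V-γ : ∀ k → suc k ℕ.≤ N → V (γ (suc k)) ≐ con (α * ι k) ⊗ γ k
  V-γ k k<N = ≐-trans (Σ-cong′ N λ a → ⊗-cong ≐-refl (perp-γ (suc a) (suc k)))
    (≐-trans (≐-sym (con-1⊗ _)) (shifted 1# (suc k) 1 k<N))

  -- The symbol of the second-order part of `D`: it measures how far `D` is from a derivation, and
  -- is itself a derivation in each argument.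
  Γ : Λ → Λ → Λ
  Γ x y = Σ< N (λ a → Σ< N (λ b → q (suc (a ℕ.+ b)) ⊗ (perp (q a) x ⊗ perp (q b) y)))

  Γ-comm : ∀ x y → Γ x y ≐ Γ y x
  Γ-comm x y = ≐-trans (Σ-swap N N _) (Σ-cong′ N λ b → Σ-cong′ N λ a →
    ⊗-cong (≡⇒≐ (≡.cong (λ n → q (suc n)) (ℕP.+-comm a b))) (L.*-comm _ _))

  Γ-⊗ : ∀ x y z → Γ x (y ⊗ z) ≐ Γ x y ⊗ z ⊕ y ⊗ Γ x z
  Γ-⊗ x y z = ≐-trans (Σ-cong′ N λ a → ≐-trans (Σ-cong′ N λ b → ≐-trans (⊗-cong ≐-refl (⊗-cong ≐-refl (perp-q-⊗ b y z)))
      (solveΛ 6 (λ q x y z dy dz → q :⊗ (x :⊗ (dy :⊗ z :⊕ y :⊗ dz)) :≐ z :⊗ (q :⊗ (x :⊗ dy)) :⊕ y :⊗ (q :⊗ (x :⊗ dz))) ≐-refl _ _ y z _ _))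
      (≐-trans (Σ-⊕ N _ _) (⊕-cong (≐-sym (Σ-⊗ N z _)) (≐-sym (Σ-⊗ N y _)))))
    (≐-trans (Σ-⊕ N _ _) (⊕-cong (≐-trans (≐-sym (Σ-⊗ N z _)) (L.*-comm _ _)) (≐-sym (Σ-⊗ N y _))))

  Γ-𝟙 : ∀ x → Γ x 𝟙 ≐ 𝟘
  Γ-𝟙 x = Σ-0 N λ a _ → Σ-0 N λ b _ → ≐-trans (⊗-cong ≐-refl (⊗-cong ≐-refl (≐-trans (perp-cong ≐-refl (≐-sym con-1)) (perp-q-con b 1#))))
    (solveΛ 2 (λ q x → q :⊗ (x :⊗ :𝟘) :≐ :𝟘) ≐-refl _ _)

  diagonal-term : Λ → ℕ → Λ
  diagonal-term x a = con ((α + - 1#) * ι a) ⊗ (q a ⊗ perp (q a) x)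

  cubic-term : Λ → ℕ → ℕ → Λ
  cubic-term x a b = q a ⊗ (q b ⊗ perp (q (suc (a ℕ.+ b))) x) ⊕ q (suc (a ℕ.+ b)) ⊗ perp (q a) (perp (q b) x)

  -- This is 2α times the usual Laplace-Beltrami operator, written with adjoints in place of
  -- derivatives. Self-adjointness is then visible: the two halves of `cubic-term` are exchanged and
  -- the diagonal terms are fixed.
  D : Λ → Λ
  D x = Σ< N (diagonal-term x) ⊕ Σ< N (λ a → Σ< N (cubic-term x a))

  D-selfadjoint : ∀ x y → ⟨ D x , y ⟩ ≈ ⟨ x , D y ⟩
  D-selfadjoint x y = trans (⟨⟩-⊕ _ _ y) (trans (+-cong (Σ-adjoint N x y diagonal) (Σ-adjoint N x y λ a → Σ-adjoint N x y λ b → cubic a b)) (sym (⟨⟩-⊕ʳ x _ _)))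
    where
    diagonal : ∀ a → ⟨ diagonal-term x a , y ⟩ ≈ ⟨ x , diagonal-term y a ⟩
    diagonal a = trans (⟨⟩-con _ _ y) (trans (*-congˡ (⟨⟩-move (q a) (q a) x y)) (sym (⟨⟩-conʳ x _ _)))
    cubic : ∀ a b → ⟨ cubic-term x a b , y ⟩ ≈ ⟨ x , cubic-term y a b ⟩
    cubic a b = begin
      ⟨ cubic-term x a b , y ⟩ ≈⟨ ⟨⟩-⊕ _ _ y ⟩
      ⟨ q a ⊗ (q b ⊗ perp (q c) x) , y ⟩ + ⟨ q c ⊗ perp (q a) (perp (q b) x) , y ⟩
        ≈⟨ +-cong (trans (⟨⟩-congˡ y (≐-sym (L.*-assoc _ _ _))) (trans (⟨⟩-move (q a ⊗ q b) (q c) x y) (⟨⟩-congʳ x (⊗-cong ≐-refl (perp-⊗ _ _ y)))))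
                  (trans (⟨⟩-congˡ y (⊗-cong ≐-refl (≐-sym (perp-⊗ _ _ x)))) (trans (⟨⟩-move (q c) (q a ⊗ q b) x y) (⟨⟩-congʳ x (L.*-assoc _ _ _)))) ⟩
      ⟨ x , q c ⊗ perp (q a) (perp (q b) y) ⟩ + ⟨ x , q a ⊗ (q b ⊗ perp (q c) y) ⟩ ≈⟨ +-comm _ _ ⟩
      ⟨ x , q a ⊗ (q b ⊗ perp (q c) y) ⟩ + ⟨ x , q c ⊗ perp (q a) (perp (q b) y) ⟩ ≈⟨ sym (⟨⟩-⊕ʳ x _ _) ⟩
      ⟨ x , cubic-term y a b ⟩ ∎
      where
      open FR
      c = suc (a ℕ.+ b)

  D-cong : ∀ {x y} → x ≐ y → D x ≐ D y
  D-cong {x} {y} e = extensional λ z → trans (D-selfadjoint x z) (trans (⟨⟩-congˡ _ e) (sym (D-selfadjoint y z)))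

  D-⊗ : ∀ x y → D (x ⊗ y) ≐ D x ⊗ y ⊕ x ⊗ D y ⊕ (Γ x y ⊕ Γ y x)
  D-⊗ x y = begin
    D (x ⊗ y)
      ≈⟨ ⊕-cong
           (≐-trans (Σ-cong′ N λ a → ≐-trans (⊗-cong ≐-refl (⊗-cong ≐-refl (perp-q-⊗ a x y)))
              (solveΛ 6 (λ c q x y dx dy → c :⊗ (q :⊗ (dx :⊗ y :⊕ x :⊗ dy)) :≐ y :⊗ (c :⊗ (q :⊗ dx)) :⊕ x :⊗ (c :⊗ (q :⊗ dy))) ≐-refl _ _ x y _ _))
            (Σ-linear (diagonal-term x) (diagonal-term y)))
           (≐-trans (Σ-cong′ N λ a → ≐-trans (Σ-cong′ N (cubic a)) (≐-trans (Σ-⊕ N _ _) (⊕-cong (Σ-linear (cubic-term x a) (cubic-term y a)) (Σ-⊕ N _ _))))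
            (≐-trans (Σ-⊕ N _ _) (⊕-cong (Σ-linear (λ a → Σ< N (cubic-term x a)) (λ a → Σ< N (cubic-term y a))) (Σ-⊕ N _ _)))) ⟩
    y ⊗ Σ< N (diagonal-term x) ⊕ x ⊗ Σ< N (diagonal-term y) ⊕ (y ⊗ Σ< N (λ a → Σ< N (cubic-term x a)) ⊕ x ⊗ Σ< N (λ a → Σ< N (cubic-term y a)) ⊕ (Γ x y ⊕ Γ y x))
      ≈⟨ solveΛ 7 (λ x y a b c d e → y :⊗ a :⊕ x :⊗ b :⊕ (y :⊗ c :⊕ x :⊗ d :⊕ e) :≐ (a :⊕ c) :⊗ y :⊕ x :⊗ (b :⊕ d) :⊕ e) ≐-refl x y _ _ _ _ _ ⟩
    D x ⊗ y ⊕ x ⊗ D y ⊕ (Γ x y ⊕ Γ y x) ∎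
    where
    open ΛR
    Σ-linear : ∀ f h → Σ< N (λ i → y ⊗ f i ⊕ x ⊗ h i) ≐ y ⊗ Σ< N f ⊕ x ⊗ Σ< N h
    Σ-linear f h = ≐-trans (Σ-⊕ N _ _) (⊕-cong (≐-sym (Σ-⊗ N y f)) (≐-sym (Σ-⊗ N x h)))
    cubic : ∀ a b → cubic-term (x ⊗ y) a b ≐ (y ⊗ cubic-term x a b ⊕ x ⊗ cubic-term y a b)
      ⊕ (q (suc (a ℕ.+ b)) ⊗ (perp (q a) x ⊗ perp (q b) y) ⊕ q (suc (a ℕ.+ b)) ⊗ (perp (q a) y ⊗ perp (q b) x))
    cubic a b = ≐-trans
      (⊕-cong (⊗-cong ≐-refl (⊗-cong ≐-refl (perp-q-⊗ _ x y)))
        (⊗-cong ≐-refl (≐-trans (perp-cong ≐-refl (perp-q-⊗ b x y)) (≐-trans (perp-⊕ʳ _ _ _) (⊕-cong (perp-q-⊗ a _ y) (perp-q-⊗ a x _))))))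
      (solveΛ 13 (λ qa qb qc x y xa xb ya yb xab yab xc yc →
         qa :⊗ (qb :⊗ (xc :⊗ y :⊕ x :⊗ yc)) :⊕ qc :⊗ (xab :⊗ y :⊕ xb :⊗ ya :⊕ (xa :⊗ yb :⊕ x :⊗ yab))
         :≐ (y :⊗ (qa :⊗ (qb :⊗ xc) :⊕ qc :⊗ xab) :⊕ x :⊗ (qa :⊗ (qb :⊗ yc) :⊕ qc :⊗ yab))
            :⊕ (qc :⊗ (xa :⊗ yb) :⊕ qc :⊗ (ya :⊗ xb))) ≐-refl (q a) (q b) (q (suc (a ℕ.+ b))) x y
         (perp (q a) x) (perp (q b) x) (perp (q a) y) (perp (q b) y) (perp (q a) (perp (q b) x)) (perp (q a) (perp (q b) y)) _ _)

  -- Summation along diagonals: m = a + b + 1 comes from m pairs (a, b). Since `F` vanishes from N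
  -- on, the square may replace the triangle of pairs.
  abel : ∀ (F : ℕ → Λ) → (∀ i → N ℕ.≤ i → F i ≐ 𝟘) →
    Σ< N (λ a → Σ< N (λ b → F (suc (a ℕ.+ b)))) ≐ Σ< N (λ m → con (ι m) ⊗ F m)
  abel F vanish = ≐-trans (general N) (≐-trans (⊕-cong ≐-refl (≐-trans (⊗-cong ≐-refl (Σ-0 N λ b _ → vanish _ (ℕP.m≤m+n N b))) (L.zeroʳ _))) (L.+-identityʳ _))
    where
    tail : ℕ → Λ
    tail n = Σ< N (λ b → F (n ℕ.+ b))
    step : ∀ n → tail n ≐ F n ⊕ tail (suc n)
    step n = ≐-trans (≐-sym (≐-trans (⊕-cong ≐-refl (vanish _ (ℕP.m≤n+m N n))) (L.+-identityʳ _)))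
      (≐-trans (≐-sym (Σ-last N _)) (≐-trans (Σ-suc N _) (⊕-cong (≡⇒≐ (≡.cong F (ℕP.+-identityʳ n)))
        (Σ-cong′ N λ b → ≡⇒≐ (≡.cong F (ℕP.+-suc n b))))))
    general : ∀ M → Σ< M (λ a → tail (suc a)) ≐ Σ< M (λ m → con (ι m) ⊗ F m) ⊕ con (ι M) ⊗ tail M
    general zero = ≐-trans (Σ-zero _) (≐-sym (≐-trans (⊕-cong (Σ-zero _) (con-0⊗ _)) (L.+-identityˡ _)))
    general (suc M) = ≐-trans (Σ-last M _) (≐-trans (⊕-cong (≐-trans (general M) (⊕-cong ≐-refl (⊗-cong ≐-refl (step M)))) ≐-refl)
      (≐-trans (solveΛ 4 (λ s i f t → s :⊕ i :⊗ (f :⊕ t) :⊕ t :≐ s :⊕ i :⊗ f :⊕ (:𝟙 :⊕ i) :⊗ t) ≐-refl _ _ _ _)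
        (⊕-cong (≐-sym (Σ-last M _)) (⊗-cong (≐-trans (⊕-cong (≐-sym con-1) ≐-refl) (≐-sym (con-⊕ _ _))) ≐-refl))))

  -- To the coefficient of p_(a+1) g_(k-a-1) the three parts of `D` contribute (α-1)a, α(k-a-1) and
  -- a. The sum α(k-1) is independent of a, and Newton's identity collects the terms into αk g_k.
  D-γ : ∀ k → k ℕ.≤ N → D (γ k) ≐ con (α * (α * (ι k * ι (k ∸ 1)))) ⊗ γ k
  D-γ k k≤N = begin
    D (γ k)
      ≈⟨ ⊕-cong (Σ-cong′ N λ a → ⊗-cong ≐-refl (⊗-cong ≐-refl (perp-γ a k)))
           (≐-trans (Σ-cong′ N λ a → Σ-⊕ N _ _) (≐-trans (Σ-⊕ N _ _) (⊕-cong (Σ-cong′ N quadratic)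
             (≐-trans (Σ-cong′ N λ a → Σ-cong′ N λ b → ⊗-cong ≐-refl (perp-perp-γ a b k)) (abel F vanish))))) ⟩
    Σ< N (λ a → con ((α + - 1#) * ι a) ⊗ F a) ⊕ (Σ< N (λ a → con (α * ι (k ∸ suc a)) ⊗ F a) ⊕ Σ< N (λ a → con (ι a) ⊗ F a))
      ≈⟨ ≐-sym (≐-trans (Σ-⊕ N _ _) (⊕-cong ≐-refl (Σ-⊕ N _ _))) ⟩
    Σ< N (λ a → con ((α + - 1#) * ι a) ⊗ F a ⊕ (con (α * ι (k ∸ suc a)) ⊗ F a ⊕ con (ι a) ⊗ F a)) ≈⟨ Σ-cong′ N combine ⟩
    Σ< N (λ a → con (α * ι (k ∸ 1)) ⊗ F a)  ≈⟨ ≐-sym (Σ-⊗ N _ _) ⟩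
    con (α * ι (k ∸ 1)) ⊗ Σ< N F           ≈⟨ ⊗-cong ≐-refl (≐-trans (≐-sym (con-1⊗ _)) (shifted 1# k 0 k≤N)) ⟩
    con (α * ι (k ∸ 1)) ⊗ (con (α * ι k) ⊗ γ k) ≈⟨ ≐-sym (L.*-assoc _ _ _) ⟩
    con (α * ι (k ∸ 1)) ⊗ con (α * ι k) ⊗ γ k ≈⟨ ⊗-cong (≐-trans (≐-sym (con-⊗ _ _))
        (con-cong (solve 3 (λ a i j → a :* j :* (a :* i) := a :* (a :* (i :* j))) refl α (ι k) (ι (k ∸ 1))))) ≐-refl ⟩
    con (α * (α * (ι k * ι (k ∸ 1)))) ⊗ γ k ∎
    where
    open ΛR
    F : ℕ → Λ
    F a = q a ⊗ g 1# k (suc a)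
    vanish : ∀ i → N ℕ.≤ i → F i ≐ 𝟘
    vanish i N≤i = ≐-trans (⊗-cong ≐-refl (≡⇒≐ (g-outside 1# (s≤s (ℕP.≤-trans k≤N N≤i))))) (L.zeroʳ _)
    quadratic : ∀ a → Σ< N (λ b → q a ⊗ (q b ⊗ perp (q (suc (a ℕ.+ b))) (γ k))) ≐ con (α * ι (k ∸ suc a)) ⊗ F a
    quadratic a = ≐-trans (≐-sym (Σ-⊗ N (q a) _)) (≐-trans
      (⊗-cong ≐-refl (≐-trans (Σ-cong′ N λ b → ⊗-cong ≐-refl (perp-γ (suc (a ℕ.+ b)) k)) (≐-trans (≐-sym (con-1⊗ _)) (shifted 1# k (suc a) k≤N))))
      (solveΛ 3 (λ q c g → q :⊗ (c :⊗ g) :≐ c :⊗ (q :⊗ g)) ≐-refl _ _ _))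
    combine : ∀ a → con ((α + - 1#) * ι a) ⊗ F a ⊕ (con (α * ι (k ∸ suc a)) ⊗ F a ⊕ con (ι a) ⊗ F a) ≐ con (α * ι (k ∸ 1)) ⊗ F a
    combine a with ℕP.≤-<-connex k a
    ... | inj₁ k≤a = ≐-trans (⊕-cong (kill _) (⊕-cong (kill _) (kill _))) (≐-trans (solveΛ 0 (:𝟘 :⊕ (:𝟘 :⊕ :𝟘) :≐ :𝟘) ≐-refl) (≐-sym (kill _)))
      where
      kill : ∀ c → con c ⊗ F a ≐ 𝟘
      kill c = ≐-trans (⊗-cong ≐-refl (≐-trans (⊗-cong ≐-refl (≡⇒≐ (g-outside 1# (s≤s k≤a)))) (L.zeroʳ _))) (L.zeroʳ _)
    ... | inj₂ a<k = ≐-trans (⊕-cong ≐-refl (≐-sym (L.distribʳ _ _ _))) (≐-trans (≐-sym (L.distribʳ _ _ _))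
      (⊗-cong (≐-trans (⊕-cong ≐-refl (≐-sym (con-⊕ _ _))) (≐-trans (≐-sym (con-⊕ _ _)) (con-cong
        (trans (solve 3 (λ a i j → (a :+ :- :1) :* i :+ (a :* j :+ i) := a :* (i :+ j)) refl α (ι a) (ι (k ∸ suc a)))
          (*-congˡ (trans (sym (ι-+ a _)) (reflexive (≡.cong ι (split a<k))))))))) ≐-refl))
      where
      split : ∀ {a k} → a ℕ.< k → a ℕ.+ (k ∸ suc a) ≡ k ∸ 1
      split (s≤s a≤k) = ℕP.m+[n∸m]≡n a≤k

  Γ-γ₀ : ∀ x → Γ x (γ 0) ≐ 𝟘
  Γ-γ₀ = Γ-𝟙

  -- Both sides arise from Σ p_{a+b+1} g_{A−a} g_{B−b} by splitting off the terms with a = 0 or with b = 0.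
  Γ-step : ∀ A′ B → A′ ℕ.< N → B ℕ.< N →
    Γ (γ A′) (γ (suc B)) ⊕ con (weight B) ⊗ (γ A′ ⊗ γ (suc B)) ≐ Γ (γ (suc A′)) (γ B) ⊕ con (weight A′) ⊗ (γ (suc A′) ⊗ γ B)
  Γ-step A′ B A<N B<N = ≐-trans (≐-sym left) right
    where
    open ΛR
    term : ℕ → ℕ → Λ
    term a b = q (a ℕ.+ b) ⊗ (g 1# A′ a ⊗ g 1# B b)
    left : Σ< N (λ a → Σ< N (term a)) ≐ Γ (γ A′) (γ (suc B)) ⊕ con (weight B) ⊗ (γ A′ ⊗ γ (suc B))
    left = begin
      Σ< N (λ a → Σ< N (term a))
        ≈⟨ ≐-sym (Σ-extend (ℕP.n≤1+n N) λ a N≤a → Σ-0 N λ b _ → ≐-trans (⊗-cong ≐-refl (≐-trans (⊗-cong (≡⇒≐ (g-outside 1# (ℕP.<-≤-trans A<N N≤a))) ≐-refl) (L.zeroˡ _))) (L.zeroʳ _)) ⟩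
      Σ< (suc N) (λ a → Σ< N (term a)) ≈⟨ Σ-suc N _ ⟩
      Σ< N (term 0) ⊕ Σ< N (λ a → Σ< N (term (suc a))) ≈⟨ L.+-comm _ _ ⟩
      Σ< N (λ a → Σ< N (term (suc a))) ⊕ Σ< N (term 0)
        ≈⟨ ⊕-cong (Σ-cong′ N λ a → Σ-cong′ N λ b → ⊗-cong ≐-refl (≐-sym (⊗-cong (perp-γ a A′) (perp-γ b (suc B)))))
             (≐-trans (Σ-cong′ N λ b → solveΛ 3 (λ q x y → q :⊗ (x :⊗ y) :≐ x :⊗ (q :⊗ y)) ≐-refl _ _ _)
               (≐-trans (≐-sym (Σ-⊗ N (γ A′) _)) (≐-trans (⊗-cong ≐-refl (≐-trans (≐-sym (con-1⊗ _)) (truncated 1# B<N)))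
                 (solveΛ 3 (λ q x y → q :⊗ (x :⊗ y) :≐ x :⊗ (q :⊗ y)) ≐-refl _ _ _)))) ⟩
      Γ (γ A′) (γ (suc B)) ⊕ con (weight B) ⊗ (γ A′ ⊗ γ (suc B)) ∎
    right : Σ< N (λ a → Σ< N (term a)) ≐ Γ (γ (suc A′)) (γ B) ⊕ con (weight A′) ⊗ (γ (suc A′) ⊗ γ B)
    right = begin
      Σ< N (λ a → Σ< N (term a))
        ≈⟨ Σ-cong′ N (λ a → ≐-trans (≐-sym (Σ-extend (ℕP.n≤1+n N) λ b N≤b → ≐-trans (⊗-cong ≐-refl (≐-trans (⊗-cong ≐-refl (≡⇒≐ (g-outside 1# (ℕP.<-≤-trans B<N N≤b)))) (L.zeroʳ _))) (L.zeroʳ _)))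
             (≐-trans (Σ-suc N _) (L.+-comm _ _))) ⟩
      Σ< N (λ a → Σ< N (λ b → term a (suc b)) ⊕ term a 0) ≈⟨ Σ-⊕ N _ _ ⟩
      Σ< N (λ a → Σ< N (λ b → term a (suc b))) ⊕ Σ< N (λ a → term a 0)
        ≈⟨ ⊕-cong (Σ-cong′ N λ a → Σ-cong′ N λ b → ⊗-cong (≡⇒≐ (≡.cong q (ℕP.+-suc a b))) (≐-sym (⊗-cong (perp-γ a (suc A′)) (perp-γ b B))))
             (≐-trans (Σ-cong′ N λ a → ≐-trans (⊗-cong (≡⇒≐ (≡.cong q (ℕP.+-identityʳ a))) ≐-refl) (solveΛ 3 (λ q x y → q :⊗ (x :⊗ y) :≐ y :⊗ (q :⊗ x)) ≐-refl _ _ _))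
               (≐-trans (≐-sym (Σ-⊗ N (γ B) _)) (≐-trans (⊗-cong ≐-refl (≐-trans (≐-sym (con-1⊗ _)) (truncated 1# A<N)))
                 (solveΛ 3 (λ q x y → q :⊗ (x :⊗ y) :≐ x :⊗ (y :⊗ q)) ≐-refl _ _ _)))) ⟩
      Γ (γ (suc A′)) (γ B) ⊕ con (weight A′) ⊗ (γ (suc A′) ⊗ γ B) ∎

  D-𝟙 : D 𝟙 ≐ 𝟘
  D-𝟙 = ≐-trans (D-γ 0 z≤n) (≐-trans (⊗-cong (con-cong (solve 2 (λ a b → a :* (a :* (:0 :* b)) := :0) refl α (ι 0))) ≐-refl) (con-0⊗ _))

  weight-0 : weight 0 ≈ α
  weight-0 = solve 1 (λ a → a :* (:1 :+ :0) := a) refl α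

  -- D annihilates p_1, a multiple of g_1, so only the symbol remains; it is computed from the
  -- orthogonality of p_1 to the other generators.
  D-q₀ : 1 ℕ.≤ N → ∀ x → D (q 0 ⊗ x) ≐ q 0 ⊗ D x ⊕ con (α + α) ⊗ U x
  D-q₀ 1≤N x = begin
    D (q 0 ⊗ x)  ≈⟨ D-⊗ (q 0) x ⟩
    D (q 0) ⊗ x ⊕ q 0 ⊗ D x ⊕ (Γ (q 0) x ⊕ Γ x (q 0)) ≈⟨ ⊕-cong (⊕-cong (⊗-cong D-generator ≐-refl) ≐-refl) (⊕-cong symbol (≐-trans (Γ-comm _ _) symbol)) ⟩
    𝟘 ⊗ x ⊕ q 0 ⊗ D x ⊕ (con α ⊗ U x ⊕ con α ⊗ U x)
      ≈⟨ solveΛ 4 (λ x d a u → :𝟘 :⊗ x :⊕ d :⊕ (a :⊗ u :⊕ a :⊗ u) :≐ d :⊕ (a :⊕ a) :⊗ u) ≐-refl x _ (con α) _ ⟩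
    q 0 ⊗ D x ⊕ (con α ⊕ con α) ⊗ U x ≈⟨ ⊕-cong ≐-refl (⊗-cong (≐-sym (con-⊕ α α)) ≐-refl) ⟩
    q 0 ⊗ D x ⊕ con (α + α) ⊗ U x ∎
    where
    open ΛR
    -- q 0 = α g_1
    D-generator : D (q 0) ≐ 𝟘
    D-generator = ≐-trans (D-cong (≐-trans (≐-sym (L.*-identityʳ (q 0))) (≐-trans (≐-sym (≐-trans (Σ-suc 0 _) (≐-trans (⊕-cong ≐-refl (Σ-zero _)) (L.+-identityʳ _))))
        (≐-trans (≐-sym (con-1⊗ _)) (recursion 1# 0)))))
      (extensional λ z → trans (D-selfadjoint _ z) (trans (⟨⟩-con _ _ _) (trans (*-congˡ (trans (sym (D-selfadjoint _ z)) (trans (⟨⟩-congˡ z (D-γ 1 1≤N))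
        (trans (⟨⟩-con _ _ z) (solve 3 (λ a b p → a :* (a :* (b :* :0)) :* p := :0) refl α (ι 1) _))))) (trans (zeroʳ _) (sym (⟨⟩-𝟘ˡ z))))))
    symbol : Γ (q 0) x ≐ con α ⊗ U x
    symbol = ≐-trans (Σ-cong′ N inner) (≐-trans (Σ-first 1≤N _ λ a → Σ-0 N λ b _ → ≐-trans (⊗-cong (≐-trans (con-cong (zeroʳ _)) con-0) ≐-refl) (L.zeroˡ _))
       (≐-trans (Σ-cong′ N λ b → ⊗-cong (con-cong (trans (*-identityʳ _) weight-0)) ≐-refl) (≐-sym (Σ-⊗ N (con α) _))))
      where
      inner : ∀ a → Σ< N (λ b → q (suc (a ℕ.+ b)) ⊗ (perp (q a) (q 0) ⊗ perp (q b) x)) ≐ Σ< N (λ b → con (weight a * δ a 0) ⊗ (q (suc (a ℕ.+ b)) ⊗ perp (q b) x))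
      inner a = Σ-cong′ N λ b → ≐-trans (⊗-cong ≐-refl (⊗-cong (perp-q-q a 0) ≐-refl)) (solveΛ 3 (λ q c p → q :⊗ (c :⊗ p) :≐ c :⊗ (q :⊗ p)) ≐-refl _ _ _)
      Σ-first : ∀ {M} → 1 ℕ.≤ M → (f : ℕ → Λ) → (∀ a → f (suc a) ≐ 𝟘) → Σ< M f ≐ f 0
      Σ-first {suc M} _ f e = ≐-trans (Σ-suc M f) (≐-trans (⊕-cong ≐-refl (Σ-0 M λ a _ → e a)) (L.+-identityʳ _))

-- Monomial coefficients by duality

module Coefficients (K : CoeffField) (A : SymmetricAlgebra K) where
  open CoeffField K
  open FieldFacts K
  open SymmetricFunctions K using (δ; weight)
  open SymmetricAlgebra A
  open AlgebraFacts K A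
  open Generating K A

  G : List ℕ → Λ
  G []      = 𝟙
  G (m ∷ v) = γ m ⊗ G v

  -- The coefficient of the monomial x^v, because the products G v are dual to the monomial symmetric functions.
  C : List ℕ → Λ → Carrier
  C v f = ⟨ f , G v ⟩

  G-swap : ∀ a b v → G (a ∷ b ∷ v) ≐ G (b ∷ a ∷ v)
  G-swap a b v = solveΛ 3 (λ a b v → a :⊗ (b :⊗ v) :≐ b :⊗ (a :⊗ v)) ≐-refl _ _ _

  record Homogeneous (d : ℕ) (f : Λ) : Set where
    constructor homogeneous
    field eigen : euler f ≐ con (ι d) ⊗ f
  open Homogeneous public

  hom-≐ : ∀ {d x y} → x ≐ y → Homogeneous d x → Homogeneous d y
  hom-≐ e (homogeneous h) = homogeneous (≐-trans (euler-cong (≐-sym e)) (≐-trans h (⊗-cong ≐-refl e)))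

  hom-γ : ∀ k → Homogeneous k (γ k)
  hom-γ k = homogeneous (≐-trans (≐-sym (≐-trans (⊕-cong ≐-refl (con-0⊗ _)) (L.+-identityʳ _))) (euler-g 1# k 0))

  hom-g : ∀ X k → Homogeneous k (g X k 0)
  hom-g X k = homogeneous (≐-trans (≐-sym (≐-trans (⊕-cong ≐-refl (con-0⊗ _)) (L.+-identityʳ _))) (euler-g X k 0))

  hom-𝟙 : Homogeneous 0 𝟙
  hom-𝟙 = homogeneous (≐-trans euler-𝟙 (≐-sym (con-0⊗ 𝟙)))

  hom-q : ∀ k → Homogeneous (suc k) (q k)
  hom-q k = homogeneous (euler-q k)

  hom-⊗ : ∀ {a b x y} → Homogeneous a x → Homogeneous b y → Homogeneous (a ℕ.+ b) (x ⊗ y)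
  hom-⊗ {a} {b} {x} {y} (homogeneous h) (homogeneous k) = homogeneous (≐-trans (euler-⊗ x y) (≐-trans (⊕-cong (⊗-cong h ≐-refl) (⊗-cong ≐-refl k))
    (≐-trans (solveΛ 4 (λ a b x y → a :⊗ x :⊗ y :⊕ x :⊗ (b :⊗ y) :≐ (a :⊕ b) :⊗ (x :⊗ y)) ≐-refl _ _ x y)
      (⊗-cong (≐-trans (≐-sym (con-⊕ _ _)) (con-cong (sym (ι-+ a b)))) ≐-refl))))

  hom-⊕ : ∀ {d x y} → Homogeneous d x → Homogeneous d y → Homogeneous d (x ⊕ y)
  hom-⊕ (homogeneous h) (homogeneous k) = homogeneous (≐-trans (euler-⊕ _ _) (≐-trans (⊕-cong h k) (≐-sym (L.distribˡ _ _ _))))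

  hom-con : ∀ {d x} c → Homogeneous d x → Homogeneous d (con c ⊗ x)
  hom-con c (homogeneous h) = homogeneous (≐-trans (euler-scale _ _) (≐-trans (⊗-cong ≐-refl h)
    (solveΛ 3 (λ a b x → a :⊗ (b :⊗ x) :≐ b :⊗ (a :⊗ x)) ≐-refl _ _ _)))

  hom-perp : ∀ {a b x y} → Homogeneous a x → Homogeneous (a ℕ.+ b) y → Homogeneous b (perp x y)
  hom-perp {a} {b} {x} {y} (homogeneous h) (homogeneous k) = homogeneous (extensional λ z → begin
    ⟨ euler (perp x y) , z ⟩  ≈⟨ trans (euler-selfadjoint _ z) (sym (⟨⟩-perp y x _)) ⟩
    ⟨ y , x ⊗ euler z ⟩       ≈⟨ solve 2 (λ s t → t := (s :+ t) :+ :- s) refl _ _ ⟩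
    (⟨ y , euler x ⊗ z ⟩ + ⟨ y , x ⊗ euler z ⟩) + - ⟨ y , euler x ⊗ z ⟩
      ≈⟨ +-cong (trans (sym (⟨⟩-⊕ʳ y _ _)) (trans (⟨⟩-congʳ y (≐-sym (euler-⊗ x z))) (trans (sym (euler-selfadjoint y _)) (trans (⟨⟩-congˡ _ k) (⟨⟩-con _ y _)))))
           (-‿cong (trans (⟨⟩-congʳ y (≐-trans (⊗-cong h ≐-refl) (L.*-assoc _ _ _))) (⟨⟩-conʳ y _ _))) ⟩
    ι (a ℕ.+ b) * ⟨ y , x ⊗ z ⟩ + - (ι a * ⟨ y , x ⊗ z ⟩)
      ≈⟨ trans (+-congʳ (*-congʳ (ι-+ a b))) (solve 3 (λ a b p → (a :+ b) :* p :+ :- (a :* p) := b :* p) refl (ι a) (ι b) _) ⟩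
    ι b * ⟨ y , x ⊗ z ⟩ ≈⟨ trans (*-congˡ (⟨⟩-perp y x z)) (sym (⟨⟩-con _ _ z)) ⟩
    ⟨ con (ι b) ⊗ perp x y , z ⟩ ∎)
    where open FR

  hom-orthogonal : ∀ {a b x y} → Homogeneous a x → Homogeneous b y → a ≢ b → ⟨ x , y ⟩ ≈ 0#
  hom-orthogonal {a} {b} {x} {y} (homogeneous h) (homogeneous k) a≢b with ⟨ x , y ⟩ ≈? 0#
  ... | yes e = e
  ... | no ≉0 = ⊥-elim (a≢b (ι-injective a b (*-cancelˡ _ ≉0 (trans (*-comm _ _) (trans (trans (sym (⟨⟩-con _ x y)) (trans (⟨⟩-congˡ y (≐-sym h))
    (trans (euler-selfadjoint x y) (trans (⟨⟩-congʳ x k) (⟨⟩-conʳ x _ y))))) (*-comm _ _))))))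

  hom-G : ∀ v → Homogeneous (sum v) (G v)
  hom-G [] = hom-𝟙
  hom-G (m ∷ v) = hom-⊗ (hom-γ m) (hom-G v)

  -- x lies in the span of the products G u with S u, expressed by duality.
  record Span (S : List ℕ → Set) (x : Λ) : Set where
    constructor span
    field annihilated : ∀ f → (∀ u → S u → C u f ≈ 0#) → ⟨ f , x ⟩ ≈ 0#
  open Span public

  span-G : ∀ {S : List ℕ → Set} {u} → S u → Span S (G u)
  span-G s = span λ f h → h _ s

  span-≐ : ∀ {S x y} → x ≐ y → Span S x → Span S y
  span-≐ e (span a) = span λ f h → trans (⟨⟩-congʳ f (≐-sym e)) (a f h)

  span-𝟘 : ∀ {S} → Span S 𝟘
  span-𝟘 = span λ f _ → ⟨⟩-𝟘ʳ f

  span-⊕ : ∀ {S x y} → Span S x → Span S y → Span S (x ⊕ y)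
  span-⊕ (span a) (span b) = span λ f h → trans (⟨⟩-⊕ʳ f _ _) (trans (+-cong (a f h) (b f h)) (+-identityˡ _))

  span-con : ∀ {S x} c → Span S x → Span S (con c ⊗ x)
  span-con c (span a) = span λ f h → trans (⟨⟩-conʳ f c _) (trans (*-congˡ (a f h)) (zeroʳ c))

  -- A functional `f` is tested on `y ⊗ x` by testing `perp y f` on `x`; annihilation of the
  -- generators passes through the same adjunction.
  span-⊗ : ∀ {S S′ x} y → (∀ u → S u → Span S′ (y ⊗ G u)) → Span S x → Span S′ (y ⊗ x)
  span-⊗ y e (span a) = span λ f h → trans (⟨⟩-perp f y _) (a (perp y f) λ u s → trans (sym (⟨⟩-perp f y _)) (annihilated (e u s) f h))

  span-weaken : ∀ {S S′ : List ℕ → Set} {x} → (∀ u → S u → S′ u) → Span S x → Span S′ x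
  span-weaken i (span a) = span λ f h → a f λ u s → h u (i u s)

  span-γ : ∀ {S S′ : List ℕ → Set} {x} m → (∀ u → S u → S′ (m ∷ u)) → Span S x → Span S′ (γ m ⊗ x)
  span-γ m i = span-⊗ (γ m) λ u s → span-G (i u s)

  span-Σ : ∀ {S} n {f} → (∀ i → i ℕ.< n → Span S (f i)) → Span S (Σ< n f)
  span-Σ zero s = span-≐ (≐-sym (Σ-zero _)) span-𝟘
  span-Σ (suc n) s = span-≐ (≐-sym (Σ-suc n _)) (span-⊕ (s 0 (s≤s z≤n)) (span-Σ n λ i i<n → s (suc i) (s≤s i<n)))

  Everything : List ℕ → Set
  Everything _ = ⊤

  -- Newton's identity solved for p_(k+1): what remains are products with smaller power sums, to
  -- which induction applies, with `n` as fuel.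
  span-q-G : ∀ n k → k ℕ.< n → ∀ v → Span Everything (q k ⊗ G v)
  span-q-G (suc n) k (s≤s k≤n) v = span-≐ solved (span-⊕ (span-con (weight k) (span-G {u = suc k ∷ v} tt))
    (span-con (- 1#) (span-≐ (≐-trans (≐-sym (Σ-⊗ k (G v) _)) (L.*-comm _ _)) (span-Σ k smaller))))
    where
    rest = Σ< k (λ a → q a ⊗ g 1# k a)
    smaller : ∀ a → a ℕ.< k → Span Everything (G v ⊗ (q a ⊗ g 1# k a))
    smaller a a<k = span-≐ (≐-trans (⊗-cong ≐-refl (⊗-cong (≡⇒≐ (≡.sym (g-inside 1# (ℕP.<⇒≤ a<k)))) ≐-refl))
      (solveΛ 3 (λ q x v → q :⊗ (x :⊗ v) :≐ v :⊗ (q :⊗ x)) ≐-refl _ _ _)) (span-q-G n a (ℕP.<-≤-trans a<k k≤n) (k ∸ a ∷ v))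
    solved : con (weight k) ⊗ G (suc k ∷ v) ⊕ con (- 1#) ⊗ (rest ⊗ G v) ≐ q k ⊗ G v
    solved = begin
      con (weight k) ⊗ (γ (suc k) ⊗ G v) ⊕ con (- 1#) ⊗ (rest ⊗ G v)
        ≈⟨ ⊕-cong (≐-trans (≐-sym (L.*-assoc _ _ _)) (⊗-cong (≐-trans (≐-sym (recursion 1# k)) (≐-trans (con-1⊗ _) (≐-trans (Σ-last k _)
             (⊕-cong ≐-refl (≐-trans (⊗-cong ≐-refl (≡⇒≐ (≡.trans (g-inside 1# {k} ℕP.≤-refl) (≡.cong γ (ℕP.n∸n≡0 k))))) (L.*-identityʳ _)))))) ≐-refl)) ≐-refl ⟩
      (rest ⊕ q k) ⊗ G v ⊕ con (- 1#) ⊗ (rest ⊗ G v)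
        ≈⟨ solveΛ 4 (λ r q v c → (r :⊕ q) :⊗ v :⊕ c :⊗ (r :⊗ v) :≐ q :⊗ v :⊕ (:𝟙 :⊕ c) :⊗ (r :⊗ v)) ≐-refl rest (q k) (G v) (con (- 1#)) ⟩
      q k ⊗ G v ⊕ (𝟙 ⊕ con (- 1#)) ⊗ (rest ⊗ G v)
        ≈⟨ ⊕-cong ≐-refl (≐-trans (⊗-cong (≐-trans (⊕-cong (≐-sym con-1) ≐-refl) (≐-trans (≐-sym (con-⊕ _ _)) (≐-trans (con-cong (-‿inverseʳ 1#)) con-0))) ≐-refl) (L.zeroˡ _)) ⟩
      q k ⊗ G v ⊕ 𝟘 ≈⟨ L.+-identityʳ _ ⟩
      q k ⊗ G v ∎
      where open ΛR

  -- Proved after multiplication by an arbitrary `G v`, which makes the claim stable under products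
  -- of `z`. It is the reason why the coefficients C v determine a function.
  spanning : ∀ z → Span Everything z
  spanning z = span-≐ (L.*-identityʳ z) (generated (λ z → ∀ v → Span Everything (z ⊗ G v))
    (λ c v → span-con c (span-G {u = v} tt)) (λ k → span-q-G (suc k) k ℕP.≤-refl)
    (λ s t v → span-≐ (≐-sym (L.distribʳ _ _ _)) (span-⊕ (s v) (t v)))
    (λ s t v → span-≐ (≐-sym (L.*-assoc _ _ _)) (span-⊗ _ (λ u _ → s u) (t v))) z [])

  nondegenerate : ∀ {f} → (∀ v → C v f ≈ 0#) → f ≐ 𝟘
  nondegenerate {f} h = extensional λ z → trans (annihilated (spanning z) f λ u _ → h u) (sym (⟨⟩-𝟘ˡ z))

  hom-C : ∀ {d f} v → Homogeneous d f → sum v ≢ d → C v f ≈ 0#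
  hom-C v h sum≢d = hom-orthogonal h (hom-G v) (λ e → sum≢d (≡.sym e))

  hom-nondegenerate : ∀ {d f} → Homogeneous d f → (∀ v → sum v ≡ d → C v f ≈ 0#) → f ≐ 𝟘
  hom-nondegenerate {d} hf h = nondegenerate λ v → case v (sum v ℕP.≟ d)
    where
    case : ∀ v → Dec (sum v ≡ d) → C v _ ≈ 0#
    case v (yes e) = h v e
    case v (no ne) = hom-C v hf ne

  hom-perp-0 : ∀ {a b x y} → Homogeneous a x → Homogeneous b y → b ℕ.< a → perp x y ≐ 𝟘
  hom-perp-0 {a} {b} {x} {y} h k b<a = nondegenerate λ v → trans (sym (⟨⟩-perp y x (G v)))
    (hom-orthogonal k (hom-⊗ h (hom-G v)) (ℕP.<⇒≢ (ℕP.<-≤-trans b<a (ℕP.m≤m+n a _))))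

  g-cases : ∀ m j → (g 1# m j ≡ 𝟘) ⊎ Σ ℕ λ i → g 1# m j ≡ γ i
  g-cases m j with ℕP.≤-<-connex j m
  ... | inj₁ j≤m = inj₂ (m ∸ j , g-inside 1# j≤m)
  ... | inj₂ m<j = inj₁ (g-outside 1# m<j)

  OfLength : ℕ → List ℕ → Set
  OfLength n u = length u ≡ n

  -- The Leibniz rule lowers one factor at a time. A factor lowered to g_0 = 1 keeps its place as an
  -- entry 0, so the number of variables does not change.
  span-perp-q-G : ∀ k v → Span (OfLength (length v)) (perp (q k) (G v))
  span-perp-q-G k [] = span-≐ (≐-sym (≐-trans (perp-cong ≐-refl (≐-sym con-1)) (perp-q-con k 1#))) span-𝟘
  span-perp-q-G k (m ∷ v) = span-≐ (≐-sym (≐-trans (perp-q-⊗ k _ _) (⊕-cong (⊗-cong (perp-γ k m) ≐-refl) ≐-refl)))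
    (span-⊕ (first (g-cases m (suc k))) (span-γ m (λ u → ≡.cong suc) (span-perp-q-G k v)))
    where
    first : (g 1# m (suc k) ≡ 𝟘) ⊎ (Σ ℕ λ i → g 1# m (suc k) ≡ γ i) → Span (OfLength (suc (length v))) (g 1# m (suc k) ⊗ G v)
    first (inj₁ e) = span-≐ (≐-sym (≐-trans (⊗-cong (≡⇒≐ e) ≐-refl) (L.zeroˡ _))) span-𝟘
    first (inj₂ (i , e)) = span-≐ (⊗-cong (≡⇒≐ (≡.sym e)) ≐-refl) (span-G {u = i ∷ v} ≡.refl)

  -- On vectors of length n, f⁺ looks like x₁⋯x_n f.
  record Shifted (n : ℕ) (f⁺ f : Λ) : Set where
    constructor shifted-by
    field
      on-suc : ∀ u → length u ≡ n → C (map suc u) f⁺ ≈ C u f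
      on-short : ∀ w → suc (length w) ≡ n → C w f⁺ ≈ 0#
  open Shifted public

  -- The transposed relation. On products of g's the adjoint operators act factor by factor, so
  -- compatibility with the shift is checked there and carried over to functions by pairing.
  record ShiftOf (n : ℕ) (x⁺ x : Λ) : Set where
    constructor shift-of
    field respects : ∀ f⁺ f → Shifted n f⁺ f → ⟨ f⁺ , x⁺ ⟩ ≈ ⟨ f , x ⟩
  open ShiftOf public

  shift-G : ∀ u {n} → length u ≡ n → ShiftOf n (G (map suc u)) (G u)
  shift-G u e = shift-of λ f⁺ f s → on-suc s u e

  shift-short : ∀ w {n} → suc (length w) ≡ n → ShiftOf n (G w) 𝟘
  shift-short w e = shift-of λ f⁺ f s → trans (on-short s w e) (sym (⟨⟩-𝟘ʳ f))

  shift-𝟘 : ∀ {n} → ShiftOf n 𝟘 𝟘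
  shift-𝟘 = shift-of λ f⁺ f _ → trans (⟨⟩-𝟘ʳ f⁺) (sym (⟨⟩-𝟘ʳ f))

  shift-≐ : ∀ {n x⁺ x y⁺ y} → x⁺ ≐ y⁺ → x ≐ y → ShiftOf n x⁺ x → ShiftOf n y⁺ y
  shift-≐ e e′ (shift-of r) = shift-of λ f⁺ f s → trans (⟨⟩-congʳ f⁺ (≐-sym e)) (trans (r f⁺ f s) (⟨⟩-congʳ f e′))

  shift-⊕ : ∀ {n x⁺ x y⁺ y} → ShiftOf n x⁺ x → ShiftOf n y⁺ y → ShiftOf n (x⁺ ⊕ y⁺) (x ⊕ y)
  shift-⊕ (shift-of r) (shift-of r′) = shift-of λ f⁺ f s → trans (⟨⟩-⊕ʳ f⁺ _ _) (trans (+-cong (r f⁺ f s) (r′ f⁺ f s)) (sym (⟨⟩-⊕ʳ f _ _)))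

  shift-con : ∀ {n x⁺ x} c → ShiftOf n x⁺ x → ShiftOf n (con c ⊗ x⁺) (con c ⊗ x)
  shift-con c (shift-of r) = shift-of λ f⁺ f s → trans (⟨⟩-conʳ f⁺ c _) (trans (*-congˡ (r f⁺ f s)) (sym (⟨⟩-conʳ f c _)))

  shifted-γ : ∀ {n f⁺ f} m → Shifted (suc n) f⁺ f → Shifted n (perp (γ (suc m)) f⁺) (perp (γ m) f)
  shifted-γ m (shifted-by s t) = shifted-by
    (λ u e → trans (sym (⟨⟩-perp _ _ _)) (trans (s (m ∷ u) (≡.cong suc e)) (⟨⟩-perp _ _ _)))
    (λ w e → trans (sym (⟨⟩-perp _ _ _)) (t (suc m ∷ w) (≡.cong suc e)))

  shift-γ : ∀ {n x⁺ x} m → ShiftOf n x⁺ x → ShiftOf (suc n) (γ (suc m) ⊗ x⁺) (γ m ⊗ x)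
  shift-γ m (shift-of r) = shift-of λ f⁺ f s → trans (⟨⟩-perp _ _ _) (trans (r _ _ (shifted-γ m s)) (sym (⟨⟩-perp _ _ _)))

  -- Lowering the exponents m + 1 and m by k + 1: both survive, or the first becomes 0 while the
  -- second disappears, or both disappear. In the middle case x_1⋯x_n no longer divides the
  -- monomial, which is what `shift-short` covers.
  data ShiftedTerm (m k : ℕ) : Set where
    inner    : ∀ j → g 1# m k ≡ γ (suc j) → g 1# m (suc k) ≡ γ j → ShiftedTerm m k
    boundary : g 1# m k ≡ 𝟙 → g 1# m (suc k) ≡ 𝟘 → ShiftedTerm m k
    outer    : g 1# m k ≡ 𝟘 → g 1# m (suc k) ≡ 𝟘 → ShiftedTerm m k

  shiftedTerm : ∀ m k → ShiftedTerm m k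
  shiftedTerm zero zero = boundary ≡.refl ≡.refl
  shiftedTerm zero (suc k) = outer ≡.refl ≡.refl
  shiftedTerm (suc m) zero = inner m ≡.refl ≡.refl
  shiftedTerm (suc m) (suc k) with shiftedTerm m k
  ... | inner j e e′ = inner j e e′
  ... | boundary e e′ = boundary e e′
  ... | outer e e′ = outer e e′

  shift-perp-q : ∀ k u {n} → length u ≡ n → ShiftOf n (perp (q k) (G (map suc u))) (perp (q k) (G u))
  shift-perp-q k [] e = shift-≐ (≐-sym zero-perp) (≐-sym zero-perp) shift-𝟘
    where
    zero-perp : perp (q k) 𝟙 ≐ 𝟘
    zero-perp = ≐-trans (perp-cong ≐-refl (≐-sym con-1)) (perp-q-con k 1#)
  shift-perp-q k (m ∷ u) ≡.refl = shift-≐ (≐-sym (≐-trans (perp-q-⊗ k _ _) (⊕-cong (⊗-cong (perp-γ k (suc m)) ≐-refl) ≐-refl)))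
      (≐-sym (≐-trans (perp-q-⊗ k _ _) (⊕-cong (⊗-cong (perp-γ k m) ≐-refl) ≐-refl)))
      (shift-⊕ (first (shiftedTerm m k)) (shift-γ m (shift-perp-q k u ≡.refl)))
    where
    first : ShiftedTerm m k → ShiftOf (suc (length u)) (g 1# m k ⊗ G (map suc u)) (g 1# m (suc k) ⊗ G u)
    first (inner j e e′) = shift-≐ (⊗-cong (≡⇒≐ (≡.sym e)) ≐-refl) (⊗-cong (≡⇒≐ (≡.sym e′)) ≐-refl) (shift-G (j ∷ u) ≡.refl)
    first (boundary e e′) = shift-≐ (≐-sym (≐-trans (⊗-cong (≡⇒≐ e) ≐-refl) (L.*-identityˡ _))) (≐-sym (≐-trans (⊗-cong (≡⇒≐ e′) ≐-refl) (L.zeroˡ _)))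
      (shift-short (map suc u) (≡.cong suc (ListP.length-map suc u)))
    first (outer e e′) = shift-≐ (≐-sym (≐-trans (⊗-cong (≡⇒≐ e) ≐-refl) (L.zeroˡ _))) (≐-sym (≐-trans (⊗-cong (≡⇒≐ e′) ≐-refl) (L.zeroˡ _))) shift-𝟘

  -- Multiplying by x_1⋯x_n commutes with multiplying by a symmetric function. For a generator this
  -- is `shift-perp-q` read through the adjoint, and vectors with too few variables stay so.
  shifted-⊗ : ∀ {n f⁺ f} x → Shifted n f⁺ f → Shifted n (x ⊗ f⁺) (x ⊗ f)
  shifted-⊗ {n} x = generated (λ x → ∀ {f⁺ f} → Shifted n f⁺ f → Shifted n (x ⊗ f⁺) (x ⊗ f)) scalar generator
    (λ a b s → shifted-≐ (≐-sym (L.distribʳ _ _ _)) (≐-sym (L.distribʳ _ _ _)) (add (a s) (b s)))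
    (λ a b s → shifted-≐ (≐-sym (L.*-assoc _ _ _)) (≐-sym (L.*-assoc _ _ _)) (a (b s))) x
    where
    shifted-≐ : ∀ {x⁺ x y⁺ y} → x⁺ ≐ y⁺ → x ≐ y → Shifted n x⁺ x → Shifted n y⁺ y
    shifted-≐ e e′ (shifted-by s t) = shifted-by (λ u l → trans (⟨⟩-congˡ _ (≐-sym e)) (trans (s u l) (⟨⟩-congˡ _ e′)))
      (λ w l → trans (⟨⟩-congˡ _ (≐-sym e)) (t w l))
    add : ∀ {x⁺ x y⁺ y} → Shifted n x⁺ x → Shifted n y⁺ y → Shifted n (x⁺ ⊕ y⁺) (x ⊕ y)
    add (shifted-by s t) (shifted-by s′ t′) = shifted-by
      (λ u l → trans (⟨⟩-⊕ _ _ _) (trans (+-cong (s u l) (s′ u l)) (sym (⟨⟩-⊕ _ _ _))))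
      (λ w l → trans (⟨⟩-⊕ _ _ _) (trans (+-cong (t w l) (t′ w l)) (+-identityˡ _)))
    scalar : ∀ c {f⁺ f} → Shifted n f⁺ f → Shifted n (con c ⊗ f⁺) (con c ⊗ f)
    scalar c (shifted-by s t) = shifted-by (λ u l → trans (⟨⟩-con _ _ _) (trans (*-congˡ (s u l)) (sym (⟨⟩-con _ _ _))))
      (λ w l → trans (⟨⟩-con _ _ _) (trans (*-congˡ (t w l)) (zeroʳ c)))
    generator : ∀ k {f⁺ f} → Shifted n f⁺ f → Shifted n (q k ⊗ f⁺) (q k ⊗ f)
    generator k {f⁺} {f} s = shifted-by
      (λ u l → trans (⟨⟩-perpˡ _ _ _) (trans (respects (shift-perp-q k u l) f⁺ f s) (sym (⟨⟩-perpˡ _ _ _))))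
      (λ w l → trans (⟨⟩-perpˡ _ _ _) (annihilated (span-perp-q-G k w) f⁺ λ u l′ → on-short s u (≡.trans (≡.cong suc l′) l)))

-- Triangular action on the basis dual to the monomials

module Triangularity (K : CoeffField) (A : SymmetricAlgebra K) (N : ℕ) where
  open CoeffField K
  open FieldFacts K
  open SymmetricFunctions K using (δ; weight)
  open SymmetricAlgebra A
  open AlgebraFacts K A
  open Generating K A
  open Operators K A N
  open Coefficients K A

  -- The eigenvalue of 2/α times the operator D on P_v.
  e₂ : List ℕ → Carrier
  e₂ []      = 0#
  e₂ (m ∷ v) = α * (ι m * ι (m ∸ 1)) + (e₂ v + - (ι (sum v) + ι (sum v)))

  record Raised (m : ℕ) (v u : List ℕ) : Set where
    constructor raised
    field
      {head}  : ℕ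
      {tail}  : List ℕ
      shape   : u ≡ head ∷ tail
      larger  : m ℕ.< head
      equal-length : length tail ≡ length v
      equal-sum : head ℕ.+ sum tail ≡ m ℕ.+ sum v
      dominates : ∀ k → m ℕ.+ sum (take k v) ℕ.≤ head ℕ.+ sum (take k tail)

  raised-step : ∀ {m b w u} → Raised (suc m) (b ∷ w) u → Raised m (suc b ∷ w) u
  raised-step {m} {b} {w} (raised e m<h l s d) = raised e (ℕP.<-trans ℕP.≤-refl m<h) l (≡.trans s (≡.sym (ℕP.+-suc m _))) dom
    where
    dom : ∀ k → m ℕ.+ sum (take k (suc b ∷ w)) ℕ.≤ _
    dom zero = ℕP.≤-trans (ℕP.n≤1+n _) (d zero)
    dom (suc k) = ℕP.≤-trans (ℕP.≤-reflexive (ℕP.+-suc m _)) (d (suc k))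

  raised-one : ∀ m b w → Raised m (suc b ∷ w) (suc m ∷ b ∷ w)
  raised-one m b w = raised ≡.refl ℕP.≤-refl ≡.refl (≡.sym (ℕP.+-suc m _)) dom
    where
    dom : ∀ k → m ℕ.+ sum (take k (suc b ∷ w)) ℕ.≤ suc m ℕ.+ sum (take k (b ∷ w))
    dom zero = ℕP.n≤1+n _
    dom (suc k) = ℕP.≤-reflexive (ℕP.+-suc m _)

  raised-insert : ∀ {m b w u} → Raised m w u → Σ (List ℕ) λ u′ → (γ b ⊗ G u ≐ G u′) × Raised m (b ∷ w) u′
  raised-insert {m} {b} {w} (raised {h} {t} ≡.refl m<h l s d) = h ∷ b ∷ t , G-swap b h t ,
    raised ≡.refl m<h (≡.cong suc l) (≡.trans (rearrange h b (sum t)) (≡.trans (≡.cong (b ℕ.+_) s) (≡.sym (rearrange m b (sum w))))) dom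
    where
    rearrange : ∀ x y z → x ℕ.+ (y ℕ.+ z) ≡ y ℕ.+ (x ℕ.+ z)
    rearrange x y z = ≡.trans (≡.sym (ℕP.+-assoc x y z)) (≡.trans (≡.cong (ℕ._+ z) (ℕP.+-comm x y)) (ℕP.+-assoc y x z))
    dom : ∀ k → m ℕ.+ sum (take k (b ∷ w)) ℕ.≤ h ℕ.+ sum (take k (b ∷ t))
    dom zero = ℕP.+-monoˡ-≤ 0 (ℕP.<⇒≤ m<h)
    dom (suc k) = ℕP.≤-trans (ℕP.≤-reflexive (rearrange m b _)) (ℕP.≤-trans (ℕP.+-monoʳ-≤ b (d k)) (ℕP.≤-reflexive (rearrange b h _)))

  -- `Γ-step` moves one unit from b to m. After b steps the second factor is g_0, where Γ vanishes;
  -- what accumulates is -αb g_m g_b and products with a larger first factor.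
  Γ-pair : ∀ b m w → m ℕ.+ b ℕ.< N → Span (Raised m (b ∷ w)) ((Γ (γ m) (γ b) ⊕ con (α * ι b) ⊗ (γ m ⊗ γ b)) ⊗ G w)
  Γ-pair zero m w _ = span-≐ (≐-sym (≐-trans (⊗-cong (≐-trans (⊕-cong (Γ-γ₀ (γ m)) (≐-trans (⊗-cong (≐-trans (con-cong (zeroʳ α)) con-0) ≐-refl) (L.zeroˡ _))) (L.+-identityˡ _)) ≐-refl) (L.zeroˡ _))) span-𝟘
  Γ-pair (suc b) m w m+b<N = span-≐ rewritten (span-⊕ (span-weaken (λ u → raised-step) (Γ-pair b (suc m) w (ℕP.≤-<-trans (ℕP.≤-reflexive (≡.sym (ℕP.+-suc m b))) m+b<N)))
      (span-con (weight m + - (α * ι b)) (span-G {u = suc m ∷ b ∷ w} (raised-one m b w))))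
    where
    open ΛR
    m<N : m ℕ.< N
    m<N = ℕP.≤-<-trans (ℕP.m≤m+n m _) m+b<N
    b<N : b ℕ.< N
    b<N = ℕP.≤-<-trans (ℕP.≤-trans (ℕP.n≤1+n b) (ℕP.m≤n+m (suc b) m)) m+b<N
    x = γ (suc m) ⊗ γ b
    rewritten : (Γ (γ (suc m)) (γ b) ⊕ con (α * ι b) ⊗ x) ⊗ G w ⊕ con (weight m + - (α * ι b)) ⊗ G (suc m ∷ b ∷ w)
      ≐ (Γ (γ m) (γ (suc b)) ⊕ con (weight b) ⊗ (γ m ⊗ γ (suc b))) ⊗ G w
    rewritten = begin
      (Γ (γ (suc m)) (γ b) ⊕ con (α * ι b) ⊗ x) ⊗ G w ⊕ con (weight m + - (α * ι b)) ⊗ (γ (suc m) ⊗ (γ b ⊗ G w))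
        ≈⟨ solveΛ 6 (λ a c d m b w → (a :⊕ c :⊗ (m :⊗ b)) :⊗ w :⊕ d :⊗ (m :⊗ (b :⊗ w)) :≐ (a :⊕ (c :⊕ d) :⊗ (m :⊗ b)) :⊗ w) ≐-refl _ _ _ (γ (suc m)) (γ b) (G w) ⟩
      (Γ (γ (suc m)) (γ b) ⊕ (con (α * ι b) ⊕ con (weight m + - (α * ι b))) ⊗ x) ⊗ G w
        ≈⟨ ⊗-cong (⊕-cong ≐-refl (⊗-cong (≐-trans (≐-sym (con-⊕ _ _)) (con-cong (solve 2 (λ a w → a :+ (w :+ :- a) := w) refl (α * ι b) (weight m)))) ≐-refl)) ≐-refl ⟩
      (Γ (γ (suc m)) (γ b) ⊕ con (weight m) ⊗ x) ⊗ G w ≈⟨ ⊗-cong (≐-sym (Γ-step m b m<N b<N)) ≐-refl ⟩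
      (Γ (γ m) (γ (suc b)) ⊕ con (weight b) ⊗ (γ m ⊗ γ (suc b))) ⊗ G w ∎

  -- Γ is a derivation in its second argument, so each factor of `G v` contributes separately;
  -- `raised-insert` carries the factor `γ b` along.
  Γ-G : ∀ m v → m ℕ.+ sum v ℕ.< N → Span (Raised m v) (Γ (γ m) (G v) ⊕ con (α * ι (sum v)) ⊗ (γ m ⊗ G v))
  Γ-G m [] _ = span-≐ (≐-sym (≐-trans (⊕-cong (Γ-𝟙 (γ m)) (≐-trans (⊗-cong (≐-trans (con-cong (zeroʳ α)) con-0) ≐-refl) (L.zeroˡ _))) (L.+-identityˡ _))) span-𝟘
  Γ-G m (b ∷ w) bound = span-≐ rewritten (span-⊕ (Γ-pair b m w (ℕP.≤-<-trans (ℕP.+-monoʳ-≤ m (ℕP.m≤m+n b _)) bound))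
      (span-⊗ {S = Raised m w} (γ b) (λ u r → let (u′ , e , r′) = raised-insert {b = b} r in span-≐ (≐-sym e) (span-G r′))
        (Γ-G m w (ℕP.≤-<-trans (ℕP.+-monoʳ-≤ m (ℕP.m≤n+m (sum w) b)) bound))))
    where
    rewritten : (Γ (γ m) (γ b) ⊕ con (α * ι b) ⊗ (γ m ⊗ γ b)) ⊗ G w ⊕ γ b ⊗ (Γ (γ m) (G w) ⊕ con (α * ι (sum w)) ⊗ (γ m ⊗ G w))
      ≐ Γ (γ m) (G (b ∷ w)) ⊕ con (α * ι (b ℕ.+ sum w)) ⊗ (γ m ⊗ G (b ∷ w))
    rewritten = ≐-trans (solveΛ 7 (λ p c r d m b w → (p :⊕ c :⊗ (m :⊗ b)) :⊗ w :⊕ b :⊗ (r :⊕ d :⊗ (m :⊗ w)) :≐ p :⊗ w :⊕ b :⊗ r :⊕ (c :⊕ d) :⊗ (m :⊗ (b :⊗ w)))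
        ≐-refl _ _ _ _ (γ m) (γ b) (G w))
      (⊕-cong (≐-sym (Γ-⊗ (γ m) (γ b) (G w))) (⊗-cong (≐-trans (≐-sym (con-⊕ _ _)) (con-cong (trans (sym (distribˡ _ _ _)) (*-congˡ (sym (ι-+ b (sum w))))))) ≐-refl))

  D-γ-⊗ : ∀ m v → m ℕ.+ sum v ℕ.< N → D (G (m ∷ v)) ≐ con (α * (α * (ι m * ι (m ∸ 1)))) ⊗ G (m ∷ v) ⊕ γ m ⊗ D (G v) ⊕ con (1# + 1#) ⊗ Γ (γ m) (G v)
  D-γ-⊗ m v bound = ≐-trans (D-⊗ (γ m) (G v)) (⊕-cong (⊕-cong (≐-trans (⊗-cong (D-γ m (ℕP.<⇒≤ (ℕP.≤-<-trans (ℕP.m≤m+n m _) bound))) ≐-refl) (L.*-assoc _ _ _)) ≐-refl)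
    (≐-trans (⊕-cong ≐-refl (Γ-comm _ _)) (≐-trans (solveΛ 1 (λ x → x :⊕ x :≐ (:𝟙 :⊕ :𝟙) :⊗ x) ≐-refl _) (⊗-cong (≐-trans (⊕-cong (≐-sym con-1) (≐-sym con-1)) (≐-sym (con-⊕ _ _))) ≐-refl))))

  record Above (v u : List ℕ) : Set where
    constructor above
    field
      same-length : length u ≡ length v
      same-sum : sum u ≡ sum v
      dominating : ∀ k → sum (take k v) ℕ.≤ sum (take k u)
      strictly : Σ ℕ λ k → sum (take k v) ℕ.< sum (take k u)

  above-∷ : ∀ m {v u} → Above v u → Above (m ∷ v) (m ∷ u)
  above-∷ m {v} {u} (above l s d (k , lt)) = above (≡.cong suc l) (≡.cong (m ℕ.+_) s) dom (suc k , ℕP.+-monoʳ-< m lt)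
    where
    dom : ∀ k → sum (take k (m ∷ v)) ℕ.≤ sum (take k (m ∷ u))
    dom zero = z≤n
    dom (suc k) = ℕP.+-monoʳ-≤ m (d k)

  raised⇒above : ∀ m v u → Raised m v u → Above (m ∷ v) u
  raised⇒above m v .(_ ∷ _) (raised {h} {t} ≡.refl m<h l s d) = above (≡.cong suc l) s dom (1 , ℕP.+-monoˡ-< 0 m<h)
    where
    dom : ∀ k → sum (take k (m ∷ v)) ℕ.≤ sum (take k (h ∷ t))
    dom zero = z≤n
    dom (suc k) = d k

  -- The diagonal coefficient has two sources: `D-γ` gives α·α m(m-1) for an entry m, and through Γ
  -- each later entry b adds -2αb. The entries are taken in the given order and need not be sorted.
  D-G : ∀ v → sum v ℕ.< N → Span (Above v) (D (G v) ⊕ con (- (α * e₂ v)) ⊗ G v)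
  D-G [] _ = span-≐ (≐-sym (≐-trans (⊕-cong D-𝟙 (≐-trans (⊗-cong (≐-trans (con-cong (solve 1 (λ a → :- (a :* :0) := :0) refl α)) con-0) ≐-refl) (L.zeroˡ _))) (L.+-identityˡ _))) span-𝟘
  D-G (m ∷ v) bound = span-≐ rewritten (span-⊕ (span-γ m (λ u → above-∷ m) (D-G v (ℕP.≤-<-trans (ℕP.m≤n+m (sum v) m) bound)))
      (span-con (1# + 1#) (span-weaken (raised⇒above m v) (Γ-G m v bound))))
    where
    open ΛR
    c = α * (α * (ι m * ι (m ∸ 1)))
    scalars : con (- (α * e₂ v)) ⊕ con (1# + 1#) ⊗ con (α * ι (sum v)) ≐ con c ⊕ con (- (α * e₂ (m ∷ v)))
    scalars = ≐-trans (⊕-cong ≐-refl (≐-sym (con-⊗ _ _))) (≐-trans (≐-sym (con-⊕ _ _)) (≐-trans (con-cong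
      (solve 4 (λ a p e s → :- (a :* e) :+ (:1 :+ :1) :* (a :* s) := a :* (a :* p) :+ :- (a :* (a :* p :+ (e :+ :- (s :+ s))))) refl α (ι m * ι (m ∸ 1)) (e₂ v) (ι (sum v)))) (con-⊕ _ _)))
    rewritten : γ m ⊗ (D (G v) ⊕ con (- (α * e₂ v)) ⊗ G v) ⊕ con (1# + 1#) ⊗ (Γ (γ m) (G v) ⊕ con (α * ι (sum v)) ⊗ (γ m ⊗ G v))
      ≐ D (G (m ∷ v)) ⊕ con (- (α * e₂ (m ∷ v))) ⊗ G (m ∷ v)
    rewritten = begin
      _ ≈⟨ solveΛ 7 (λ m d e v t r s → m :⊗ (d :⊕ e :⊗ v) :⊕ t :⊗ (r :⊕ s :⊗ (m :⊗ v)) :≐ m :⊗ d :⊕ t :⊗ r :⊕ (e :⊕ t :⊗ s) :⊗ (m :⊗ v))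
             ≐-refl (γ m) (D (G v)) _ (G v) _ (Γ (γ m) (G v)) _ ⟩
      γ m ⊗ D (G v) ⊕ con (1# + 1#) ⊗ Γ (γ m) (G v) ⊕ (con (- (α * e₂ v)) ⊕ con (1# + 1#) ⊗ con (α * ι (sum v))) ⊗ G (m ∷ v)
        ≈⟨ ⊕-cong ≐-refl (⊗-cong scalars ≐-refl) ⟩
      γ m ⊗ D (G v) ⊕ con (1# + 1#) ⊗ Γ (γ m) (G v) ⊕ (con c ⊕ con (- (α * e₂ (m ∷ v)))) ⊗ G (m ∷ v)
        ≈⟨ solveΛ 5 (λ d r c e w → d :⊕ r :⊕ (c :⊕ e) :⊗ w :≐ c :⊗ w :⊕ d :⊕ r :⊕ e :⊗ w) ≐-refl _ _ _ _ _ ⟩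
      con c ⊗ G (m ∷ v) ⊕ γ m ⊗ D (G v) ⊕ con (1# + 1#) ⊗ Γ (γ m) (G v) ⊕ con (- (α * e₂ (m ∷ v))) ⊗ G (m ∷ v)
        ≈⟨ ⊕-cong (≐-sym (D-γ-⊗ m v bound)) ≐-refl ⟩
      D (G (m ∷ v)) ⊕ con (- (α * e₂ (m ∷ v))) ⊗ G (m ∷ v) ∎

  ι-falling : ∀ m → ι (suc m) * ι m ≈ ι m * ι (m ∸ 1) + (ι m + ι m)
  ι-falling zero = solve 1 (λ x → x :* :0 := :0 :* :0 :+ (:0 :+ :0)) refl (ι 1)
  ι-falling (suc k) = solve 1 (λ k → (:1 :+ (:1 :+ k)) :* (:1 :+ k) := (:1 :+ k) :* k :+ ((:1 :+ k) :+ (:1 :+ k))) refl (ι k)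

  sum-map-suc : ∀ v → sum (map suc v) ≡ sum v ℕ.+ length v
  sum-map-suc [] = ≡.refl
  sum-map-suc (m ∷ v) = ≡.cong suc (≡.trans (≡.cong (m ℕ.+_) (sum-map-suc v)) (≡.trans (≡.sym (ℕP.+-assoc m _ _)) ≡.refl)) ⨾ ≡.sym (ℕP.+-suc _ _)
    where
    _⨾_ : ∀ {a b c : ℕ} → a ≡ b → b ≡ c → a ≡ c
    _⨾_ = ≡.trans

  e₂-suc-∷ : ∀ m v → e₂ (map suc (m ∷ v)) + - e₂ (m ∷ v) ≈ α * (ι m + ι m) + ((e₂ (map suc v) + - e₂ v) + - (ι (length v) + ι (length v)))
  e₂-suc-∷ m v = trans (+-congʳ (+-cong (*-congˡ (ι-falling m)) (+-congˡ (-‿cong (+-cong shifted-sum shifted-sum)))))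
    (solve 7 (λ a p m e⁺ e s n → a :* (p :+ (m :+ m)) :+ (e⁺ :+ :- ((s :+ n) :+ (s :+ n))) :+ :- (a :* p :+ (e :+ :- (s :+ s)))
       := a :* (m :+ m) :+ ((e⁺ :+ :- e) :+ :- (n :+ n))) refl α (ι m * ι (m ∸ 1)) (ι m) (e₂ (map suc v)) (e₂ v) (ι (sum v)) (ι (length v)))
    where
    shifted-sum : ι (sum (map suc v)) ≈ ι (sum v) + ι (length v)
    shifted-sum = trans (reflexive (≡.cong ι (sum-map-suc v))) (ι-+ (sum v) (length v))

  -- The change depends only on the sum and the length. Hence in n variables a single scalar
  -- corrects `D` on all exponent vectors of a given degree.
  e₂-suc : ∀ v → e₂ (map suc v) + - e₂ v ≈ (α + α) * ι (sum v) + - (ι (length v) * ι (length v ∸ 1))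
  e₂-suc [] = solve 2 (λ a x → :0 :+ :- :0 := (a :+ a) :* :0 :+ :- (:0 :* x)) refl α (ι 0)
  e₂-suc (m ∷ v) = trans (e₂-suc-∷ m v) (trans (+-congˡ (+-congʳ (e₂-suc v))) (trans
    (solve 5 (λ a m s p n → a :* (m :+ m) :+ (((a :+ a) :* s :+ :- p) :+ :- (n :+ n)) := (a :+ a) :* (m :+ s) :+ :- (p :+ (n :+ n))) refl α (ι m) (ι (sum v)) _ (ι (length v)))
    (+-cong (*-congˡ (sym (ι-+ m (sum v)))) (-‿cong (sym (ι-falling (length v)))))))

  weight-suc : ∀ m → weight (suc m) ≈ α + weight m
  weight-suc m = solve 2 (λ a m → a :* (:1 :+ (:1 :+ m)) := a :+ a :* (:1 :+ m)) refl α (ι m)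

  Γ-step′ : ∀ m b → m ℕ.< N → b ℕ.< N →
    Γ (γ m) (γ (suc b)) ≐ Γ (γ (suc m)) (γ b) ⊕ (con (weight m) ⊗ (γ (suc m) ⊗ γ b) ⊕ con (- weight b) ⊗ (γ m ⊗ γ (suc b)))
  Γ-step′ m b m<N b<N = begin
    x ≈⟨ ≐-sym (L.+-identityʳ x) ⟩
    x ⊕ 𝟘 ≈⟨ ⊕-cong ≐-refl (≐-sym (≐-trans (≐-sym (L.distribʳ y _ _)) (≐-trans (⊗-cong (≐-trans (≐-sym (con-⊕ _ _)) (≐-trans (con-cong (-‿inverseʳ _)) con-0)) ≐-refl) (L.zeroˡ y)))) ⟩
    x ⊕ (con (weight b) ⊗ y ⊕ con (- weight b) ⊗ y) ≈⟨ ≐-sym (L.+-assoc _ _ _) ⟩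
    x ⊕ con (weight b) ⊗ y ⊕ con (- weight b) ⊗ y ≈⟨ ⊕-cong (Γ-step m b m<N b<N) ≐-refl ⟩
    Γ (γ (suc m)) (γ b) ⊕ con (weight m) ⊗ (γ (suc m) ⊗ γ b) ⊕ con (- weight b) ⊗ y ≈⟨ L.+-assoc _ _ _ ⟩
    _ ∎
    where
    open ΛR
    x = Γ (γ m) (γ (suc b))
    y = γ m ⊗ γ (suc b)

  -- The iteration of `Γ-pair`, run in parallel for exponents raised by one. The raised side takes
  -- one step more; it produces g_(m+2) without a partner, which has too few variables to count, and
  -- the extra -α.
  shift-Γ-pair : ∀ b m w → suc m ℕ.+ suc b ℕ.< N →
    ShiftOf (suc (suc (length w))) (Γ (γ (suc m)) (γ (suc b)) ⊗ G (map suc w)) ((Γ (γ m) (γ b) ⊕ con (- α) ⊗ (γ m ⊗ γ b)) ⊗ G w)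
  shift-Γ-pair zero m w bound = shift-≐
      (≐-trans (≐-sym (L.distribʳ (G (map suc w)) _ _)) (⊗-cong (≐-sym (≐-trans (Γ-step′ (suc m) 0 (bound′ (s≤s (ℕP.≤-reflexive (ℕP.+-comm 1 m)))) (bound′ z<)) (≐-trans (⊕-cong (Γ-γ₀ _) ≐-refl) (L.+-identityˡ _)))) ≐-refl))
      (≐-trans (solveΛ 4 (λ c m b w → :𝟘 :⊕ c :⊗ (m :⊗ (b :⊗ w)) :≐ (:𝟘 :⊕ c :⊗ (m :⊗ b)) :⊗ w) ≐-refl _ (γ m) (γ 0) (G w))
        (⊗-cong (⊕-cong (≐-sym (Γ-γ₀ (γ m))) (⊗-cong (con-cong (-‿cong weight-0)) ≐-refl)) ≐-refl))
      (shift-⊕ (shift-≐ (≐-trans (⊗-cong ≐-refl (⊗-cong ≐-refl (≐-sym (L.*-identityˡ _)))) (solveΛ 4 (λ c m b w → c :⊗ (m :⊗ (b :⊗ w)) :≐ c :⊗ (m :⊗ b) :⊗ w) ≐-refl _ _ (γ 0) _)) (L.zeroʳ _)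
                  (shift-con (weight (suc m)) (shift-short (suc (suc m) ∷ map suc w) (≡.cong (λ n → suc (suc n)) (ListP.length-map suc w)))))
                (shift-≐ (solveΛ 4 (λ c m b w → c :⊗ (m :⊗ (b :⊗ w)) :≐ c :⊗ (m :⊗ b) :⊗ w) ≐-refl _ _ _ _) ≐-refl
                  (shift-con (- weight 0) (shift-G (m ∷ 0 ∷ w) ≡.refl))))
    where
    z< : 0 ℕ.< suc m ℕ.+ 1
    z< = s≤s z≤n
    bound′ : ∀ {x} → x ℕ.< suc m ℕ.+ 1 → x ℕ.< N
    bound′ lt = ℕP.<-trans lt bound
  shift-Γ-pair (suc b) m w bound = shift-≐
      (≐-trans (solveΛ 6 (λ p c x d y w → p :⊗ w :⊕ (c :⊗ (x :⊗ w) :⊕ d :⊗ (y :⊗ w)) :≐ (p :⊕ (c :⊗ x :⊕ d :⊗ y)) :⊗ w) ≐-refl _ _ _ _ _ (G (map suc w)))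
        (⊗-cong (≐-sym (Γ-step′ (suc m) (suc b) (below (ℕP.m≤m+n (suc m) _)) (below (ℕP.≤-trans (ℕP.n≤1+n _) (ℕP.m≤n+m (suc (suc b)) (suc m)))))) ≐-refl))
      (≐-trans (solveΛ 7 (λ p a x c d y w → (p :⊕ a :⊗ x) :⊗ w :⊕ (c :⊗ (x :⊗ w) :⊕ d :⊗ (y :⊗ w)) :≐ (p :⊕ ((a :⊕ c) :⊗ x :⊕ d :⊗ y)) :⊗ w) ≐-refl _ _ _ _ _ _ (G w))
        (⊗-cong (≐-trans (⊕-cong ≐-refl (⊕-cong (⊗-cong first-scalar ≐-refl) (⊗-cong second-scalar ≐-refl)))
          (≐-trans (solveΛ 6 (λ p c x d a y → p :⊕ (c :⊗ x :⊕ (d :⊕ a) :⊗ y) :≐ p :⊕ (c :⊗ x :⊕ d :⊗ y) :⊕ a :⊗ y) ≐-refl _ _ _ _ _ _)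
            (⊕-cong (≐-sym (Γ-step′ m b (below (ℕP.≤-trans (ℕP.n≤1+n m) (ℕP.m≤m+n (suc m) _))) (below (ℕP.≤-trans (ℕP.m≤n+m b 2) (ℕP.m≤n+m (suc (suc b)) (suc m)))))) ≐-refl))) ≐-refl))
      (shift-⊕ (shift-Γ-pair b (suc m) w (ℕP.≤-<-trans (ℕP.≤-reflexive (≡.cong suc (≡.sym (ℕP.+-suc m (suc b))))) bound))
        (shift-⊕ (shift-con (weight (suc m)) (shift-≐ (≐-sym (L.*-assoc _ _ _)) (≐-sym (L.*-assoc _ _ _)) (shift-G (suc m ∷ b ∷ w) ≡.refl)))
                 (shift-con (- weight (suc b)) (shift-≐ (≐-sym (L.*-assoc _ _ _)) (≐-sym (L.*-assoc _ _ _)) (shift-G (m ∷ suc b ∷ w) ≡.refl)))))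
    where
    below : ∀ {x} → x ℕ.≤ suc m ℕ.+ suc (suc b) → x ℕ.< N
    below le = ℕP.≤-<-trans le bound
    first-scalar : con (- α) ⊕ con (weight (suc m)) ≐ con (weight m)
    first-scalar = ≐-trans (≐-sym (con-⊕ _ _)) (con-cong (trans (+-congˡ (weight-suc m)) (solve 2 (λ a w → :- a :+ (a :+ w) := w) refl α (weight m))))
    second-scalar : con (- weight (suc b)) ≐ con (- weight b) ⊕ con (- α)
    second-scalar = ≐-trans (con-cong (trans (-‿cong (weight-suc b)) (solve 2 (λ a w → :- (a :+ w) := :- w :+ :- a) refl α (weight b)))) (con-⊕ _ _)

  shift-Γ-G : ∀ m v → suc m ℕ.+ sum (map suc v) ℕ.< N →
    ShiftOf (suc (length v)) (Γ (γ (suc m)) (G (map suc v))) (Γ (γ m) (G v) ⊕ con (- (α * ι (length v))) ⊗ (γ m ⊗ G v))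
  shift-Γ-G m [] _ = shift-≐ (≐-sym (Γ-𝟙 _)) (≐-sym (≐-trans (⊕-cong (Γ-𝟙 _) (≐-trans (⊗-cong (≐-trans (con-cong (solve 1 (λ a → :- (a :* :0) := :0) refl α)) con-0) ≐-refl) (L.zeroˡ _))) (L.+-identityˡ _))) shift-𝟘
  shift-Γ-G m (b ∷ w) bound = shift-≐ (≐-sym (Γ-⊗ _ _ _))
      (≐-trans (solveΛ 7 (λ p c r d m b w → (p :⊕ c :⊗ (m :⊗ b)) :⊗ w :⊕ b :⊗ (r :⊕ d :⊗ (m :⊗ w)) :≐ p :⊗ w :⊕ b :⊗ r :⊕ (c :⊕ d) :⊗ (m :⊗ (b :⊗ w)))
          ≐-refl _ _ _ _ (γ m) (γ b) (G w))
        (⊕-cong (≐-sym (Γ-⊗ (γ m) (γ b) (G w))) (⊗-cong (≐-trans (≐-sym (con-⊕ _ _)) (con-cong (solve 2 (λ a l → :- a :+ :- (a :* l) := :- (a :* (:1 :+ l))) refl α (ι (length w))))) ≐-refl)))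
      (shift-⊕ (shift-Γ-pair b m w (ℕP.≤-<-trans (ℕP.+-monoʳ-≤ (suc m) (ℕP.m≤m+n (suc b) _)) bound))
        (shift-γ b (shift-Γ-G m w (ℕP.≤-<-trans (ℕP.+-monoʳ-≤ (suc m) (ℕP.m≤n+m _ (suc b))) bound))))

  -- Conjugated by multiplication with x_1⋯x_n, the operator `D` in n variables changes by a scalar,
  -- the difference of the two diagonal coefficients. This is what lets an eigenfunction of `D`
  -- acquire a column.
  shift-D : ∀ v → sum (map suc v) ℕ.< N → ShiftOf (length v) (D (G (map suc v))) (D (G v) ⊕ con (α * (e₂ (map suc v) + - e₂ v)) ⊗ G v)
  shift-D [] _ = shift-≐ (≐-sym D-𝟙) (≐-sym (≐-trans (⊕-cong D-𝟙 (≐-trans (⊗-cong (≐-trans (con-cong (solve 1 (λ a → a :* (:0 :+ :- :0) := :0) refl α)) con-0) ≐-refl) (L.zeroˡ _))) (L.+-identityˡ _))) shift-𝟘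
  shift-D (m ∷ v) bound = shift-≐ (≐-sym (D-γ-⊗ (suc m) (map suc v) bound)) rewritten
      (shift-⊕ (shift-⊕ (shift-con _ (shift-G (m ∷ v) ≡.refl)) (shift-γ m (shift-D v (ℕP.≤-<-trans (ℕP.m≤n+m _ (suc m)) bound))))
        (shift-con (1# + 1#) (shift-Γ-G m v bound)))
    where
    open ΛR
    c = α * (α * (ι m * ι (m ∸ 1)))
    c⁺ = α * (α * (ι (suc m) * ι m))
    ε = α * (e₂ (map suc v) + - e₂ v)
    scalars : con c⁺ ⊕ con ε ⊕ con (1# + 1#) ⊗ con (- (α * ι (length v))) ≐ con c ⊕ con (α * (e₂ (map suc (m ∷ v)) + - e₂ (m ∷ v)))
    scalars = ≐-trans (⊕-cong (≐-sym (con-⊕ _ _)) (≐-sym (con-⊗ _ _))) (≐-trans (≐-sym (con-⊕ _ _)) (≐-trans (con-cong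
      (trans (+-congʳ (+-congʳ (*-congˡ (*-congˡ (ι-falling m))))) (trans
        (solve 5 (λ a p m e n → a :* (a :* (p :+ (m :+ m))) :+ a :* e :+ (:1 :+ :1) :* :- (a :* n) := a :* (a :* p) :+ a :* (a :* (m :+ m) :+ (e :+ :- (n :+ n)))) refl α (ι m * ι (m ∸ 1)) (ι m) (e₂ (map suc v) + - e₂ v) (ι (length v)))
        (+-congˡ (*-congˡ (sym (e₂-suc-∷ m v))))))) (con-⊕ _ _)))
    rewritten : con c⁺ ⊗ G (m ∷ v) ⊕ γ m ⊗ (D (G v) ⊕ con ε ⊗ G v) ⊕ con (1# + 1#) ⊗ (Γ (γ m) (G v) ⊕ con (- (α * ι (length v))) ⊗ (γ m ⊗ G v))
      ≐ D (G (m ∷ v)) ⊕ con (α * (e₂ (map suc (m ∷ v)) + - e₂ (m ∷ v))) ⊗ G (m ∷ v)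
    rewritten = begin
      _ ≈⟨ solveΛ 8 (λ c m v d e t r n → c :⊗ (m :⊗ v) :⊕ m :⊗ (d :⊕ e :⊗ v) :⊕ t :⊗ (r :⊕ n :⊗ (m :⊗ v)) :≐ m :⊗ d :⊕ t :⊗ r :⊕ (c :⊕ e :⊕ t :⊗ n) :⊗ (m :⊗ v))
             ≐-refl (con c⁺) (γ m) (G v) (D (G v)) _ _ (Γ (γ m) (G v)) _ ⟩
      γ m ⊗ D (G v) ⊕ con (1# + 1#) ⊗ Γ (γ m) (G v) ⊕ (con c⁺ ⊕ con ε ⊕ con (1# + 1#) ⊗ con (- (α * ι (length v)))) ⊗ G (m ∷ v)
        ≈⟨ ⊕-cong ≐-refl (⊗-cong scalars ≐-refl) ⟩
      γ m ⊗ D (G v) ⊕ con (1# + 1#) ⊗ Γ (γ m) (G v) ⊕ (con c ⊕ con (α * (e₂ (map suc (m ∷ v)) + - e₂ (m ∷ v)))) ⊗ G (m ∷ v)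
        ≈⟨ solveΛ 5 (λ d r c e w → d :⊕ r :⊕ (c :⊕ e) :⊗ w :≐ c :⊗ w :⊕ d :⊕ r :⊕ e :⊗ w) ≐-refl _ _ _ _ _ ⟩
      con c ⊗ G (m ∷ v) ⊕ γ m ⊗ D (G v) ⊕ con (1# + 1#) ⊗ Γ (γ m) (G v) ⊕ con (α * (e₂ (map suc (m ∷ v)) + - e₂ (m ∷ v))) ⊗ G (m ∷ v)
        ≈⟨ ⊕-cong (≐-sym (D-γ-⊗ m v (ℕP.≤-<-trans (ℕP.≤-trans (ℕP.+-monoʳ-≤ m smaller) (ℕP.n≤1+n _)) bound))) ≐-refl ⟩
      D (G (m ∷ v)) ⊕ con (α * (e₂ (map suc (m ∷ v)) + - e₂ (m ∷ v))) ⊗ G (m ∷ v) ∎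
      where
      smaller : sum v ℕ.≤ sum (map suc v)
      smaller = ℕP.≤-trans (ℕP.m≤m+n _ _) (ℕP.≤-reflexive (≡.sym (sum-map-suc v)))

  -- For one factor `U-g` reads U g_m + p_1 g_m = α(m+1) g_(m+1). Adding p_1 once for each factor
  -- therefore keeps the number of factors fixed.
  U-G : ∀ v → sum v ℕ.≤ N → Span (OfLength (length v)) (U (G v) ⊕ con (ι (length v)) ⊗ (q 0 ⊗ G v))
  U-G [] _ = span-≐ (≐-sym (≐-trans (⊕-cong (Σ-0 N λ a _ → ≐-trans (⊗-cong ≐-refl (≐-trans (perp-cong ≐-refl (≐-sym con-1)) (perp-q-con a 1#))) (L.zeroʳ _)) (con-0⊗ _)) (L.+-identityˡ _))) span-𝟘
  U-G (m ∷ v) bound = span-≐ rewritten (span-⊕ (span-con (weight m) (span-G {u = suc m ∷ v} ≡.refl)) (span-γ m (λ u → ≡.cong suc) (U-G v (ℕP.≤-trans (ℕP.m≤n+m _ m) bound))))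
    where
    rewritten : con (weight m) ⊗ (γ (suc m) ⊗ G v) ⊕ γ m ⊗ (U (G v) ⊕ con (ι (length v)) ⊗ (q 0 ⊗ G v)) ≐ U (G (m ∷ v)) ⊕ con (ι (suc (length v))) ⊗ (q 0 ⊗ G (m ∷ v))
    rewritten = ≐-trans (⊕-cong (≐-trans (≐-sym (L.*-assoc _ _ _)) (⊗-cong (≐-trans (≐-sym (U-g 1# m (ℕP.≤-trans (ℕP.m≤m+n m _) bound))) (⊕-cong ≐-refl (con-1⊗ _))) ≐-refl)) ≐-refl)
      (≐-trans (solveΛ 6 (λ u q m v w n → (u :⊕ q :⊗ m) :⊗ v :⊕ m :⊗ (w :⊕ n :⊗ (q :⊗ v)) :≐ u :⊗ v :⊕ m :⊗ w :⊕ (:𝟙 :⊕ n) :⊗ (q :⊗ (m :⊗ v))) ≐-refl (U (γ m)) (q 0) (γ m) (G v) (U (G v)) (con (ι (length v))))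
        (⊕-cong (≐-sym (vectorField-⊗ _ _ (γ m) (G v))) (⊗-cong (≐-trans (⊕-cong (≐-sym con-1) ≐-refl) (≐-sym (con-⊕ _ _))) ≐-refl)))

-- Partitions and the dominance order

module Partitions where
  open import Data.Nat using (_+_; _*_; _≤_; _<_)

  -- Weakly decreasing lists with entries at most m; trailing zeros are allowed.
  data Decreasing (m : ℕ) : List ℕ → Set where
    []  : Decreasing m []
    _∷_ : ∀ {x v} → x ≤ m → Decreasing x v → Decreasing m (x ∷ v)

  data Bounded (m : ℕ) : List ℕ → Set where
    []   : Bounded m []
    cons : ∀ {x v} → 1 ≤ x → x ≤ m → Bounded x v → Bounded m (x ∷ v)

  data IsPartition : List ℕ → Set where
    []   : IsPartition []
    cons : ∀ {x v} → 1 ≤ x → Bounded x v → IsPartition (x ∷ v)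

  bounded⇒partition : ∀ {m v} → Bounded m v → IsPartition v
  bounded⇒partition [] = []
  bounded⇒partition (cons p _ b) = cons p b

  bounded-weaken : ∀ {m n v} → m ≤ n → Bounded m v → Bounded n v
  bounded-weaken m≤n [] = []
  bounded-weaken m≤n (cons p q b) = cons p (ℕP.≤-trans q m≤n) b

  bounded⇒decreasing : ∀ {m v} → Bounded m v → Decreasing m v
  bounded⇒decreasing [] = []
  bounded⇒decreasing (cons p q b) = q ∷ bounded⇒decreasing b

  partition⇒bounded : ∀ {v} → IsPartition v → Bounded (sum v) v
  partition⇒bounded [] = []
  partition⇒bounded (cons {x} p b) = cons p (ℕP.m≤m+n x _) b

  decreasing-weaken : ∀ {m n v} → m ≤ n → Decreasing m v → Decreasing n v
  decreasing-weaken m≤n [] = []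
  decreasing-weaken m≤n (q ∷ b) = ℕP.≤-trans q m≤n ∷ b

  dropZeros-bounded : ∀ {m v} → Decreasing m v → Bounded m (dropZeros v)
  dropZeros-bounded [] = []
  dropZeros-bounded {m} {zero ∷ v} (q ∷ b) = bounded-weaken z≤n (dropZeros-bounded b)
  dropZeros-bounded {m} {suc x ∷ v} (q ∷ b) = cons (s≤s z≤n) q (dropZeros-bounded b)

  dropZeros-partition : ∀ {m v} → Decreasing m v → IsPartition (dropZeros v)
  dropZeros-partition d = bounded⇒partition (dropZeros-bounded d)

  dropZeros-bounded-id : ∀ {m v} → Bounded m v → dropZeros v ≡ v
  dropZeros-bounded-id [] = ≡.refl
  dropZeros-bounded-id (cons (s≤s _) _ b) = ≡.cong (_ ∷_) (dropZeros-bounded-id b)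

  dropZeros-id : ∀ {v} → IsPartition v → dropZeros v ≡ v
  dropZeros-id p = dropZeros-bounded-id (partition⇒bounded p)

  dropZeros-empty : ∀ {v} → Decreasing 0 v → dropZeros v ≡ []
  dropZeros-empty [] = ≡.refl
  dropZeros-empty (z≤n ∷ d) = dropZeros-empty d

  sum-dropZeros : ∀ v → sum (dropZeros v) ≡ sum v
  sum-dropZeros [] = ≡.refl
  sum-dropZeros (zero ∷ v) = sum-dropZeros v
  sum-dropZeros (suc x ∷ v) = ≡.cong (suc x +_) (sum-dropZeros v)

  length-dropZeros : ∀ v → length (dropZeros v) ≤ length v
  length-dropZeros [] = z≤n
  length-dropZeros (zero ∷ v) = ℕP.≤-trans (length-dropZeros v) (ℕP.n≤1+n _)
  length-dropZeros (suc x ∷ v) = s≤s (length-dropZeros v)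

  partial : ℕ → List ℕ → ℕ
  partial k v = sum (take k v)

  partial≤sum : ∀ k v → partial k v ≤ sum v
  partial≤sum zero v = z≤n
  partial≤sum (suc k) [] = z≤n
  partial≤sum (suc k) (x ∷ v) = ℕP.+-monoʳ-≤ x (partial≤sum k v)

  partial-full : ∀ k v → length v ≤ k → partial k v ≡ sum v
  partial-full zero [] _ = ≡.refl
  partial-full (suc k) [] _ = ≡.refl
  partial-full (suc k) (x ∷ v) (s≤s l) = ≡.cong (x +_) (partial-full k v l)

  partial-zero : ∀ {v} → Decreasing 0 v → ∀ k → partial k v ≡ 0
  partial-zero d zero = ≡.refl
  partial-zero [] (suc k) = ≡.refl
  partial-zero (z≤n ∷ d) (suc k) = partial-zero d k

  partial-dropZeros : ∀ {m v} → Decreasing m v → ∀ k → partial k (dropZeros v) ≡ partial k v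
  partial-dropZeros d zero = ≡.refl
  partial-dropZeros [] (suc k) = ≡.refl
  partial-dropZeros {m} {zero ∷ v} (q ∷ d) (suc k) = ≡.trans (ℕP.n≤0⇒n≡0 (ℕP.≤-trans (partial≤sum (suc k) (dropZeros v))
    (ℕP.≤-reflexive (≡.trans (sum-dropZeros v) (≡.trans (≡.sym (partial-full (length v) v ℕP.≤-refl)) (partial-zero d (length v))))))) (≡.sym (partial-zero d k))
  partial-dropZeros {m} {suc x ∷ v} (q ∷ d) (suc k) = ≡.cong (suc x +_) (partial-dropZeros d k)

  record Dominated (μ κ : List ℕ) : Set where
    constructor dominated
    field
      equal-sums : sum μ ≡ sum κ
      partials : ∀ k → partial k μ ≤ partial k κ
  open Dominated public

  dominated-trans : ∀ {μ κ ρ} → Dominated μ κ → Dominated κ ρ → Dominated μ ρ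
  dominated-trans (dominated e p) (dominated e′ p′) = dominated (≡.trans e e′) λ k → ℕP.≤-trans (p k) (p′ k)

  dominated-tail : ∀ {m μ κ} → Dominated (m ∷ μ) (m ∷ κ) → Dominated μ κ
  dominated-tail {m} (dominated e p) = dominated (ℕP.+-cancelˡ-≡ m _ _ e) λ k → ℕP.+-cancelˡ-≤ m _ _ (p (suc k))

  dominated-head : ∀ {a b μ κ} → Dominated (a ∷ μ) (b ∷ κ) → a ≤ b
  dominated-head {a} {b} (dominated e p) = ≡.subst₂ _≤_ (ℕP.+-identityʳ a) (ℕP.+-identityʳ b) (p 1)

  dominated-antisym : ∀ {μ κ} → IsPartition μ → IsPartition κ → Dominated μ κ → Dominated κ μ → μ ≡ κ
  dominated-antisym [] [] d e = ≡.refl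
  dominated-antisym [] (cons (s≤s _) b) (dominated () _) e
  dominated-antisym (cons (s≤s _) b) [] (dominated () _) e
  dominated-antisym (cons p b) (cons p′ b′) d e with ℕP.≤-antisym (dominated-head d) (dominated-head e)
  ... | ≡.refl = ≡.cong (_ ∷_) (dominated-antisym (bounded⇒partition b) (bounded⇒partition b′) (dominated-tail d) (dominated-tail e))

  partial<sum : ∀ {m κ} → Bounded m κ → ∀ n → n < length κ → partial n κ < sum κ
  partial<sum (cons {x} p _ b) zero _ = ℕP.≤-trans p (ℕP.m≤m+n x _)
  partial<sum (cons {x} p _ b) (suc n) (s≤s l) = ℕP.+-monoʳ-< x (partial<sum b n l)

  -- At the length of `v` its partial sums have reached the total, so those of κ have as well; the
  -- parts of κ being positive, none can be left.
  dominated-length : ∀ {v κ} → IsPartition κ → Dominated v κ → length κ ≤ length v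
  dominated-length {v} {κ} p (dominated e d) with ℕP.≤-<-connex (length κ) (length v)
  ... | inj₁ le = le
  ... | inj₂ lt = ⊥-elim (ℕP.<⇒≱ (partial<sum (partition⇒bounded p) (length v) lt)
    (ℕP.≤-trans (ℕP.≤-reflexive (≡.trans (≡.sym e) (≡.sym (partial-full (length v) v ℕP.≤-refl)))) (d (length v))))

  -- Domination is an intersection of infinitely many decidable conditions and so stable under
  -- double negation. Triangularity delivers it in the negated form only.
  dominated? : ∀ {μ κ} → ¬ ¬ Dominated μ κ → Dominated μ κ
  dominated? {μ} {κ} nn = dominated (stable (sum μ ℕP.≟ sum κ) λ n → nn λ d → n (equal-sums d))
    λ k → stable (partial k μ ℕP.≤? partial k κ) λ n → nn λ d → n (partials d k)
    where
    stable : ∀ {Q : Set} → Dec Q → ¬ ¬ Q → Q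
    stable (yes q) _ = q
    stable (no nq) nn = ⊥-elim (nn nq)

  insert : ℕ → List ℕ → List ℕ
  insert x [] = x ∷ []
  insert x (y ∷ v) with y ℕP.≤? x
  ... | yes _ = x ∷ y ∷ v
  ... | no _  = y ∷ insert x v

  sort : List ℕ → List ℕ
  sort [] = []
  sort (x ∷ v) = insert x (sort v)

  insert-decreasing : ∀ {m} x v → x ≤ m → Decreasing m v → Decreasing m (insert x v)
  insert-decreasing x [] x≤m [] = x≤m ∷ []
  insert-decreasing x (y ∷ v) x≤m (y≤m ∷ d) with y ℕP.≤? x
  ... | yes y≤x = x≤m ∷ (y≤x ∷ d)
  ... | no y≰x  = y≤m ∷ insert-decreasing x v (ℕP.<⇒≤ (ℕP.≰⇒> y≰x)) d

  sort-decreasing : ∀ v → Decreasing (sum v) (sort v)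
  sort-decreasing [] = []
  sort-decreasing (x ∷ v) = insert-decreasing x (sort v) (ℕP.m≤m+n x _) (decreasing-weaken (ℕP.m≤n+m _ x) (sort-decreasing v))

  exchange : ∀ x y z → x + (y + z) ≡ y + (x + z)
  exchange x y z = ≡.trans (≡.sym (ℕP.+-assoc x y z)) (≡.trans (≡.cong (_+ z) (ℕP.+-comm x y)) (ℕP.+-assoc y x z))

  sum-insert : ∀ x v → sum (insert x v) ≡ x + sum v
  sum-insert x [] = ≡.refl
  sum-insert x (y ∷ v) with y ℕP.≤? x
  ... | yes _ = ≡.refl
  ... | no _  = ≡.trans (≡.cong (y +_) (sum-insert x v)) (exchange y x (sum v))

  sum-sort : ∀ v → sum (sort v) ≡ sum v
  sum-sort [] = ≡.refl
  sum-sort (x ∷ v) = ≡.trans (sum-insert x (sort v)) (≡.cong (x +_) (sum-sort v))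

  partial-insert : ∀ x v k → partial k (x ∷ v) ≤ partial k (insert x v)
  partial-insert x [] k = ℕP.≤-refl
  partial-insert x (y ∷ v) k with y ℕP.≤? x
  partial-insert x (y ∷ v) k | yes _ = ℕP.≤-refl
  partial-insert x (y ∷ v) zero | no _ = z≤n
  partial-insert x (y ∷ v) (suc zero) | no y≰x = ℕP.+-monoˡ-≤ 0 (ℕP.<⇒≤ (ℕP.≰⇒> y≰x))
  partial-insert x (y ∷ v) (suc (suc k)) | no _ = ℕP.≤-trans (ℕP.≤-reflexive (exchange x y _)) (ℕP.+-monoʳ-≤ y (partial-insert x v (suc k)))

  partial-sort : ∀ v k → partial k v ≤ partial k (sort v)
  partial-sort [] k = ℕP.≤-refl
  partial-sort (x ∷ v) zero = z≤n
  partial-sort (x ∷ v) (suc k) = ℕP.≤-trans (ℕP.+-monoʳ-≤ x (partial-sort v k)) (partial-insert x (sort v) (suc k))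

  length-insert : ∀ x v → length (insert x v) ≡ suc (length v)
  length-insert x [] = ≡.refl
  length-insert x (y ∷ v) with y ℕP.≤? x
  ... | yes _ = ≡.refl
  ... | no _  = ≡.cong suc (length-insert x v)

  length-sort : ∀ v → length (sort v) ≡ length v
  length-sort [] = ≡.refl
  length-sort (x ∷ v) = ≡.trans (length-insert x (sort v)) (≡.cong suc (length-sort v))

  normalize : List ℕ → List ℕ
  normalize v = dropZeros (sort v)

  normalize-partition : ∀ v → IsPartition (normalize v)
  normalize-partition v = dropZeros-partition (sort-decreasing v)

  length-normalize : ∀ v → length (normalize v) ≤ length v
  length-normalize v = ℕP.≤-trans (length-dropZeros (sort v)) (ℕP.≤-reflexive (length-sort v))

  normalize-dominates : ∀ v → Dominated v (normalize v)
  normalize-dominates v = dominated (≡.sym (≡.trans (sum-dropZeros (sort v)) (sum-sort v)))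
    λ k → ℕP.≤-trans (partial-sort v k) (ℕP.≤-reflexive (≡.sym (partial-dropZeros (sort-decreasing v) k)))

  -- n(λ) and 2n(λ′) in Macdonald's notation.
  tailSums : List ℕ → ℕ
  tailSums [] = 0
  tailSums (m ∷ v) = tailSums v + sum v

  fallingSquares : List ℕ → ℕ
  fallingSquares [] = 0
  fallingSquares (m ∷ v) = m * (m ∸ 1) + fallingSquares v

  sumTo : ℕ → (ℕ → ℕ) → ℕ
  sumTo zero f = 0
  sumTo (suc n) f = f 0 + sumTo n (λ k → f (suc k))

  sumTo-mono : ∀ n {f g} → (∀ k → f k ≤ g k) → sumTo n f ≤ sumTo n g
  sumTo-mono zero e = z≤n
  sumTo-mono (suc n) e = ℕP.+-mono-≤ (e 0) (sumTo-mono n λ k → e (suc k))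

  sumTo-tight : ∀ n {f g} → (∀ k → f k ≤ g k) → sumTo n g ≤ sumTo n f → ∀ k → k < n → g k ≤ f k
  sumTo-tight (suc n) {f} {g} e le zero _ = ℕP.+-cancelʳ-≤ (sumTo n (λ k → f (suc k))) _ _ (ℕP.≤-trans (ℕP.+-monoʳ-≤ (g 0) (sumTo-mono n λ k → e (suc k))) le)
  sumTo-tight (suc n) {f} {g} e le (suc k) (s≤s k<n) = sumTo-tight n (λ k → e (suc k)) (ℕP.+-cancelˡ-≤ (f 0) _ _ (ℕP.≤-trans (ℕP.+-monoˡ-≤ _ (e 0)) le)) k k<n

  -- An entry in row i, counted from 0, is missing from exactly i of the partial sums; altogether
  -- n(v) is missing.
  sumTo-partial : ∀ L v → length v ≤ L → sumTo L (λ k → partial (suc k) v) + tailSums v ≡ L * sum v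
  sumTo-partial L [] _ = ≡.trans (ℕP.+-identityʳ _) (≡.trans (zeros L) (≡.sym (ℕP.*-zeroʳ L)))
    where
    zeros : ∀ L → sumTo L (λ k → 0) ≡ 0
    zeros zero = ≡.refl
    zeros (suc L) = zeros L
  sumTo-partial (suc L) (m ∷ v) (s≤s l) = begin
    sumTo (suc L) (λ k → m + partial k v) + (tailSums v + sum v) ≡⟨ ≡.cong (_+ (tailSums v + sum v)) (constant (suc L)) ⟩
    suc L * m + sumTo L (λ k → partial (suc k) v) + (tailSums v + sum v) ≡⟨ ℕP.+-assoc (suc L * m) _ _ ⟩
    suc L * m + (sumTo L (λ k → partial (suc k) v) + (tailSums v + sum v)) ≡⟨ ≡.cong (suc L * m +_) (≡.trans (≡.sym (ℕP.+-assoc (sumTo L _) _ _)) (≡.cong (_+ sum v) (sumTo-partial L v l))) ⟩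
    suc L * m + (L * sum v + sum v) ≡⟨ ≡.cong (suc L * m +_) (ℕP.+-comm _ (sum v)) ⟩
    suc L * m + suc L * sum v ≡⟨ ≡.sym (ℕP.*-distribˡ-+ (suc L) m (sum v)) ⟩
    suc L * (m + sum v) ∎
    where
    open ≡.≡-Reasoning
    constant′ : ∀ M (f : ℕ → ℕ) → sumTo M (λ k → m + f k) ≡ M * m + sumTo M f
    constant′ zero f = ≡.refl
    constant′ (suc M) f = ≡.trans (≡.cong (m + f 0 +_) (constant′ M (λ k → f (suc k))))
      (≡.trans (ℕP.+-assoc m _ _) (≡.trans (≡.cong (m +_) (exchange (f 0) (M * m) _)) (≡.sym (ℕP.+-assoc m _ _))))
    constant : ∀ M → sumTo M (λ k → m + partial k v) ≡ M * m + sumTo M (λ k → partial k v)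
    constant M = constant′ M (λ k → partial k v)

  -- By `sumTo-partial` larger partial sums mean a smaller n, so equality of n makes every
  -- inequality of the domination tight.
  dominated-tailSums : ∀ {μ κ} → IsPartition μ → IsPartition κ → Dominated μ κ → tailSums μ ≡ tailSums κ → μ ≡ κ
  dominated-tailSums {μ} {κ} p p′ d e = dominated-antisym p p′ d (dominated (≡.sym (equal-sums d)) converse)
    where
    L = length μ + length κ
    totals : sumTo L (λ k → partial (suc k) μ) ≡ sumTo L (λ k → partial (suc k) κ)
    totals = ℕP.+-cancelʳ-≡ (tailSums μ) _ _ (≡.trans (sumTo-partial L μ (ℕP.m≤m+n _ _)) (≡.trans (≡.cong (L *_) (equal-sums d))
      (≡.trans (≡.sym (sumTo-partial L κ (ℕP.m≤n+m _ _))) (≡.cong (sumTo L (λ k → partial (suc k) κ) +_) (≡.sym e)))))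
    converse : ∀ k → partial k κ ≤ partial k μ
    converse zero = z≤n
    converse (suc k) with ℕP.≤-<-connex L k
    ... | inj₂ k<L = sumTo-tight L (λ k → partials d (suc k)) (ℕP.≤-reflexive (≡.sym totals)) k k<L
    ... | inj₁ L≤k = ℕP.≤-trans (partial≤sum (suc k) κ) (ℕP.≤-reflexive (≡.trans (≡.sym (equal-sums d))
      (≡.sym (partial-full (suc k) μ (ℕP.≤-trans (ℕP.m≤m+n _ _) (ℕP.≤-trans L≤k (ℕP.n≤1+n k)))))))

  -- The partitions of d with parts at most m, in decreasing lexicographic order; n ≥ d is fuel.
  enumerate : ℕ → ℕ → ℕ → List (List ℕ)
  enumerate n m zero = [] ∷ []
  enumerate zero m (suc d) = []
  enumerate (suc n) zero (suc d) = []
  enumerate (suc n) (suc m) (suc d) with suc m ℕP.≤? suc d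
  ... | yes _ = map (suc m ∷_) (enumerate n (suc m) (d ∸ m)) ++ enumerate (suc n) m (suc d)
  ... | no _  = enumerate (suc n) m (suc d)

  BoundedOf : ℕ → ℕ → List ℕ → Set
  BoundedOf m d κ = Bounded m κ × sum κ ≡ d

  empty-sum : ∀ {m κ} → Bounded m κ → sum κ ≡ 0 → κ ≡ []
  empty-sum [] _ = ≡.refl
  empty-sum (cons (s≤s _) _ _) ()

  enumerate-complete : ∀ n m d κ → d ≤ n → BoundedOf m d κ → κ ∈ enumerate n m d
  enumerate-complete n m zero κ _ (b , s) = here (empty-sum b s)
  enumerate-complete (suc n) zero (suc d) .(_ ∷ _) _ (cons (s≤s _) () b , s)
  enumerate-complete (suc n) zero (suc d) [] _ ([] , ())
  enumerate-complete (suc n) (suc m) (suc d) [] _ ([] , ())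
  enumerate-complete (suc n) (suc m) (suc d) (x ∷ κ) (s≤s d≤n) (cons p x≤ b , s) with suc m ℕP.≤? suc d | x ℕP.≟ suc m
  ... | yes _ | yes ≡.refl = ∈-++⁺ˡ (∈-map⁺ (suc m ∷_) (enumerate-complete n (suc m) (d ∸ m) κ (ℕP.≤-trans (ℕP.m∸n≤m d m) d≤n)
    (b , ≡.trans (≡.sym (ℕP.m+n∸m≡n m (sum κ))) (≡.cong (_∸ m) (ℕP.suc-injective s)))))
  ... | yes _ | no x≢ = ∈-++⁺ʳ (map (suc m ∷_) (enumerate n (suc m) (d ∸ m))) (enumerate-complete (suc n) m (suc d) (x ∷ κ) (s≤s d≤n) (cons p (ℕP.≤-pred (ℕP.≤∧≢⇒< x≤ x≢)) b , s))
  ... | no m≰d | yes ≡.refl = ⊥-elim (m≰d (ℕP.≤-trans (ℕP.m≤m+n (suc m) _) (ℕP.≤-reflexive s)))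
  ... | no _ | no x≢ = enumerate-complete (suc n) m (suc d) (x ∷ κ) (s≤s d≤n) (cons p (ℕP.≤-pred (ℕP.≤∧≢⇒< x≤ x≢)) b , s)

  enumerate-sound : ∀ n m d κ → κ ∈ enumerate n m d → BoundedOf m d κ
  enumerate-sound n m zero κ (here ≡.refl) = [] , ≡.refl
  enumerate-sound (suc n) (suc m) (suc d) κ κ∈ with suc m ℕP.≤? suc d
  ... | no _ = let (b , s) = enumerate-sound (suc n) m (suc d) κ κ∈ in bounded-weaken (ℕP.n≤1+n m) b , s
  ... | yes (s≤s m≤d) with ∈-++⁻ (map (suc m ∷_) (enumerate n (suc m) (d ∸ m))) κ∈
  ...   | inj₂ κ∈ʳ = let (b , s) = enumerate-sound (suc n) m (suc d) κ κ∈ʳ in bounded-weaken (ℕP.n≤1+n m) b , s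
  ...   | inj₁ κ∈ˡ with ∈-map⁻ (suc m ∷_) κ∈ˡ
  ...     | κ′ , κ′∈ , ≡.refl = let (b , s) = enumerate-sound n (suc m) (d ∸ m) κ′ κ′∈ in
    cons (s≤s z≤n) ℕP.≤-refl b , ≡.cong suc (≡.trans (≡.cong (m +_) s) (ℕP.m+[n∸m]≡n m≤d))

  -- A listing in which everything strictly dominated by an entry comes after it, that is, an order
  -- in which leading terms can be eliminated one by one.
  data Tower (d : ℕ) : List (List ℕ) → Set where
    []  : Tower d []
    _∷_ : ∀ {κ L} → (∀ {μ} → IsPartition μ → sum μ ≡ d → Dominated μ κ → μ ≢ κ → μ ∈ L) → Tower d L → Tower d (κ ∷ L)

  -- A partition below an entry of `L′` either has first part `suc m`, and then lies further down in
  -- `L′`, or has a smaller first part and is listed in `L`.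
  tower-++ : ∀ {d L} m → (L′ : List (List ℕ)) → (∀ {κ} → κ ∈ L′ → sum κ ≡ d × Σ (List ℕ) λ κ′ → κ ≡ suc m ∷ κ′) →
    (∀ {κ} → BoundedOf m d κ → κ ∈ L) → (∀ L₁ {κ} L₂ → L′ ≡ L₁ ++ κ ∷ L₂ → ∀ {μ′} → IsPartition (suc m ∷ μ′) → sum (suc m ∷ μ′) ≡ d → Dominated (suc m ∷ μ′) κ → suc m ∷ μ′ ≢ κ → suc m ∷ μ′ ∈ L₂) →
    Tower d L → Tower d (L′ ++ L)
  tower-++ m [] heads complete inner t = t
  tower-++ {d} {L} m (κ ∷ L′) heads complete inner t = later ∷ tower-++ m L′ (λ κ∈ → heads (there κ∈)) complete (λ L₁ L₂ e → inner (κ ∷ L₁) L₂ (≡.cong (κ ∷_) e)) t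
    where
    later : ∀ {μ} → IsPartition μ → sum μ ≡ d → Dominated μ κ → μ ≢ κ → μ ∈ L′ ++ L
    later {[]} _ s _ _ = ∈-++⁺ʳ L′ (complete ([] , s))
    later {x ∷ μ} (cons p b) s dom μ≢κ with proj₂ (heads (here ≡.refl)) | x ℕP.≟ suc m
    ... | κ′ , ≡.refl | yes ≡.refl = ∈-++⁺ˡ (inner [] L′ ≡.refl (cons p b) s dom μ≢κ)
    ... | κ′ , ≡.refl | no x≢ = ∈-++⁺ʳ L′ (complete (cons p (ℕP.≤-pred (ℕP.≤∧≢⇒< (dominated-head dom) x≢)) b , s))

  tower-suffix : ∀ {d} L₁ {κ} L₂ → Tower d (L₁ ++ κ ∷ L₂) → ∀ {μ} → IsPartition μ → sum μ ≡ d → Dominated μ κ → μ ≢ κ → μ ∈ L₂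
  tower-suffix [] L₂ (h ∷ t) = h
  tower-suffix (x ∷ L₁) L₂ (h ∷ t) = tower-suffix L₁ L₂ t

  map-split : ∀ m (L : List (List ℕ)) L₁ {κ} L₂ → map (m ∷_) L ≡ L₁ ++ κ ∷ L₂ →
    Σ (List (List ℕ)) λ M₁ → Σ (List ℕ) λ κ′ → Σ (List (List ℕ)) λ M₂ → (L ≡ M₁ ++ κ′ ∷ M₂) × (κ ≡ m ∷ κ′) × (L₂ ≡ map (m ∷_) M₂)
  map-split m (x ∷ L) [] L₂ ≡.refl = [] , x , L , ≡.refl , ≡.refl , ≡.refl
  map-split m (x ∷ L) (y ∷ L₁) L₂ e with map-split m L L₁ L₂ (≡.cong (λ { [] → [] ; (_ ∷ t) → t }) e)
  ... | M₁ , κ′ , M₂ , p , q , r = x ∷ M₁ , κ′ , M₂ , ≡.cong (x ∷_) p , q , r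

  enumerate-tower : ∀ n m d → d ≤ n → Tower d (enumerate n m d)
  enumerate-tower n m zero _ = (λ p s _ μ≢ → ⊥-elim (μ≢ (empty-sum (partition⇒bounded p) s))) ∷ []
  enumerate-tower (suc n) zero (suc d) _ = []
  enumerate-tower (suc n) (suc m) (suc d) (s≤s d≤n) with suc m ℕP.≤? suc d
  ... | no _ = enumerate-tower (suc n) m (suc d) (s≤s d≤n)
  ... | yes (s≤s m≤d) = tower-++ m (map (suc m ∷_) (enumerate n (suc m) (d ∸ m))) heads (λ {κ} b → enumerate-complete (suc n) m (suc d) κ (s≤s d≤n) b) inner (enumerate-tower (suc n) m (suc d) (s≤s d≤n))
    where
    heads : ∀ {κ} → κ ∈ map (suc m ∷_) (enumerate n (suc m) (d ∸ m)) → sum κ ≡ suc d × Σ (List ℕ) λ κ′ → κ ≡ suc m ∷ κ′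
    heads κ∈ with ∈-map⁻ (suc m ∷_) κ∈
    ... | κ′ , κ′∈ , ≡.refl = ≡.cong suc (≡.trans (≡.cong (m +_) (proj₂ (enumerate-sound n (suc m) (d ∸ m) κ′ κ′∈))) (ℕP.m+[n∸m]≡n m≤d)) , κ′ , ≡.refl
    inner : ∀ L₁ {κ} L₂ → map (suc m ∷_) (enumerate n (suc m) (d ∸ m)) ≡ L₁ ++ κ ∷ L₂ → ∀ {μ′} → IsPartition (suc m ∷ μ′) → sum (suc m ∷ μ′) ≡ suc d → Dominated (suc m ∷ μ′) κ → suc m ∷ μ′ ≢ κ → suc m ∷ μ′ ∈ L₂
    inner L₁ L₂ e (cons _ b) s dom μ≢ with map-split (suc m) (enumerate n (suc m) (d ∸ m)) L₁ L₂ e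
    ... | M₁ , κ′ , M₂ , split , ≡.refl , ≡.refl = ∈-map⁺ (suc m ∷_)
      (tower-suffix M₁ M₂ (≡.subst (Tower (d ∸ m)) split (enumerate-tower n (suc m) (d ∸ m) (ℕP.≤-trans (ℕP.m∸n≤m d m) d≤n)))
        (bounded⇒partition b) (≡.trans (≡.sym (ℕP.m+n∸m≡n m _)) (≡.cong (_∸ m) (ℕP.suc-injective s))) (dominated-tail dom) (λ e′ → μ≢ (≡.cong (suc m ∷_) e′)))

  partitionsOf : ℕ → List (List ℕ)
  partitionsOf d = enumerate d d d

  partitionsOf-complete : ∀ {κ} → IsPartition κ → κ ∈ partitionsOf (sum κ)
  partitionsOf-complete {κ} p = enumerate-complete (sum κ) (sum κ) (sum κ) κ ℕP.≤-refl (partition⇒bounded p , ≡.refl)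

  partitionsOf-sound : ∀ {d κ} → κ ∈ partitionsOf d → IsPartition κ × sum κ ≡ d
  partitionsOf-sound {d} {κ} κ∈ = let (b , s) = enumerate-sound d d d κ κ∈ in bounded⇒partition b , s

  partitionsOf-tower : ∀ d → Tower d (partitionsOf d)
  partitionsOf-tower d = enumerate-tower d d d ℕP.≤-refl

-- Expansion in Jack functions

record JackBasis (K : CoeffField) (A : SymmetricAlgebra K) : Set where
  open CoeffField K using (_≈_; 0#; 1#)
  open SymmetricAlgebra A using (Λ; ⟨_,_⟩)
  open Coefficients K A using (C)
  open Partitions
  field
    P : List ℕ → Λ
    leading : ∀ {κ} → IsPartition κ → C κ (P κ) ≈ 1#
    triangular : ∀ {κ μ} → IsPartition κ → IsPartition μ → ¬ Dominated μ κ → C μ (P κ) ≈ 0#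
    orthogonal : ∀ {κ μ} → IsPartition κ → IsPartition μ → κ ≢ μ → ⟨ P κ , P μ ⟩ ≈ 0#

module Expansion (K : CoeffField) (A : SymmetricAlgebra K) (J : JackBasis K A) where
  open CoeffField K
  open FieldFacts K
  open SymmetricAlgebra A
  open AlgebraFacts K A
  open Generating K A
  open Coefficients K A
  open Partitions
  open JackBasis J

  G-insert : ∀ x v → G (insert x v) ≐ G (x ∷ v)
  G-insert x [] = ≐-refl
  G-insert x (y ∷ v) with y ℕP.≤? x
  ... | yes _ = ≐-refl
  ... | no _  = ≐-trans (⊗-cong ≐-refl (G-insert x v)) (G-swap y x v)

  G-sort : ∀ v → G (sort v) ≐ G v
  G-sort [] = ≐-refl
  G-sort (x ∷ v) = ≐-trans (G-insert x (sort v)) (⊗-cong ≐-refl (G-sort v))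

  G-dropZeros : ∀ v → G (dropZeros v) ≐ G v
  G-dropZeros [] = ≐-refl
  G-dropZeros (zero ∷ v) = ≐-trans (G-dropZeros v) (≐-sym (L.*-identityˡ _))
  G-dropZeros (suc x ∷ v) = ⊗-cong ≐-refl (G-dropZeros v)

  C-normalize : ∀ v f → C (normalize v) f ≈ C v f
  C-normalize v f = ⟨⟩-congʳ f (≐-trans (G-dropZeros (sort v)) (G-sort v))

  -- Triangularity speaks of partitions. An arbitrary exponent vector is first sorted and stripped
  -- of zeros, which leaves the coefficient alone and can only raise the vector in dominance order.
  P-support : ∀ {κ} → IsPartition κ → ∀ v → ¬ C v (P κ) ≈ 0# → Dominated v κ
  P-support {κ} p v ≉0 = dominated-trans (normalize-dominates v)
    (dominated? λ n → ≉0 (trans (sym (C-normalize v (P κ))) (triangular p (normalize-partition v) n)))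

  infixl 6 _⊖_
  _⊖_ : Λ → Λ → Λ
  f ⊖ h = f ⊕ con (- 1#) ⊗ h

  ⟨⟩-⊖ : ∀ f h z → ⟨ f ⊖ h , z ⟩ ≈ ⟨ f , z ⟩ + - ⟨ h , z ⟩
  ⟨⟩-⊖ f h z = trans (⟨⟩-⊕ f _ z) (+-congˡ (trans (⟨⟩-con _ h z) (solve 1 (λ b → :- :1 :* b := :- b) refl ⟨ h , z ⟩)))

  ⊖-≐ : ∀ {f h} → f ⊖ h ≐ 𝟘 → f ≐ h
  ⊖-≐ {f} {h} e = extensional λ z → difference≈0 (trans (sym (⟨⟩-⊖ f h z)) (trans (⟨⟩-congˡ z e) (⟨⟩-𝟘ˡ z)))

  C-ext : ∀ {f h} → (∀ v → C v f ≈ C v h) → f ≐ h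
  C-ext {f} {h} e = ⊖-≐ (nondegenerate λ v → trans (⟨⟩-⊖ f h _) (trans (+-congʳ (e v)) (-‿inverseʳ _)))

  hom-⊖ : ∀ {d f h} → Homogeneous d f → Homogeneous d h → Homogeneous d (f ⊖ h)
  hom-⊖ a b = hom-⊕ a (hom-con _ b)

  hom-P : ∀ {κ} → IsPartition κ → Homogeneous (sum κ) (P κ)
  hom-P {κ} p = homogeneous (C-ext λ v → trans (euler-selfadjoint _ _) (trans (⟨⟩-congʳ (P κ) (eigen (hom-G v))) (trans (⟨⟩-conʳ (P κ) _ _) (trans (same v (C v (P κ) ≈? 0#)) (sym (⟨⟩-con _ _ _))))))
    where
    same : ∀ v → Dec (C v (P κ) ≈ 0#) → ι (sum v) * C v (P κ) ≈ ι (sum κ) * C v (P κ)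
    same v (yes e) = trans (*-congˡ e) (trans (zeroʳ _) (sym (trans (*-congˡ e) (zeroʳ _))))
    same v (no n) = *-congʳ (reflexive (≡.cong ι (equal-sums (P-support p v n))))

  Terms : Set
  Terms = List (Carrier × List ℕ)

  combination : Terms → Λ
  combination [] = 𝟘
  combination ((c , κ) ∷ t) = con c ⊗ P κ ⊕ combination t

  PartitionOf : ℕ → List ℕ → Set
  PartitionOf d κ = IsPartition κ × sum κ ≡ d

  DownClosed : (List ℕ → Set) → Set
  DownClosed S = ∀ {μ κ} → IsPartition μ → IsPartition κ → Dominated μ κ → S κ → S μ

  record Supported (d : ℕ) (S : List ℕ → Set) (f : Λ) : Set where
    constructor supported
    field
      degree : Homogeneous d f
      support : ∀ {μ} → PartitionOf d μ → ¬ C μ f ≈ 0# → S μ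
  open Supported public

  -- Elimination along the tower: subtracting C κ f times P_κ clears κ and alters coefficients only
  -- at partitions below κ, which are still to come in the list and again satisfy `S`.
  eliminate : ∀ {d S} → DownClosed S → ∀ L → Tower d L → (∀ {κ} → κ ∈ L → PartitionOf d κ) → ∀ f →
    Supported d (λ μ → μ ∈ L × S μ) f → Σ Terms λ t → All (λ u → PartitionOf d (proj₂ u) × S (proj₂ u)) t × f ≐ combination t
  eliminate {d} down [] _ _ f (supported h s) = [] , [] , hom-nondegenerate h λ v e → vanish v e (C v f ≈? 0#)
    where
    vanish : ∀ v → sum v ≡ d → Dec (C v f ≈ 0#) → C v f ≈ 0#
    vanish v _ (yes e) = e
    vanish v e (no n) with s (normalize-partition v , ≡.trans (≡.sym (equal-sums (normalize-dominates v))) e) (λ z → n (trans (sym (C-normalize v f)) z))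
    ... | () , _
  eliminate {d} {S} down (κ ∷ L) (later ∷ tower) parts f (supported h s) with C κ f ≈? 0#
  ... | yes e = eliminate down L tower (λ i → parts (there i)) f (supported h λ p n → shrink (s p n) n)
    where
    shrink : ∀ {μ} → μ ∈ κ ∷ L × S μ → ¬ C μ f ≈ 0# → μ ∈ L × S μ
    shrink (here ≡.refl , _) n = ⊥-elim (n e)
    shrink (there i , sμ) n = i , sμ
  ... | no n = let (t , all , e) = eliminate down L tower (λ i → parts (there i)) f′ (supported (hom-⊕ h (hom-con _ homκ)) λ {μ} p n′ → shrink p n′ (C μ f ≈? 0#))
    in (C κ f , κ) ∷ t , (parts (here ≡.refl) , proj₂ (s (parts (here ≡.refl)) n)) ∷ all , ≐-trans restore (⊕-cong ≐-refl e)
    where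
    partκ = proj₁ (parts (here ≡.refl))
    homκ : Homogeneous d (P κ)
    homκ = ≡.subst (λ n → Homogeneous n (P κ)) (proj₂ (parts (here ≡.refl))) (hom-P partκ)
    f′ = f ⊕ con (- C κ f) ⊗ P κ
    restore : f ≐ con (C κ f) ⊗ P κ ⊕ f′
    restore = extensional λ z → sym (trans (⟨⟩-⊕ _ _ z) (trans (+-cong (⟨⟩-con _ _ z) (trans (⟨⟩-⊕ _ _ z) (+-congˡ (⟨⟩-con _ _ z))))
      (solve 3 (λ c p f → c :* p :+ (f :+ :- c :* p) := f) refl (C κ f) ⟨ P κ , z ⟩ ⟨ f , z ⟩)))
    coefficient : ∀ μ → C μ f′ ≈ C μ f + - C κ f * C μ (P κ)
    coefficient μ = trans (⟨⟩-⊕ _ _ _) (+-congˡ (⟨⟩-con _ _ _))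
    κ-gone : C κ f′ ≈ 0#
    κ-gone = trans (coefficient κ) (trans (+-congˡ (*-congˡ (leading partκ))) (solve 1 (λ c → c :+ :- c :* :1 := :0) refl (C κ f)))
    shrink : ∀ {μ} → PartitionOf d μ → ¬ C μ f′ ≈ 0# → Dec (C μ f ≈ 0#) → μ ∈ L × S μ
    shrink {μ} p n′ (no nf) with s p nf
    ... | here ≡.refl , _ = ⊥-elim (n′ κ-gone)
    ... | there i , sμ = i , sμ
    shrink {μ} p n′ (yes e) = later (proj₁ p) (proj₂ p) dom (λ { ≡.refl → n′ κ-gone }) , down (proj₁ p) partκ dom (proj₂ (s (parts (here ≡.refl)) n))
      where
      dom : Dominated μ κ
      dom = P-support partκ μ λ z → n′ (trans (coefficient μ) (trans (+-cong e (trans (*-congˡ z) (zeroʳ _))) (+-identityˡ 0#)))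

  opaque
    expand : ∀ {d S f} → DownClosed S → Supported d S f → Σ Terms λ t → All (λ u → PartitionOf d (proj₂ u) × S (proj₂ u)) t × f ≐ combination t
    expand {d} {S} {f} down (supported h s) = eliminate down (partitionsOf d) (partitionsOf-tower d) partitionsOf-sound f
      (supported h λ { {μ} p n → ≡.subst (λ m → μ ∈ partitionsOf m) (proj₂ p) (partitionsOf-complete (proj₁ p)) , s p n })

  combination-pairing : ∀ {Q : List ℕ → Set} t ρ → All (λ u → Q (proj₂ u)) t → (∀ {κ} → Q κ → ⟨ P κ , ρ ⟩ ≈ 0#) → ⟨ combination t , ρ ⟩ ≈ 0#
  combination-pairing [] ρ _ _ = ⟨⟩-𝟘ˡ ρ
  combination-pairing ((c , κ) ∷ t) ρ (qκ ∷ all) e = trans (⟨⟩-⊕ _ _ ρ) (trans (+-cong (trans (⟨⟩-con _ _ ρ) (trans (*-congˡ (e qκ)) (zeroʳ c))) (combination-pairing t ρ all e)) (+-identityˡ 0#))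

  _≟ᴸ_ : (κ μ : List ℕ) → Dec (κ ≡ μ)
  _≟ᴸ_ = ListP.≡-dec ℕP._≟_

  opaque
    -- For a down-closed set, monomial support and Jack support agree: `expand` keeps to `S`, and
    -- orthogonality then excludes every other ρ. `pairing-support` is the converse.
    support-pairing : ∀ {d S f} → DownClosed S → Supported d S f → ∀ {ρ} → PartitionOf d ρ → ¬ ⟨ f , P ρ ⟩ ≈ 0# → S ρ
    support-pairing {d} {S} {f} down s {ρ} p n with expand down s
    ... | t , all , e = go t all λ z → n (trans (⟨⟩-congˡ (P ρ) e) z)
      where
      go : ∀ t → All (λ u → PartitionOf d (proj₂ u) × S (proj₂ u)) t → ¬ ⟨ combination t , P ρ ⟩ ≈ 0# → S ρ
      go [] _ n = ⊥-elim (n (⟨⟩-𝟘ˡ _))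
      go ((c , κ) ∷ t) ((pκ , sκ) ∷ all) n with κ ≟ᴸ ρ
      ... | yes ≡.refl = sκ
      ... | no κ≢ρ = go t all λ z → n (trans (⟨⟩-⊕ _ _ _) (trans (+-cong (trans (⟨⟩-con _ _ _) (trans (*-congˡ (orthogonal (proj₁ pκ) (proj₁ p) κ≢ρ)) (zeroʳ c))) z) (+-identityˡ 0#)))

  Any : List ℕ → Set
  Any _ = ⊤

  any-supported : ∀ {d f} → Homogeneous d f → Supported d Any f
  any-supported h = supported h λ _ _ → tt

  norm : List ℕ → Carrier
  norm κ = ⟨ P κ , P κ ⟩

  -- No positivity is available over a general field. Instead, `G κ` pairs to 1 with P_κ, while its
  -- expansion in Jack functions would pair to 0 if the norm vanished.
  norm≉0 : ∀ {κ} → IsPartition κ → ¬ norm κ ≈ 0#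
  norm≉0 {κ} p e with expand {sum κ} {Any} {G κ} (λ _ _ _ _ → tt) (any-supported (hom-G κ))
  ... | t , all , eq = 1≉0 (trans (sym (leading p)) (trans (⟨⟩-comm _ _) (trans (⟨⟩-congˡ (P κ) eq) (combination-pairing t (P κ) all each))))
    where
    each : ∀ {ρ} → PartitionOf (sum κ) ρ × Any ρ → ⟨ P ρ , P κ ⟩ ≈ 0#
    each {ρ} ((pρ , _) , _) with ρ ≟ᴸ κ
    ... | yes ≡.refl = e
    ... | no ρ≢κ = orthogonal pρ p ρ≢κ

  P-nondegenerate : ∀ {d f} → Homogeneous d f → (∀ {ρ} → PartitionOf d ρ → ⟨ f , P ρ ⟩ ≈ 0#) → f ≐ 𝟘
  P-nondegenerate {d} {f} h z = hom-nondegenerate h vanish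
    where
    vanish : ∀ v → sum v ≡ d → C v f ≈ 0#
    vanish v ≡.refl with expand {sum v} {Any} {G v} (λ _ _ _ _ → tt) (any-supported (hom-G v))
    ... | t , all , eq = trans (⟨⟩-comm _ _) (trans (⟨⟩-congˡ f eq) (combination-pairing t f all λ q → trans (⟨⟩-comm _ _) (z (proj₁ q))))

  P-ext : ∀ {d f h} → Homogeneous d f → Homogeneous d h → (∀ {ρ} → PartitionOf d ρ → ⟨ f , P ρ ⟩ ≈ ⟨ h , P ρ ⟩) → f ≐ h
  P-ext {d} {f} {h} a b e = ⊖-≐ (P-nondegenerate (hom-⊖ a b) λ {ρ} p → trans (⟨⟩-⊖ f h (P ρ)) (trans (+-congʳ (e p)) (-‿inverseʳ _)))

  hom-𝟘 : ∀ {d} → Homogeneous d 𝟘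
  hom-𝟘 = homogeneous (≐-trans euler-𝟘 (≐-sym (L.zeroʳ _)))

  hom-combination : ∀ {d} {S : List ℕ → Set} t → All (λ u → PartitionOf d (proj₂ u) × S (proj₂ u)) t → Homogeneous d (combination t)
  hom-combination [] _ = hom-𝟘
  hom-combination ((c , κ) ∷ t) (((p , ≡.refl) , _) ∷ all) = hom-⊕ (hom-con c (hom-P p)) (hom-combination t all)

  record Visible (f : Λ) (κ : List ℕ) : Set where
    constructor visible
    field pairs : ¬ ⟨ f , P κ ⟩ ≈ 0#
  open Visible public

  filtered : ∀ {d} f t → All (λ u → PartitionOf d (proj₂ u) × Any (proj₂ u)) t →
    Σ Terms λ t′ → All (λ u → PartitionOf d (proj₂ u) × Visible f (proj₂ u)) t′ ×
      (∀ {ρ} → PartitionOf d ρ → ¬ ⟨ f , P ρ ⟩ ≈ 0# → ⟨ combination t , P ρ ⟩ ≈ ⟨ combination t′ , P ρ ⟩)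
  filtered f [] _ = [] , [] , λ _ _ → refl
  filtered f ((c , κ) ∷ t) ((pκ , _) ∷ all) with ⟨ f , P κ ⟩ ≈? 0# | filtered f t all
  ... | no n | t′ , all′ , e = (c , κ) ∷ t′ , (pκ , visible n) ∷ all′ , λ p n′ → trans (⟨⟩-⊕ _ _ _) (trans (+-congˡ (e p n′)) (sym (⟨⟩-⊕ _ _ _)))
  ... | yes z | t′ , all′ , e = t′ , all′ , λ {ρ} p n′ → trans (⟨⟩-⊕ _ _ _) (trans (+-cong (trans (⟨⟩-con _ _ _)
    (trans (*-congˡ (orthogonal (proj₁ pκ) (proj₁ p) λ { ≡.refl → n′ z })) (zeroʳ c))) (e p n′)) (+-identityˡ _))

  opaque
    -- The expansion is filtered by the pairing with `f` itself, so that each listed partition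
    -- carries the nonvanishing from which later arguments start.
    decompose : ∀ {d f} → Homogeneous d f → Σ Terms λ t → All (λ u → PartitionOf d (proj₂ u) × Visible f (proj₂ u)) t × f ≐ combination t
    decompose {d} {f} h with expand {d} {Any} {f} (λ _ _ _ _ → tt) (any-supported h)
    ... | t , all , e with filtered f t all
    ...   | t′ , all′ , same = t′ , all′ , P-ext h (hom-combination t′ all′) λ {ρ} p → compare p (⟨ f , P ρ ⟩ ≈? 0#)
      where
      compare : ∀ {ρ} → PartitionOf d ρ → Dec (⟨ f , P ρ ⟩ ≈ 0#) → ⟨ f , P ρ ⟩ ≈ ⟨ combination t′ , P ρ ⟩
      compare {ρ} p (no n) = trans (⟨⟩-congˡ _ e) (same p n)
      compare {ρ} p (yes z) = trans z (sym (combination-pairing t′ (P ρ) all′ λ { {κ} (pκ , visible n) → orthogonal (proj₁ pκ) (proj₁ p) λ { ≡.refl → n z } }))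

  opaque
    disjoint : ∀ {d f h} → Homogeneous d f → (∀ {ρ} → PartitionOf d ρ → ¬ ⟨ f , P ρ ⟩ ≈ 0# → ⟨ h , P ρ ⟩ ≈ 0#) → ⟨ f , h ⟩ ≈ 0#
    disjoint {d} {f} {h} hf z = let (t , all , e) = decompose hf in trans (⟨⟩-congˡ h e) (combination-pairing {λ κ → PartitionOf d κ × Visible f κ} t h all
      λ { {κ} (p , visible n) → trans (⟨⟩-comm (P κ) h) (z {κ} p n) })

  opaque
    pairing-support : ∀ {d S f} → DownClosed S → Homogeneous d f → (∀ {ρ} → PartitionOf d ρ → ¬ ⟨ f , P ρ ⟩ ≈ 0# → S ρ) → Supported d S f
    pairing-support {d} {S} {f} down h s = let (t , all , e) = decompose h in supported h λ {μ} p n → go t all p λ z → n (trans (⟨⟩-congˡ _ e) z)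
      where
      go : ∀ t → All (λ u → PartitionOf d (proj₂ u) × Visible f (proj₂ u)) t → ∀ {μ} → PartitionOf d μ → ¬ C μ (combination t) ≈ 0# → S μ
      go [] _ p n = ⊥-elim (n (⟨⟩-𝟘ˡ _))
      go ((c , κ) ∷ t) ((pκ , visible v) ∷ all) {μ} p n with C μ (P κ) ≈? 0#
      ... | no n′ = down (proj₁ p) (proj₁ pκ) (P-support (proj₁ pκ) μ n′) (s pκ v)
      ... | yes z = go t all p λ z′ → n (trans (⟨⟩-⊕ _ _ _) (trans (+-cong (trans (⟨⟩-con _ _ _) (trans (*-congˡ z) (zeroʳ c))) z′) (+-identityˡ 0#)))

  proportional : ∀ {κ f} → IsPartition κ → Homogeneous (sum κ) f → (∀ {ρ} → PartitionOf (sum κ) ρ → ρ ≢ κ → ⟨ f , P ρ ⟩ ≈ 0#) →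
    con (norm κ) ⊗ f ≐ con ⟨ f , P κ ⟩ ⊗ P κ
  proportional {κ} {f} p h z = P-ext (hom-con _ h) (hom-con _ (hom-P p)) λ {ρ} pρ → compare pρ (ρ ≟ᴸ κ)
    where
    compare : ∀ {ρ} → PartitionOf (sum κ) ρ → Dec (ρ ≡ κ) → ⟨ con (norm κ) ⊗ f , P ρ ⟩ ≈ ⟨ con ⟨ f , P κ ⟩ ⊗ P κ , P ρ ⟩
    compare pρ (yes ≡.refl) = trans (⟨⟩-con _ _ _) (trans (*-comm _ _) (sym (⟨⟩-con _ _ _)))
    compare pρ (no ρ≢κ) = trans (⟨⟩-con _ _ _) (trans (*-congˡ (z pρ ρ≢κ)) (trans (zeroʳ _) (sym (trans (⟨⟩-con _ _ _) (trans (*-congˡ (orthogonal p (proj₁ pρ) λ e → ρ≢κ (≡.sym e))) (zeroʳ _))))))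

  P-empty : P [] ≐ 𝟙
  P-empty = ⊖-≐ (hom-nondegenerate {0} (hom-⊖ (hom-P []) hom-𝟙) λ v s → trans (⟨⟩-⊖ _ _ _)
    (trans (+-cong (constant v s (P []) (leading [])) (-‿cong (constant v s 𝟙 ⟨𝟙,𝟙⟩))) (-‿inverseʳ 1#)))
    where
    constant : ∀ v → sum v ≡ 0 → ∀ f → C [] f ≈ 1# → C v f ≈ 1#
    constant [] _ f e = e
    constant (zero ∷ v) s f e = trans (⟨⟩-congʳ f (L.*-identityˡ _)) (constant v s f e)

-- First rows, first columns and padding

module Columns where
  open Partitions

  top : List ℕ → ℕ
  top []      = 0
  top (x ∷ _) = x

  dominated-top : ∀ {μ κ} → Dominated μ κ → top μ ℕ.≤ top κ
  dominated-top {[]} d = z≤n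
  dominated-top {a ∷ μ} {b ∷ κ} d = dominated-head d
  dominated-top {a ∷ μ} {[]} (dominated e _) = ℕP.≤-trans (ℕP.m≤m+n a _) (ℕP.≤-reflexive e)

  ones : ℕ → List ℕ
  ones n = replicate n 1

  ones-partition : ∀ n → IsPartition (ones n)
  ones-partition n = bounded⇒partition (bounded n)
    where
    bounded : ∀ n → Bounded 1 (ones n)
    bounded zero = []
    bounded (suc n) = cons (s≤s z≤n) (s≤s z≤n) (bounded n)

  sum-ones : ∀ n → sum (ones n) ≡ n
  sum-ones zero = ≡.refl
  sum-ones (suc n) = ≡.cong suc (sum-ones n)

  map-suc-zeros : ∀ u → sum u ≡ 0 → map suc u ≡ ones (length u)
  map-suc-zeros [] _ = ≡.refl
  map-suc-zeros (zero ∷ u) e = ≡.cong (1 ∷_) (map-suc-zeros u e)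

  map-suc-bounded : ∀ {m v} → Decreasing m v → Bounded (suc m) (map suc v)
  map-suc-bounded [] = []
  map-suc-bounded (q ∷ d) = cons (s≤s z≤n) (s≤s q) (map-suc-bounded d)

  map-suc-injective : ∀ {u v} → map suc u ≡ map suc v → u ≡ v
  map-suc-injective = ListP.map-injective ℕP.suc-injective

  partial-map-suc : ∀ k v → partial k (map suc v) ≡ partial k v ℕ.+ (k ℕ.⊓ length v)
  partial-map-suc zero v = ≡.refl
  partial-map-suc (suc k) [] = ≡.refl
  partial-map-suc (suc k) (x ∷ v) = ≡.cong suc (≡.trans (≡.cong (x ℕ.+_) (partial-map-suc k v)) (≡.sym (ℕP.+-assoc x _ _))) ⨾ ≡.sym (ℕP.+-suc _ _)
    where
    _⨾_ : ∀ {a b c : ℕ} → a ≡ b → b ≡ c → a ≡ c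
    _⨾_ = ≡.trans

  dominated-map-suc : ∀ {u v} → length u ≡ length v → Dominated u v → Dominated (map suc u) (map suc v)
  dominated-map-suc {u} {v} l (dominated e p) = dominated
    (≡.trans (total u) (≡.trans (≡.cong₂ ℕ._+_ e l) (≡.sym (total v))))
    λ k → ℕP.≤-trans (ℕP.≤-reflexive (partial-map-suc k u)) (ℕP.≤-trans (ℕP.+-mono-≤ (p k) (ℕP.≤-reflexive (≡.cong (k ℕ.⊓_) l))) (ℕP.≤-reflexive (≡.sym (partial-map-suc k v))))
    where
    total : ∀ v → sum (map suc v) ≡ sum v ℕ.+ length v
    total [] = ≡.refl
    total (m ∷ v) = ≡.trans (≡.cong suc (≡.trans (≡.cong (m ℕ.+_) (total v)) (≡.sym (ℕP.+-assoc m _ _)))) (≡.sym (ℕP.+-suc _ _))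

  pad : ℕ → List ℕ → List ℕ
  pad n v = v ++ replicate (n ∸ length v) 0

  length-pad : ∀ n v → length v ℕ.≤ n → length (pad n v) ≡ n
  length-pad n v l = ≡.trans (ListP.length-++ v) (≡.trans (≡.cong (length v ℕ.+_) (ListP.length-replicate (n ∸ length v))) (ℕP.m+[n∸m]≡n l))

  dropZeros-zeros : ∀ n → dropZeros (replicate n 0) ≡ []
  dropZeros-zeros zero = ≡.refl
  dropZeros-zeros (suc n) = dropZeros-zeros n

  dropZeros-++ : ∀ u v → dropZeros (u ++ v) ≡ dropZeros u ++ dropZeros v
  dropZeros-++ [] v = ≡.refl
  dropZeros-++ (zero ∷ u) v = dropZeros-++ u v
  dropZeros-++ (suc x ∷ u) v = ≡.cong (suc x ∷_) (dropZeros-++ u v)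

  dropZeros-pad : ∀ n {v} → IsPartition v → dropZeros (pad n v) ≡ v
  dropZeros-pad n {v} p = ≡.trans (dropZeros-++ v _) (≡.trans (≡.cong₂ _++_ (dropZeros-id p) (dropZeros-zeros (n ∸ length v))) (ListP.++-identityʳ v))

  decreasing-zeros : ∀ {m} n → Decreasing m (replicate n 0)
  decreasing-zeros zero = []
  decreasing-zeros (suc n) = z≤n ∷ decreasing-zeros n

  decreasing-++zeros : ∀ {m v} n → Decreasing m v → Decreasing m (v ++ replicate n 0)
  decreasing-++zeros n [] = decreasing-zeros n
  decreasing-++zeros n (q ∷ d) = q ∷ decreasing-++zeros n d

  pad-decreasing : ∀ n {v} → IsPartition v → Decreasing (sum v) (pad n v)
  pad-decreasing n {v} p = decreasing-++zeros (n ∸ length v) (bounded⇒decreasing (partition⇒bounded p))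

  -- Either the product of all n variables divides the monomial, or a variable is absent; the second
  -- alternative exhibits its place.
  data Shape (n : ℕ) (u : List ℕ) : Set where
    shifted : ∀ u′ → length u′ ≡ n → u ≡ map suc u′ → Shape n u
    shorter : ∀ a b → suc (length (a ++ b)) ≡ n → u ≡ a ++ 0 ∷ b → Shape n u

  shape : ∀ u → Shape (length u) u
  shape [] = shifted [] ≡.refl ≡.refl
  shape (zero ∷ u) = shorter [] u ≡.refl ≡.refl
  shape (suc x ∷ u) with shape u
  ... | shifted u′ l ≡.refl = shifted (x ∷ u′) (≡.cong suc l) ≡.refl
  ... | shorter a b l ≡.refl = shorter (suc x ∷ a) b (≡.cong suc l) ≡.refl

-- Jack functions as eigenfunctions; removal of a row

module Spectrum (K : CoeffField) (A : SymmetricAlgebra K) (J : JackBasis K A) (N : ℕ) where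
  open CoeffField K
  open FieldFacts K
  open SymmetricFunctions K using (weight)
  open SymmetricAlgebra A
  open AlgebraFacts K A
  open Generating K A
  open Operators K A N
  open Coefficients K A
  open Triangularity K A N
  open Partitions
  open Columns
  open JackBasis J
  open Expansion K A J

  hom-Σ : ∀ {d} n {f} → (∀ i → Homogeneous d (f i)) → Homogeneous d (Σ< n f)
  hom-Σ zero h = hom-≐ (≐-sym (Σ-zero _)) hom-𝟘
  hom-Σ (suc n) h = hom-≐ (≐-sym (Σ-suc n _)) (hom-⊕ (h 0) (hom-Σ n λ i → h (suc i)))

  -- If the degree of `y` exceeds that of `f` the result is 0, which is homogeneous of every degree,
  -- so the degree count is uniform.
  hom-move : ∀ {a b d t x y f} → a ℕ.+ d ≡ b ℕ.+ t → Homogeneous a x → Homogeneous b y → Homogeneous d f → Homogeneous t (x ⊗ perp y f)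
  hom-move {a} {b} {d} {t} {x} {y} {f} e hx hy hf with ℕP.≤-<-connex b d
  ... | inj₂ d<b = hom-≐ (≐-sym (≐-trans (⊗-cong ≐-refl (hom-perp-0 hy hf d<b)) (L.zeroʳ x))) hom-𝟘
  ... | inj₁ b≤d = ≡.subst (λ n → Homogeneous n (x ⊗ perp y f)) degree′
      (hom-⊗ hx (hom-perp {b} {d ∸ b} hy (≡.subst (λ n → Homogeneous n f) (≡.sym (ℕP.m+[n∸m]≡n b≤d)) hf)))
    where
    degree′ : a ℕ.+ (d ∸ b) ≡ t
    degree′ = ≡.trans (≡.sym (ℕP.+-∸-assoc a b≤d)) (≡.trans (≡.cong (_∸ b) e) (ℕP.m+n∸m≡n b t))

  hom-D : ∀ {d f} → Homogeneous d f → Homogeneous d (D f)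
  hom-D {d} {f} h = hom-⊕ (hom-Σ N λ a → hom-con _ (hom-move ≡.refl (hom-q a) (hom-q a) h)) (hom-Σ N λ a → hom-Σ N λ b →
    hom-⊕ (hom-≐ (L.*-assoc _ _ _) (hom-move (≡.cong (ℕ._+ d) (≡.cong suc (ℕP.+-suc a b))) (hom-⊗ (hom-q a) (hom-q b)) (hom-q (suc (a ℕ.+ b))) h))
          (hom-≐ (⊗-cong ≐-refl (perp-⊗ _ _ f)) (hom-move (≡.cong (ℕ._+ d) (≡.cong suc (≡.sym (ℕP.+-suc a b)))) (hom-q (suc (a ℕ.+ b))) (hom-⊗ (hom-q a) (hom-q b)) h)))

  hom-U : ∀ {d f} → Homogeneous d f → Homogeneous (suc d) (U f)
  hom-U {d} h = hom-Σ N λ a → hom-move (≡.sym (ℕP.+-suc (suc a) d)) (hom-q (suc a)) (hom-q a) h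

  hom-V : ∀ {d f} → Homogeneous (suc d) f → Homogeneous d (V f)
  hom-V {d} h = hom-Σ N λ a → hom-move (ℕP.+-suc (suc a) d) (hom-q a) (hom-q (suc a)) h

  e₂-closed : ∀ v → e₂ v + (ι (tailSums v) + ι (tailSums v)) ≈ α * ι (fallingSquares v)
  e₂-closed [] = solve 1 (λ a → :0 :+ (:0 :+ :0) := a :* :0) refl α
  e₂-closed (m ∷ v) = begin
    e₂ (m ∷ v) + (ι (tailSums v ℕ.+ sum v) + ι (tailSums v ℕ.+ sum v)) ≈⟨ +-congˡ (+-cong (ι-+ (tailSums v) (sum v)) (ι-+ (tailSums v) (sum v))) ⟩
    α * p + (e₂ v + - (s + s)) + (t + s + (t + s))
      ≈⟨ solve 5 (λ a p e s t → a :* p :+ (e :+ :- (s :+ s)) :+ (t :+ s :+ (t :+ s)) := a :* p :+ (e :+ (t :+ t))) refl α p (e₂ v) s t ⟩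
    α * p + (e₂ v + (t + t)) ≈⟨ +-congˡ (e₂-closed v) ⟩
    α * p + α * ι (fallingSquares v) ≈⟨ sym (distribˡ _ _ _) ⟩
    α * (p + ι (fallingSquares v)) ≈⟨ *-congˡ (trans (+-congʳ (sym (ι-* m (m ∸ 1)))) (sym (ι-+ (m ℕ.* (m ∸ 1)) _))) ⟩
    α * ι (fallingSquares (m ∷ v)) ∎
    where
    open FR
    p = ι m * ι (m ∸ 1)
    s = ι (sum v)
    t = ι (tailSums v)

  -- Comparing the terms free of α in `e₂-closed` gives equal n, which decides on comparable
  -- partitions. Comparability matters: (4,1,1) and (3,3) have the same eigenvalue.
  e₂-injective : ∀ {μ κ} → IsPartition μ → IsPartition κ → Dominated μ κ → e₂ μ ≈ e₂ κ → μ ≡ κ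
  e₂-injective {μ} {κ} p p′ d e = dominated-tailSums p p′ d (halve (proj₁ (independent _ (fallingSquares κ) _ (fallingSquares μ) linear-relation)))
    where
    halve : ∀ {a b} → a ℕ.+ a ≡ b ℕ.+ b → a ≡ b
    halve {a} {b} e = ℕP.*-cancelʳ-≡ a b 2 (≡.trans (double a) (≡.trans e (≡.sym (double b))))
      where
      double : ∀ a → a ℕ.* 2 ≡ a ℕ.+ a
      double a = ≡.trans (ℕP.*-comm a 2) (≡.cong (a ℕ.+_) (ℕP.+-identityʳ a))
    -- Terms are moved across so that all coefficients are natural numbers, the only case in which
    -- `independent` speaks.
    linear-relation : ι (tailSums μ ℕ.+ tailSums μ) + ι (fallingSquares κ) * α ≈ ι (tailSums κ ℕ.+ tailSums κ) + ι (fallingSquares μ) * α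
    linear-relation = begin
      ι (tailSums μ ℕ.+ tailSums μ) + ι (fallingSquares κ) * α ≈⟨ +-cong (ι-+ (tailSums μ) (tailSums μ)) (trans (*-comm _ _) (sym (e₂-closed κ))) ⟩
      t + (e₂ κ + t′) ≈⟨ +-congˡ (+-congʳ (sym e)) ⟩
      t + (e₂ μ + t′) ≈⟨ solve 3 (λ t e s → t :+ (e :+ s) := s :+ (e :+ t)) refl t (e₂ μ) t′ ⟩
      t′ + (e₂ μ + t) ≈⟨ sym (+-cong (ι-+ (tailSums κ) (tailSums κ)) (trans (*-comm _ _) (sym (e₂-closed μ)))) ⟩
      ι (tailSums κ ℕ.+ tailSums κ) + ι (fallingSquares μ) * α ∎
      where
      open FR
      t = ι (tailSums μ) + ι (tailSums μ)
      t′ = ι (tailSums κ) + ι (tailSums κ)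

  Below StrictlyBelow : List ℕ → List ℕ → Set
  Below κ μ = Dominated μ κ
  StrictlyBelow κ μ = Dominated μ κ × μ ≢ κ

  below-down : ∀ {κ} → DownClosed (Below κ)
  below-down _ _ d e = dominated-trans d e

  strictly-below-down : ∀ {κ} → IsPartition κ → DownClosed (StrictlyBelow κ)
  strictly-below-down p pμ pρ d (e , ne) = dominated-trans d e , λ { ≡.refl → ne (dominated-antisym pρ p e d) }

  above-dominated : ∀ {v u κ} → Above v u → Dominated u κ → Dominated v κ
  above-dominated (above _ s d _) (dominated e p) = dominated (≡.trans (≡.sym s) e) λ k → ℕP.≤-trans (d k) (p k)

  D-coefficient : ∀ f v → sum v ℕ.< N → (∀ u → Above v u → C u f ≈ 0#) → C v (D f) ≈ α * e₂ v * C v f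
  D-coefficient f v bound z = trans (D-selfadjoint f _) (difference≈0 (trans (+-congˡ (-‿*-move _ _))
    (trans (sym (trans (⟨⟩-⊕ʳ f _ _) (+-congˡ (⟨⟩-conʳ f _ _)))) (annihilated (D-G v bound) f z))))
    where
    -‿*-move : ∀ a b → - (a * b) ≈ - a * b
    -‿*-move a b = solve 2 (λ a b → :- (a :* b) := :- a :* b) refl a b

  D-P-below : ∀ {κ} → IsPartition κ → sum κ ℕ.< N → ∀ {μ} → PartitionOf (sum κ) μ → ¬ Dominated μ κ → C μ (D (P κ)) ≈ 0#
  D-P-below {κ} p bound {μ} (pμ , e) nd = trans (D-coefficient (P κ) μ (≡.subst (ℕ._< N) (≡.sym e) bound)
      λ u ab → vanish u λ d → nd (above-dominated ab d)) (trans (*-congˡ (vanish μ nd)) (zeroʳ _))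
    where
    vanish : ∀ u → ¬ Dominated u κ → C u (P κ) ≈ 0#
    vanish u nd with C u (P κ) ≈? 0#
    ... | yes z = z
    ... | no n = ⊥-elim (nd (P-support p u n))

  -- If the difference of the two sides pairs with P_ρ, then ρ lies strictly below κ. By
  -- self-adjointness D(P_ρ), supported below ρ, pairs with P_κ, which puts κ below ρ as well.
  D-P : ∀ {κ} → IsPartition κ → sum κ ℕ.< N → D (P κ) ≐ con (α * e₂ κ) ⊗ P κ
  D-P {κ} p bound = ⊖-≐ (P-nondegenerate hom λ {ρ} pρ → vanish pρ (⟨ h , P ρ ⟩ ≈? 0#))
    where
    h = D (P κ) ⊖ con (α * e₂ κ) ⊗ P κ
    hom : Homogeneous (sum κ) h
    hom = hom-⊖ (hom-D (hom-P p)) (hom-con _ (hom-P p))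
    coefficient : ∀ μ → C μ h ≈ C μ (D (P κ)) + - (α * e₂ κ * C μ (P κ))
    coefficient μ = trans (⟨⟩-⊖ _ _ _) (+-congˡ (-‿cong (⟨⟩-con _ _ _)))
    strict : ∀ {μ} → PartitionOf (sum κ) μ → ¬ C μ h ≈ 0# → StrictlyBelow κ μ
    strict {μ} pμ n = below , λ { ≡.refl → n (trans (coefficient κ) (trans (+-congʳ (D-coefficient (P κ) κ bound above-vanish)) (-‿inverseʳ _))) }
      where
      below : Dominated μ κ
      below = dominated? λ nd → n (trans (coefficient μ) (trans (+-cong (D-P-below p bound pμ nd)
        (-‿cong (trans (*-congˡ (triangular p (proj₁ pμ) nd)) (zeroʳ _)))) (-‿inverseʳ 0#)))
      above-vanish : ∀ u → Above κ u → C u (P κ) ≈ 0#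
      above-vanish u (above _ _ _ (k , lt)) with C u (P κ) ≈? 0#
      ... | yes z = z
      ... | no n = ⊥-elim (ℕP.<⇒≱ lt (partials (P-support p u n) k))
    vanish : ∀ {ρ} → PartitionOf (sum κ) ρ → Dec (⟨ h , P ρ ⟩ ≈ 0#) → ⟨ h , P ρ ⟩ ≈ 0#
    vanish pρ (yes z) = z
    vanish {ρ} pρ (no n) = let (ρ⊴κ , ρ≢κ) = support-pairing (strictly-below-down p) (supported hom strict) pρ n in ⊥-elim (ρ≢κ (dominated-antisym (proj₁ pρ) p ρ⊴κ (support-pairing below-down D-P-supported (p , ≡.sym (proj₂ pρ)) λ z → n (trans (⟨⟩-⊖ _ _ _)
        (trans (+-cong (trans (D-selfadjoint _ _) (trans (⟨⟩-comm _ _) z)) (-‿cong (trans (⟨⟩-con _ _ _) (trans (*-congˡ (orthogonal p (proj₁ pρ) λ e → ρ≢κ (≡.sym e))) (zeroʳ _))))) (-‿inverseʳ 0#))))))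
      where
      D-P-supported : Supported (sum ρ) (Below ρ) (D (P ρ))
      D-P-supported = supported (hom-D (hom-P (proj₁ pρ))) λ pμ n → dominated? λ nd → n (D-P-below (proj₁ pρ) (≡.subst (ℕ._< N) (≡.sym (proj₂ pρ)) bound) pμ nd)

  -- Distinct comparable partitions have distinct eigenvalues, so P κ is the only eigenvector with its leading term.
  D-separates : ∀ {κ ρ h} → PartitionOf (sum κ) ρ → IsPartition κ → sum κ ℕ.< N → StrictlyBelow κ ρ → ⟨ D h , P ρ ⟩ ≈ α * e₂ κ * ⟨ h , P ρ ⟩ → ⟨ h , P ρ ⟩ ≈ 0#
  D-separates {κ} {ρ} {h} pρ p bound (ρ⊴κ , ρ≢κ) e with ⟨ h , P ρ ⟩ ≈? 0#
  ... | yes z = z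
  ... | no n = ⊥-elim (ρ≢κ (e₂-injective (proj₁ pρ) p ρ⊴κ (*-cancelˡ _ (product≉0 n α≉0) (begin
    ⟨ h , P ρ ⟩ * α * e₂ ρ    ≈⟨ solve 3 (λ h a e → h :* a :* e := a :* e :* h) refl _ α (e₂ ρ) ⟩
    α * e₂ ρ * ⟨ h , P ρ ⟩    ≈⟨ sym (⟨⟩-conʳ-cong h (D-P (proj₁ pρ) (≡.subst (ℕ._< N) (≡.sym (proj₂ pρ)) bound))) ⟩
    ⟨ h , D (P ρ) ⟩           ≈⟨ sym (D-selfadjoint h _) ⟩
    ⟨ D h , P ρ ⟩             ≈⟨ e ⟩
    α * e₂ κ * ⟨ h , P ρ ⟩    ≈⟨ solve 3 (λ h a e → a :* e :* h := h :* a :* e) refl _ α (e₂ κ) ⟩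
    ⟨ h , P ρ ⟩ * α * e₂ κ    ∎))))
    where open FR

  -- The difference from P_κ has lost its leading term, so whatever it pairs with lies strictly
  -- below κ, where `D-separates` applies.
  P-unique : ∀ {κ f} → IsPartition κ → sum κ ℕ.< N → Supported (sum κ) (Below κ) f → C κ f ≈ 1# → D f ≐ con (α * e₂ κ) ⊗ f → f ≐ P κ
  P-unique {κ} {f} p bound (supported hf s) lead eig = ⊖-≐ (P-nondegenerate hom λ {ρ} pρ → vanish pρ (⟨ h , P ρ ⟩ ≈? 0#))
    where
    h = f ⊖ P κ
    hom = hom-⊖ hf (hom-P p)
    strict : ∀ {μ} → PartitionOf (sum κ) μ → ¬ C μ h ≈ 0# → StrictlyBelow κ μ
    strict {μ} pμ n = below (C μ f ≈? 0#) , λ { ≡.refl → n (trans (⟨⟩-⊖ f _ _) (trans (+-cong lead (-‿cong (leading p))) (-‿inverseʳ 1#))) }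
      where
      below : Dec (C μ f ≈ 0#) → Dominated μ κ
      below (no n′) = s pμ n′
      below (yes z) = P-support p μ λ z′ → n (trans (⟨⟩-⊖ f _ _) (trans (+-cong z (-‿cong z′)) (-‿inverseʳ 0#)))
    eigen-h : D h ≐ con (α * e₂ κ) ⊗ h
    eigen-h = extensional λ z → trans (D-selfadjoint h z) (trans (⟨⟩-⊖ f _ _) (trans (+-cong (trans (sym (D-selfadjoint f z)) (trans (⟨⟩-congˡ z eig) (⟨⟩-con _ _ z)))
      (-‿cong (trans (sym (D-selfadjoint (P κ) z)) (trans (⟨⟩-congˡ z (D-P p bound)) (⟨⟩-con _ _ z)))))
      (trans (solve 3 (λ c a b → c :* a :+ :- (c :* b) := c :* (a :+ :- b)) refl (α * e₂ κ) _ _) (sym (trans (⟨⟩-con _ _ z) (*-congˡ (⟨⟩-⊖ f _ z)))))))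
    vanish : ∀ {ρ} → PartitionOf (sum κ) ρ → Dec (⟨ h , P ρ ⟩ ≈ 0#) → ⟨ h , P ρ ⟩ ≈ 0#
    vanish pρ (yes z) = z
    vanish {ρ} pρ (no n) = D-separates pρ p bound (support-pairing (strictly-below-down p) (supported hom strict) pρ n) (trans (⟨⟩-congˡ _ eigen-h) (⟨⟩-con _ _ _))

  partition-tail : ∀ {m σ} → IsPartition (m ∷ σ) → IsPartition σ
  partition-tail (cons _ b) = bounded⇒partition b

  -- In ⟨P, D(g_m G_v)⟩ the symbol produces products with a factor beyond m, invisible to a P whose
  -- first row is m. Γ thus acts as the scalar -α|σ|, and the eigenvalue equation descends to σ
  -- together with the leading term.
  row-removal : ∀ {m σ} → IsPartition (m ∷ σ) → m ℕ.+ sum σ ℕ.< N → perp (γ m) (P (m ∷ σ)) ≐ P σ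
  row-removal {m} {σ} p bound = P-unique pσ (ℕP.≤-<-trans (ℕP.m≤n+m (sum σ) m) bound)
      (supported hf λ {μ} pμ n → dominated-tail (P-support p (m ∷ μ) λ z → n (trans (sym (⟨⟩-perp (P (m ∷ σ)) (γ m) (G μ))) z)))
      (trans (sym (⟨⟩-perp _ _ _)) (leading p))
      (⊖-≐ (hom-nondegenerate (hom-⊖ (hom-D hf) (hom-con _ hf)) λ v s → trans (⟨⟩-⊖ (D f) _ _) (trans (+-cong (trans (D-selfadjoint f _) (eigenvalue v s)) (-‿cong (⟨⟩-con _ f _))) (-‿inverseʳ _))))
    where
    pσ = partition-tail p
    f = perp (γ m) (P (m ∷ σ))
    hf : Homogeneous (sum σ) f
    hf = hom-perp (hom-γ m) (hom-P p)
    c = α * (α * (ι m * ι (m ∸ 1)))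
    eigenvalue : ∀ v → sum v ≡ sum σ → ⟨ f , D (G v) ⟩ ≈ α * e₂ σ * ⟨ f , G v ⟩
    eigenvalue v s = begin
      ⟨ f , D (G v) ⟩ ≈⟨ sym (⟨⟩-perp _ _ _) ⟩
      y ≈⟨ solve 3 (λ y a b → y := (a :+ y :+ b) :+ :- (a :+ b)) refl y (c * x) ((1# + 1#) * z) ⟩
      (c * x + y + (1# + 1#) * z) + - (c * x + (1# + 1#) * z)
        ≈⟨ +-cong (trans (sym total) eigen-P) (-‿cong (+-congˡ (*-congˡ Γ-value))) ⟩
      α * e₂ (m ∷ σ) * x + - (c * x + (1# + 1#) * - (α * ι (sum σ) * x))
        ≈⟨ solve 5 (λ a p e s x → a :* (a :* p :+ (e :+ :- (s :+ s))) :* x :+ :- (a :* (a :* p) :* x :+ (:1 :+ :1) :* :- (a :* s :* x)) := a :* e :* x) refl α (ι m * ι (m ∸ 1)) (e₂ σ) (ι (sum σ)) x ⟩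
      α * e₂ σ * x ≈⟨ *-congˡ (⟨⟩-perp _ _ _) ⟩
      α * e₂ σ * ⟨ f , G v ⟩ ∎
      where
      open FR
      bound′ : m ℕ.+ sum v ℕ.< N
      bound′ = ≡.subst (λ n → m ℕ.+ n ℕ.< N) (≡.sym s) bound
      x = ⟨ P (m ∷ σ) , G (m ∷ v) ⟩
      y = ⟨ P (m ∷ σ) , γ m ⊗ D (G v) ⟩
      z = ⟨ P (m ∷ σ) , Γ (γ m) (G v) ⟩
      total : ⟨ P (m ∷ σ) , D (G (m ∷ v)) ⟩ ≈ c * x + y + (1# + 1#) * z
      total = trans (⟨⟩-congʳ _ (D-γ-⊗ m v bound′)) (trans (⟨⟩-⊕ʳ _ _ _) (+-cong (trans (⟨⟩-⊕ʳ _ _ _) (+-congʳ (⟨⟩-conʳ _ _ _))) (⟨⟩-conʳ _ _ _)))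
      eigen-P : ⟨ P (m ∷ σ) , D (G (m ∷ v)) ⟩ ≈ α * e₂ (m ∷ σ) * x
      eigen-P = trans (sym (D-selfadjoint _ _)) (trans (⟨⟩-congˡ _ (D-P p bound)) (⟨⟩-con _ _ _))
      vanish : ∀ u → Raised m v u → C u (P (m ∷ σ)) ≈ 0#
      vanish u (raised ≡.refl m<h _ _ _) with C u (P (m ∷ σ)) ≈? 0#
      ... | yes z = z
      ... | no n = ⊥-elim (ℕP.<⇒≱ m<h (dominated-head (P-support p u n)))
      Γ-value : z ≈ - (α * ι (sum σ) * x)
      Γ-value = difference≈0 (trans (solve 2 (λ z w → z :+ :- (:- w) := z :+ w) refl z (α * ι (sum σ) * x))
        (trans (+-congˡ (*-congʳ (*-congˡ (reflexive (≡.cong ι (≡.sym s)))))) (trans (sym (trans (⟨⟩-⊕ʳ _ _ _) (+-congˡ (⟨⟩-conʳ _ _ _)))) (annihilated (Γ-G m v bound′) _ vanish))))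

  row-too-long : ∀ {m κ} → IsPartition κ → top κ ℕ.< m → perp (γ m) (P κ) ≐ 𝟘
  row-too-long {m} {κ} p lt = nondegenerate λ v → trans (sym (⟨⟩-perp _ _ _)) (vanish v)
    where
    vanish : ∀ v → C (m ∷ v) (P κ) ≈ 0#
    vanish v with C (m ∷ v) (P κ) ≈? 0#
    ... | yes z = z
    ... | no n = ⊥-elim (ℕP.<⇒≱ lt (dominated-top (P-support p (m ∷ v) n)))

  -- `row-removal` tells how g_m P_σ pairs with the P_ρ whose first row is at most m: only ρ = m ∷ σ
  -- counts. The remaining ρ have a longer first row and do not occur in `f`.
  row-duality : ∀ {m σ f} → IsPartition (m ∷ σ) → m ℕ.+ sum σ ℕ.< N → Homogeneous (m ℕ.+ sum σ) f →
    (∀ {ρ} → PartitionOf (m ℕ.+ sum σ) ρ → m ℕ.< top ρ → ⟨ f , P ρ ⟩ ≈ 0#) →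
    norm σ * ⟨ f , P (m ∷ σ) ⟩ ≈ norm (m ∷ σ) * ⟨ f , γ m ⊗ P σ ⟩
  row-duality {m} {σ} {f} p@(cons {x = m} 1≤m _) bound hf z = sym (difference≈0 (trans (sym (trans (⟨⟩-comm _ _) (trans (⟨⟩-⊖ _ _ f)
      (+-cong (trans (⟨⟩-con _ _ f) (*-congˡ (⟨⟩-comm _ _))) (-‿cong (trans (⟨⟩-con _ _ f) (*-congˡ (⟨⟩-comm _ _)))))))) zero-pairing))
    where
    pσ = partition-tail p
    h = con (norm (m ∷ σ)) ⊗ (γ m ⊗ P σ) ⊖ con (norm σ) ⊗ P (m ∷ σ)
    value : ∀ ρ → ⟨ h , P ρ ⟩ ≈ norm (m ∷ σ) * ⟨ P σ , perp (γ m) (P ρ) ⟩ + - (norm σ * ⟨ P (m ∷ σ) , P ρ ⟩)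
    value ρ = trans (⟨⟩-⊖ _ _ _) (+-cong (trans (⟨⟩-con _ _ _) (*-congˡ (⟨⟩-perpˡ _ _ _))) (-‿cong (⟨⟩-con _ _ _)))
    nothing-left : ∀ {a b x y} → x ≈ 0# → y ≈ 0# → a * x + - (b * y) ≈ 0#
    nothing-left ex ey = trans (+-cong (trans (*-congˡ ex) (zeroʳ _)) (-‿cong (trans (*-congˡ ey) (zeroʳ _)))) (-‿inverseʳ 0#)
    long : ∀ {ρ} → PartitionOf (m ℕ.+ sum σ) ρ → ¬ ⟨ h , P ρ ⟩ ≈ 0# → m ℕ.< top ρ
    long {[]} (_ , e) _ = ⊥-elim (ℕP.<⇒≢ (ℕP.<-≤-trans 1≤m (ℕP.m≤m+n m _)) e)
    long {k ∷ ρ} (pρ , e) n with ℕP.<-cmp m k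
    ... | tri< m<k _ _ = m<k
    ... | tri> _ m≢k k<m = ⊥-elim (n (trans (value (k ∷ ρ)) (nothing-left
            (trans (⟨⟩-congʳ _ (row-too-long pρ k<m)) (⟨⟩-𝟘ʳ _)) (orthogonal p pρ λ { ≡.refl → m≢k ≡.refl }))))
    ... | tri≈ _ ≡.refl _ with σ ≟ᴸ ρ
    ...   | yes ≡.refl = ⊥-elim (n (trans (value (m ∷ σ)) (trans (+-congʳ (trans (*-congˡ (⟨⟩-congʳ _ (row-removal p bound))) (*-comm _ _))) (-‿inverseʳ _))))
    ...   | no σ≢ρ = ⊥-elim (n (trans (value (m ∷ ρ)) (nothing-left
            (trans (⟨⟩-congʳ _ (row-removal pρ (≡.subst (ℕ._< N) (≡.sym e) bound))) (orthogonal pσ (partition-tail pρ) σ≢ρ)) (orthogonal p pρ λ { ≡.refl → σ≢ρ ≡.refl }))))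
    zero-pairing : ⟨ f , h ⟩ ≈ 0#
    zero-pairing = disjoint hf λ {ρ} pρ n → decide pρ n (⟨ h , P ρ ⟩ ≈? 0#)
      where
      decide : ∀ {ρ} → PartitionOf (m ℕ.+ sum σ) ρ → ¬ ⟨ f , P ρ ⟩ ≈ 0# → Dec (⟨ h , P ρ ⟩ ≈ 0#) → ⟨ h , P ρ ⟩ ≈ 0#
      decide pρ n (yes e) = e
      decide pρ n (no n′) = ⊥-elim (n (z pρ (long pρ n′)))

-- Restriction to finitely many variables; removal of a column

module ColumnRemoval (K : CoeffField) (A : SymmetricAlgebra K) (J : JackBasis K A) (N : ℕ) where
  open CoeffField K
  open FieldFacts K
  open SymmetricFunctions K using (weight)
  open SymmetricAlgebra A
  open AlgebraFacts K A
  open Generating K A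
  open Operators K A N
  open Coefficients K A
  open Triangularity K A N
  open Partitions
  open Columns
  open JackBasis J
  open Expansion K A J
  open Spectrum K A J N

  G-++0 : ∀ a b → G (a ++ 0 ∷ b) ≐ G (a ++ b)
  G-++0 [] b = L.*-identityˡ _
  G-++0 (x ∷ a) b = ⊗-cong ≐-refl (G-++0 a b)

  G-pad : ∀ n v → G (pad n v) ≐ G v
  G-pad n v = appended v (n ∸ length v)
    where
    zeros : ∀ k → G (replicate k 0) ≐ 𝟙
    zeros zero = ≐-refl
    zeros (suc k) = ≐-trans (L.*-identityˡ _) (zeros k)
    appended : ∀ v k → G (v ++ replicate k 0) ≐ G v
    appended [] k = zeros k
    appended (x ∷ v) k = ⊗-cong ≐-refl (appended v k)

  sum-++0 : ∀ a b → sum (a ++ 0 ∷ b) ≡ sum (a ++ b)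
  sum-++0 [] b = ≡.refl
  sum-++0 (x ∷ a) b = ≡.cong (x ℕ.+_) (sum-++0 a b)

  -- The kernel of restriction to n variables.
  record Ideal (n : ℕ) (f : Λ) : Set where
    constructor ideal
    field vanishes : ∀ u → length u ℕ.≤ n → C u f ≈ 0#
  open Ideal public

  ideal-≐ : ∀ {n f h} → f ≐ h → Ideal n f → Ideal n h
  ideal-≐ e (ideal v) = ideal λ u l → trans (⟨⟩-congˡ _ (≐-sym e)) (v u l)

  ideal-⊕ : ∀ {n f h} → Ideal n f → Ideal n h → Ideal n (f ⊕ h)
  ideal-⊕ (ideal v) (ideal w) = ideal λ u l → trans (⟨⟩-⊕ _ _ _) (trans (+-cong (v u l) (w u l)) (+-identityˡ 0#))

  ideal-con : ∀ {n f} c → Ideal n f → Ideal n (con c ⊗ f)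
  ideal-con c (ideal v) = ideal λ u l → trans (⟨⟩-con _ _ _) (trans (*-congˡ (v u l)) (zeroʳ c))

  ideal-⊗ : ∀ {n f} x → Ideal n f → Ideal n (x ⊗ f)
  ideal-⊗ {n} x = generated (λ x → ∀ {f} → Ideal n f → Ideal n (x ⊗ f)) (λ c → ideal-con c)
    (λ k {f} i → ideal λ u l → trans (⟨⟩-perpˡ _ _ _) (annihilated (span-perp-q-G k u) f λ w e → vanishes i w (≡.subst (ℕ._≤ n) (≡.sym e) l)))
    (λ a b i → ideal-≐ (≐-sym (L.distribʳ _ _ _)) (ideal-⊕ (a i) (b i)))
    (λ a b i → ideal-≐ (≐-sym (L.*-assoc _ _ _)) (a (b i))) x

  P-ideal : ∀ {n κ} → IsPartition κ → n ℕ.< length κ → Ideal n (P κ)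
  P-ideal {n} {κ} p lt = ideal λ u l → vanish u l (C u (P κ) ≈? 0#)
    where
    vanish : ∀ u → length u ℕ.≤ n → Dec (C u (P κ) ≈ 0#) → C u (P κ) ≈ 0#
    vanish u l (yes z) = z
    vanish u l (no nz) = ⊥-elim (ℕP.<⇒≱ lt (ℕP.≤-trans (dominated-length p (P-support p u nz)) l))

  Long : ℕ → List ℕ → Set
  Long n μ = n ℕ.< length μ

  long-down : ∀ {n} → DownClosed (Long n)
  long-down _ pκ d lt = ℕP.<-≤-trans lt (dominated-length pκ d)

  -- The monomial support of a function in the ideal consists of partitions with more than n rows.
  -- This set is down-closed, since going down in dominance never loses rows, so it contains the
  -- Jack support too.
  ideal-pairing : ∀ {n d f} → Ideal n f → Homogeneous d f → ∀ {ρ} → PartitionOf d ρ → length ρ ℕ.≤ n → ⟨ f , P ρ ⟩ ≈ 0#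
  ideal-pairing {n} {d} {f} (ideal v) h {ρ} pρ l with ⟨ f , P ρ ⟩ ≈? 0#
  ... | yes z = z
  ... | no nz = ⊥-elim (ℕP.<⇒≱ (support-pairing (long-down {n}) (supported h long) pρ nz) l)
    where
    long : ∀ {μ} → PartitionOf d μ → ¬ C μ f ≈ 0# → Long n μ
    long {μ} _ n≉ with ℕP.≤-<-connex (length μ) n
    ... | inj₁ le = ⊥-elim (n≉ (v μ le))
    ... | inj₂ lt = lt

  pairing-ideal : ∀ {n d f} → Homogeneous d f → (∀ {ρ} → PartitionOf d ρ → length ρ ℕ.≤ n → ⟨ f , P ρ ⟩ ≈ 0#) → Ideal n f
  pairing-ideal {n} {d} {f} h z = ideal λ u l → vanish u l (C u f ≈? 0#) (sum u ℕP.≟ d)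
    where
    long : ∀ {ρ} → PartitionOf d ρ → ¬ ⟨ f , P ρ ⟩ ≈ 0# → Long n ρ
    long {ρ} pρ nz with ℕP.≤-<-connex (length ρ) n
    ... | inj₁ le = ⊥-elim (nz (z pρ le))
    ... | inj₂ lt = lt
    vanish : ∀ u → length u ℕ.≤ n → Dec (C u f ≈ 0#) → Dec (sum u ≡ d) → C u f ≈ 0#
    vanish u l (yes e) _ = e
    vanish u l (no nz) (no s) = hom-C u h s
    vanish u l (no nz) (yes s) = ⊥-elim (ℕP.<⇒≱ (support (pairing-support (long-down {n}) h long)
      (normalize-partition u , ≡.trans (≡.sym (equal-sums (normalize-dominates u))) s) (λ e → nz (trans (sym (C-normalize u f)) e)))
      (ℕP.≤-trans (length-normalize u) l))

  -- The elementary symmetric function e_n.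
  e : ℕ → Λ
  e n = P (ones n)

  hom-e : ∀ n → Homogeneous n (e n)
  hom-e n = ≡.subst (λ m → Homogeneous m (e n)) (sum-ones n) (hom-P (ones-partition n))

  -- In n variables e_n is the single monomial x_1⋯x_n, and in fewer it vanishes; a further factor
  -- `x` is taken care of by `shifted-⊗`.
  e-shifted : ∀ n x → Shifted n (x ⊗ e n) x
  e-shifted n x = shifted-by (λ u l → trans (on-suc s u l) (⟨⟩-congˡ _ (L.*-identityʳ x))) (on-short s)
    where
    one-variable : ∀ u → length u ≡ n → Dec (sum u ≡ 0) → C (map suc u) (e n) ≈ C u 𝟙
    one-variable u l (yes z) = trans (⟨⟩-congʳ _ (≡⇒≐ (≡.cong G (≡.trans (map-suc-zeros u z) (≡.cong ones l))))) (trans (leading (ones-partition n)) (sym (empty u z)))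
      where
      empty : ∀ u → sum u ≡ 0 → C u 𝟙 ≈ 1#
      empty [] _ = ⟨𝟙,𝟙⟩
      empty (zero ∷ u) z = trans (⟨⟩-congʳ 𝟙 (L.*-identityˡ _)) (empty u z)
    one-variable u l (no nz) = trans (hom-C (map suc u) (hom-e n) (λ s → nz (ℕP.+-cancelʳ-≡ n (sum u) 0 (≡.trans (≡.cong (sum u ℕ.+_) (≡.sym l)) (≡.trans (≡.sym (sum-map-suc u)) s)))))
      (sym (hom-C u hom-𝟙 nz))
    no-short : ∀ w → suc (length w) ≡ n → C w (e n) ≈ 0#
    no-short w l with C w (e n) ≈? 0#
    ... | yes z = z
    ... | no nz = ⊥-elim (ℕP.<⇒≱ (ℕP.≤-reflexive l) (ℕP.≤-trans (ℕP.≤-reflexive (≡.sym (ListP.length-replicate n))) (dominated-length (ones-partition n) (P-support (ones-partition n) w nz))))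
    s : Shifted n (x ⊗ e n) (x ⊗ 𝟙)
    s = shifted-⊗ x (shifted-by (λ u l → one-variable u l (sum u ℕP.≟ 0)) no-short)

  e₂-zeros : ∀ {v} → Decreasing 0 v → sum v ≡ 0 × e₂ v ≈ 0#
  e₂-zeros [] = ≡.refl , refl
  e₂-zeros (z≤n ∷ d) = let (s , z) = e₂-zeros d in s , trans (+-congˡ (+-cong z (-‿cong (+-cong (reflexive (≡.cong ι s)) (reflexive (≡.cong ι s))))))
    (solve 2 (λ a x → a :* (:0 :* x) :+ (:0 :+ :- (:0 :+ :0)) := :0) refl α (ι 0))

  e₂-dropZeros : ∀ {m v} → Decreasing m v → e₂ (dropZeros v) ≈ e₂ v
  e₂-dropZeros [] = refl
  e₂-dropZeros {v = zero ∷ v} (_ ∷ d) = trans (reflexive (≡.cong e₂ (nothing (dropZeros-bounded d)))) (sym (proj₂ (e₂-zeros (z≤n ∷ d))))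
    where
    nothing : ∀ {v} → Bounded 0 v → v ≡ []
    nothing [] = ≡.refl
    nothing (cons (s≤s _) () _)
  e₂-dropZeros {v = suc x ∷ v} (_ ∷ d) = +-congˡ (+-cong (e₂-dropZeros d) (-‿cong (+-cong s s)))
    where
    s : ι (sum (dropZeros v)) ≈ ι (sum v)
    s = reflexive (≡.cong ι (sum-dropZeros v))

  -- A partition with exactly n rows is presented as `map suc v`. The list `v` keeps its trailing
  -- zeros, which remember n; the partition without its first column is `dropZeros v`.
  record ColumnData (n : ℕ) (v : List ℕ) : Set where
    constructor columnData
    field
      {bound} : ℕ
      decreasing : Decreasing bound v
      columns : length v ≡ n
      small : sum (map suc v) ℕ.< N
    longer : IsPartition (map suc v)
    longer = bounded⇒partition (map-suc-bounded decreasing)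
    shorter-partition : IsPartition (dropZeros v)
    shorter-partition = dropZeros-partition decreasing
    longer-length : length (map suc v) ≡ n
    longer-length = ≡.trans (ListP.length-map suc v) columns
    longer-sum : sum (map suc v) ≡ sum (dropZeros v) ℕ.+ n
    longer-sum = ≡.trans (sum-map-suc v) (≡.cong₂ ℕ._+_ (≡.sym (sum-dropZeros v)) columns)

  -- In n variables both functions are eigenfunctions of `D` with the same eigenvalue, by `shift-D`,
  -- and with the same leading monomial. Only partitions with at most n rows are tested, since
  -- longer ones belong to the ideal.
  column-removal : ∀ {n v} → ColumnData n v → Ideal n (P (dropZeros v) ⊗ e n ⊖ P (map suc v))
  column-removal {n} {v} cd = pairing-ideal hom-h λ {ρ} pρ l → vanish pρ l (⟨ h , P ρ ⟩ ≈? 0#)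
    where
    open ColumnData cd
    κ = map suc v
    κ⁻ = dropZeros v
    f = P κ⁻ ⊗ e n
    h = f ⊖ P κ
    f-shifted = e-shifted n (P κ⁻)
    hom-f : Homogeneous (sum κ) f
    hom-f = ≡.subst (λ d → Homogeneous d f) (≡.sym longer-sum) (hom-⊗ (hom-P shorter-partition) (hom-e n))
    hom-h = hom-⊖ hom-f (hom-P longer)
    small⁻ : sum κ⁻ ℕ.< N
    small⁻ = ℕP.≤-<-trans (ℕP.≤-trans (ℕP.m≤m+n _ n) (ℕP.≤-reflexive (≡.sym longer-sum))) small
    C-h-short : ∀ a b {u} → suc (length (a ++ b)) ≡ n → u ≡ a ++ 0 ∷ b → C u h ≈ 0#
    C-h-short a b l ≡.refl = trans (⟨⟩-congʳ h (G-++0 a b)) (trans (⟨⟩-⊖ f _ _) (trans (+-cong (on-short f-shifted (a ++ b) l)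
      (-‿cong (vanishes (P-ideal longer (ℕP.≤-reflexive (≡.trans l (≡.sym longer-length)))) (a ++ b) ℕP.≤-refl))) (-‿inverseʳ 0#)))
    -- The condition is imposed on short partitions only, as nothing is known about `h` beyond n
    -- variables. It is still down-closed, because a dominated partition has at least as many rows.
    StrictlyBelowIfShort : List ℕ → Set
    StrictlyBelowIfShort ρ = length ρ ℕ.≤ n → StrictlyBelow κ ρ
    down : DownClosed StrictlyBelowIfShort
    down pμ pρ d s l = strictly-below-down longer pμ pρ d (s (ℕP.≤-trans (dominated-length pρ d) l))
    strict : ∀ {μ} → PartitionOf (sum κ) μ → ¬ C μ h ≈ 0# → StrictlyBelowIfShort μ
    strict {μ} pμ nz l = from-shape (≡.subst (λ k → Shape k (pad n μ)) (length-pad n μ l) (shape (pad n μ)))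
      where
      nz′ : ¬ C (pad n μ) h ≈ 0#
      nz′ z = nz (trans (⟨⟩-congʳ h (≐-sym (G-pad n μ))) z)
      partial-pad : ∀ k → partial k μ ≡ partial k (pad n μ)
      partial-pad k = ≡.trans (≡.cong (partial k) (≡.sym (dropZeros-pad n (proj₁ pμ)))) (partial-dropZeros (pad-decreasing n (proj₁ pμ)) k)
      from-shape : Shape n (pad n μ) → StrictlyBelow κ μ
      from-shape (shorter a b l′ e) = ⊥-elim (nz′ (C-h-short a b l′ e))
      from-shape (shifted u′ l′ e) = below (C u′ (P κ⁻) ≈? 0#) , unequal
        where
        dominated-pad : Dominated (map suc u′) κ → Dominated μ κ
        dominated-pad d = dominated (proj₂ pμ) λ k → ℕP.≤-trans (ℕP.≤-reflexive (≡.trans (partial-pad k) (≡.cong (partial k) e))) (partials d k)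
        below : Dec (C u′ (P κ⁻) ≈ 0#) → Dominated μ κ
        below (no m) = dominated-pad (dominated-map-suc (≡.trans l′ (≡.sym columns)) (dominated (≡.trans (equal-sums d) (sum-dropZeros v))
          λ k → ℕP.≤-trans (partials d k) (ℕP.≤-reflexive (partial-dropZeros decreasing k))))
          where d = P-support shorter-partition u′ m
        below (yes z) = dominated-pad (P-support longer (map suc u′) λ z′ → nz′ (trans (⟨⟩-congʳ h (≡⇒≐ (≡.cong G e))) (trans (⟨⟩-⊖ f _ _)
          (trans (+-cong (trans (on-suc f-shifted u′ l′) z) (-‿cong z′)) (-‿inverseʳ 0#)))))
        unequal : μ ≢ κ
        unequal ≡.refl = nz (trans (⟨⟩-⊖ f _ _) (trans (+-cong (trans (on-suc f-shifted v columns) (trans (⟨⟩-congʳ _ (≐-sym (G-dropZeros v))) (leading shorter-partition))) (-‿cong (leading longer))) (-‿inverseʳ 1#)))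
    eigen-f : ∀ u → length u ≡ n → sum u ≡ sum κ → ⟨ D f , G u ⟩ ≈ α * e₂ κ * C u f
    eigen-f u l s = trans (D-selfadjoint f _) (from-shape (≡.subst (λ k → Shape k u) l (shape u)))
      where
      from-shape : Shape n u → ⟨ f , D (G u) ⟩ ≈ α * e₂ κ * C u f
      -- An exponent 0 may be omitted. On the vector of length n - 1 that remains, `D` leads only to
      -- vectors of this length, where `f` vanishes.
      from-shape (shorter a b l′ ≡.refl) = begin
        ⟨ f , D (G (a ++ 0 ∷ b)) ⟩ ≈⟨ trans (⟨⟩-congʳ f (D-cong (G-++0 a b))) (sym (D-selfadjoint f _)) ⟩
        C (a ++ b) (D f) ≈⟨ D-coefficient f (a ++ b) (≡.subst (ℕ._< N) (≡.trans (≡.sym s) (sum-++0 a b)) small) (λ w ab → on-short f-shifted w (≡.trans (≡.cong suc (Above.same-length ab)) l′)) ⟩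
        α * e₂ (a ++ b) * C (a ++ b) f ≈⟨ trans (*-congˡ zero-coefficient) (zeroʳ _) ⟩
        0# ≈⟨ sym (trans (*-congˡ (trans (⟨⟩-congʳ f (G-++0 a b)) zero-coefficient)) (zeroʳ _)) ⟩
        α * e₂ κ * C (a ++ 0 ∷ b) f ∎
        where
        open FR
        zero-coefficient : C (a ++ b) f ≈ 0#
        zero-coefficient = on-short f-shifted (a ++ b) l′
      from-shape (shifted u′ l′ ≡.refl) = begin
        ⟨ f , D (G (map suc u′)) ⟩ ≈⟨ respects (≡.subst (λ k → ShiftOf k (D (G (map suc u′))) (D (G u′) ⊕ con ε ⊗ G u′)) l′ (shift-D u′ (≡.subst (ℕ._< N) (≡.sym s) small))) f (P κ⁻) f-shifted ⟩
        ⟨ P κ⁻ , D (G u′) ⊕ con ε ⊗ G u′ ⟩ ≈⟨ trans (⟨⟩-⊕ʳ _ _ _) (+-cong (trans (sym (D-selfadjoint _ _)) (trans (⟨⟩-congˡ _ (D-P shorter-partition small⁻)) (⟨⟩-con _ _ _))) (⟨⟩-conʳ _ _ _)) ⟩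
        α * e₂ κ⁻ * x + ε * x ≈⟨ trans (+-cong (*-congʳ (*-congˡ (e₂-dropZeros decreasing))) (*-congʳ (*-congˡ same-shift)))
            (solve 4 (λ a e e⁺ x → a :* e :* x :+ a :* (e⁺ :+ :- e) :* x := a :* e⁺ :* x) refl α (e₂ v) (e₂ κ) x) ⟩
        α * e₂ κ * x ≈⟨ *-congˡ (sym (on-suc f-shifted u′ l′)) ⟩
        α * e₂ κ * C (map suc u′) f ∎
        where
        open FR
        ε = α * (e₂ (map suc u′) + - e₂ u′)
        x = C u′ (P κ⁻)
        same-sum′ : sum u′ ≡ sum v
        same-sum′ = ℕP.+-cancelʳ-≡ n _ _ (≡.trans (≡.cong (sum u′ ℕ.+_) (≡.sym l′)) (≡.trans (≡.sym (sum-map-suc u′)) (≡.trans s (≡.trans (sum-map-suc v) (≡.cong (sum v ℕ.+_) columns)))))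
        same-shift : e₂ (map suc u′) + - e₂ u′ ≈ e₂ κ + - e₂ v
        same-shift = trans (e₂-suc u′) (trans (reflexive (≡.cong₂ (λ a b → (α + α) * ι a + - (ι b * ι (b ∸ 1))) same-sum′ (≡.trans l′ (≡.sym columns)))) (sym (e₂-suc v)))
    eigen-ideal : Ideal n (D h ⊖ con (α * e₂ κ) ⊗ h)
    eigen-ideal = ideal λ u l → trans (⟨⟩-congʳ _ (≐-sym (G-pad n u))) (at (pad n u) (length-pad n u l) (sum (pad n u) ℕP.≟ sum κ))
      where
      at : ∀ u → length u ≡ n → Dec (sum u ≡ sum κ) → C u (D h ⊖ con (α * e₂ κ) ⊗ h) ≈ 0#
      at u l (no s) = hom-C u (hom-⊖ (hom-D hom-h) (hom-con _ hom-h)) s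
      at u l (yes s) = trans (⟨⟩-⊖ (D h) _ _) (trans (+-cong (trans (D-selfadjoint h _) (trans (⟨⟩-⊖ f _ _) (+-cong (trans (sym (D-selfadjoint f _)) (eigen-f u l s))
          (-‿cong (trans (sym (D-selfadjoint (P κ) _)) (trans (⟨⟩-congˡ _ (D-P longer small)) (⟨⟩-con _ _ _)))))))
          (-‿cong (trans (⟨⟩-con _ h _) (*-congˡ (⟨⟩-⊖ f _ _)))))
        (solve 3 (λ c a b → c :* a :+ :- (c :* b) :+ :- (c :* (a :+ :- b)) := :0) refl (α * e₂ κ) _ _))
    vanish : ∀ {ρ} → PartitionOf (sum κ) ρ → length ρ ℕ.≤ n → Dec (⟨ h , P ρ ⟩ ≈ 0#) → ⟨ h , P ρ ⟩ ≈ 0#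
    vanish pρ l (yes z) = z
    vanish {ρ} pρ l (no nz) = D-separates pρ longer small (support-pairing down (supported hom-h strict) pρ nz l)
      (difference≈0 (trans (sym (trans (⟨⟩-⊖ (D h) _ _) (+-congˡ (-‿cong (⟨⟩-con _ h _))))) (ideal-pairing eigen-ideal (hom-⊖ (hom-D hom-h) (hom-con _ hom-h)) pρ l)))

  -- e_n^⊥ P_κ is proportional to P_ρ for the partition ρ without the first column. Any other
  -- partition either has more than n rows and lies in the ideal, or receives a column by
  -- `column-removal` and is excluded by orthogonality.
  column-duality : ∀ {n v} → ColumnData n v → ∀ {z} → norm (dropZeros v) * ⟨ z ⊗ e n , P (map suc v) ⟩ ≈ norm (map suc v) * ⟨ z , P (dropZeros v) ⟩
  column-duality {n} {v} cd {z} = begin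
    norm κ⁻ * ⟨ z ⊗ e n , P κ ⟩ ≈⟨ *-congˡ (trans (⟨⟩-congˡ _ (L.*-comm z (e n))) (trans (⟨⟩-perpˡ _ _ _) (⟨⟩-comm _ _))) ⟩
    norm κ⁻ * ⟨ f , z ⟩ ≈⟨ sym (⟨⟩-con _ _ _) ⟩
    ⟨ con (norm κ⁻) ⊗ f , z ⟩ ≈⟨ ⟨⟩-congˡ z (proportional shorter-partition hom-f only) ⟩
    ⟨ con ⟨ f , P κ⁻ ⟩ ⊗ P κ⁻ , z ⟩ ≈⟨ trans (⟨⟩-con _ _ _) (*-cong diagonal (⟨⟩-comm _ _)) ⟩
    norm κ * ⟨ z , P κ⁻ ⟩ ∎
    where
    open FR
    open ColumnData cd
    κ = map suc v
    κ⁻ = dropZeros v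
    f = perp (e n) (P κ)
    hom-f : Homogeneous (sum κ⁻) f
    hom-f = hom-perp (hom-e n) (≡.subst (λ d → Homogeneous d (P κ)) (≡.trans longer-sum (ℕP.+-comm _ n)) (hom-P longer))
    pair : ∀ {n′ u} → ColumnData n′ u → n′ ≡ n → sum (dropZeros u) ≡ sum κ⁻ → ⟨ f , P (dropZeros u) ⟩ ≈ ⟨ P (map suc u) , P κ ⟩
    pair {u = u} cu ≡.refl s = trans (trans (sym (⟨⟩-perp _ _ _)) (trans (⟨⟩-congʳ _ (L.*-comm _ _)) (⟨⟩-comm _ _)))
      (difference≈0 (trans (sym (⟨⟩-⊖ _ _ _)) (ideal-pairing (column-removal cu)
        (hom-⊖ (≡.subst (λ d → Homogeneous d (P (dropZeros u) ⊗ e n)) (≡.trans (≡.cong (ℕ._+ n) s) (≡.sym longer-sum)) (hom-⊗ (hom-P (ColumnData.shorter-partition cu)) (hom-e n)))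
          (≡.subst (λ d → Homogeneous d (P (map suc u))) (≡.trans (ColumnData.longer-sum cu) (≡.trans (≡.cong (ℕ._+ n) s) (≡.sym longer-sum))) (hom-P (ColumnData.longer cu))))
        (longer , ≡.refl) (ℕP.≤-reflexive longer-length))))
    diagonal : ⟨ f , P κ⁻ ⟩ ≈ norm κ
    diagonal = pair cd ≡.refl ≡.refl
    only : ∀ {ρ} → PartitionOf (sum κ⁻) ρ → ρ ≢ κ⁻ → ⟨ f , P ρ ⟩ ≈ 0#
    only {ρ} (pρ , s) ρ≢ with ℕP.≤-<-connex (length ρ) n
    ... | inj₂ lt = trans (sym (⟨⟩-perp _ _ _)) (trans (⟨⟩-comm _ _) (ideal-pairing (ideal-⊗ (e n) (P-ideal pρ lt))
          (≡.subst (λ d → Homogeneous d (e n ⊗ P ρ)) (≡.trans (≡.cong (n ℕ.+_) s) (≡.trans (ℕP.+-comm n _) (≡.sym longer-sum))) (hom-⊗ (hom-e n) (hom-P pρ))) (longer , ≡.refl) (ℕP.≤-reflexive longer-length)))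
    ... | inj₁ le = trans (⟨⟩-congʳ f (≡⇒≐ (≡.cong P (≡.sym (dropZeros-pad n pρ))))) (trans (pair cu ≡.refl (≡.trans (≡.cong sum (dropZeros-pad n pρ)) s))
          (orthogonal (ColumnData.longer cu) longer λ eq → ρ≢ (≡.trans (≡.sym (dropZeros-pad n pρ)) (≡.cong dropZeros (map-suc-injective eq)))))
      where
      cu : ColumnData n (pad n ρ)
      cu = columnData (pad-decreasing n pρ) (length-pad n ρ le) (≡.subst (ℕ._< N) (≡.trans longer-sum (≡.trans (≡.cong₂ ℕ._+_ (≡.sym (≡.trans (≡.sym (sum-dropZeros (pad n ρ))) (≡.trans (≡.cong sum (dropZeros-pad n pρ)) s))) (≡.sym (length-pad n ρ le))) (≡.sym (sum-map-suc (pad n ρ))))) small)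

  -- Modulo the ideal, e_n supplies the column of the factor, and multiplication by `y` does not
  -- leave the ideal; `column-duality` then takes the column off the other side.
  column-product : ∀ {n u v a y} → ColumnData n u → ColumnData n v → Homogeneous a y → a ℕ.+ sum (map suc u) ≡ sum (map suc v) →
    norm (dropZeros v) * ⟨ y ⊗ P (map suc u) , P (map suc v) ⟩ ≈ norm (map suc v) * ⟨ y ⊗ P (dropZeros u) , P (dropZeros v) ⟩
  column-product {n} {u} {v} {a} {y} cu cv hy s = trans (*-congˡ (trans (sym same) (⟨⟩-congˡ _ (≐-sym (L.*-assoc _ _ _))))) (column-duality cv)
    where
    module U = ColumnData cu
    module W = ColumnData cv
    same : ⟨ y ⊗ (P (dropZeros u) ⊗ e n) , P (map suc v) ⟩ ≈ ⟨ y ⊗ P (map suc u) , P (map suc v) ⟩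
    same = difference≈0 (trans (sym (trans (⟨⟩-congˡ _ (≐-trans (L.distribˡ y _ _) (⊕-cong ≐-refl (solveΛ 3 (λ y c x → y :⊗ (c :⊗ x) :≐ c :⊗ (y :⊗ x)) ≐-refl _ _ _)))) (⟨⟩-⊖ _ _ _)))
      (ideal-pairing (ideal-⊗ y (column-removal cu)) (≡.subst (λ d → Homogeneous d (y ⊗ (P (dropZeros u) ⊗ e n ⊖ P (map suc u)))) s
        (hom-⊗ hy (hom-⊖ (≡.subst (λ d → Homogeneous d (P (dropZeros u) ⊗ e n)) (≡.sym U.longer-sum) (hom-⊗ (hom-P U.shorter-partition) (hom-e n))) (hom-P U.longer))))
        (W.longer , ≡.refl) (ℕP.≤-reflexive W.longer-length)))

-- The support of the Pieri rule

-- Add σ κ i j: κ is σ with a box added in row i and column j, both counted from 0.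
data Add : List ℕ → List ℕ → ℕ → ℕ → Set where
  here  : ∀ {x σ} → Add (x ∷ σ) (suc x ∷ σ) 0 x
  new   : Add [] (1 ∷ []) 0 0
  there : ∀ {x σ κ i j} → Add σ κ i j → Add (x ∷ σ) (x ∷ κ) (suc i) j

module PieriRule (K : CoeffField) (A : SymmetricAlgebra K) (J : JackBasis K A) (N : ℕ) where
  open CoeffField K
  open FieldFacts K
  open SymmetricFunctions K using (weight)
  open SymmetricAlgebra A
  open AlgebraFacts K A
  open Generating K A
  open Operators K A N
  open Coefficients K A
  open Triangularity K A N
  open Partitions
  open Columns
  open JackBasis J
  open Expansion K A J
  open Spectrum K A J N
  open ColumnRemoval K A J N

  add-sum : ∀ {σ κ i j} → Add σ κ i j → sum κ ≡ suc (sum σ)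
  add-sum here = ≡.refl
  add-sum new = ≡.refl
  add-sum {x ∷ σ} (there a) = ≡.trans (≡.cong (x ℕ.+_) (add-sum a)) (ℕP.+-suc x _)

  -- Twice the content of the added box: the box contributes 2αj in its own row, and each of the i
  -- rows above subtracts 2.
  add-e₂ : ∀ {σ κ i j} → Add σ κ i j → e₂ κ + - e₂ σ ≈ (α + α) * ι j + - (ι i + ι i)
  add-e₂ {x ∷ σ} here = trans (+-congʳ (+-congʳ (*-congˡ (ι-falling x)))) (solve 4 (λ a p x r → (a :* (p :+ (x :+ x)) :+ r) :+ :- (a :* p :+ r) := (a :+ a) :* x :+ :- (:0 :+ :0)) refl α _ (ι x) _)
  add-e₂ new = solve 1 (λ a → a :* ((:1 :+ :0) :* :0) :+ (:0 :+ :- (:0 :+ :0)) :+ :- :0 := (a :+ a) :* :0 :+ :- (:0 :+ :0)) refl α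
  add-e₂ {x ∷ σ} {_ ∷ κ} {suc i} {j} (there a) = trans (+-congʳ (+-congˡ (+-congˡ (-‿cong (+-cong s s)))))
    (trans (solve 4 (λ p e⁺ e s → (p :+ (e⁺ :+ :- ((:1 :+ s) :+ (:1 :+ s)))) :+ :- (p :+ (e :+ :- (s :+ s))) := (e⁺ :+ :- e) :+ :- (:1 :+ :1)) refl _ (e₂ κ) (e₂ σ) (ι (sum σ)))
      (trans (+-congʳ (add-e₂ a)) (solve 2 (λ c i → (c :+ :- (i :+ i)) :+ :- (:1 :+ :1) := c :+ :- ((:1 :+ i) :+ (:1 :+ i))) refl _ (ι i))))
    where
    s : ι (sum κ) ≈ 1# + ι (sum σ)
    s = reflexive (≡.cong ι (add-sum a))

  -- `D-q₀` taken between two eigenvectors: the commutator turns into the difference of the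
  -- eigenvalues times the matrix entry of p_1.
  U-value : ∀ {σ κ} → IsPartition σ → IsPartition κ → sum σ ℕ.< N → sum κ ℕ.< N →
    (1# + 1#) * ⟨ U (P σ) , P κ ⟩ ≈ (e₂ κ + - e₂ σ) * ⟨ q 0 ⊗ P σ , P κ ⟩
  U-value {σ} {κ} pσ pκ bσ bκ = *-cancelˡ α α≉0 (begin
    α * ((1# + 1#) * u)        ≈⟨ solve 4 (λ a u e x → a :* ((:1 :+ :1) :* u) := (a :* e :* x :+ (a :+ a) :* u) :+ :- (a :* e :* x)) refl α u (e₂ σ) x ⟩
    (α * e₂ σ * x + (α + α) * u) + - (α * e₂ σ * x)
      ≈⟨ +-congʳ (sym (trans (⟨⟩-congˡ _ (D-q₀ (ℕP.≤-trans (s≤s z≤n) bσ) (P σ))) (trans (⟨⟩-⊕ _ _ _) (+-cong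
           (trans (⟨⟩-congˡ _ (≐-trans (⊗-cong ≐-refl (D-P pσ bσ)) (solveΛ 3 (λ q c p → q :⊗ (c :⊗ p) :≐ c :⊗ (q :⊗ p)) ≐-refl _ _ _))) (⟨⟩-con _ _ _)) (⟨⟩-con _ _ _))))) ⟩
    ⟨ D (q 0 ⊗ P σ) , P κ ⟩ + - (α * e₂ σ * x) ≈⟨ +-congʳ (trans (D-selfadjoint _ _) (trans (⟨⟩-congʳ _ (D-P pκ bκ)) (⟨⟩-conʳ _ _ _))) ⟩
    α * e₂ κ * x + - (α * e₂ σ * x) ≈⟨ solve 4 (λ a e f x → a :* e :* x :+ :- (a :* f :* x) := a :* ((e :+ :- f) :* x)) refl α (e₂ κ) (e₂ σ) x ⟩
    α * ((e₂ κ + - e₂ σ) * x)  ∎)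
    where
    open FR
    u = ⟨ U (P σ) , P κ ⟩
    x = ⟨ q 0 ⊗ P σ , P κ ⟩

  2≉0 : ¬ 1# + 1# ≈ 0#
  2≉0 z = 0≉ι-suc 1 (trans (+-congˡ (+-identityʳ 1#)) z)

  q₀-γ : con α ⊗ γ 1 ≐ q 0
  q₀-γ = ≐-trans (⊗-cong (con-cong (sym weight-0)) ≐-refl) (≐-trans (≐-sym (recursion 1# 0)) (≐-trans (con-1⊗ _)
    (≐-trans (Σ-suc 0 _) (≐-trans (⊕-cong (L.*-identityʳ _) (Σ-zero _)) (L.+-identityʳ _)))))

  hom-q₀P : ∀ {σ} → IsPartition σ → Homogeneous (suc (sum σ)) (q 0 ⊗ P σ)
  hom-q₀P p = hom-⊗ (hom-q 0) (hom-P p)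

  -- If σ has fewer rows than κ, restriction to n variables shows that their content difference is −n, where κ has n + 1 rows.
  fewer-rows : ∀ {n σ κ} → IsPartition σ → IsPartition κ → sum κ ≡ suc (sum σ) → sum κ ℕ.< N → length σ ℕ.≤ n → n ℕ.< length κ →
    ⟨ U (P σ) , P κ ⟩ + ι n * ⟨ q 0 ⊗ P σ , P κ ⟩ ≈ 0#
  fewer-rows {n} {σ} {κ} pσ pκ s bound l lt = trans (+-cong (U-adjoint _ _) (*-congˡ (trans (⟨⟩-perpˡ _ _ _) refl))) (trans (sym (trans (⟨⟩-comm _ _) (trans (⟨⟩-⊕ʳ (P σ) _ _) (+-congˡ (⟨⟩-conʳ _ _ _))))) (ideal-pairing in-ideal hom-y (pσ , ≡.refl) l))
    where
    y = V (P κ) ⊕ con (ι n) ⊗ perp (q 0) (P κ)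
    homκ : Homogeneous (suc (sum σ)) (P κ)
    homκ = ≡.subst (λ d → Homogeneous d (P κ)) s (hom-P pκ)
    hom-y : Homogeneous (sum σ) y
    hom-y = hom-⊕ (hom-V homκ) (hom-con _ (hom-perp {1} {sum σ} (hom-q 0) homκ))
    κ-ideal = P-ideal pκ lt
    in-ideal : Ideal n y
    in-ideal = ideal λ u l → trans (⟨⟩-congʳ y (≐-sym (G-pad n u))) (at (pad n u) (length-pad n u l) (sum (pad n u) ℕP.≟ sum σ))
      where
      at : ∀ u → length u ≡ n → Dec (sum u ≡ sum σ) → C u y ≈ 0#
      at u l (no ne) = hom-C u hom-y ne
      at u ≡.refl (yes e) = trans (trans (⟨⟩-comm _ _) (trans (⟨⟩-⊕ʳ _ _ _) (+-cong (trans (sym (U-adjoint _ _)) (⟨⟩-comm _ _)) (trans (⟨⟩-conʳ _ _ _) (*-congˡ (trans (⟨⟩-comm _ _) (sym (⟨⟩-perp _ _ _))))))))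
        (trans (sym (trans (⟨⟩-⊕ʳ (P κ) _ _) (+-congˡ (⟨⟩-conʳ _ _ _)))) (annihilated (U-G u small) (P κ) λ w lw → vanishes κ-ideal w (ℕP.≤-reflexive lw)))
        where
        small : sum u ℕ.≤ N
        small = ℕP.≤-trans (ℕP.≤-reflexive e) (ℕP.≤-trans (ℕP.n≤1+n _) (ℕP.≤-trans (ℕP.≤-reflexive (≡.sym s)) (ℕP.<⇒≤ bound)))

  -- Dually, if the first row of σ is shorter than that of κ, which has length m + 1, the content difference is αm.
  shorter-row : ∀ {m σ κ} → IsPartition σ → IsPartition κ → sum κ ≡ suc (sum σ) → sum κ ℕ.< N → top σ ℕ.≤ m → m ℕ.< top κ →
    ⟨ U (P σ) , P κ ⟩ + - (α * ι m * ⟨ q 0 ⊗ P σ , P κ ⟩) ≈ 0#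
  shorter-row {m} {σ} {κ} pσ pκ s bound l lt with ⟨ y , P κ ⟩ ≈? 0#
    where y = U (P σ) ⊕ con (- (α * ι m)) ⊗ (q 0 ⊗ P σ)
  ... | yes z = trans (sym (trans (⟨⟩-⊕ _ _ _) (+-congˡ (trans (⟨⟩-con _ _ _) (solve 2 (λ c x → :- c :* x := :- (c :* x)) refl (α * ι m) _))))) z
  ... | no nz = ⊥-elim (ℕP.<⇒≱ lt (support-pairing narrow-down (supported hom-y narrow) (pκ , s) nz))
    where
    y = U (P σ) ⊕ con (- (α * ι m)) ⊗ (q 0 ⊗ P σ)
    hom-y : Homogeneous (suc (sum σ)) y
    hom-y = hom-⊕ (hom-U (hom-P pσ)) (hom-con _ (hom-q₀P pσ))
    Narrow : List ℕ → Set
    Narrow μ = top μ ℕ.≤ m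
    narrow-down : DownClosed Narrow
    narrow-down _ _ d l = ℕP.≤-trans (dominated-top d) l
    killed : ∀ {k} z → m ℕ.< k → ⟨ P σ , γ k ⊗ z ⟩ ≈ 0#
    killed {k} z m<k = trans (⟨⟩-perp _ _ _) (trans (⟨⟩-congˡ z (row-too-long pσ (ℕP.≤-<-trans l m<k))) (⟨⟩-𝟘ˡ z))
    coefficient : ∀ k v → m ℕ.≤ k → suc k ℕ.≤ N → C (suc k ∷ v) y ≈ 0#
    coefficient k v m≤k k<N = begin
      C (suc k ∷ v) y ≈⟨ trans (⟨⟩-⊕ _ _ _) (+-cong (U-adjoint _ _) (trans (⟨⟩-con _ _ _) (*-congˡ (trans (⟨⟩-perpˡ _ _ _) refl)))) ⟩
      ⟨ P σ , V (γ (suc k) ⊗ G v) ⟩ + - (α * ι m) * ⟨ P σ , perp (q 0) (γ (suc k) ⊗ G v) ⟩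
        ≈⟨ +-cong (trans (⟨⟩-congʳ _ (vectorField-⊗ q suc (γ (suc k)) (G v))) (trans (⟨⟩-⊕ʳ _ _ _) (trans (+-cong (trans (⟨⟩-congʳ _ (≐-trans (⊗-cong (V-γ k k<N) ≐-refl) (L.*-assoc _ _ _))) (⟨⟩-conʳ _ _ _)) (killed _ (s≤s m≤k))) (+-identityʳ _))))
             (*-congˡ (trans (⟨⟩-congʳ _ (perp-q-⊗ 0 (γ (suc k)) (G v))) (trans (⟨⟩-⊕ʳ _ _ _) (trans (+-cong (⟨⟩-congʳ _ (⊗-cong (perp-γ 0 (suc k)) ≐-refl)) (killed _ (s≤s m≤k))) (+-identityʳ _))))) ⟩
      α * ι k * x + - (α * ι m) * x ≈⟨ final (ℕP.m≤n⇒m<n∨m≡n m≤k) ⟩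
      0# ∎
      where
      open FR
      x = ⟨ P σ , γ k ⊗ G v ⟩
      final : m ℕ.< k ⊎ m ≡ k → α * ι k * x + - (α * ι m) * x ≈ 0#
      final (inj₁ m<k) = trans (+-cong (trans (*-congˡ (killed (G v) m<k)) (zeroʳ _)) (trans (*-congˡ (killed (G v) m<k)) (zeroʳ _))) (+-identityʳ 0#)
      final (inj₂ ≡.refl) = solve 2 (λ c x → c :* x :+ :- c :* x := :0) refl (α * ι m) x
    narrow : ∀ {μ} → PartitionOf (suc (sum σ)) μ → ¬ C μ y ≈ 0# → Narrow μ
    narrow {[]} _ _ = z≤n
    narrow {zero ∷ μ} _ _ = z≤n
    narrow {suc k ∷ μ} (_ , e) nz with ℕP.≤-<-connex (suc k) m
    ... | inj₁ le = le
    ... | inj₂ (s≤s m≤k) = ⊥-elim (nz (coefficient k μ m≤k (ℕP.≤-trans (ℕP.m≤m+n (suc k) _) (ℕP.≤-trans (ℕP.≤-reflexive (≡.trans e (≡.sym s))) (ℕP.<⇒≤ bound)))))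

  -- As p_1 = α g_1, the coefficient of p_1^⊥ P_κ at x ∷ μ is α times that of P_κ at x ∷ 1 ∷ μ, so
  -- first rows cannot grow.
  top-bound : ∀ {κ ρ} → IsPartition κ → PartitionOf (ℕ.pred (sum κ)) ρ → 1 ℕ.≤ sum κ → top κ ℕ.< top ρ → ⟨ perp (q 0) (P κ) , P ρ ⟩ ≈ 0#
  top-bound {κ} {ρ} pκ pρ 1≤ lt with ⟨ perp (q 0) (P κ) , P ρ ⟩ ≈? 0#
  ... | yes z = z
  ... | no nz = ⊥-elim (ℕP.<⇒≱ lt (support-pairing (λ _ _ d l → ℕP.≤-trans (dominated-top d) l) (supported hom narrow) pρ nz))
    where
    hom : Homogeneous (ℕ.pred (sum κ)) (perp (q 0) (P κ))
    hom = hom-perp {1} {ℕ.pred (sum κ)} (hom-q 0) (≡.subst (λ d → Homogeneous d (P κ)) (≡.sym (ℕP.m+[n∸m]≡n 1≤)) (hom-P pκ))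
    narrow : ∀ {μ} → PartitionOf (ℕ.pred (sum κ)) μ → ¬ C μ (perp (q 0) (P κ)) ≈ 0# → top μ ℕ.≤ top κ
    narrow {[]} _ _ = z≤n
    narrow {x ∷ μ} _ nz = dominated-top (P-support pκ (x ∷ 1 ∷ μ) λ z → nz (trans (sym (⟨⟩-perp _ _ _)) (trans (⟨⟩-congʳ _
      (≐-trans (⊗-cong (≐-sym q₀-γ) ≐-refl) (solveΛ 4 (λ a o x m → a :⊗ o :⊗ (x :⊗ m) :≐ a :⊗ (x :⊗ (o :⊗ m))) ≐-refl _ _ _ _))) (trans (⟨⟩-conʳ _ _ _) (trans (*-congˡ z) (zeroʳ α))))))

  add-map-suc : ∀ {σ κ i j} n → length κ ℕ.≤ n → Add σ κ i j → Σ ℕ λ i′ → Σ ℕ λ j′ → Add (map suc (pad n σ)) (map suc (pad n κ)) i′ j′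
  add-map-suc (suc n) _ here = 0 , _ , here
  add-map-suc (suc n) _ new = 0 , _ , here
  add-map-suc (suc n) (s≤s l) (there a) = let (i , j , b) = add-map-suc n l a in suc i , j , there b

  map-pred : ∀ {m κ} → Bounded m κ → Σ (List ℕ) λ v → κ ≡ map suc v × Decreasing m v
  map-pred [] = [] , ≡.refl , []
  map-pred (cons {suc x} _ q b) = let (v , e , d) = map-pred b in x ∷ v , ≡.cong (suc x ∷_) e , ℕP.<⇒≤ q ∷ lower d b e
    where
    lower : ∀ {κ v} → Decreasing (suc x) v → Bounded (suc x) κ → κ ≡ map suc v → Decreasing x v
    lower {v = []} d b e = []
    lower {v = y ∷ v} (_ ∷ d) (cons _ (s≤s q) _) ≡.refl = q ∷ d

  columnsOf : ∀ {κ} → IsPartition κ → sum κ ℕ.< N → Σ (List ℕ) λ v → κ ≡ map suc v × ColumnData (length κ) v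
  columnsOf {κ} p bound with map-pred (partition⇒bounded p)
  ... | v , ≡.refl , d = v , ≡.refl , columnData d (≡.sym (ListP.length-map suc v)) bound

  Pieri : ℕ → Set
  Pieri b = ∀ {σ κ} → sum κ ℕ.≤ b → IsPartition σ → IsPartition κ → sum κ ≡ suc (sum σ) → sum κ ℕ.< N →
    ¬ ⟨ q 0 ⊗ P σ , P κ ⟩ ≈ 0# → Σ ℕ λ i → Σ ℕ λ j → Add σ κ i j

  -- `column-product` carries the nonvanishing over to the partitions without their first columns.
  -- Padding with zeros restores the common number of rows, so that a box in a new row becomes a box
  -- in an old one.
  pieri-columns : ∀ {b σ κ} → Pieri b → sum κ ℕ.≤ suc b → IsPartition σ → IsPartition κ → sum κ ≡ suc (sum σ) → sum κ ℕ.< N →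
    length σ ≡ length κ → 1 ℕ.≤ length κ → ¬ ⟨ q 0 ⊗ P σ , P κ ⟩ ≈ 0# → Σ ℕ λ i → Σ ℕ λ j → Add σ κ i j
  pieri-columns {b} {σ} {κ} rec s≤ pσ pκ s bound l 1≤l nz
    with columnsOf pσ (ℕP.<-trans (ℕP.≤-reflexive (≡.sym s)) bound) | columnsOf pκ bound
  ... | u , ≡.refl , cu | v , ≡.refl , cv = ≡.subst₂ (λ a b → Σ ℕ λ i → Σ ℕ λ j → Add (map suc a) (map suc b) i j) (pad-dropZeros cu′) (pad-dropZeros cv)
      (let (i , j , a) = rec smaller (U.shorter-partition) (W.shorter-partition) s⁻ bound⁻ nz⁻ in add-map-suc n (ℕP.≤-trans (length-dropZeros v) (ℕP.≤-reflexive W.columns)) a)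
    where
    n = length (map suc v)
    cu′ : ColumnData n u
    cu′ = ≡.subst (λ k → ColumnData k u) l cu
    module U = ColumnData cu′
    module W = ColumnData cv
    pad-decreasing′ : ∀ {m w} → Decreasing m w → pad (length w) (dropZeros w) ≡ w
    pad-decreasing′ [] = ≡.refl
    pad-decreasing′ {w = suc x ∷ w} (_ ∷ d) = ≡.cong (suc x ∷_) (pad-decreasing′ d)
    pad-decreasing′ {w = zero ∷ w} (_ ∷ d) with zeros d
      where
      zeros : ∀ {w} → Decreasing 0 w → w ≡ replicate (length w) 0
      zeros [] = ≡.refl
      zeros (z≤n ∷ d) = ≡.cong (0 ∷_) (zeros d)
    ... | e = ≡.trans (≡.cong (λ k → k ++ replicate (suc (length w) ∸ length k) 0) (≡.trans (≡.cong dropZeros e) (dropZeros-zeros (length w)))) (≡.cong (0 ∷_) (≡.sym e))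
    pad-dropZeros : ∀ {w} → ColumnData n w → pad n (dropZeros w) ≡ w
    pad-dropZeros {w} c = ≡.trans (≡.cong (λ k → pad k (dropZeros w)) (≡.sym (ColumnData.columns c))) (pad-decreasing′ (ColumnData.decreasing c))
    s⁻ : sum (dropZeros v) ≡ suc (sum (dropZeros u))
    s⁻ = ℕP.+-cancelʳ-≡ n _ _ (≡.trans (≡.sym W.longer-sum) (≡.trans s (≡.cong suc U.longer-sum)))
    smaller : sum (dropZeros v) ℕ.≤ b
    smaller = ℕP.≤-pred (ℕP.≤-trans (ℕP.≤-trans (ℕP.≤-reflexive (ℕP.+-comm 1 _)) (ℕP.+-monoʳ-≤ _ 1≤l)) (ℕP.≤-trans (ℕP.≤-reflexive (≡.sym W.longer-sum)) s≤))
    bound⁻ : sum (dropZeros v) ℕ.< N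
    bound⁻ = ℕP.≤-<-trans (ℕP.≤-trans (ℕP.m≤m+n _ n) (ℕP.≤-reflexive (≡.sym W.longer-sum))) bound
    nz⁻ : ¬ ⟨ q 0 ⊗ P (dropZeros u) , P (dropZeros v) ⟩ ≈ 0#
    nz⁻ z = nz (factor≈0 (norm≉0 W.shorter-partition) (trans (column-product cu′ cv (hom-q 0) (≡.sym s)) (trans (*-congˡ z) (zeroʳ _))))

  -- No constituent of p_1^⊥ P has a first row beyond m, so `row-duality` takes the common first row
  -- off σ; since adjoints commute, `row-removal` takes it off κ.
  pieri-rows : ∀ {b m σ κ} → Pieri b → m ℕ.+ sum κ ℕ.≤ suc b → IsPartition (m ∷ σ) → IsPartition (m ∷ κ) → m ℕ.+ sum κ ≡ suc (m ℕ.+ sum σ) → m ℕ.+ sum κ ℕ.< N →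
    ¬ ⟨ q 0 ⊗ P (m ∷ σ) , P (m ∷ κ) ⟩ ≈ 0# → Σ ℕ λ i → Σ ℕ λ j → Add (m ∷ σ) (m ∷ κ) i j
  pieri-rows {b} {m} {σ} {κ} rec s≤ pσ@(cons 1≤m _) pκ s bound nz = let (i , j , a) = rec smaller (partition-tail pσ) (partition-tail pκ) s⁻ (ℕP.≤-<-trans (ℕP.m≤n+m _ m) bound) nz⁻ in suc i , j , there a
    where
    f = perp (q 0) (P (m ∷ κ))
    hom-f : Homogeneous (m ℕ.+ sum σ) f
    hom-f = hom-perp {1} {m ℕ.+ sum σ} (hom-q 0) (≡.subst (λ d → Homogeneous d (P (m ∷ κ))) s (hom-P pκ))
    s⁻ : sum κ ≡ suc (sum σ)
    s⁻ = ℕP.+-cancelˡ-≡ m _ _ (≡.trans s (≡.sym (ℕP.+-suc m _)))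
    smaller : sum κ ℕ.≤ b
    smaller = ℕP.≤-pred (ℕP.≤-trans (ℕP.+-monoˡ-≤ (sum κ) 1≤m) s≤)
    narrow : ∀ {ρ} → PartitionOf (m ℕ.+ sum σ) ρ → m ℕ.< top ρ → ⟨ f , P ρ ⟩ ≈ 0#
    narrow {ρ} (pρ , e) lt = top-bound pκ (pρ , ≡.trans e (≡.cong ℕ.pred (≡.sym s))) (ℕP.≤-trans 1≤m (ℕP.m≤m+n m _)) lt
    nz⁻ : ¬ ⟨ q 0 ⊗ P σ , P κ ⟩ ≈ 0#
    nz⁻ z = nz (trans (trans (⟨⟩-perpˡ _ _ _) (⟨⟩-comm _ _)) (factor≈0 (norm≉0 (partition-tail pσ)) (trans (row-duality pσ (ℕP.<-trans (ℕP.≤-reflexive (≡.sym s)) bound) hom-f narrow)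
      (trans (*-congˡ (trans (⟨⟩-perp _ _ _) (trans (⟨⟩-congˡ _ (≐-trans (perp-comm _ _ _) (perp-cong ≐-refl (row-removal pκ bound)))) (trans (⟨⟩-comm _ _) (trans (sym (⟨⟩-perpˡ _ _ _)) z))))) (zeroʳ _)))))

  -- The two restrictions evaluate U as -n and as αm times the same nonzero matrix entry.
  -- Independence of 1 and α forces n = m = 0, so κ is a single box.
  pieri-corner : ∀ {σ κ} → IsPartition σ → IsPartition κ → sum κ ≡ suc (sum σ) → sum κ ℕ.< N → length σ ℕ.< length κ → top σ ℕ.< top κ →
    ¬ ⟨ q 0 ⊗ P σ , P κ ⟩ ≈ 0# → Σ ℕ λ i → Σ ℕ λ j → Add σ κ i j
  pieri-corner {σ} {suc m ∷ κ} pσ pκ s bound (s≤s l) (s≤s t) nz = single (independent (length κ) m 0 0 (factor≈0 nz (begin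
      x * (ι n + ι m * α) ≈⟨ solve 5 (λ x n m a u → x :* (n :+ m :* a) := (u :+ n :* x) :+ :- (u :+ :- (a :* m :* x))) refl x (ι n) (ι m) α ⟨ U (P σ) , P (suc m ∷ κ) ⟩ ⟩
      _ ≈⟨ +-cong (fewer-rows pσ pκ s bound l ℕP.≤-refl) (-‿cong (shorter-row pσ pκ s bound t ℕP.≤-refl)) ⟩
      0# + - 0# ≈⟨ -‿inverseʳ 0# ⟩
      0# ∎) ⟩≈⟨ solve 1 (λ a → :0 := :0 :+ :0 :* a) refl α))
    where
    open FR
    n = length κ
    x = ⟨ q 0 ⊗ P σ , P (suc m ∷ κ) ⟩
    infixl 1 _⟩≈⟨_
    _⟩≈⟨_ : ∀ {a b c : Carrier} → a ≈ b → b ≈ c → a ≈ c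
    _⟩≈⟨_ = trans
    single : n ≡ 0 × m ≡ 0 → Σ ℕ λ i → Σ ℕ λ j → Add σ (suc m ∷ κ) i j
    single (n≡0 , ≡.refl) = by-shape κ n≡0 s
      where
      by-shape : ∀ κ → length κ ≡ 0 → suc (sum κ) ≡ suc (sum σ) → Σ ℕ λ i → Σ ℕ λ j → Add σ (1 ∷ κ) i j
      by-shape [] _ e = 0 , 0 , ≡.subst (λ ρ → Add ρ (1 ∷ []) 0 0) (≡.sym (empty-sum (partition⇒bounded pσ) (≡.sym (ℕP.suc-injective e)))) new

  -- With equally many rows the first columns are stripped, with equal first rows these rows. If σ
  -- exceeds κ in either respect the entry is 0; if it falls short in both, only the single box is
  -- left.
  pieri-rule : ∀ b → Pieri b
  pieri-rule zero {σ} {κ} s≤ pσ pκ s bound nz = ⊥-elim (ℕP.<⇒≢ (ℕP.<-≤-trans (s≤s z≤n) (ℕP.≤-reflexive (≡.sym s))) (≡.sym (ℕP.n≤0⇒n≡0 s≤)))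
  pieri-rule (suc b) {σ} {[]} s≤ pσ pκ () bound nz
  pieri-rule (suc b) {σ} {k ∷ κ} s≤ pσ pκ s bound nz with ℕP.<-cmp (length σ) (suc (length κ))
  ... | tri≈ _ l _ = pieri-columns (pieri-rule b) s≤ pσ pκ s bound l (s≤s z≤n) nz
  ... | tri> _ _ l = ⊥-elim (nz (ideal-pairing (ideal-⊗ (q 0) (P-ideal pσ l)) (hom-q₀P pσ) (pκ , s) ℕP.≤-refl))
  ... | tri< l _ _ with ℕP.<-cmp (top σ) k
  ...   | tri< t _ _ = pieri-corner pσ pκ s bound l t nz
  ...   | tri> _ _ t = ⊥-elim (nz (trans (trans (⟨⟩-perpˡ _ _ _) (⟨⟩-comm _ _)) (top-bound pκ (pσ , ≡.cong ℕ.pred (≡.sym s)) (ℕP.≤-trans (s≤s z≤n) (ℕP.≤-reflexive (≡.sym s))) t)))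
  ...   | tri≈ _ t _ = equal-tops σ t pσ s nz
    where
    positive : ∀ {k κ} → IsPartition (k ∷ κ) → k ≢ 0
    positive (cons (s≤s _) _) ()
    equal-tops : ∀ σ → top σ ≡ k → IsPartition σ → k ℕ.+ sum κ ≡ suc (sum σ) → ¬ ⟨ q 0 ⊗ P σ , P (k ∷ κ) ⟩ ≈ 0# → Σ ℕ λ i → Σ ℕ λ j → Add σ (k ∷ κ) i j
    equal-tops [] e _ _ _ = ⊥-elim (positive pκ (≡.sym e))
    equal-tops (m ∷ σ) ≡.refl pσ s nz = pieri-rows (pieri-rule b) s≤ pσ pκ s bound nz

  opaque
    pieri : ∀ {σ κ} → IsPartition σ → IsPartition κ → sum κ ≡ suc (sum σ) → sum κ ℕ.< N → ¬ ⟨ q 0 ⊗ P σ , P κ ⟩ ≈ 0# → Σ ℕ λ i → Σ ℕ λ j → Add σ κ i j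
    pieri {κ = κ} = pieri-rule (sum κ) ℕP.≤-refl

-- Hook and content products

module HookProducts (K : CoeffField) where
  open CoeffField K
  open FieldFacts K
  open Partitions
  open Columns

  Π< : ℕ → (ℕ → Carrier) → Carrier
  Π< zero f    = 1#
  Π< (suc n) f = Π< n f * f n

  Π-cong : ∀ n {f h} → (∀ j → j ℕ.< n → f j ≈ h j) → Π< n f ≈ Π< n h
  Π-cong zero e = refl
  Π-cong (suc n) e = *-cong (Π-cong n λ j lt → e j (ℕP.<-trans lt ℕP.≤-refl)) (e n ℕP.≤-refl)

  Π-first : ∀ n f → Π< (suc n) f ≈ f 0 * Π< n (λ j → f (suc j))
  Π-first zero f = *-comm _ _
  Π-first (suc n) f = trans (*-congʳ (Π-first n f)) (*-assoc _ _ _)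

  Π-≉0 : ∀ n {f} → (∀ j → j ℕ.< n → ¬ f j ≈ 0#) → ¬ Π< n f ≈ 0#
  Π-≉0 zero e = 1≉0
  Π-≉0 (suc n) e = product≉0 (Π-≉0 n λ j lt → e j (ℕP.<-trans lt ℕP.≤-refl)) (e n ℕP.≤-refl)

  Π-≈0 : ∀ {n j} f → j ℕ.< n → f j ≈ 0# → Π< n f ≈ 0#
  Π-≈0 {suc n} {j} f (s≤s j≤n) e with ℕP.m≤n⇒m<n∨m≡n j≤n
  ... | inj₁ j<n = trans (*-congʳ (Π-≈0 f j<n e)) (zeroˡ _)
  ... | inj₂ ≡.refl = trans (*-congˡ e) (zeroʳ _)

  Π-* : ∀ n f h → Π< n (λ j → f j * h j) ≈ Π< n f * Π< n h
  Π-* zero f h = sym (*-identityˡ 1#)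
  Π-* (suc n) f h = trans (*-congʳ (Π-* n f h)) (solve 4 (λ a b c d → a :* b :* (c :* d) := a :* c :* (b :* d)) refl _ _ _ _)

  -- When a row m is put on top of σ, the leg of its box in column j, counted from 0, is the height
  -- `conjPart σ (suc j)` of that column. Hook products thus become recursive in the rows.
  lowerRow upperRow : ℕ → List ℕ → Carrier
  lowerRow m σ = Π< m (λ j → linear (suc (conjPart σ (suc j))) (m ∸ suc j))
  upperRow m σ = Π< m (λ j → linear (conjPart σ (suc j)) (suc (m ∸ suc j)))

  lowerHooks upperHooks : List ℕ → Carrier
  lowerHooks []      = 1#
  lowerHooks (m ∷ σ) = lowerRow m σ * lowerHooks σ
  upperHooks []      = 1#
  upperHooks (m ∷ σ) = upperRow m σ * upperHooks σ

  -- With r = 0 this is, up to a factor free of X, the value of P_κ at p_k = X, as `specialization`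
  -- shows; the starting row r serves the recursion.
  contentsFrom : Carrier → ℕ → List ℕ → Carrier
  contentsFrom X r []      = 1#
  contentsFrom X r (m ∷ σ) = Π< m (λ j → X + content r j) * contentsFrom X (suc r) σ

  add-contents : ∀ X r {σ κ i j} → Add σ κ i j → contentsFrom X r κ ≈ (X + content (r ℕ.+ i) j) * contentsFrom X r σ
  add-contents X r {x ∷ σ} here = trans (solve 3 (λ p f c → p :* f :* c := f :* (p :* c)) refl _ _ _) (*-congʳ (reflexive (≡.cong (λ k → X + content k x) (≡.sym (ℕP.+-identityʳ r)))))
  add-contents X r new = trans (solve 1 (λ f → :1 :* f :* :1 := f :* :1) refl (X + content r 0)) (*-congʳ (reflexive (≡.cong (λ k → X + content k 0) (≡.sym (ℕP.+-identityʳ r)))))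
  add-contents X r {x ∷ σ} {i = suc i} {j} (there a) = trans (*-congˡ (add-contents X (suc r) a)) (trans (solve 3 (λ p f c → p :* (f :* c) := f :* (p :* c)) refl _ _ _)
    (*-congʳ (reflexive (≡.cong (λ k → X + content k j) (≡.sym (ℕP.+-suc r i))))))

  contents-zeros : ∀ X r {v} → Decreasing 0 v → contentsFrom X r v ≈ 1#
  contents-zeros X r [] = refl
  contents-zeros X r (z≤n ∷ d) = trans (*-identityˡ _) (contents-zeros X (suc r) d)

  contents-dropZeros : ∀ X r {m v} → Decreasing m v → contentsFrom X r (dropZeros v) ≈ contentsFrom X r v
  contents-dropZeros X r [] = refl
  contents-dropZeros X r {v = zero ∷ v} (_ ∷ d) = trans (reflexive (≡.cong (contentsFrom X r) (dropZeros-empty d))) (sym (contents-zeros X r (z≤n ∷ d)))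
  contents-dropZeros X r {v = suc x ∷ v} (_ ∷ d) = *-congˡ (contents-dropZeros X (suc r) d)

  conj-dropZeros : ∀ v j → conjPart (dropZeros v) (suc j) ≡ conjPart v (suc j)
  conj-dropZeros [] j = ≡.refl
  conj-dropZeros (zero ∷ v) j = conj-dropZeros v j
  conj-dropZeros (suc x ∷ v) j = ≡.cong (λ c → if suc j ℕ.≤ᵇ suc x then suc c else c) (conj-dropZeros v j)

  lowerHooks-dropZeros : ∀ v → lowerHooks (dropZeros v) ≈ lowerHooks v
  lowerHooks-dropZeros [] = refl
  lowerHooks-dropZeros (zero ∷ v) = trans (lowerHooks-dropZeros v) (sym (*-identityˡ _))
  lowerHooks-dropZeros (suc x ∷ v) = *-cong (Π-cong (suc x) λ j _ → reflexive (≡.cong (λ c → linear (suc c) (suc x ∸ suc j)) (conj-dropZeros v j))) (lowerHooks-dropZeros v)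

  conj-first : ∀ v → conjPart (map suc v) 1 ≡ length v
  conj-first [] = ≡.refl
  conj-first (x ∷ v) = ≡.cong suc (conj-first v)

  conj-suc : ∀ v j → conjPart (map suc v) (suc (suc j)) ≡ conjPart v (suc j)
  conj-suc [] j = ≡.refl
  conj-suc (x ∷ v) j = ≡.cong (λ c → if j ℕ.<ᵇ x then suc c else c) (conj-suc v j)

  firstColumn : List ℕ → Carrier
  firstColumn []      = 1#
  firstColumn (m ∷ v) = linear (suc (length v)) m * firstColumn v

  lowerHooks-suc : ∀ v → lowerHooks (map suc v) ≈ firstColumn v * lowerHooks v
  lowerHooks-suc [] = sym (*-identityˡ 1#)
  lowerHooks-suc (m ∷ v) = trans (*-cong (trans (Π-first m _) (*-cong (reflexive (≡.cong (λ c → linear (suc c) m) (conj-first v)))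
      (Π-cong m λ j _ → reflexive (≡.cong (λ c → linear (suc c) (m ∸ suc j)) (conj-suc v j))))) (lowerHooks-suc v))
    (solve 4 (λ a b c d → a :* b :* (c :* d) := a :* c :* (b :* d)) refl _ _ _ _)

  -- The last boxes of the rows of κ have the same contents as the lower hooks of the first column.
  contents-suc : ∀ n r v → r ℕ.+ length v ≡ n → contentsFrom (ι n) r (map suc v) ≈ firstColumn v * contentsFrom (ι n) r v
  contents-suc n r [] _ = sym (*-identityˡ 1#)
  contents-suc n r (m ∷ v) e = trans (*-cong (*-congˡ last) (contents-suc n (suc r) v (≡.trans (≡.sym (ℕP.+-suc r _)) e)))
    (solve 4 (λ a b c d → a :* b :* (c :* d) := b :* c :* (a :* d)) refl _ _ _ _)
    where
    last : ι n + content r m ≈ linear (suc (length v)) m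
    last = trans (+-congʳ (trans (reflexive (≡.cong ι (≡.sym e))) (ι-+ r (suc (length v))))) (solve 4 (λ r l m a → (r :+ l) :+ (a :* m :+ :- r) := l :+ m :* a) refl (ι r) _ (ι m) α)

  h₁-product h₂-product : ℕ → List ℕ → Carrier
  h₁-product r []      = 1#
  h₁-product r (m ∷ σ) = Π< m (λ j → linear (conjPart σ (suc j)) (r ∸ j)) * h₁-product r σ
  h₂-product s []      = 1#
  h₂-product s (m ∷ σ) = Π< m (λ j → linear s j) * h₂-product (s ∸ 1) σ

  -- The first column contributes the same factors to `h₁-product` of a partition with n rows and to
  -- the upper hooks of the rectangle with n rows. This agreement lets the final formula pass
  -- through the addition of a column.
  columnFactor : ℕ → ℕ → Carrier
  columnFactor r zero    = 1#
  columnFactor r (suc n) = linear n (suc r) * columnFactor r n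

  h₁-dropZeros : ∀ r v → h₁-product r (dropZeros v) ≈ h₁-product r v
  h₁-dropZeros r [] = refl
  h₁-dropZeros r (zero ∷ v) = trans (h₁-dropZeros r v) (sym (*-identityˡ _))
  h₁-dropZeros r (suc x ∷ v) = *-cong (Π-cong (suc x) λ j _ → reflexive (≡.cong (λ c → linear c (r ∸ j)) (conj-dropZeros v j))) (h₁-dropZeros r v)

  upperHooks-dropZeros : ∀ v → upperHooks (dropZeros v) ≈ upperHooks v
  upperHooks-dropZeros [] = refl
  upperHooks-dropZeros (zero ∷ v) = trans (upperHooks-dropZeros v) (sym (*-identityˡ _))
  upperHooks-dropZeros (suc x ∷ v) = *-cong (Π-cong (suc x) λ j _ → reflexive (≡.cong (λ c → linear c (suc (suc x ∸ suc j))) (conj-dropZeros v j))) (upperHooks-dropZeros v)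

  h₁-suc : ∀ r v → h₁-product (suc r) (map suc v) ≈ columnFactor r (length v) * h₁-product r v
  h₁-suc r [] = sym (*-identityˡ 1#)
  h₁-suc r (m ∷ v) = trans (*-cong (trans (Π-first m _) (*-cong (reflexive (≡.cong (λ c → linear c (suc r)) (conj-first v)))
      (Π-cong m λ j _ → reflexive (≡.cong (λ c → linear c (r ∸ j)) (conj-suc v j))))) (h₁-suc r v))
    (solve 4 (λ a b c d → a :* b :* (c :* d) := a :* c :* (b :* d)) refl _ _ _ _)

  upperHooks-suc-replicate : ∀ r n → upperHooks (map suc (replicate n r)) ≈ columnFactor r n * upperHooks (replicate n r)
  upperHooks-suc-replicate r zero = sym (*-identityˡ 1#)
  upperHooks-suc-replicate r (suc n) = trans (*-cong (trans (Π-first r _) (*-cong (reflexive (≡.cong (λ c → linear c (suc r)) (≡.trans (conj-first (replicate n r)) (ListP.length-replicate n))))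
      (Π-cong r λ j _ → reflexive (≡.cong (λ c → linear c (suc (r ∸ suc j))) (conj-suc (replicate n r) j))))) (upperHooks-suc-replicate r n))
    (solve 4 (λ a b c d → a :* b :* (c :* d) := a :* c :* (b :* d)) refl _ _ _ _)

  Π-reverse : ∀ n f → Π< n (λ j → f (n ∸ suc j)) ≈ Π< n f
  Π-reverse zero f = refl
  Π-reverse (suc n) f = trans (Π-first n _) (trans (*-congˡ (Π-reverse n f)) (*-comm _ _))

  linear≉0 : ∀ a b → ¬ (a ≡ 0 × b ≡ 0) → ¬ linear a b ≈ 0#
  linear≉0 a b n z = n (independent a b 0 0 (trans z (sym (trans (+-identityˡ _) (zeroˡ α)))))

  h₁≉0 : ∀ {m r σ} → Bounded m σ → m ℕ.≤ r → ¬ h₁-product r σ ≈ 0#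
  h₁≉0 [] _ = 1≉0
  h₁≉0 {r = r} (cons {x} {v} _ x≤m b) m≤r = product≉0 (Π-≉0 x λ j lt → linear≉0 (conjPart v (suc j)) (r ∸ j) λ { (_ , e) → ℕP.<⇒≱ (ℕP.<-≤-trans lt (ℕP.≤-trans x≤m m≤r)) (ℕP.m∸n≡0⇒m≤n e) }) (h₁≉0 b (ℕP.≤-trans x≤m m≤r))

  h₂≉0 : ∀ {s} σ → length σ ℕ.≤ s → ¬ h₂-product s σ ≈ 0#
  h₂≉0 [] _ = 1≉0
  h₂≉0 {suc s} (x ∷ σ) (s≤s l) = product≉0 (Π-≉0 x λ j _ → linear≉0 (suc s) j λ { (() , _) }) (h₂≉0 σ l)

  conj-beyond : ∀ {x σ} → Decreasing x σ → ∀ j → x ℕ.≤ j → conjPart σ (suc j) ≡ 0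
  conj-beyond [] j _ = ≡.refl
  conj-beyond {σ = y ∷ σ} (y≤x ∷ d) j x≤j with j ℕ.<ᵇ y in eq
  ... | false = conj-beyond d j (ℕP.≤-trans y≤x x≤j)
  ... | true  = ⊥-elim (ℕP.<⇒≱ (ℕP.<ᵇ⇒< j y (≡.subst T (≡.sym eq) tt)) (ℕP.≤-trans y≤x x≤j))

  module Columnwise (m : ℕ) where
    F : ℕ → ℕ → Carrier
    F r j = ι r + α * (ι m + - ι j)

    X : Carrier
    X = - (α * ι m)

    row-sign : ℕ → Carrier
    row-sign x = Π< x (λ _ → - 1#)

    row-contents : ∀ r x → Π< x (λ j → X + content r j) ≈ row-sign x * Π< x (F r)
    row-contents r x = trans (Π-cong x λ j _ → solve 4 (λ a m j r → :- (a :* m) :+ (a :* j :+ :- r) := :- :1 :* (r :+ a :* (m :+ :- j))) refl α (ι m) (ι j) (ι r)) (Π-* x _ _)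

    -- In a column j of height c the factors are -F i j for c consecutive i, so shifting the rows by
    -- one trades F r j for F (r+c) j, which is F r j + c.
    telescope : ∀ r {y σ} → Decreasing y σ → contentsFrom X (suc r) σ * Π< y (F r) ≈ contentsFrom X r σ * Π< y (λ j → F r j + ι (conjPart σ (suc j)))
    telescope r {y} [] = *-congˡ (Π-cong y λ j _ → sym (+-identityʳ _))
    telescope r {y} {x ∷ τ} (x≤y ∷ d) = extend y x≤y
      where
      open FR
      σ = x ∷ τ
      conj-row : ∀ j → j ℕ.< x → conjPart σ (suc j) ≡ suc (conjPart τ (suc j))
      conj-row j lt with j ℕ.<ᵇ x | ℕP.<⇒<ᵇ lt
      ... | true | _ = ≡.refl
      base : contentsFrom X (suc r) σ * Π< x (F r) ≈ contentsFrom X r σ * Π< x (λ j → F r j + ι (conjPart σ (suc j)))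
      base = begin
        Π< x (λ j → X + content (suc r) j) * a * Π< x (F r) ≈⟨ *-congʳ (*-congʳ (row-contents (suc r) x)) ⟩
        s * Π< x (F (suc r)) * a * Π< x (F r) ≈⟨ solve 4 (λ s f a g → s :* f :* a :* g := s :* g :* (a :* f)) refl s _ a _ ⟩
        s * Π< x (F r) * (a * Π< x (F (suc r))) ≈⟨ *-cong (sym (row-contents r x)) (telescope (suc r) d) ⟩
        Π< x (λ j → X + content r j) * (b * Π< x (λ j → F (suc r) j + ι (conjPart τ (suc j)))) ≈⟨ sym (*-assoc _ _ _) ⟩
        Π< x (λ j → X + content r j) * b * Π< x (λ j → F (suc r) j + ι (conjPart τ (suc j)))
          ≈⟨ *-congˡ (Π-cong x λ j lt → trans (solve 3 (λ r f c → (:1 :+ r) :+ f :+ c := r :+ f :+ (:1 :+ c)) refl (ι r) (α * (ι m + - ι j)) _) (+-congˡ (reflexive (≡.cong ι (≡.sym (conj-row j lt)))))) ⟩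
        Π< x (λ j → X + content r j) * b * Π< x (λ j → F r j + ι (conjPart σ (suc j))) ∎
        where
        s = row-sign x
        a = contentsFrom X (suc (suc r)) τ
        b = contentsFrom X (suc r) τ
      extend : ∀ z → x ℕ.≤ z → contentsFrom X (suc r) σ * Π< z (F r) ≈ contentsFrom X r σ * Π< z (λ j → F r j + ι (conjPart σ (suc j)))
      extend z x≤z with ℕP.m≤n⇒m<n∨m≡n x≤z
      ... | inj₂ ≡.refl = base
      extend (suc z) _ | inj₁ (s≤s x≤z) = trans (sym (*-assoc _ _ _)) (trans (*-cong (extend z x≤z) (sym (trans (+-congˡ (reflexive (≡.cong ι (conj-beyond (ℕP.≤-refl ∷ d) z x≤z)))) (+-identityʳ _)))) (*-assoc _ _ _))

-- Evaluation at p_k = X and the norms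

module NormFormula (K : CoeffField) (A : SymmetricAlgebra K) (J : JackBasis K A) (N : ℕ) where
  open CoeffField K
  open FieldFacts K
  open SymmetricFunctions K using (weight)
  open SymmetricAlgebra A
  open AlgebraFacts K A
  open Generating K A
  open Operators K A N
  open Coefficients K A
  open Triangularity K A N
  open Partitions
  open Columns
  open JackBasis J
  open Expansion K A J
  open Spectrum K A J N
  open ColumnRemoval K A J N
  open PieriRule K A J N
  open HookProducts K

  q₀^ : ℕ → Λ
  q₀^ zero    = 𝟙
  q₀^ (suc d) = q 0 ⊗ q₀^ d

  -- This is α^d d!, the norm of p_1^d, which also clears the denominators of the series in degree
  -- d.
  scale : ℕ → Carrier
  scale zero    = 1#
  scale (suc d) = weight d * scale d

  scale≉0 : ∀ d → ¬ scale d ≈ 0#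
  scale≉0 zero = 1≉0
  scale≉0 (suc d) = product≉0 (weight≉0 d) (scale≉0 d)

  power-coefficient : List ℕ → Carrier
  power-coefficient κ = ⟨ P κ , q₀^ (sum κ) ⟩

  half-difference : List ℕ → List ℕ → Carrier
  half-difference κ σ = (e₂ κ + - e₂ σ) * (1# + 1#) ⁻¹

  U-half : ∀ {σ κ} → IsPartition σ → IsPartition κ → sum σ ℕ.< N → sum κ ℕ.< N → ⟨ U (P σ) , P κ ⟩ ≈ half-difference κ σ * ⟨ q 0 ⊗ P σ , P κ ⟩
  U-half pσ pκ bσ bκ = *-cancelˡ (1# + 1#) 2≉0 (trans (U-value pσ pκ bσ bκ) (trans (*-congʳ (sym (*-identityʳ _))) (trans (*-congʳ (*-congˡ (sym (inverse _ 2≉0))))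
    (solve 4 (λ e i t x → e :* (t :* i) :* x := t :* (e :* i :* x)) refl _ _ _ _))))

  half-content : ∀ {σ κ i j} → Add σ κ i j → half-difference κ σ ≈ content i j
  half-content {i = i} {j} a = trans (*-congʳ (add-e₂ a)) (trans (solve 4 (λ a i j h → ((a :+ a) :* j :+ :- (i :+ i)) :* h := (:1 :+ :1) :* h :* (a :* j :+ :- i)) refl α (ι i) (ι j) _)
    (trans (*-congʳ (inverse _ 2≉0)) (*-identityˡ _)))

  -- Pairing with the series evaluates at p_k = X. By `U-g` it can be computed, up to a weight, from
  -- (V + X p_1^⊥) P_κ, and on each constituent σ of p_1^⊥ P_κ this operator brings in X plus the
  -- content of the removed box. Pairing with powers of p_1 obeys the same recursion without that
  -- factor.
  specialization : ∀ X d {κ} → PartitionOf d κ → d ℕ.< N → scale d * ⟨ P κ , g X d 0 ⟩ ≈ ⟨ P κ , q₀^ d ⟩ * contentsFrom X 0 κ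
  specialization X zero {κ} (p , s) _ with empty-sum (partition⇒bounded p) s
  ... | ≡.refl = *-comm _ _
  specialization X (suc d) {κ} (p , s) bound = begin
    weight d * scale d * ⟨ P κ , g X (suc d) 0 ⟩ ≈⟨ solve 3 (λ w k p → w :* k :* p := k :* (w :* p)) refl _ _ _ ⟩
    scale d * (weight d * ⟨ P κ , g X (suc d) 0 ⟩) ≈⟨ *-congˡ (trans (sym (⟨⟩-conʳ _ _ _)) (trans (⟨⟩-congʳ _ (≐-sym (U-g X d (ℕP.≤-trans (ℕP.n≤1+n d) (ℕP.<⇒≤ bound)))))
        (trans (⟨⟩-⊕ʳ _ _ _) (trans (+-cong (trans (⟨⟩-comm _ _) (trans (U-adjoint _ _) (⟨⟩-comm _ _))) (trans (⟨⟩-conʳ _ _ _) (trans (*-congˡ (⟨⟩-perp _ _ _)) (sym (⟨⟩-con _ _ _))))) (sym (⟨⟩-⊕ _ _ _)))))) ⟩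
    scale d * ⟨ y₁ , g X d 0 ⟩ ≈⟨ *-congˡ (⟨⟩-congˡ _ y₁-terms) ⟩
    scale d * ⟨ combination (rescale t) , g X d 0 ⟩ ≈⟨ compare t all ⟩
    ⟨ combination t , q₀^ d ⟩ * contentsFrom X 0 κ ≈⟨ *-congʳ (trans (⟨⟩-congˡ _ (≐-sym y₂-terms)) (sym (⟨⟩-perp _ _ _))) ⟩
    ⟨ P κ , q₀^ (suc d) ⟩ * contentsFrom X 0 κ ∎
    where
    open FR
    homκ : Homogeneous (suc d) (P κ)
    homκ = ≡.subst (λ n → Homogeneous n (P κ)) s (hom-P p)
    y₂ = perp (q 0) (P κ)
    y₁ = V (P κ) ⊕ con X ⊗ y₂
    hom₂ : Homogeneous d y₂
    hom₂ = hom-perp {1} {d} (hom-q 0) homκ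
    hom₁ : Homogeneous d y₁
    hom₁ = hom-⊕ (hom-V homκ) (hom-con X hom₂)
    bound⁻ = ℕP.<-trans (ℕP.n<1+n d) bound
    boundκ : sum κ ℕ.< N
    boundκ = ≡.subst (ℕ._< N) (≡.sym s) bound
    pair : ∀ {ρ} → PartitionOf d ρ → ⟨ y₁ , P ρ ⟩ ≈ (X + half-difference κ ρ) * ⟨ y₂ , P ρ ⟩
    pair {ρ} (pρ , sρ) = trans (⟨⟩-⊕ _ _ _) (trans (+-cong (trans (⟨⟩-comm _ _) (trans (sym (U-adjoint _ _)) (trans (U-half pρ p (≡.subst (ℕ._< N) (≡.sym sρ) bound⁻) boundκ)
      (*-congˡ (trans (⟨⟩-perpˡ _ _ _) (⟨⟩-comm _ _)))))) (⟨⟩-con _ _ _)) (solve 3 (λ c x y → c :* y :+ x :* y := (x :+ c) :* y) refl _ X _))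
    decomposition = decompose hom₂
    t = proj₁ decomposition
    all = proj₁ (proj₂ decomposition)
    y₂-terms = proj₂ (proj₂ decomposition)
    rescale : Terms → Terms
    rescale = map (λ u → (X + half-difference κ (proj₂ u)) * proj₁ u , proj₂ u)
    rescaled-all : ∀ t → All (λ u → PartitionOf d (proj₂ u) × Visible y₂ (proj₂ u)) t → All (λ u → PartitionOf d (proj₂ u) × Visible y₂ (proj₂ u)) (rescale t)
    rescaled-all [] [] = []
    rescaled-all (_ ∷ t) (a ∷ all) = a ∷ rescaled-all t all
    rescaled-pair : ∀ t → All (λ u → PartitionOf d (proj₂ u) × Visible y₂ (proj₂ u)) t → ∀ {ρ} → PartitionOf d ρ →
      ⟨ combination (rescale t) , P ρ ⟩ ≈ (X + half-difference κ ρ) * ⟨ combination t , P ρ ⟩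
    rescaled-pair [] _ _ = trans (⟨⟩-𝟘ˡ _) (sym (trans (*-congˡ (⟨⟩-𝟘ˡ _)) (zeroʳ _)))
    rescaled-pair ((c , σ) ∷ t) ((pσ , _) ∷ all) {ρ} pρ = trans (⟨⟩-⊕ _ _ _) (trans (+-cong (trans (⟨⟩-con _ _ _) (same (σ ≟ᴸ ρ))) (rescaled-pair t all pρ))
      (trans (sym (distribˡ _ _ _)) (*-congˡ (sym (trans (⟨⟩-⊕ _ _ _) (+-congʳ (⟨⟩-con _ _ _)))))))
      where
      same : Dec (σ ≡ ρ) → (X + half-difference κ σ) * c * ⟨ P σ , P ρ ⟩ ≈ (X + half-difference κ ρ) * (c * ⟨ P σ , P ρ ⟩)
      same (yes ≡.refl) = *-assoc _ _ _
      same (no ne) = trans (*-congˡ (orthogonal (proj₁ pσ) (proj₁ pρ) ne)) (trans (zeroʳ _) (sym (trans (*-congˡ (trans (*-congˡ (orthogonal (proj₁ pσ) (proj₁ pρ) ne)) (zeroʳ _))) (zeroʳ _))))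
    y₁-terms : y₁ ≐ combination (rescale t)
    y₁-terms = P-ext hom₁ (hom-combination (rescale t) (rescaled-all t all)) λ pρ → trans (pair pρ) (trans (*-congˡ (⟨⟩-congˡ _ y₂-terms)) (sym (rescaled-pair t all pρ)))
    compare : ∀ t → All (λ u → PartitionOf d (proj₂ u) × Visible y₂ (proj₂ u)) t →
      scale d * ⟨ combination (rescale t) , g X d 0 ⟩ ≈ ⟨ combination t , q₀^ d ⟩ * contentsFrom X 0 κ
    compare [] _ = trans (*-congˡ (⟨⟩-𝟘ˡ _)) (trans (zeroʳ _) (sym (trans (*-congʳ (⟨⟩-𝟘ˡ _)) (zeroˡ _))))
    compare ((c , σ) ∷ t) (((pσ , sσ) , visible nz) ∷ all) = trans (*-congˡ (trans (⟨⟩-⊕ _ _ _) (+-congʳ (⟨⟩-con _ _ _)))) (trans (distribˡ _ _ _) (trans (+-cong first (compare t all))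
      (trans (sym (distribʳ _ _ _)) (*-congʳ (sym (trans (⟨⟩-⊕ _ _ _) (+-congʳ (⟨⟩-con _ _ _))))))))
      where
      added = pieri pσ p (≡.trans s (≡.cong suc (≡.sym sσ))) boundκ (λ z → nz (trans (⟨⟩-comm _ _) (trans (sym (⟨⟩-perpˡ _ _ _)) z)))
      row = proj₁ added
      column = proj₁ (proj₂ added)
      first : scale d * ((X + half-difference κ σ) * c * ⟨ P σ , g X d 0 ⟩) ≈ c * ⟨ P σ , q₀^ d ⟩ * contentsFrom X 0 κ
      first = begin
        scale d * ((X + half-difference κ σ) * c * ⟨ P σ , g X d 0 ⟩) ≈⟨ solve 4 (λ k h c p → k :* (h :* c :* p) := h :* c :* (k :* p)) refl _ _ c _ ⟩
        (X + half-difference κ σ) * c * (scale d * ⟨ P σ , g X d 0 ⟩) ≈⟨ *-cong (*-congʳ (+-congˡ (half-content (proj₂ (proj₂ added))))) (specialization X d (pσ , sσ) bound⁻) ⟩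
        (X + content row column) * c * (⟨ P σ , q₀^ d ⟩ * contentsFrom X 0 σ) ≈⟨ solve 4 (λ x c a k → x :* c :* (a :* k) := c :* a :* (x :* k)) refl _ c _ _ ⟩
        c * ⟨ P σ , q₀^ d ⟩ * ((X + content row column) * contentsFrom X 0 σ) ≈⟨ *-congˡ (sym (add-contents X 0 (proj₂ (proj₂ added)))) ⟩
        c * ⟨ P σ , q₀^ d ⟩ * contentsFrom X 0 κ ∎

  -- The series is an eigenvector of every x^⊥, the eigenvalue being the value of x at p_k = X. Both
  -- sides agree under all p_k^⊥ by induction on b and have equal constant terms, so `taylor`
  -- concludes; `n` is fuel.
  perp-g : ∀ X {a x} → Homogeneous a x → ∀ n b → b ℕ.< n → perp x (g X (a ℕ.+ b) 0) ≐ con ⟨ x , g X a 0 ⟩ ⊗ g X b 0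
  perp-g X {a} {x} hx (suc n) b (s≤s b≤n) = ⊖-≐ (taylor y killed constant)
    where
    c = ⟨ x , g X a 0 ⟩
    y = perp x (g X (a ℕ.+ b) 0) ⊖ con c ⊗ g X b 0
    perp-both : ∀ k → perp x (g X (a ℕ.+ b) (suc k)) ≐ con c ⊗ g X b (suc k)
    perp-both k with ℕP.≤-<-connex (suc k) b
    ... | inj₁ k<b = ≐-trans (perp-cong ≐-refl (≡⇒≐ (≡.trans (g-inside X (ℕP.≤-trans k<b (ℕP.m≤n+m b a))) (≡.cong (λ n → g X n 0) (ℕP.+-∸-assoc a k<b)))))
      (≐-trans (perp-g X hx n (b ∸ suc k) (ℕP.<-≤-trans (ℕP.∸-monoʳ-< {o = 0} (s≤s z≤n) k<b) b≤n)) (⊗-cong ≐-refl (≡⇒≐ (≡.sym (g-inside X k<b)))))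
    ... | inj₂ b≤k = ≐-trans (vanish (ℕP.≤-<-connex (suc k) (a ℕ.+ b))) (≐-sym (≐-trans (⊗-cong ≐-refl (≡⇒≐ (g-outside X b≤k))) (L.zeroʳ _)))
      where
      vanish : suc k ℕ.≤ a ℕ.+ b ⊎ a ℕ.+ b ℕ.< suc k → perp x (g X (a ℕ.+ b) (suc k)) ≐ 𝟘
      vanish (inj₁ le) = ≐-trans (perp-cong ≐-refl (≡⇒≐ (g-inside X le))) (hom-perp-0 hx (hom-g X _) (ℕP.+-cancelʳ-< (suc k) _ _ (ℕP.≤-<-trans (ℕP.≤-reflexive (ℕP.m∸n+n≡m le)) (ℕP.+-monoʳ-< a b≤k))))
      vanish (inj₂ gt) = ≐-trans (perp-cong ≐-refl (≡⇒≐ (g-outside X gt))) (perp-𝟘 x)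
    perp-q-g′ : ∀ k m → perp (q k) (g X m 0) ≐ con X ⊗ g X m (suc k)
    perp-q-g′ k m = ≐-trans (perp-q-g X k m 0) (≡⇒≐ (≡.cong (λ n → con X ⊗ g X m n) (ℕP.+-identityʳ (suc k))))
    killed : ∀ k → perp (q k) y ≐ 𝟘
    killed k = ≐-trans (perp-⊕ʳ _ _ _) (≐-trans (⊕-cong
        (≐-trans (perp-comm _ _ _) (≐-trans (perp-cong ≐-refl (perp-q-g′ k (a ℕ.+ b))) (≐-trans (perp-scale _ _ _) (⊗-cong ≐-refl (perp-both k)))))
        (≐-trans (perp-scale _ _ _) (⊗-cong ≐-refl (≐-trans (perp-scale _ _ _) (⊗-cong ≐-refl (perp-q-g′ k b))))))
      (≐-trans (solveΛ 4 (λ x c g m → x :⊗ (c :⊗ g) :⊕ m :⊗ (c :⊗ (x :⊗ g)) :≐ (:𝟙 :⊕ m) :⊗ (x :⊗ (c :⊗ g))) ≐-refl (con X) (con c) (g X b (suc k)) (con (- 1#)))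
        (≐-trans (⊗-cong (≐-trans (⊕-cong (≐-sym con-1) ≐-refl) (≐-trans (≐-sym (con-⊕ _ _)) (≐-trans (con-cong (-‿inverseʳ 1#)) con-0))) ≐-refl) (L.zeroˡ _))))
    constant : ⟨ y , 𝟙 ⟩ ≈ 0#
    constant = trans (⟨⟩-⊖ _ _ 𝟙) (trans (+-cong (trans (sym (⟨⟩-perp _ x 𝟙)) (trans (⟨⟩-congʳ _ (L.*-identityʳ x)) (⟨⟩-comm _ _))) (-‿cong (⟨⟩-con _ _ _))) (at b))
      where
      at : ∀ b → ⟨ x , g X (a ℕ.+ b) 0 ⟩ + - (c * ⟨ g X b 0 , 𝟙 ⟩) ≈ 0#
      at zero = trans (+-cong (reflexive (≡.cong (λ n → ⟨ x , g X n 0 ⟩) (ℕP.+-identityʳ a))) (-‿cong (trans (*-congˡ ⟨𝟙,𝟙⟩) (*-identityʳ c)))) (-‿inverseʳ c)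
      at (suc b) = trans (+-cong (hom-orthogonal hx (hom-g X _) (λ e → ℕP.m≢1+m+n a (≡.trans e (ℕP.+-suc a b)))) (-‿cong (trans (*-congˡ (hom-orthogonal (hom-g X (suc b)) hom-𝟙 λ ())) (zeroʳ c)))) (-‿inverseʳ 0#)

  multiplicative : ∀ X {a b x y} → Homogeneous a x → ⟨ x ⊗ y , g X (a ℕ.+ b) 0 ⟩ ≈ ⟨ x , g X a 0 ⟩ * ⟨ y , g X b 0 ⟩
  multiplicative X {b = b} hx = trans (⟨⟩-perpˡ _ _ _) (trans (⟨⟩-congʳ _ (perp-g X hx (suc b) b ℕP.≤-refl)) (⟨⟩-conʳ _ _ _))

  γ-specialization : ∀ X d → d ℕ.< N → scale d * ⟨ γ d , g X d 0 ⟩ ≈ Π< d (λ j → X + content 0 j)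
  γ-specialization X zero _ = trans (*-identityˡ _) ⟨𝟙,𝟙⟩
  γ-specialization X (suc d) bound = begin
    weight d * scale d * ⟨ γ (suc d) , g X (suc d) 0 ⟩ ≈⟨ solve 3 (λ w k p → w :* k :* p := k :* (w :* p)) refl _ _ _ ⟩
    scale d * (weight d * ⟨ γ (suc d) , g X (suc d) 0 ⟩) ≈⟨ *-congˡ (trans (sym (⟨⟩-conʳ _ _ _)) (trans (⟨⟩-congʳ _ (≐-sym (U-g X d (ℕP.≤-trans (ℕP.n≤1+n d) (ℕP.<⇒≤ bound)))))
      (trans (⟨⟩-⊕ʳ _ _ _) (+-cong (trans (⟨⟩-comm _ _) (trans (U-adjoint _ _) (trans (⟨⟩-comm _ _) (trans (⟨⟩-congˡ _ (V-γ d (ℕP.<⇒≤ bound))) (⟨⟩-con _ _ _)))))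
        (trans (⟨⟩-conʳ _ _ _) (*-congˡ (trans (⟨⟩-perp _ _ _) (⟨⟩-congˡ _ (perp-γ 0 (suc d)))))))))) ⟩
    scale d * (α * ι d * ⟨ γ d , g X d 0 ⟩ + X * ⟨ γ d , g X d 0 ⟩) ≈⟨ solve 5 (λ k a d x p → k :* (a :* d :* p :+ x :* p) := k :* p :* (x :+ (a :* d :+ :- :0))) refl _ α (ι d) X _ ⟩
    scale d * ⟨ γ d , g X d 0 ⟩ * (X + content 0 d) ≈⟨ *-congʳ (γ-specialization X d (ℕP.<-trans (ℕP.n<1+n d) bound)) ⟩
    Π< d (λ j → X + content 0 j) * (X + content 0 d) ∎
    where open FR

  -- For n variables equal to 1 one has p_k = n and e_n = x_1⋯x_n = 1. Here the value comes out of
  -- the content product n(n-1)⋯1 of a single column.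
  e-specialization : ∀ n → n ℕ.< N → ⟨ e n , g (ι n) n 0 ⟩ ≈ 1#
  e-specialization n bound = *-cancelˡ (scale n) (scale≉0 n) (begin
    scale n * ⟨ e n , g (ι n) n 0 ⟩ ≈⟨ specialization (ι n) n (ones-partition n , sum-ones n) bound ⟩
    ⟨ e n , q₀^ n ⟩ * contentsFrom (ι n) 0 (ones n) ≈⟨ *-cong (trans (⟨⟩-congʳ _ (powers n)) (trans (⟨⟩-conʳ _ _ _) (trans (*-congˡ (leading (ones-partition n))) (*-identityʳ _)))) refl ⟩
    Π< n (λ _ → α) * contentsFrom (ι n) 0 (ones n) ≈⟨ factorial n 0 ≡.refl ⟩
    scale n ≈⟨ sym (*-identityʳ _) ⟩
    scale n * 1# ∎)
    where
    open FR
    powers : ∀ k → q₀^ k ≐ con (Π< k (λ _ → α)) ⊗ G (ones k)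
    powers zero = ≐-sym (con-1⊗ 𝟙)
    powers (suc k) = ≐-trans (⊗-cong (≐-sym q₀-γ) (powers k)) (≐-trans (solveΛ 4 (λ a o c x → a :⊗ o :⊗ (c :⊗ x) :≐ c :⊗ a :⊗ (o :⊗ x)) ≐-refl _ _ _ _) (⊗-cong (≐-sym (con-⊗ _ _)) ≐-refl))
    factorial : ∀ k r → r ℕ.+ k ≡ n → Π< k (λ _ → α) * contentsFrom (ι n) r (ones k) ≈ scale k
    factorial zero r _ = *-identityˡ 1#
    factorial (suc k) r eq = trans (trans (*-congˡ (*-congʳ (*-congˡ (trans (+-congʳ (trans (reflexive (≡.cong ι (≡.sym eq))) (ι-+ r (suc k)))) (solve 3 (λ r l a → (r :+ l) :+ (a :* :0 :+ :- r) := l) refl (ι r) (ι (suc k)) α)))))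
      (solve 4 (λ p a l c → p :* a :* (:1 :* l :* c) := a :* l :* (p :* c)) refl _ α (ι (suc k)) _)) (*-congˡ (factorial k (suc r) (≡.trans (≡.sym (ℕP.+-suc r k)) eq)))

  -- The first box of row n, counted from 0, has content -n and contributes the factor 0, in
  -- accordance with P_κ being zero in n variables.
  contents-long : ∀ n r κ → IsPartition κ → r ℕ.≤ n → n ℕ.< r ℕ.+ length κ → contentsFrom (ι n) r κ ≈ 0#
  contents-long n r [] _ r≤n lt = ⊥-elim (ℕP.<⇒≱ lt (ℕP.≤-trans (ℕP.≤-reflexive (ℕP.+-identityʳ r)) r≤n))
  contents-long n r (m ∷ κ) (cons 1≤m b) r≤n lt with ℕP.m≤n⇒m<n∨m≡n r≤n
  ... | inj₁ r<n = trans (*-congˡ (contents-long n (suc r) κ (bounded⇒partition b) r<n (ℕP.<-≤-trans lt (ℕP.≤-reflexive (ℕP.+-suc r _))))) (zeroʳ _)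
  ... | inj₂ ≡.refl = trans (*-congʳ (Π-≈0 _ 1≤m (solve 2 (λ r a → r :+ (a :* :0 :+ :- r) := :0) refl (ι r) α))) (zeroˡ _)

  contents-rows≉0 : ∀ n r v → r ℕ.+ length v ≡ n → ¬ contentsFrom (ι n) r v ≈ 0#
  contents-rows≉0 n r [] _ = 1≉0
  contents-rows≉0 n r (m ∷ v) e = product≉0 (Π-≉0 m λ j _ z → absurd j (trans (sym (factor j)) z)) (contents-rows≉0 n (suc r) v (≡.trans (≡.sym (ℕP.+-suc r _)) e))
    where
    factor : ∀ j → ι n + content r j ≈ linear (suc (length v)) j
    factor j = trans (+-congʳ (trans (reflexive (≡.cong ι (≡.sym e))) (ι-+ r (suc (length v))))) (solve 4 (λ r l m a → (r :+ l) :+ (a :* m :+ :- r) := l :+ m :* a) refl (ι r) (ι (suc (length v))) (ι j) α)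
    absurd : ∀ j → ¬ linear (suc (length v)) j ≈ 0#
    absurd j z with independent (suc (length v)) j 0 0 (trans z (sym (trans (+-identityˡ _) (zeroˡ α))))
    ... | () , _

  -- With n the number of rows, setting n variables to 1 turns `column-removal` into an equality of
  -- values: the error lies in the ideal and e_n becomes 1. Both values are content products, and by
  -- `contents-suc` their quotient is the product of the lower hooks in the first column.
  lower-formula : ∀ b {κ} → sum κ ℕ.≤ b → IsPartition κ → sum κ ℕ.< N → power-coefficient κ * lowerHooks κ ≈ scale (sum κ)
  lower-formula b {[]} _ p _ = trans (*-identityʳ _) (leading p)
  lower-formula zero {x ∷ κ} s≤ (cons 1≤x _) _ = ⊥-elim (ℕP.<⇒≱ 1≤x (ℕP.≤-trans (ℕP.m≤m+n x _) s≤))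
  lower-formula (suc b) {κ@(_ ∷ _)} s≤ p bound with columnsOf p bound
  ... | v , κ≡ , cd = ≡.subst (λ κ → power-coefficient κ * lowerHooks κ ≈ scale (sum κ)) (≡.sym κ≡) (*-cancelˡ c⁻ c≉0 (*-cancelˡ k⁻ (scale≉0 d⁻) (begin
      k⁻ * (c⁻ * (a⁺ * lowerHooks (map suc v))) ≈⟨ *-congˡ (*-congˡ (*-congˡ (lowerHooks-suc v))) ⟩
      k⁻ * (c⁻ * (a⁺ * (firstColumn v * lowerHooks v))) ≈⟨ solve 5 (λ k c a f l → k :* (c :* (a :* (f :* l))) := k :* l :* (a :* (f :* c))) refl k⁻ c⁻ a⁺ (firstColumn v) (lowerHooks v) ⟩
      k⁻ * lowerHooks v * (a⁺ * (firstColumn v * c⁻)) ≈⟨ *-congˡ (*-congˡ (trans (*-congˡ (contents-dropZeros (ι n) 0 decreasing)) (sym (contents-suc n 0 v columns)))) ⟩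
      k⁻ * lowerHooks v * (a⁺ * contentsFrom (ι n) 0 (map suc v)) ≈⟨ *-congˡ (sym (specialization (ι n) d (longer , ≡.refl) small)) ⟩
      k⁻ * lowerHooks v * (k * s⁺) ≈⟨ *-congˡ (*-congˡ same) ⟩
      k⁻ * lowerHooks v * (k * s⁻) ≈⟨ solve 4 (λ k⁻ l k s → k⁻ :* l :* (k :* s) := k :* l :* (k⁻ :* s)) refl k⁻ _ k s⁻ ⟩
      k * lowerHooks v * (k⁻ * s⁻) ≈⟨ *-congˡ (specialization (ι n) d⁻ (shorter-partition , ≡.refl) bound⁻) ⟩
      k * lowerHooks v * (a⁻ * c⁻) ≈⟨ trans (*-congʳ (*-congˡ (sym (lowerHooks-dropZeros v)))) (solve 4 (λ k l a c → k :* l :* (a :* c) := c :* k :* (a :* l)) refl k _ a⁻ c⁻) ⟩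
      c⁻ * k * (a⁻ * lowerHooks (dropZeros v)) ≈⟨ *-congˡ (lower-formula b smaller shorter-partition bound⁻) ⟩
      c⁻ * k * k⁻ ≈⟨ solve 3 (λ c k k⁻ → c :* k :* k⁻ := k⁻ :* (c :* k)) refl c⁻ k k⁻ ⟩
      k⁻ * (c⁻ * k) ∎)))
    where
    open FR
    open ColumnData cd
    n = length κ
    d = sum (map suc v)
    d⁻ = sum (dropZeros v)
    k = scale d
    k⁻ = scale d⁻
    a⁺ = power-coefficient (map suc v)
    a⁻ = power-coefficient (dropZeros v)
    c⁻ = contentsFrom (ι n) 0 (dropZeros v)
    s⁺ = ⟨ P (map suc v) , g (ι n) d 0 ⟩
    s⁻ = ⟨ P (dropZeros v) , g (ι n) d⁻ 0 ⟩
    c≉0 : ¬ c⁻ ≈ 0#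
    c≉0 z = contents-rows≉0 n 0 v columns (trans (sym (contents-dropZeros (ι n) 0 decreasing)) z)
    bound⁻ : d⁻ ℕ.< N
    bound⁻ = ℕP.≤-<-trans (ℕP.≤-trans (ℕP.m≤m+n _ n) (ℕP.≤-reflexive (≡.sym longer-sum))) small
    n<N : n ℕ.< N
    n<N = ℕP.≤-<-trans (ℕP.≤-trans (ℕP.m≤n+m n _) (ℕP.≤-reflexive (≡.sym longer-sum))) small
    smaller : d⁻ ℕ.≤ b
    smaller = ℕP.≤-pred (ℕP.≤-trans (ℕP.≤-trans (ℕP.≤-reflexive (ℕP.+-comm 1 d⁻)) (ℕP.+-monoʳ-≤ d⁻ (s≤s z≤n))) (ℕP.≤-trans (ℕP.≤-reflexive (≡.trans (≡.sym longer-sum) (≡.cong sum (≡.sym κ≡)))) s≤))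
    hom-product : Homogeneous d (P (dropZeros v) ⊗ e n)
    hom-product = ≡.subst (λ m → Homogeneous m (P (dropZeros v) ⊗ e n)) (≡.sym longer-sum) (hom-⊗ (hom-P shorter-partition) (hom-e n))
    hom-h : Homogeneous d (P (dropZeros v) ⊗ e n ⊖ P (map suc v))
    hom-h = hom-⊖ hom-product (hom-P longer)
    long-vanish : ∀ {ρ} → PartitionOf d ρ → ¬ ⟨ P (dropZeros v) ⊗ e n ⊖ P (map suc v) , P ρ ⟩ ≈ 0# → ⟨ g (ι n) d 0 , P ρ ⟩ ≈ 0#
    long-vanish {ρ} pρ nz with ℕP.≤-<-connex (length ρ) n
    ... | inj₁ le = ⊥-elim (nz (ideal-pairing (column-removal cd) hom-h pρ le))
    ... | inj₂ lt = trans (⟨⟩-comm _ _) (factor≈0 (scale≉0 d) (trans (specialization (ι n) d pρ small) (trans (*-congˡ (contents-long n 0 ρ (proj₁ pρ) z≤n lt)) (zeroʳ _))))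
    same : s⁺ ≈ s⁻
    same = trans (sym (difference≈0 (trans (sym (⟨⟩-⊖ _ _ _)) (disjoint hom-h long-vanish)))) (trans (reflexive (≡.cong (λ m → ⟨ P (dropZeros v) ⊗ e n , g (ι n) m 0 ⟩) longer-sum))
      (trans (multiplicative (ι n) {b = n} (hom-P shorter-partition)) (trans (*-congˡ (e-specialization n n<N)) (*-identityʳ _))))

  lowerHooks≉0 : ∀ {κ} → IsPartition κ → sum κ ℕ.< N → ¬ lowerHooks κ ≈ 0#
  lowerHooks≉0 {κ} p bound z = scale≉0 (sum κ) (trans (sym (lower-formula (sum κ) ℕP.≤-refl p bound)) (trans (*-congˡ z) (zeroʳ _)))

  -- The choice X = -αm gives the box in column m of the first row the factor 0, so the series has
  -- no constituent with a first row beyond m, as `row-duality` demands. The norms before and after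
  -- removal of the row are then compared through content products, which `telescope` turns into the
  -- upper hooks of that row.
  norm-formula : ∀ {κ} → IsPartition κ → sum κ ℕ.< N → norm κ * lowerHooks κ ≈ upperHooks κ
  norm-formula {[]} p _ = trans (*-identityʳ _) (trans (⟨⟩-congʳ _ P-empty) (leading p))
  norm-formula {m ∷ σ} p@(cons 1≤m bσ) bound = *-cancelˡ c₀ c₀≉0 (*-cancelˡ t t≉0 (*-cancelˡ (k⁺ * k) (product≉0 (scale≉0 (m ℕ.+ d)) (scale≉0 d)) (begin
      k⁺ * k * (t * (c₀ * (norm (m ∷ σ) * lowerHooks (m ∷ σ))))
        ≈⟨ solve 6 (λ k⁺ k t c n l → k⁺ :* k :* (t :* (c :* (n :* l))) := n :* t :* l :* (k⁺ :* (k :* c))) refl k⁺ k t c₀ (norm (m ∷ σ)) (lowerHooks (m ∷ σ)) ⟩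
      norm (m ∷ σ) * t * lowerHooks (m ∷ σ) * (k⁺ * (k * c₀)) ≈⟨ *-congˡ (*-congˡ (trans (*-congʳ (sym lower-σ)) (solve 3 (λ a l c → a :* l :* c := l :* (a :* c)) refl a _ c₀))) ⟩
      norm (m ∷ σ) * t * lowerHooks (m ∷ σ) * (k⁺ * (lowerHooks σ * (a * c₀))) ≈⟨ *-congˡ (*-congˡ (*-congˡ (sym (specialization X d (pσ , ≡.refl) boundσ)))) ⟩
      norm (m ∷ σ) * t * lowerHooks (m ∷ σ) * (k⁺ * (lowerHooks σ * (k * s)))
        ≈⟨ solve 7 (λ n t l⁺ k⁺ l k s → n :* t :* l⁺ :* (k⁺ :* (l :* (k :* s))) := n :* (t :* s) :* (l⁺ :* (k⁺ :* (l :* k)))) refl (norm (m ∷ σ)) t (lowerHooks (m ∷ σ)) k⁺ (lowerHooks σ) k s ⟩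
      norm (m ∷ σ) * (t * s) * (lowerHooks (m ∷ σ) * (k⁺ * (lowerHooks σ * k)))
        ≈⟨ *-congʳ (trans (*-congˡ (trans (sym (multiplicative X {b = d} (hom-γ m))) (⟨⟩-comm _ _))) (trans (sym (row-duality p bound (hom-g X (m ℕ.+ d)) narrow)) (*-congˡ (⟨⟩-comm _ _)))) ⟩
      norm σ * s⁺ * (lowerHooks (m ∷ σ) * (k⁺ * (lowerHooks σ * k)))
        ≈⟨ solve 6 (λ n s⁺ l⁺ k⁺ l k → n :* s⁺ :* (l⁺ :* (k⁺ :* (l :* k))) := n :* l :* k :* l⁺ :* (k⁺ :* s⁺)) refl (norm σ) s⁺ (lowerHooks (m ∷ σ)) k⁺ (lowerHooks σ) k ⟩
      norm σ * lowerHooks σ * k * lowerHooks (m ∷ σ) * (k⁺ * s⁺)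
        ≈⟨ *-cong (*-congʳ (*-congʳ (norm-formula pσ boundσ))) (specialization X (m ℕ.+ d) (p , ≡.refl) bound) ⟩
      upperHooks σ * k * lowerHooks (m ∷ σ) * (a⁺ * (r * c₁))
        ≈⟨ solve 6 (λ u k l a r c → u :* k :* l :* (a :* (r :* c)) := u :* k :* (a :* l) :* (r :* c)) refl (upperHooks σ) k (lowerHooks (m ∷ σ)) a⁺ r c₁ ⟩
      upperHooks σ * k * (a⁺ * lowerHooks (m ∷ σ)) * (r * c₁) ≈⟨ *-cong (*-congˡ (lower-formula (m ℕ.+ d) ℕP.≤-refl p bound)) (*-congʳ (sym (γ-specialization X m (ℕP.≤-<-trans (ℕP.m≤m+n m d) bound)))) ⟩
      upperHooks σ * k * k⁺ * (scale m * t * c₁) ≈⟨ solve 6 (λ u k k⁺ sc t c → u :* k :* k⁺ :* (sc :* t :* c) := k⁺ :* k :* (t :* (u :* (c :* sc)))) refl (upperHooks σ) k k⁺ (scale m) t c₁ ⟩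
      k⁺ * k * (t * (upperHooks σ * (c₁ * scale m))) ≈⟨ *-congˡ (*-congˡ (*-congˡ columns)) ⟩
      k⁺ * k * (t * (upperHooks σ * (c₀ * upperRow m σ))) ≈⟨ *-congˡ (*-congˡ (solve 3 (λ u c r → u :* (c :* r) := c :* (r :* u)) refl (upperHooks σ) c₀ (upperRow m σ))) ⟩
      k⁺ * k * (t * (c₀ * upperHooks (m ∷ σ))) ∎)))
    where
    open FR
    open Columnwise m
    pσ = partition-tail p
    d = sum σ
    boundσ : d ℕ.< N
    boundσ = ℕP.≤-<-trans (ℕP.m≤n+m d m) bound
    k = scale d
    k⁺ = scale (m ℕ.+ d)
    a = power-coefficient σ
    a⁺ = power-coefficient (m ∷ σ)
    s = ⟨ P σ , g X d 0 ⟩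
    s⁺ = ⟨ P (m ∷ σ) , g X (m ℕ.+ d) 0 ⟩
    t = ⟨ γ m , g X m 0 ⟩
    r = Π< m (λ j → X + content 0 j)
    c₀ = contentsFrom X 0 σ
    c₁ = contentsFrom X 1 σ
    lower-σ : a * lowerHooks σ ≈ k
    lower-σ = lower-formula d ℕP.≤-refl pσ boundσ
    narrow : ∀ {ρ} → PartitionOf (m ℕ.+ d) ρ → m ℕ.< top ρ → ⟨ g X (m ℕ.+ d) 0 , P ρ ⟩ ≈ 0#
    narrow {x ∷ ρ} pρ m<x = trans (⟨⟩-comm _ _) (factor≈0 (scale≉0 (m ℕ.+ d)) (trans (specialization X (m ℕ.+ d) pρ bound) (trans (*-congˡ
      (trans (*-congʳ (Π-≈0 _ m<x (solve 2 (λ a m → :- (a :* m) :+ (a :* m :+ :- :0) := :0) refl α (ι m)))) (zeroˡ _))) (zeroʳ _))))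
    factor≉0 : ∀ i j → j ℕ.< m → ¬ X + content i j ≈ 0#
    factor≉0 i j j<m z with independent (i) m 0 j (trans (solve 4 (λ a m j i → i :+ m :* a := (:0 :+ j :* a) :+ :- (:- (a :* m) :+ (a :* j :+ :- i))) refl α (ι m) (ι j) (ι i)) (trans (+-congˡ (-‿cong z)) (solve 1 (λ x → x :+ :- :0 := x) refl _)))
    ... | _ , ≡.refl = ⊥-elim (ℕP.<-irrefl ≡.refl j<m)
    t≉0 : ¬ t ≈ 0#
    t≉0 z = Π-≉0 m (factor≉0 0) (trans (sym (γ-specialization X m (ℕP.≤-<-trans (ℕP.m≤m+n m d) bound))) (trans (*-congˡ z) (zeroʳ _)))
    contents≉0 : ∀ i {y σ} → Bounded y σ → y ℕ.≤ m → ¬ contentsFrom X i σ ≈ 0#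
    contents≉0 i [] _ = 1≉0
    contents≉0 i (cons {x} _ x≤y b) y≤m = product≉0 (Π-≉0 x λ j lt → factor≉0 i j (ℕP.<-≤-trans lt (ℕP.≤-trans x≤y y≤m))) (contents≉0 (suc i) b (ℕP.≤-trans x≤y y≤m))
    c₀≉0 : ¬ c₀ ≈ 0#
    c₀≉0 = contents≉0 0 bσ ℕP.≤-refl
    scale-F : ∀ m → Π< m (λ j → ι 0 + α * (ι m + - ι j)) ≈ scale m
    scale-F zero = refl
    scale-F (suc m) = trans (Π-first m _) (*-cong (solve 2 (λ a m → :0 :+ a :* (m :+ :- :0) := a :* m) refl α (ι (suc m)))
      (trans (Π-cong m λ j _ → solve 3 (λ a m j → :0 :+ a :* ((:1 :+ m) :+ :- (:1 :+ j)) := :0 :+ a :* (m :+ :- j)) refl α (ι m) (ι j)) (scale-F m)))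
    columns : c₁ * scale m ≈ c₀ * upperRow m σ
    columns = trans (*-congˡ (sym (scale-F m))) (trans (telescope 0 (bounded⇒decreasing bσ)) (*-congˡ (Π-cong m λ j j<m →
      trans (solve 4 (λ a m j c → :0 :+ a :* (m :+ :- j) :+ c := c :+ (m :+ :- j) :* a) refl α (ι m) (ι j) (ι (conjPart σ (suc j)))) (+-congˡ (*-congʳ (armLength j j<m))))))
      where
      armLength : ∀ j → j ℕ.< m → ι m + - ι j ≈ ι (suc (m ∸ suc j))
      armLength j j<m = trans (+-congʳ (trans (reflexive (≡.cong ι (≡.sym (≡.trans (ℕP.+-suc j (m ∸ suc j)) (ℕP.m+[n∸m]≡n j<m))))) (ι-+ j (suc (m ∸ suc j))))) (solve 2 (λ j x → (j :+ x) :+ :- j := x) refl (ι j) _)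

-- Complements in a rectangle

module Complements where
  open Partitions
  open Columns

  flip : ℕ → List ℕ → List ℕ
  flip r w = reverse (map (r ∸_) w)

  -- The relation is stated through one list of exactly s rows, zeros included. This makes it
  -- symmetric and compatible with the addition of a row or of a column.
  record Complementary (r s : ℕ) (μ ν : List ℕ) : Set where
    constructor complementary
    field
      {rows} : List ℕ
      rows-length : length rows ≡ s
      rows-decreasing : Decreasing r rows
      right : ν ≡ dropZeros rows
      left  : μ ≡ dropZeros (flip r rows)

  length-flip : ∀ r w → length (flip r w) ≡ length w
  length-flip r w = ≡.trans (ListP.length-reverse (map (r ∸_) w)) (ListP.length-map (r ∸_) w)

  decreasing-∷ʳ : ∀ {m x v} → Decreasing m v → All (x ℕ.≤_) v → x ℕ.≤ m → Decreasing m (v ∷ʳ x)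
  decreasing-∷ʳ [] [] x≤m = x≤m ∷ []
  decreasing-∷ʳ (y≤m ∷ d) (x≤y ∷ a) _ = y≤m ∷ decreasing-∷ʳ d a x≤y

  flip-∷ : ∀ r x w → flip r (x ∷ w) ≡ flip r w ∷ʳ (r ∸ x)
  flip-∷ r x w = ListP.unfold-reverse (r ∸ x) (map (r ∸_) w)

  flip-bounds : ∀ {r x w} → Decreasing x w → x ℕ.≤ r → All (r ∸ x ℕ.≤_) (flip r w) × Decreasing r (flip r w)
  flip-bounds [] _ = [] , []
  flip-bounds {r} {x} {y ∷ w} (y≤x ∷ d) x≤r with flip-bounds d (ℕP.≤-trans y≤x x≤r)
  ... | a , dec = ≡.subst (λ u → All (r ∸ x ℕ.≤_) u × Decreasing r u) (≡.sym (flip-∷ r y w))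
    (all-∷ʳ (All.map (ℕP.≤-trans (ℕP.∸-monoʳ-≤ r y≤x)) a) (ℕP.∸-monoʳ-≤ r y≤x) , decreasing-∷ʳ dec a (ℕP.m∸n≤m r y))
    where
    all-∷ʳ : ∀ {Q : ℕ → Set} {v x} → All Q v → Q x → All Q (v ∷ʳ x)
    all-∷ʳ [] q = q ∷ []
    all-∷ʳ (p ∷ a) q = p ∷ all-∷ʳ a q

  flip-flip : ∀ {r x w} → Decreasing x w → x ℕ.≤ r → flip r (flip r w) ≡ w
  flip-flip {r} {x} {w} d x≤r = ≡.trans (≡.cong reverse (ListP.reverse-map (r ∸_) (map (r ∸_) w))) (≡.trans (ListP.reverse-involutive _)
    (≡.trans (≡.sym (ListP.map-∘ w)) (involutive d x≤r)))
    where
    involutive : ∀ {x w} → Decreasing x w → x ℕ.≤ r → map (λ y → r ∸ (r ∸ y)) w ≡ w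
    involutive [] _ = ≡.refl
    involutive (y≤x ∷ d) x≤r = ≡.cong₂ _∷_ (ℕP.m∸[m∸n]≡n (ℕP.≤-trans y≤x x≤r)) (involutive d (ℕP.≤-trans y≤x x≤r))

  complementary-sym : ∀ {r s μ ν} → Complementary r s μ ν → Complementary r s ν μ
  complementary-sym {r} (complementary {w} l d e e′) = complementary (≡.trans (length-flip r w) l) (proj₂ (flip-bounds d ℕP.≤-refl)) e′
    (≡.trans e (≡.cong dropZeros (≡.sym (flip-flip d ℕP.≤-refl))))

  dropZeros-∷ʳ0 : ∀ v → dropZeros (v ∷ʳ 0) ≡ dropZeros v
  dropZeros-∷ʳ0 [] = ≡.refl
  dropZeros-∷ʳ0 (zero ∷ v) = dropZeros-∷ʳ0 v
  dropZeros-∷ʳ0 (suc x ∷ v) = ≡.cong (suc x ∷_) (dropZeros-∷ʳ0 v)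

  flip-full : ∀ r w → dropZeros (flip r (r ∷ w)) ≡ dropZeros (flip r w)
  flip-full r w = ≡.trans (≡.cong dropZeros (≡.trans (flip-∷ r r w) (≡.cong (flip r w ∷ʳ_) (ℕP.n∸n≡0 r)))) (dropZeros-∷ʳ0 (flip r w))

  flip-suc : ∀ {r w} → Decreasing r w → flip (suc r) w ≡ map suc (flip r w)
  flip-suc {r} {w} d = ≡.trans (≡.cong reverse (≡.trans (step d ℕP.≤-refl) (ListP.map-∘ w))) (≡.sym (ListP.reverse-map suc (map (r ∸_) w)))
    where
    step : ∀ {x w} → Decreasing x w → x ℕ.≤ r → map (suc r ∸_) w ≡ map (λ y → suc (r ∸ y)) w
    step [] _ = ≡.refl
    step (y≤x ∷ d) x≤r = ≡.cong₂ _∷_ (ℕP.+-∸-assoc 1 (ℕP.≤-trans y≤x x≤r)) (step d (ℕP.≤-trans y≤x x≤r))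

  flip-map-suc : ∀ r w → flip (suc r) (map suc w) ≡ flip r w
  flip-map-suc r w = ≡.cong reverse (≡.sym (ListP.map-∘ w))

  decreasing-map-suc : ∀ {m v} → Decreasing m v → Decreasing (suc m) (map suc v)
  decreasing-map-suc [] = []
  decreasing-map-suc (q ∷ d) = s≤s q ∷ decreasing-map-suc d

  complementary-row : ∀ {r s μ ν} → Complementary (suc r) s μ ν → Complementary (suc r) (suc s) μ (suc r ∷ ν)
  complementary-row {r} (complementary {w} l d e e′) = complementary {rows = suc r ∷ w} (≡.cong suc l) (ℕP.≤-refl ∷ d) (≡.cong (suc r ∷_) e) (≡.trans e′ (≡.sym (flip-full (suc r) w)))

  empty≢cons : ∀ {u y w} → Decreasing 0 u → dropZeros u ≢ suc y ∷ w
  empty≢cons d e with ≡.trans (≡.sym (dropZeros-empty d)) e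
  ... | ()

  decreasing-lists : ∀ {m m′} u v → Decreasing m u → Decreasing m′ v → length u ≡ length v → dropZeros u ≡ dropZeros v → u ≡ v
  decreasing-lists [] [] _ _ _ _ = ≡.refl
  decreasing-lists (zero ∷ u) (zero ∷ v) (_ ∷ d) (_ ∷ d′) l e = ≡.cong (0 ∷_) (decreasing-lists u v d d′ (ℕP.suc-injective l) e)
  decreasing-lists (suc x ∷ u) (suc y ∷ v) (_ ∷ d) (_ ∷ d′) l e = ≡.cong₂ _∷_ (ListP.∷-injectiveˡ e) (decreasing-lists u v d d′ (ℕP.suc-injective l) (ListP.∷-injectiveʳ e))
  decreasing-lists (zero ∷ u) (suc y ∷ v) (_ ∷ d) _ _ e = ⊥-elim (empty≢cons d e)
  decreasing-lists (suc x ∷ u) (zero ∷ v) _ (_ ∷ d) _ e = ⊥-elim (empty≢cons d (≡.sym e))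

  complementary-column : ∀ {r s μ m u} → Decreasing m u → length u ≡ s → Complementary r s μ (dropZeros u) → Complementary (suc r) s μ (map suc u)
  complementary-column {r} {u = u} du lu (complementary {w} l d e e′) = complementary {rows = map suc w} (≡.trans (ListP.length-map suc w) l) (decreasing-map-suc d)
    (≡.trans (≡.cong (map suc) (decreasing-lists u w du d (≡.trans lu (≡.sym l)) e)) (≡.sym (dropZeros-bounded-id (map-suc-bounded d))))
    (≡.trans e′ (≡.cong dropZeros (≡.sym (flip-map-suc r w))))

  last-zero : ∀ {m} w → Decreasing m w → length (dropZeros w) ℕ.< length w → Σ (List ℕ) λ w′ → w ≡ w′ ∷ʳ 0
  last-zero (zero ∷ []) _ _ = [] , ≡.refl
  last-zero (suc x ∷ []) _ (s≤s ())
  last-zero (zero ∷ zero ∷ w) (_ ∷ d) lt = let (w′ , e) = last-zero (zero ∷ w) d (≡.subst (λ k → length k ℕ.< suc (length w)) (≡.sym (dropZeros-empty d)) (s≤s z≤n)) in zero ∷ w′ , ≡.cong (zero ∷_) e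
  last-zero (zero ∷ suc y ∷ w) (_ ∷ (() ∷ d)) lt
  last-zero (suc x ∷ y ∷ w) (_ ∷ d) (s≤s lt) = let (w′ , e) = last-zero (y ∷ w) d lt in suc x ∷ w′ , ≡.cong (suc x ∷_) e

  -- An empty last row of ν turns into a full first row of μ.
  short-complement : ∀ {r s μ ν} → Complementary (suc r) s μ ν → length ν ℕ.< s → top μ ≡ suc r
  short-complement {r} (complementary {w} ≡.refl d ≡.refl ≡.refl) lt with last-zero w d lt
  ... | w′ , ≡.refl = ≡.cong (λ v → top (dropZeros v)) (≡.trans (≡.cong reverse (ListP.map-++ (suc r ∸_) w′ (0 ∷ []))) (ListP.reverse-++ (map (suc r ∸_) w′) (suc r ∷ [])))

  touches : ∀ {r s μ ν} → Complementary (suc r) s μ ν → Decreasing (suc r) μ → length μ ℕ.< s → top μ ℕ.< suc r → top ν ≡ suc r × s ℕ.≤ length ν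
  touches {r} {s} {μ} {ν} c _ lμ tμ = short-complement (complementary-sym c) lμ , long
    where
    long : s ℕ.≤ length ν
    long with ℕP.≤-<-connex s (length ν)
    ... | inj₁ le = le
    ... | inj₂ lt = ⊥-elim (ℕP.<-irrefl (short-complement c lt) tμ)

  add-top : ∀ {σ κ i j} → Add σ κ i j → top σ ℕ.≤ top κ
  add-top here = ℕP.n≤1+n _
  add-top new = z≤n
  add-top (there a) = ℕP.≤-refl

  add-length : ∀ {σ κ i j} → Add σ κ i j → length σ ℕ.≤ length κ
  add-length here = ℕP.≤-refl
  add-length new = z≤n
  add-length (there a) = s≤s (add-length a)

  -- Only the box added to the empty partition changes first row and first column together, and it
  -- completes both only if the rectangle is a single box; the bound on the width excludes this.
  add-inside : ∀ {r s σ κ i j} → 2 ℕ.≤ r → Add σ κ i j → top σ ℕ.< r → length σ ℕ.< s → ¬ (top κ ≡ r × s ℕ.≤ length κ)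
  add-inside _ here _ l (_ , le) = ℕP.<⇒≱ l le
  add-inside (s≤s ()) new _ _ (≡.refl , _)
  add-inside _ (there a) t _ (e , _) = ℕP.<-irrefl e t

  add-corner : ∀ {r s σ i j} → IsPartition σ → Add σ (replicate (suc s) (suc r)) i j → i ≡ s × j ≡ r
  add-corner {s = zero} p here = ≡.refl , ≡.refl
  add-corner {r} {suc s} (cons _ (cons _ r≤ _)) here = ⊥-elim (ℕP.<-irrefl ≡.refl r≤)
  add-corner {zero} {zero} p new = ≡.refl , ≡.refl
  add-corner {s = zero} p (there ())
  add-corner {s = suc s} p (there a) = let (e , e′) = add-corner {s = s} (tail p) a in ≡.cong suc e , e′
    where
    tail : ∀ {x σ} → IsPartition (x ∷ σ) → IsPartition σ
    tail (cons _ b) = bounded⇒partition b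

  rect-suc : ∀ r s → rect (suc r) s ≡ map suc (replicate s r)
  rect-suc r zero = ≡.refl
  rect-suc r (suc s) = ≡.cong (suc r ∷_) (rect-suc r s)

  rect-replicate : ∀ r s → rect (suc r) s ≡ replicate s (suc r)
  rect-replicate r s = ≡.trans (rect-suc r s) (ListP.map-replicate suc s r)

  replicate-decreasing : ∀ r s → Decreasing r (replicate s r)
  replicate-decreasing r zero = []
  replicate-decreasing r (suc s) = ℕP.≤-refl ∷ replicate-decreasing r s

  rect-partition : ∀ r s → IsPartition (rect r s)
  rect-partition r s = dropZeros-partition (replicate-decreasing r s)

  rect-length : ∀ r s → length (rect r s) ℕ.≤ s
  rect-length r s = ℕP.≤-trans (length-dropZeros (replicate s r)) (ℕP.≤-reflexive (ListP.length-replicate s))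

  rect-top : ∀ r s → top (rect r s) ℕ.≤ r
  rect-top zero s = ℕP.≤-reflexive (≡.cong top (dropZeros-zeros s))
  rect-top (suc r) zero = z≤n
  rect-top (suc r) (suc s) = ℕP.≤-refl

-- Products paired with a rectangular Jack function

module Selection (K : CoeffField) (A : SymmetricAlgebra K) (J : JackBasis K A) (N : ℕ) where
  open CoeffField K
  open FieldFacts K
  open SymmetricFunctions K using (weight)
  open SymmetricAlgebra A
  open AlgebraFacts K A
  open Generating K A
  open Operators K A N
  open Coefficients K A
  open Triangularity K A N
  open Partitions
  open Columns
  open Complements
  open JackBasis J
  open Expansion K A J
  open Spectrum K A J N
  open ColumnRemoval K A J N
  open PieriRule K A J N
  open HookProducts K
  open NormFormula K A J N

  structure : ℕ → ℕ → Λ → Λ → Carrier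
  structure r s x y = ⟨ x ⊗ y , P (rect r s) ⟩

  structure-comm : ∀ r s x y → structure r s x y ≈ structure r s y x
  structure-comm r s x y = ⟨⟩-congˡ _ (L.*-comm x y)

  structure-perp : ∀ r s x y → structure r s x y ≈ ⟨ perp x (P (rect r s)) , y ⟩
  structure-perp r s x y = trans (⟨⟩-perpˡ x y _) (⟨⟩-comm _ _)

  hom-rect : ∀ r s {d} → sum (rect r s) ≡ d → Homogeneous d (P (rect r s))
  hom-rect r s e = ≡.subst (λ d → Homogeneous d (P (rect r s))) e (hom-P (rect-partition r s))

  hom-quotient : ∀ {r s μ d} → IsPartition μ → sum μ ℕ.+ d ≡ sum (rect r s) → Homogeneous d (perp (P μ) (P (rect r s)))
  hom-quotient {r} {s} p e = hom-perp (hom-P p) (hom-rect r s (≡.sym e))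

  inside-length : ∀ r s {μ ν} → IsPartition μ → IsPartition ν → sum μ ℕ.+ sum ν ≡ sum (rect r s) → ¬ structure r s (P μ) (P ν) ≈ 0# → length ν ℕ.≤ s
  inside-length r s {μ} {ν} pμ pν e nz with ℕP.≤-<-connex (length ν) s
  ... | inj₁ le = le
  ... | inj₂ lt = ⊥-elim (nz (ideal-pairing (ideal-⊗ (P μ) (P-ideal pν lt)) (≡.subst (λ d → Homogeneous d (P μ ⊗ P ν)) e (hom-⊗ (hom-P pμ) (hom-P pν))) (rect-partition r s , ≡.refl) (rect-length r s)))

  -- g_x^⊥ commutes with P_μ^⊥ and kills P_λ as soon as x exceeds the width of the rectangle, so no
  -- wider constituent can arise.
  quotient-top : ∀ r s {μ ρ d} → IsPartition μ → sum μ ℕ.+ d ≡ sum (rect r s) → PartitionOf d ρ → ¬ ⟨ perp (P μ) (P (rect r s)) , P ρ ⟩ ≈ 0# → top ρ ℕ.≤ r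
  quotient-top r s {μ} {ρ} {d} pμ e pρ nz = support-pairing (λ _ _ dom l → ℕP.≤-trans (dominated-top dom) l) (supported (hom-quotient {r} {s} pμ e) narrow) pρ nz
    where
    narrow : ∀ {κ} → PartitionOf d κ → ¬ C κ (perp (P μ) (P (rect r s))) ≈ 0# → top κ ℕ.≤ r
    narrow {[]} _ _ = z≤n
    narrow {x ∷ κ} _ n with ℕP.≤-<-connex x r
    ... | inj₁ le = le
    ... | inj₂ lt = ⊥-elim (n (trans (sym (⟨⟩-perp _ _ _)) (trans (⟨⟩-congʳ _ (solveΛ 3 (λ m x k → m :⊗ (x :⊗ k) :≐ x :⊗ (m :⊗ k)) ≐-refl _ _ _))
      (trans (⟨⟩-perp _ _ _) (trans (⟨⟩-congˡ _ (row-too-long (rect-partition r s) (ℕP.≤-<-trans (rect-top r s) lt))) (⟨⟩-𝟘ˡ _))))))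

  inside-top : ∀ r s {μ ν} → IsPartition μ → IsPartition ν → sum μ ℕ.+ sum ν ≡ sum (rect r s) → ¬ structure r s (P μ) (P ν) ≈ 0# → top ν ℕ.≤ r
  inside-top r s pμ pν e nz = quotient-top r s pμ e (pν , ≡.refl) λ z → nz (trans (structure-perp r s _ _) z)

  -- `row-duality` for P_μ^⊥ P_λ, whose constituents are no wider than the rectangle. The factor
  -- g_(r+1) then acts on P_λ, from which `row-removal` takes one row.
  row-step : ∀ r s {μ ν} → IsPartition μ → IsPartition (suc r ∷ ν) → sum μ ℕ.+ (suc r ℕ.+ sum ν) ≡ sum (rect (suc r) (suc s)) → sum (rect (suc r) (suc s)) ℕ.< N →
    norm ν * structure (suc r) (suc s) (P μ) (P (suc r ∷ ν)) ≈ norm (suc r ∷ ν) * structure (suc r) s (P μ) (P ν)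
  row-step r s {μ} {ν} pμ pν e bound = trans (*-congˡ (structure-perp (suc r) (suc s) (P μ) (P (suc r ∷ ν)))) (trans (row-duality pν (ℕP.≤-<-trans (ℕP.≤-trans (ℕP.m≤n+m _ (sum μ)) (ℕP.≤-reflexive e)) bound)
      (hom-quotient {suc r} {suc s} pμ e) narrow) (*-congˡ (begin
      ⟨ f , γ (suc r) ⊗ P ν ⟩ ≈⟨ sym (⟨⟩-perp _ _ _) ⟩
      ⟨ P (rect (suc r) (suc s)) , P μ ⊗ (γ (suc r) ⊗ P ν) ⟩ ≈⟨ ⟨⟩-congʳ _ (solveΛ 3 (λ m x k → m :⊗ (x :⊗ k) :≐ x :⊗ (m :⊗ k)) ≐-refl _ _ _) ⟩
      ⟨ P (rect (suc r) (suc s)) , γ (suc r) ⊗ (P μ ⊗ P ν) ⟩ ≈⟨ ⟨⟩-perp _ _ _ ⟩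
      ⟨ perp (γ (suc r)) (P (rect (suc r) (suc s))) , P μ ⊗ P ν ⟩ ≈⟨ trans (⟨⟩-congˡ _ (row-removal (rect-partition (suc r) (suc s)) bound)) (⟨⟩-comm _ _) ⟩
      structure (suc r) s (P μ) (P ν) ∎)))
    where
    open FR
    f = perp (P μ) (P (rect (suc r) (suc s)))
    narrow : ∀ {ρ} → PartitionOf (suc r ℕ.+ sum ν) ρ → suc r ℕ.< top ρ → ⟨ f , P ρ ⟩ ≈ 0#
    narrow {ρ} pρ lt with ⟨ f , P ρ ⟩ ≈? 0#
    ... | yes z = z
    ... | no nz = ⊥-elim (ℕP.<⇒≱ lt (quotient-top (suc r) (suc s) pμ e pρ nz))

  rect-columns : ∀ r s → sum (rect (suc r) s) ℕ.< N → ColumnData s (replicate s r)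
  rect-columns r s bound = columnData (replicate-decreasing r s) (ListP.length-replicate s) (≡.subst (λ v → sum v ℕ.< N) (rect-suc r s) bound)

  column-step : ∀ r s {μ u} → IsPartition μ → ColumnData s u → sum μ ℕ.+ sum (map suc u) ≡ sum (rect (suc r) s) → sum (rect (suc r) s) ℕ.< N →
    norm (rect r s) * structure (suc r) s (P μ) (P (map suc u)) ≈ norm (rect (suc r) s) * structure r s (P μ) (P (dropZeros u))
  column-step r s {μ} {u} pμ cu e bound = ≡.subst (λ κ → norm (rect r s) * ⟨ P μ ⊗ P (map suc u) , P κ ⟩ ≈ norm κ * structure r s (P μ) (P (dropZeros u))) (≡.sym (rect-suc r s))
    (column-product cu (rect-columns r s bound) (hom-P pμ) (≡.trans e (≡.cong sum (rect-suc r s))))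

  Inside : ℕ → ℕ → List ℕ → Set
  Inside r s μ = top μ ℕ.< r × length μ ℕ.< s

  inside? : ∀ r s μ → Dec (Inside r s μ)
  inside? r s μ with top μ ℕP.<? r | length μ ℕP.<? s
  ... | yes a | yes b = yes (a , b)
  ... | no a  | _     = no λ i → a (proj₁ i)
  ... | _     | no b  = no λ i → b (proj₂ i)

  Selects : ℕ → ℕ → List ℕ → List ℕ → Set
  Selects r s μ ν = IsPartition μ → IsPartition ν → sum μ ℕ.+ sum ν ≡ sum (rect r s) → ¬ structure r s (P μ) (P ν) ≈ 0# → Complementary r s μ ν

  V-rect : ∀ r s → sum (rect (suc r) (suc s)) ℕ.< N → ∀ {d} → sum (rect (suc r) (suc s)) ≡ suc d →
    V (P (rect (suc r) (suc s))) ≐ con (content s r) ⊗ perp (q 0) (P (rect (suc r) (suc s)))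
  V-rect r s bound {d} e = P-ext (hom-V homλ) (hom-con _ (hom-perp {1} {d} (hom-q 0) homλ)) λ {σ} pσ → pair pσ (⟨ q 0 ⊗ P σ , P λ′ ⟩ ≈? 0#)
    where
    λ′ = rect (suc r) (suc s)
    homλ : Homogeneous (suc d) (P λ′)
    homλ = hom-rect (suc r) (suc s) e
    pair : ∀ {σ} → PartitionOf d σ → Dec (⟨ q 0 ⊗ P σ , P λ′ ⟩ ≈ 0#) → ⟨ V (P λ′) , P σ ⟩ ≈ ⟨ con (content s r) ⊗ perp (q 0) (P λ′) , P σ ⟩
    pair {σ} (pσ , sσ) zero? = trans (trans (⟨⟩-comm _ _) (trans (sym (U-adjoint _ _)) (trans (U-half pσ (rect-partition (suc r) (suc s)) boundσ bound) (go zero?))))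
        (sym (trans (⟨⟩-con _ _ _) (*-congˡ (trans (⟨⟩-comm _ _) (sym (⟨⟩-perpˡ _ _ _))))))
      where
      boundσ : sum σ ℕ.< N
      boundσ = ℕP.<-trans (ℕP.≤-reflexive (≡.trans (≡.cong suc sσ) (≡.sym e))) bound
      go : Dec (⟨ q 0 ⊗ P σ , P λ′ ⟩ ≈ 0#) → half-difference λ′ σ * ⟨ q 0 ⊗ P σ , P λ′ ⟩ ≈ content s r * ⟨ q 0 ⊗ P σ , P λ′ ⟩
      go (yes z) = trans (*-congˡ z) (trans (zeroʳ _) (sym (trans (*-congˡ z) (zeroʳ _))))
      go (no nz) = let (i , j , a) = pieri pσ (rect-partition (suc r) (suc s)) (≡.trans e (≡.cong suc (≡.sym sσ))) bound nz
                       (ei , ej) = add-corner {s = s} pσ (≡.subst (λ κ → Add σ κ i j) (rect-replicate r (suc s)) a) in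
        *-congʳ (trans (half-content a) (reflexive (≡.cong₂ content ei ej)))

  split-terms : ∀ {d} r s f (t : Terms) → All (λ u → PartitionOf d (proj₂ u) × Visible f (proj₂ u)) t →
    Σ Terms λ t₁ → Σ Terms λ t₂ → All (λ u → PartitionOf d (proj₂ u) × Inside r s (proj₂ u)) t₁ ×
      All (λ u → PartitionOf d (proj₂ u) × (Visible f (proj₂ u) × ¬ Inside r s (proj₂ u))) t₂ × combination t ≐ combination t₁ ⊕ combination t₂
  split-terms r s f [] _ = [] , [] , [] , [] , ≐-sym (L.+-identityˡ _)
  split-terms r s f ((c , κ) ∷ t) ((p , v) ∷ all) with split-terms r s f t all | inside? r s κ
  ... | t₁ , t₂ , a₁ , a₂ , e | yes i = (c , κ) ∷ t₁ , t₂ , (p , i) ∷ a₁ , a₂ , ≐-trans (⊕-cong ≐-refl e) (≐-sym (L.+-assoc _ _ _))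
  ... | t₁ , t₂ , a₁ , a₂ , e | no o = t₁ , (c , κ) ∷ t₂ , a₁ , (p , v , o) ∷ a₂ , ≐-trans (⊕-cong ≐-refl e) (solveΛ 3 (λ x a b → x :⊕ (a :⊕ b) :≐ a :⊕ (x :⊕ b)) ≐-refl _ _ _)

  -- The part of P_μ^⊥ P_λ inside the rectangle is killed by ∂/∂p_1 and by V, hence by every ∂/∂p_k.
  module Interior (r s : ℕ) (bound : sum (rect (suc r) (suc s)) ℕ.< N) {μ : List ℕ} (pμ : IsPartition μ) (inside-μ : Inside (suc r) (suc s) μ)
    {d : ℕ} (degrees : sum μ ℕ.+ suc d ≡ sum (rect (suc r) (suc s))) (2≤r : 2 ℕ.≤ suc r)
    (edge-select : ∀ {κ} → PartitionOf (suc d) κ → ¬ Inside (suc r) (suc s) κ → ¬ structure (suc r) (suc s) (P μ) (P κ) ≈ 0# → Complementary (suc r) (suc s) μ κ)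
    (smaller-select : ∀ {ρ ν} → sum ν ≡ d → Selects (suc r) (suc s) ρ ν) where

    λ′ = rect (suc r) (suc s)
    y = perp (P μ) (P λ′)

    hom-y : Homogeneous (suc d) y
    hom-y = hom-quotient {suc r} {suc s} pμ degrees

    total : sum λ′ ≡ suc (sum μ ℕ.+ d)
    total = ≡.trans (≡.sym degrees) (ℕP.+-suc (sum μ) d)

    -- The empty last row of μ becomes a full first row of κ, and the gap at the end of the first
    -- row of μ gives κ all its rows.
    touch : ∀ {κ} → Complementary (suc r) (suc s) μ κ → top κ ≡ suc r × suc s ℕ.≤ length κ
    touch c = touches c (decreasing-weaken (ℕP.<⇒≤ (proj₁ inside-μ)) (lower pμ)) (proj₂ inside-μ) (proj₁ inside-μ)
      where
      lower : ∀ {μ} → IsPartition μ → Decreasing (top μ) μ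
      lower [] = []
      lower (cons _ b) = ℕP.≤-refl ∷ bounded⇒decreasing b

    InsideTerm EdgeTerm : List ℕ → Set
    InsideTerm κ = PartitionOf (suc d) κ × Inside (suc r) (suc s) κ
    EdgeTerm κ = PartitionOf (suc d) κ × (Visible y κ × ¬ Inside (suc r) (suc s) κ)

    opaque
      splitting : Σ Terms λ t₁ → Σ Terms λ t₂ → All (λ u → InsideTerm (proj₂ u)) t₁ × All (λ u → EdgeTerm (proj₂ u)) t₂ × y ≐ combination t₁ ⊕ combination t₂
      splitting = let (t , all , e) = decompose hom-y ; (t₁ , t₂ , a₁ , a₂ , e′) = split-terms (suc r) (suc s) y t all in t₁ , t₂ , a₁ , a₂ , ≐-trans e e′

    inside-terms edge-terms : Terms
    inside-terms = proj₁ splitting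
    edge-terms = proj₁ (proj₂ splitting)

    w edge : Λ
    w = combination inside-terms
    edge = combination edge-terms

    w-inside : All (λ u → InsideTerm (proj₂ u)) inside-terms
    w-inside = proj₁ (proj₂ (proj₂ splitting))

    edge-outside : All (λ u → EdgeTerm (proj₂ u)) edge-terms
    edge-outside = proj₁ (proj₂ (proj₂ (proj₂ splitting)))

    y-split : y ≐ w ⊕ edge
    y-split = proj₂ (proj₂ (proj₂ (proj₂ splitting)))

    hom-w : Homogeneous (suc d) w
    hom-w = hom-combination {S = Inside (suc r) (suc s)} inside-terms w-inside

    w-visible : ∀ {ρ} → PartitionOf (suc d) ρ → ¬ ⟨ w , P ρ ⟩ ≈ 0# → Inside (suc r) (suc s) ρ
    w-visible {ρ} pρ nz with inside? (suc r) (suc s) ρ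
    ... | yes i = i
    ... | no o = ⊥-elim (nz (combination-pairing {InsideTerm} inside-terms (P ρ) w-inside
          λ { {κ} (pκ , i) → orthogonal (proj₁ pκ) (proj₁ pρ) λ { ≡.refl → o i } }))

    -- All that the argument uses of p_1 P_ν and U P_ν is which P_ρ they can meet, so both are
    -- treated at once.
    record OneBoxMore (ν : List ℕ) (z : Λ) : Set where
      constructor oneBoxMore
      field
        hom-z : Homogeneous (suc (sum ν)) z
        adds : ∀ {ρ} → PartitionOf (suc (sum ν)) ρ → sum ρ ℕ.< N → ¬ ⟨ z , P ρ ⟩ ≈ 0# → Σ ℕ λ i → Σ ℕ λ j → Add ν ρ i j
    open OneBoxMore

    q₀-adds : ∀ {ν} → IsPartition ν → OneBoxMore ν (q 0 ⊗ P ν)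
    q₀-adds pν = oneBoxMore (hom-q₀P pν) λ pρ b nz → pieri pν (proj₁ pρ) (proj₂ pρ) b nz

    U-adds : ∀ {ν} → IsPartition ν → OneBoxMore ν (U (P ν))
    U-adds {ν} pν = oneBoxMore (hom-U (hom-P pν)) λ {ρ} pρ b nz → pieri pν (proj₁ pρ) (proj₂ pρ) b
      λ z → nz (trans (U-half pν (proj₁ pρ) (ℕP.<-trans (ℕP.≤-reflexive (≡.sym (proj₂ pρ))) b) b) (trans (*-congˡ z) (zeroʳ _)))

    small : ∀ {ρ} → PartitionOf (suc d) ρ → sum ρ ℕ.< N
    small (_ , e) = ℕP.≤-<-trans (ℕP.≤-trans (ℕP.≤-reflexive e) (ℕP.≤-trans (ℕP.m≤n+m (suc d) (sum μ)) (ℕP.≤-reflexive degrees))) bound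

    small-μ : ∀ {ρ} → PartitionOf (suc (sum μ)) ρ → sum ρ ℕ.< N
    small-μ (_ , e) = ℕP.≤-<-trans (ℕP.≤-trans (ℕP.≤-reflexive e) (ℕP.≤-trans (s≤s (ℕP.m≤m+n (sum μ) d)) (ℕP.≤-reflexive (≡.sym total)))) bound

    -- A constituent ρ of `z` is μ with one box added. Were its product with P_ν to meet P_λ, then ρ
    -- would be the complement of ν, which lies inside, so ρ would touch both borders; one box does
    -- not achieve that.
    μ-vanish : ∀ {ν z} → PartitionOf d ν → Inside (suc r) (suc s) ν → OneBoxMore μ z → structure (suc r) (suc s) z (P ν) ≈ 0#
    μ-vanish {ν} {z} (pν , sν) inside-ν add = trans (trans (structure-comm (suc r) (suc s) _ _) (trans (structure-perp (suc r) (suc s) _ _) (⟨⟩-comm _ _))) (disjoint (hom-z add) λ {ρ} pρ nz → zero-at pρ nz (structure (suc r) (suc s) (P ρ) (P ν) ≈? 0#))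
      where
      lower : ∀ {μ} → IsPartition μ → Decreasing (top μ) μ
      lower [] = []
      lower (cons _ b) = ℕP.≤-refl ∷ bounded⇒decreasing b
      zero-at : ∀ {ρ} → PartitionOf (suc (sum μ)) ρ → ¬ ⟨ z , P ρ ⟩ ≈ 0# → Dec (structure (suc r) (suc s) (P ρ) (P ν) ≈ 0#) → ⟨ perp (P ν) (P λ′) , P ρ ⟩ ≈ 0#
      zero-at pρ _ (yes e) = trans (sym (structure-perp (suc r) (suc s) _ _)) (trans (structure-comm (suc r) (suc s) _ _) e)
      zero-at {ρ} pρ nz (no nz′) = let (i , j , a) = adds add pρ (small-μ pρ) nz in
        ⊥-elim (add-inside 2≤r a (proj₁ inside-μ) (proj₂ inside-μ) (touches (complementary-sym (smaller-select sν (proj₁ pρ) pν (≡.trans (≡.cong₂ ℕ._+_ (proj₂ pρ) sν) (≡.sym total)) nz′))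
          (decreasing-weaken (ℕP.<⇒≤ (proj₁ inside-ν)) (lower pν)) (proj₂ inside-ν) (proj₁ inside-ν)))

    -- If ν lies inside, the edge constituents touch both borders and cannot arise from ν by one
    -- box, so `w` and `y` pair equally with `z`. If ν does not lie inside, neither does anything
    -- containing it, while `w` has inside constituents only.
    w-vanish : ∀ {ν z} → PartitionOf d ν → OneBoxMore ν z → (Inside (suc r) (suc s) ν → ⟨ y , z ⟩ ≈ 0#) → ⟨ w , z ⟩ ≈ 0#
    w-vanish {ν} {z} (pν , ≡.refl) add y-zero with inside? (suc r) (suc s) ν
    ... | no o = disjoint hom-w λ {ρ} pρ nz → zero-at pρ (w-visible pρ nz) (⟨ z , P ρ ⟩ ≈? 0#)
      where
      zero-at : ∀ {ρ} → PartitionOf (suc d) ρ → Inside (suc r) (suc s) ρ → Dec (⟨ z , P ρ ⟩ ≈ 0#) → ⟨ z , P ρ ⟩ ≈ 0#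
      zero-at pρ _ (yes e) = e
      zero-at pρ (t , l) (no nz) = let (i , j , a) = adds add pρ (small pρ) nz in ⊥-elim (o (ℕP.≤-<-trans (add-top a) t , ℕP.≤-<-trans (add-length a) l))
    ... | yes i = begin
      ⟨ w , z ⟩ ≈⟨ solve 2 (λ a b → a := (a :+ b) :+ :- b) refl _ _ ⟩
      (⟨ w , z ⟩ + ⟨ edge , z ⟩) + - ⟨ edge , z ⟩ ≈⟨ +-cong (trans (sym (⟨⟩-⊕ _ _ z)) (trans (⟨⟩-congˡ z (≐-sym y-split)) (y-zero i))) (-‿cong edge-zero) ⟩
      0# + - 0# ≈⟨ -‿inverseʳ 0# ⟩
      0# ∎
      where
      open FR
      edge-zero : ⟨ edge , z ⟩ ≈ 0#
      edge-zero = combination-pairing {EdgeTerm} edge-terms z edge-outside λ { {κ} (pκ , visible nz , o) → zero-at pκ nz o (⟨ z , P κ ⟩ ≈? 0#) }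
        where
        zero-at : ∀ {κ} → PartitionOf (suc d) κ → ¬ ⟨ y , P κ ⟩ ≈ 0# → ¬ Inside (suc r) (suc s) κ → Dec (⟨ z , P κ ⟩ ≈ 0#) → ⟨ P κ , z ⟩ ≈ 0#
        zero-at pκ nz o (yes e) = trans (⟨⟩-comm _ _) e
        zero-at pκ nz o (no nz′) = let (i′ , j , a) = adds add pκ (small pκ) nz′ in
          ⊥-elim (add-inside 2≤r a (proj₁ i) (proj₂ i) (touch (edge-select pκ o λ e → nz (trans (sym (structure-perp (suc r) (suc s) _ _)) e))))

    q₀-zero : ∀ {ν} → PartitionOf d ν → Inside (suc r) (suc s) ν → ⟨ P μ ⊗ P ν , perp (q 0) (P λ′) ⟩ ≈ 0#
    q₀-zero pν i = trans (sym (⟨⟩-perpˡ _ _ _)) (trans (⟨⟩-congˡ _ (≐-sym (L.*-assoc _ _ _))) (μ-vanish pν i (q₀-adds pμ)))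

    y-q₀ : ∀ {ν} → PartitionOf d ν → Inside (suc r) (suc s) ν → ⟨ y , q 0 ⊗ P ν ⟩ ≈ 0#
    y-q₀ {ν} pν i = trans (sym (structure-perp (suc r) (suc s) _ _)) (trans (⟨⟩-congˡ _ (solveΛ 3 (λ m q n → m :⊗ (q :⊗ n) :≐ q :⊗ (m :⊗ n)) ≐-refl (P μ) (q 0) (P ν))) (trans (⟨⟩-perpˡ _ _ _) (q₀-zero pν i)))

    -- U is a derivation: up to the term with U P_μ it may act on the whole product P_μ P_ν and move
    -- from there, as V, to P_λ, where `V-rect` reduces it to p_1^⊥.
    y-U : ∀ {ν} → PartitionOf d ν → Inside (suc r) (suc s) ν → ⟨ y , U (P ν) ⟩ ≈ 0#
    y-U {ν} pν i = begin
      ⟨ y , U (P ν) ⟩ ≈⟨ sym (structure-perp (suc r) (suc s) _ _) ⟩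
      ⟨ P μ ⊗ U (P ν) , P λ′ ⟩ ≈⟨ solve 2 (λ a b → b := (a :+ b) :+ :- a) refl _ _ ⟩
      (⟨ U (P μ) ⊗ P ν , P λ′ ⟩ + ⟨ P μ ⊗ U (P ν) , P λ′ ⟩) + - ⟨ U (P μ) ⊗ P ν , P λ′ ⟩
        ≈⟨ +-cong (trans (sym (⟨⟩-⊕ _ _ _)) (trans (⟨⟩-congˡ _ (≐-sym (vectorField-⊗ _ _ (P μ) (P ν)))) (trans (U-adjoint _ _) (trans (⟨⟩-congʳ _ (V-rect r s bound total)) (trans (⟨⟩-conʳ _ _ _) (trans (*-congˡ (q₀-zero pν i)) (zeroʳ _)))))))
             (-‿cong (μ-vanish pν i (U-adds pμ))) ⟩
      0# + - 0# ≈⟨ -‿inverseʳ 0# ⟩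
      0# ∎
      where open FR

    killed₀ : perp (q 0) w ≐ 𝟘
    killed₀ = P-nondegenerate {d} (hom-perp {1} {d} (hom-q 0) hom-w) λ pν → trans (sym (⟨⟩-perp _ _ _)) (w-vanish pν (q₀-adds (proj₁ pν)) (y-q₀ pν))

    V-killed : V w ≐ 𝟘
    V-killed = P-nondegenerate {d} (hom-V hom-w) λ pν → trans (trans (⟨⟩-comm _ _) (trans (sym (U-adjoint _ _)) (⟨⟩-comm _ _))) (w-vanish pν (U-adds (proj₁ pν)) (y-U pν))

    -- The commutator of `perp (q k)` with V is `weight k` times `perp (q (suc k))`, so annihilation
    -- by V and by one power sum passes on to the next.
    killed : ∀ k → perp (q k) w ≐ 𝟘
    killed zero = killed₀
    killed (suc k) = con-cancel (weight≉0 k) (begin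
      con (weight k) ⊗ perp (q (suc k)) w ≈⟨ ≐-sym (Σ-δ N k (weight k) (λ a → perp (q (suc a)) w) beyond) ⟩
      Σ< N (λ a → con (weight k * δ′ k a) ⊗ perp (q (suc a)) w) ≈⟨ Σ-cong′ N term ⟩
      Σ< N (λ a → perp (q k) (q a ⊗ perp (q (suc a)) w)) ≈⟨ ≐-sym (Σ-perp N (q k) _) ⟩
      perp (q k) (V w) ≈⟨ ≐-trans (perp-cong ≐-refl V-killed) (perp-𝟘 _) ⟩
      𝟘 ≈⟨ ≐-sym (L.zeroʳ _) ⟩
      con (weight k) ⊗ 𝟘 ∎)
      where
      open ΛR
      δ′ = SymmetricFunctions.δ K
      beyond : ∀ a → N ℕ.≤ a → perp (q (suc a)) w ≐ 𝟘
      beyond a N≤a = hom-perp-0 (hom-q (suc a)) hom-w (ℕP.<-≤-trans (s≤s (ℕP.≤-trans (ℕP.≤-trans (ℕP.m≤n+m (suc d) (sum μ)) (ℕP.≤-reflexive degrees)) (ℕP.<⇒≤ (ℕP.<-≤-trans bound N≤a)))) (ℕP.n≤1+n _))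
      term : ∀ a → con (weight k * δ′ k a) ⊗ perp (q (suc a)) w ≐ perp (q k) (q a ⊗ perp (q (suc a)) w)
      term a = ≐-sym (≐-trans (perp-q-⊗ k _ _) (≐-trans (⊕-cong (⊗-cong (perp-q-q k a) ≐-refl)
        (≐-trans (⊗-cong ≐-refl (≐-trans (perp-comm _ _ _) (≐-trans (perp-cong ≐-refl (killed k)) (perp-𝟘 _)))) (L.zeroʳ _))) (L.+-identityʳ _)))

    w-zero : w ≐ 𝟘
    w-zero = taylor w killed (hom-orthogonal hom-w hom-𝟙 λ ())

    interior-zero : ∀ {κ} → PartitionOf (suc d) κ → Inside (suc r) (suc s) κ → structure (suc r) (suc s) (P μ) (P κ) ≈ 0#
    interior-zero {κ} pκ i = trans (structure-perp (suc r) (suc s) _ _) (trans (⟨⟩-congˡ _ (≐-trans y-split (≐-trans (⊕-cong w-zero ≐-refl) (L.+-identityˡ _))))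
      (combination-pairing {EdgeTerm} edge-terms (P κ) edge-outside
        λ { {ρ} (pρ , _ , o) → orthogonal (proj₁ pρ) (proj₁ pκ) λ { ≡.refl → o i } }))

  empty-rect : ∀ s → rect 0 s ≡ []
  empty-rect s = dropZeros-zeros s

  complementary-empty : ∀ s → Complementary 0 s [] []
  complementary-empty s = complementary {rows = replicate s 0} (ListP.length-replicate s) (replicate-decreasing 0 s) (≡.sym (dropZeros-zeros s))
    (≡.sym (dropZeros-empty (proj₂ (flip-bounds (replicate-decreasing 0 s) z≤n))))

  rect-sum-suc : ∀ r s → sum (rect (suc r) s) ≡ sum (rect r s) ℕ.+ s
  rect-sum-suc r s = ≡.trans (≡.cong sum (rect-suc r s)) (≡.trans (sum-map-suc (replicate s r)) (≡.cong₂ ℕ._+_ (≡.sym (sum-dropZeros (replicate s r))) (ListP.length-replicate s)))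

  SelectsAll : ℕ → ℕ → Set
  SelectsAll r s = sum (rect r s) ℕ.< N → ∀ {μ ν} → Selects r s μ ν

  select-row : ∀ r s {μ ν} → sum (rect (suc r) (suc s)) ℕ.< N → SelectsAll (suc r) s → Selects (suc r) (suc s) μ (suc r ∷ ν)
  select-row r s {μ} {ν} bound rec pμ pν e nz = complementary-row (rec (ℕP.≤-<-trans (ℕP.m≤n+m _ (suc r)) bound) pμ (partition-tail pν) degrees
      λ z → nz (factor≈0 (norm≉0 (partition-tail pν)) (trans (row-step r s pμ pν e bound) (trans (*-congˡ z) (zeroʳ _)))))
    where
    degrees : sum μ ℕ.+ sum ν ≡ sum (rect (suc r) s)
    degrees = ℕP.+-cancelˡ-≡ (suc r) _ _ (≡.trans (exchange (suc r) (sum μ) (sum ν)) e)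

  column-degrees : ∀ r s {μ u} → ColumnData s u → sum μ ℕ.+ sum (map suc u) ≡ sum (rect (suc r) s) → sum μ ℕ.+ sum (dropZeros u) ≡ sum (rect r s)
  column-degrees r s {μ} {u} cu e = ℕP.+-cancelʳ-≡ s _ _ (≡.trans (ℕP.+-assoc (sum μ) _ s) (≡.trans (≡.cong (sum μ ℕ.+_) (≡.sym (ColumnData.longer-sum cu))) (≡.trans e (rect-sum-suc r s))))

  select-column : ∀ r s {μ u} → ColumnData s u → sum (rect (suc r) s) ℕ.< N → SelectsAll r s → Selects (suc r) s μ (map suc u)
  select-column r s {μ} {u} cu bound rec pμ pν e nz = complementary-column (ColumnData.decreasing cu) (ColumnData.columns cu)
    (rec (ℕP.≤-<-trans (ℕP.≤-trans (ℕP.m≤m+n _ s) (ℕP.≤-reflexive (≡.sym (rect-sum-suc r s)))) bound) pμ (ColumnData.shorter-partition cu) (column-degrees r s {μ} cu e)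
      λ z → nz (factor≈0 (norm≉0 (rect-partition r s)) (trans (column-step r s pμ cu e bound) (trans (*-congˡ z) (zeroʳ _)))))

  select-edge : ∀ r s {μ ν} → sum (rect (suc r) (suc s)) ℕ.< N → SelectsAll (suc r) s → SelectsAll r (suc s) → ¬ Inside (suc r) (suc s) ν → Selects (suc r) (suc s) μ ν
  select-edge r s {μ} {ν} bound rec-row rec-column outside pμ pν e nz = cases (ℕP.m≤n⇒m<n∨m≡n (inside-top (suc r) (suc s) pμ pν e nz)) (ℕP.m≤n⇒m<n∨m≡n (inside-length (suc r) (suc s) pμ pν e nz))
    where
    full-row : ∀ ν → top ν ≡ suc r → Selects (suc r) (suc s) μ ν
    full-row (.(suc r) ∷ ν) ≡.refl = select-row r s bound rec-row
    small : sum ν ℕ.< N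
    small = ℕP.≤-<-trans (ℕP.≤-trans (ℕP.m≤n+m _ (sum μ)) (ℕP.≤-reflexive e)) bound
    full-column : length ν ≡ suc s → Selects (suc r) (suc s) μ ν
    full-column l = let (u , ν≡ , cu) = columnsOf pν small in
      ≡.subst (Selects (suc r) (suc s) μ) (≡.sym ν≡) (select-column r (suc s) (≡.subst (λ k → ColumnData k u) l cu) bound rec-column)
    cases : top ν ℕ.< suc r ⊎ top ν ≡ suc r → length ν ℕ.< suc s ⊎ length ν ≡ suc s → Complementary (suc r) (suc s) μ ν
    cases (inj₂ t) _ = full-row ν t pμ pν e nz
    cases _ (inj₂ l) = full-column l pμ pν e nz
    cases (inj₁ t) (inj₁ l) = ⊥-elim (outside (t , l))

  -- When both partitions lie inside, the pairing must vanish. The interior argument for this uses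
  -- the selection rule for all pairs with a second member of degree one less, whence the induction
  -- on the degree of ν.
  select-degree : ∀ r s → sum (rect (suc r) (suc s)) ℕ.< N → SelectsAll (suc r) s → SelectsAll r (suc s) → ∀ n {μ ν} → sum ν ℕ.≤ n → Selects (suc r) (suc s) μ ν
  select-degree r s bound rec-row rec-column n {μ} {ν} s≤ pμ pν e nz with inside? (suc r) (suc s) μ | inside? (suc r) (suc s) ν
  ... | no o | _ = complementary-sym (select-edge r s bound rec-row rec-column o pν pμ (≡.trans (ℕP.+-comm (sum ν) _) e) λ z → nz (trans (structure-comm (suc r) (suc s) _ _) z))
  ... | yes _ | no o = select-edge r s bound rec-row rec-column o pμ pν e nz
  ... | yes iμ | yes iν = ⊥-elim (both-inside n ν s≤ pν e iν nz)
    where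
    both-inside : ∀ n ν → sum ν ℕ.≤ n → IsPartition ν → sum μ ℕ.+ sum ν ≡ sum (rect (suc r) (suc s)) → Inside (suc r) (suc s) ν → ¬ structure (suc r) (suc s) (P μ) (P ν) ≈ 0# → ⊥
    -- For ν empty the product is P_μ, and μ, having a shorter first row, is not the rectangle.
    both-inside n [] _ _ e _ nz = nz (trans (⟨⟩-congˡ _ (≐-trans (⊗-cong ≐-refl P-empty) (L.*-identityʳ _))) (orthogonal pμ (rect-partition (suc r) (suc s)) λ { ≡.refl → ℕP.<-irrefl ≡.refl (proj₁ iμ) }))
    -- A nonempty ν whose first row is not full shows that the width is at least 2.
    both-inside (suc n) (suc x ∷ ν) (s≤s s≤) pν e iν nz = nz (Interior.interior-zero r s bound pμ iμ e (ℕP.≤-trans (s≤s (s≤s z≤n)) (proj₁ iν))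
      (λ pκ o nz′ → select-edge r s bound rec-row rec-column o pμ (proj₁ pκ) (≡.trans (≡.cong (sum μ ℕ.+_) (proj₂ pκ)) e) nz′)
      (λ sν → select-degree r s bound rec-row rec-column n (ℕP.≤-trans (ℕP.≤-reflexive sν) s≤)) (pν , ≡.refl) iν)
    both-inside n (zero ∷ ν) _ (cons () _) _ _ _

  select : ∀ b r s → r ℕ.+ s ℕ.≤ b → SelectsAll r s
  select b zero s _ bound {μ} {ν} pμ pν e nz = ≡.subst₂ (Complementary 0 s) (≡.sym (empty-sum (partition⇒bounded pμ) (ℕP.m+n≡0⇒m≡0 (sum μ) {sum ν} total))) (≡.sym (empty-sum (partition⇒bounded pν) (ℕP.m+n≡0⇒n≡0 (sum μ) {sum ν} total))) (complementary-empty s)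
    where total = ≡.trans e (≡.cong sum (empty-rect s))
  select b (suc r) zero _ bound {μ} {ν} pμ pν e nz = ≡.subst₂ (Complementary (suc r) 0) (≡.sym (empty-sum (partition⇒bounded pμ) (ℕP.m+n≡0⇒m≡0 (sum μ) {sum ν} e))) (≡.sym (empty-sum (partition⇒bounded pν) (ℕP.m+n≡0⇒n≡0 (sum μ) {sum ν} e)))
    (complementary {rows = []} ≡.refl [] ≡.refl ≡.refl)
  select (suc b) (suc r) (suc s) (s≤s le) bound {ν = ν} = select-degree r s bound (select b (suc r) s (ℕP.≤-trans (ℕP.≤-reflexive (≡.sym (ℕP.+-suc r s))) le)) (select b r (suc s) le) (sum ν) ℕP.≤-refl

  -- The lower hooks of the rectangle on the left come from J_λ. On the right the norm of P_ν is
  -- kept as it stands; with the lower hooks from J_ν it later becomes the upper hook product.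
  Value : ℕ → ℕ → List ℕ → List ℕ → Set
  Value r s μ ν = (sum μ ℕ.+ sum ν ≡ sum (rect r s)) × structure r s (P μ) (P ν) * lowerHooks (rect r s) ≈ norm ν * (h₁-product r μ * h₂-product s ν)

  value-empty : ∀ {r s} → rect r s ≡ [] → Value r s [] []
  value-empty {r} {s} e = ≡.cong sum (≡.sym e) , ≡.subst (λ κ → ⟨ P [] ⊗ P [] , P κ ⟩ * lowerHooks κ ≈ norm [] * (1# * 1#)) (≡.sym e)
    (trans (*-identityʳ _) (trans (⟨⟩-congˡ _ (≐-trans (⊗-cong P-empty ≐-refl) (L.*-identityˡ _))) (solve 1 (λ x → x := x :* (:1 :* :1)) refl _)))

  -- The lower hooks in the first row of the rectangle, read from right to left, are the factors of
  -- h₂ for the new full row of ν, while h₁ is untouched.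
  value-row : ∀ r s {μ ν} → IsPartition μ → IsPartition (suc r ∷ ν) → sum (rect (suc r) (suc s)) ℕ.< N → Value (suc r) s μ ν → Value (suc r) (suc s) μ (suc r ∷ ν)
  value-row r s {μ} {ν} pμ pν bound (e , v) = degrees , *-cancelˡ (norm ν) (norm≉0 (partition-tail pν)) (begin
      norm ν * (structure (suc r) (suc s) (P μ) (P (suc r ∷ ν)) * (lowerRow (suc r) (rect (suc r) s) * lowerHooks (rect (suc r) s)))
        ≈⟨ solve 4 (λ n b l h → n :* (b :* (l :* h)) := n :* b :* h :* l) refl (norm ν) _ (lowerRow (suc r) (rect (suc r) s)) (lowerHooks (rect (suc r) s)) ⟩
      norm ν * structure (suc r) (suc s) (P μ) (P (suc r ∷ ν)) * lowerHooks (rect (suc r) s) * lowerRow (suc r) (rect (suc r) s) ≈⟨ *-congʳ (*-congʳ (row-step r s pμ pν degrees bound)) ⟩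
      norm (suc r ∷ ν) * structure (suc r) s (P μ) (P ν) * lowerHooks (rect (suc r) s) * lowerRow (suc r) (rect (suc r) s) ≈⟨ trans (*-congʳ (*-assoc _ _ _)) (*-cong (*-congˡ v) full-row) ⟩
      norm (suc r ∷ ν) * (norm ν * (h₁-product (suc r) μ * h₂-product s ν)) * Π< (suc r) (λ j → linear (suc s) j)
        ≈⟨ solve 5 (λ m n a b c → m :* (n :* (a :* b)) :* c := n :* (m :* (a :* (c :* b)))) refl (norm (suc r ∷ ν)) (norm ν) (h₁-product (suc r) μ) (h₂-product s ν) _ ⟩
      norm ν * (norm (suc r ∷ ν) * (h₁-product (suc r) μ * h₂-product (suc s) (suc r ∷ ν))) ∎)
    where
    open FR
    degrees : sum μ ℕ.+ sum (suc r ∷ ν) ≡ sum (rect (suc r) (suc s))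
    degrees = ≡.trans (exchange (sum μ) (suc r) (sum ν)) (≡.cong (suc r ℕ.+_) e)
    conj-rect : ∀ s j → j ℕ.< suc r → conjPart (rect (suc r) s) (suc j) ≡ s
    conj-rect zero j _ = ≡.refl
    conj-rect (suc s) j lt with j ℕ.<ᵇ suc r | ℕP.<⇒<ᵇ lt
    ... | true | _ = ≡.cong suc (conj-rect s j lt)
    full-row : lowerRow (suc r) (rect (suc r) s) ≈ Π< (suc r) (λ j → linear (suc s) j)
    full-row = trans (Π-cong (suc r) λ j lt → reflexive (≡.cong (λ k → linear (suc k) (suc r ∸ suc j)) (conj-rect s j lt))) (Π-reverse (suc r) (linear (suc s)))

  -- The column is added to the first factor. The norms of the two rectangles enter through
  -- `column-step`; their upper hooks differ by `columnFactor`, which is exactly what h₁ gains.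
  value-column : ∀ r s {μ u} → IsPartition μ → ColumnData s u → sum (rect (suc r) s) ℕ.< N → Value r s (dropZeros u) μ → Value (suc r) s (map suc u) μ
  value-column r s {μ} {u} pμ cu bound (e , v) = ≡.trans (ℕP.+-comm _ (sum μ)) degrees , *-cancelˡ (norm ρ * lowerHooks ρ) (product≉0 (norm≉0 pρ) (lowerHooks≉0 pρ boundρ)) (begin
      norm ρ * lowerHooks ρ * (structure (suc r) s (P (map suc u)) (P μ) * lowerHooks κ)
        ≈⟨ trans (*-congˡ (*-congʳ (structure-comm (suc r) s _ _))) (solve 4 (λ n l b h → n :* l :* (b :* h) := n :* b :* (l :* h)) refl (norm ρ) (lowerHooks ρ) _ (lowerHooks κ)) ⟩
      norm ρ * structure (suc r) s (P μ) (P (map suc u)) * (lowerHooks ρ * lowerHooks κ) ≈⟨ *-congʳ (trans (column-step r s pμ cu degrees bound) (*-congˡ (structure-comm r s _ _))) ⟩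
      norm κ * structure r s (P (dropZeros u)) (P μ) * (lowerHooks ρ * lowerHooks κ) ≈⟨ solve 4 (λ n b l h → n :* b :* (l :* h) := n :* h :* (b :* l)) refl (norm κ) _ (lowerHooks ρ) (lowerHooks κ) ⟩
      norm κ * lowerHooks κ * (structure r s (P (dropZeros u)) (P μ) * lowerHooks ρ) ≈⟨ *-cong (trans (norm-formula (rect-partition (suc r) s) bound) upper-κ) v ⟩
      columnFactor r s * upperHooks ρ * (norm μ * (h₁-product r (dropZeros u) * h₂-product s μ))
        ≈⟨ *-cong (*-congˡ (sym (norm-formula pρ boundρ))) (*-congˡ (*-congʳ (h₁-dropZeros r u))) ⟩
      columnFactor r s * (norm ρ * lowerHooks ρ) * (norm μ * (h₁-product r u * h₂-product s μ))
        ≈⟨ solve 5 (λ c n m a b → c :* n :* (m :* (a :* b)) := n :* (m :* (c :* a :* b))) refl (columnFactor r s) (norm ρ * lowerHooks ρ) (norm μ) (h₁-product r u) (h₂-product s μ) ⟩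
      norm ρ * lowerHooks ρ * (norm μ * (columnFactor r s * h₁-product r u * h₂-product s μ)) ≈⟨ *-congˡ (*-congˡ (*-congʳ (sym (trans (h₁-suc r u) (*-congʳ (reflexive (≡.cong (columnFactor r) (ColumnData.columns cu)))))))) ⟩
      norm ρ * lowerHooks ρ * (norm μ * (h₁-product (suc r) (map suc u) * h₂-product s μ)) ∎)
    where
    open FR
    κ = rect (suc r) s
    ρ = rect r s
    pρ = rect-partition r s
    boundρ : sum ρ ℕ.< N
    boundρ = ℕP.≤-<-trans (ℕP.≤-trans (ℕP.m≤m+n _ s) (ℕP.≤-reflexive (≡.sym (rect-sum-suc r s)))) bound
    degrees : sum μ ℕ.+ sum (map suc u) ≡ sum κ
    degrees = ≡.trans (≡.cong (sum μ ℕ.+_) (ColumnData.longer-sum cu)) (≡.trans (≡.sym (ℕP.+-assoc (sum μ) _ s)) (≡.trans (≡.cong (ℕ._+ s) (≡.trans (ℕP.+-comm (sum μ) _) e)) (≡.sym (rect-sum-suc r s))))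
    upper-κ : upperHooks κ ≈ columnFactor r s * upperHooks ρ
    upper-κ = trans (reflexive (≡.cong upperHooks (rect-suc r s))) (trans (upperHooks-suc-replicate r s) (*-congˡ (sym (upperHooks-dropZeros (replicate s r)))))

  -- Either ν begins with a full row, or it is narrower than the rectangle and its complement μ has
  -- a full first column. So the two reductions reach every complementary pair.
  value : ∀ b r s → r ℕ.+ s ℕ.≤ b → sum (rect r s) ℕ.< N → ∀ {μ ν} → Complementary r s μ ν → Value r s μ ν
  value b zero s _ _ (complementary {w} l d ≡.refl ≡.refl) = ≡.subst₂ (Value 0 s) (≡.sym (dropZeros-empty (proj₂ (flip-bounds d z≤n)))) (≡.sym (dropZeros-empty d)) (value-empty {0} {s} (empty-rect s))
  value b (suc r) s _ _ (complementary {[]} ≡.refl d ≡.refl ≡.refl) = value-empty {suc r} {0} ≡.refl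
  value (suc b) (suc r) (suc s) (s≤s le) bound (complementary {x ∷ w} l (x≤ ∷ d) ≡.refl ≡.refl) with ℕP.m≤n⇒m<n∨m≡n x≤
  ... | inj₂ ≡.refl = value-row r s pμ (bounded⇒partition (dropZeros-bounded (ℕP.≤-refl {suc r} ∷ d))) bound
      (value b (suc r) s (ℕP.≤-trans (ℕP.≤-reflexive (≡.sym (ℕP.+-suc r s))) le) (ℕP.≤-<-trans (ℕP.m≤n+m _ (suc r)) bound)
        (complementary {rows = w} (ℕP.suc-injective l) d ≡.refl (flip-full (suc r) w)))
    where
    pμ : IsPartition (dropZeros (flip (suc r) (suc r ∷ w)))
    pμ = dropZeros-partition (proj₂ (flip-bounds (ℕP.≤-refl ∷ d) ℕP.≤-refl))
  ... | inj₁ (s≤s x≤r) = ≡.subst (λ μ → Value (suc r) (suc s) μ (dropZeros (x ∷ w))) (≡.sym μ≡) (value-column r (suc s) (dropZeros-partition (x≤r ∷ d)) cu bound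
      (value b r (suc s) le (ℕP.≤-<-trans (ℕP.≤-trans (ℕP.m≤m+n _ (suc s)) (ℕP.≤-reflexive (≡.sym (rect-sum-suc r (suc s))))) bound) (complementary {rows = x ∷ w} l (x≤r ∷ d) ≡.refl ≡.refl)))
    where
    u = flip r (x ∷ w)
    decreasing-u : Decreasing r u
    decreasing-u = proj₂ (flip-bounds (x≤r ∷ d) ℕP.≤-refl)
    μ≡ : dropZeros (flip (suc r) (x ∷ w)) ≡ map suc u
    μ≡ = ≡.trans (≡.cong dropZeros (flip-suc (x≤r ∷ d))) (dropZeros-bounded-id (map-suc-bounded decreasing-u))
    length-u : length u ≡ suc s
    length-u = ≡.trans (length-flip r (x ∷ w)) l
    cu : ColumnData (suc s) u
    cu = columnData decreasing-u length-u (ℕP.≤-<-trans (ℕP.≤-trans (sum-bound (decreasing-map-suc decreasing-u)) (ℕP.≤-reflexive area)) bound)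
      where
      sum-bound : ∀ {m v} → Decreasing m v → sum v ℕ.≤ length v ℕ.* m
      sum-bound [] = z≤n
      sum-bound {m} {_ ∷ v} (q ∷ d) = ℕP.+-mono-≤ q (sum-bound (decreasing-weaken q d))
      sum-replicate : ∀ n m → sum (replicate n m) ≡ n ℕ.* m
      sum-replicate zero m = ≡.refl
      sum-replicate (suc n) m = ≡.cong (m ℕ.+_) (sum-replicate n m)
      area : length (map suc u) ℕ.* suc r ≡ sum (rect (suc r) (suc s))
      area = ≡.trans (≡.cong (ℕ._* suc r) (≡.trans (ListP.length-map suc u) length-u)) (≡.sym (≡.trans (≡.cong sum (rect-replicate r (suc s))) (sum-replicate (suc s) (suc r))))

  structure≉0 : ∀ r s → sum (rect r s) ℕ.< N → ∀ {μ ν} → Complementary r s μ ν → ¬ structure r s (P μ) (P ν) ≈ 0#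
  structure≉0 r s bound c@(complementary {w} l d ≡.refl ≡.refl) z = product≉0 (norm≉0 (dropZeros-partition d))
    (product≉0 (h₁≉0 (dropZeros-bounded (proj₂ (flip-bounds d ℕP.≤-refl))) ℕP.≤-refl) (h₂≉0 (dropZeros w) (ℕP.≤-trans (length-dropZeros w) (ℕP.≤-reflexive l))))
    (trans (sym (proj₂ (value (r ℕ.+ s) r s ℕP.≤-refl bound c))) (trans (*-congʳ z) (zeroˡ _)))

-- Integer polynomials through their values

module Evaluation where
  open import Data.Integer using (+_; ∣_∣)
  open IntegerSolver ℤP.+-*-commutativeRing using (solve; _:=_; _:+_; _:*_; :-_; :0; :1)

  -- Coefficient lists may end in zeros. Values at natural numbers settle equality without
  -- bookkeeping of coefficients, because a nonzero polynomial has only finitely many natural roots.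
  ev : Poly → ℕ → ℤ
  ev []      n = + 0
  ev (a ∷ p) n = a ℤ.+ + n ℤ.* ev p n

  ev-+ : ∀ p q n → ev (p +P q) n ≡ ev p n ℤ.+ ev q n
  ev-+ [] q n = ≡.sym (ℤP.+-identityˡ _)
  ev-+ (a ∷ p) [] n = ≡.sym (ℤP.+-identityʳ _)
  ev-+ (a ∷ p) (b ∷ q) n = ≡.trans (≡.cong (λ e → a ℤ.+ b ℤ.+ + n ℤ.* e) (ev-+ p q n))
    (solve 5 (λ a b n p q → a :+ b :+ n :* (p :+ q) := (a :+ n :* p) :+ (b :+ n :* q)) ≡.refl a b (+ n) (ev p n) (ev q n))

  ev-neg : ∀ p n → ev (negP p) n ≡ ℤ.- ev p n
  ev-neg [] n = ≡.refl
  ev-neg (a ∷ p) n = ≡.trans (≡.cong (λ e → ℤ.- a ℤ.+ + n ℤ.* e) (ev-neg p n))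
    (solve 3 (λ a n p → :- a :+ n :* (:- p) := :- (a :+ n :* p)) ≡.refl a (+ n) (ev p n))

  ev-scale : ∀ c p n → ev (scaleP c p) n ≡ c ℤ.* ev p n
  ev-scale c [] n = ≡.sym (ℤP.*-zeroʳ c)
  ev-scale c (a ∷ p) n = ≡.trans (≡.cong (λ e → c ℤ.* a ℤ.+ + n ℤ.* e) (ev-scale c p n))
    (solve 4 (λ c a n p → c :* a :+ n :* (c :* p) := c :* (a :+ n :* p)) ≡.refl c a (+ n) (ev p n))

  ev-* : ∀ p q n → ev (p *P q) n ≡ ev p n ℤ.* ev q n
  ev-* [] q n = ≡.refl
  ev-* (a ∷ p) q n = ≡.trans (ev-+ (scaleP a q) _ n) (≡.trans (≡.cong₂ (λ e f → e ℤ.+ (+ 0 ℤ.+ + n ℤ.* f)) (ev-scale a q n) (ev-* p q n))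
    (solve 4 (λ a q n p → a :* q :+ (:0 :+ n :* (p :* q)) := (a :+ n :* p) :* q) ≡.refl a (ev q n) (+ n) (ev p n)))

  isZero? : ∀ p → Dec (IsZeroP p)
  isZero? = All.all? (ℤ._≟ + 0)

  zero-ev : ∀ {p} → IsZeroP p → ∀ n → ev p n ≡ + 0
  zero-ev [] n = ≡.refl
  zero-ev (≡.refl ∷ z) n = ≡.trans (≡.cong (λ e → + 0 ℤ.+ + n ℤ.* e) (zero-ev z n)) (≡.trans (ℤP.+-identityˡ _) (ℤP.*-zeroʳ (+ n)))

  -- A root n of a polynomial divides its constant term.
  root-bound : ∀ a e n → a ℤ.+ + n ℤ.* e ≡ + 0 → ∣ a ∣ ℕ.< n → a ≡ + 0 × e ≡ + 0
  root-bound a e n@(suc _) z lt = a≡0 , e≡0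
    where
    ∣a∣ : ∣ a ∣ ≡ n ℕ.* ∣ e ∣
    ∣a∣ = ≡.trans (≡.cong ∣_∣ (≡.trans (solve 2 (λ a b → a := a :+ b :+ :- b) ≡.refl a (+ n ℤ.* e)) (≡.trans (≡.cong (ℤ._+ ℤ.- (+ n ℤ.* e)) z) (ℤP.+-identityˡ (ℤ.- (+ n ℤ.* e))))))
      (≡.trans (ℤP.∣-i∣≡∣i∣ (+ n ℤ.* e)) (ℤP.abs-* (+ n) e))
    e≡0 : e ≡ + 0
    e≡0 = ℤP.∣i∣≡0⇒i≡0 (small ∣ e ∣ ∣a∣)
      where
      small : ∀ k → ∣ a ∣ ≡ n ℕ.* k → k ≡ 0
      small zero _ = ≡.refl
      small (suc k) eq = ⊥-elim (ℕP.<⇒≱ lt (ℕP.≤-trans (ℕP.m≤m*n n (suc k)) (ℕP.≤-reflexive (≡.sym eq))))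
    a≡0 : a ≡ + 0
    a≡0 = ≡.trans (≡.sym (ℤP.+-identityʳ a)) (≡.trans (≡.cong (λ e → a ℤ.+ e) (≡.sym (≡.trans (≡.cong (+ n ℤ.*_) e≡0) (ℤP.*-zeroʳ (+ n))))) z)

  -- By `root-bound` a large root forces the constant term to vanish and is also a root of the
  -- remaining list, so the bound grows by induction along the list.
  nonvanishing : ∀ p → ¬ IsZeroP p → Σ ℕ λ B → ∀ n → B ℕ.≤ n → ev p n ≢ + 0
  nonvanishing [] nz = ⊥-elim (nz [])
  nonvanishing (a ∷ p) nz = at (isZero? p)
    where
    at : Dec (IsZeroP p) → Σ ℕ λ B → ∀ n → B ℕ.≤ n → ev (a ∷ p) n ≢ + 0
    at (yes z) = suc ∣ a ∣ , λ n le e → nz (proj₁ (root-bound a (ev p n) n e le) ∷ z)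
    at (no nz′) = let (B , h) = nonvanishing p nz′ in suc (∣ a ∣ ℕ.+ B) , λ n le e →
      h n (ℕP.≤-trans (ℕP.m≤n+m B (suc ∣ a ∣)) le) (proj₂ (root-bound a (ev p n) n e (ℕP.≤-trans (ℕP.m≤m+n (suc ∣ a ∣) B) le)))

  eventually-zero : ∀ p B → (∀ n → B ℕ.≤ n → ev p n ≡ + 0) → IsZeroP p
  eventually-zero p B h = at (isZero? p)
    where
    at : Dec (IsZeroP p) → IsZeroP p
    at (yes z) = z
    at (no nz) = let (B′ , h′) = nonvanishing p nz in ⊥-elim (h′ (B ℕ.+ B′) (ℕP.m≤n+m B′ B) (h (B ℕ.+ B′) (ℕP.m≤m+n B B′)))

  infix 4 _≗_
  record _≗_ (p q : Poly) : Set where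
    constructor pointwise
    field at : ∀ n → ev p n ≡ ev q n
  open _≗_ public

  difference : ∀ p q n → ev (p +P negP q) n ≡ ev p n ℤ.- ev q n
  difference p q n = ≡.trans (ev-+ p (negP q) n) (≡.cong (λ e → ev p n ℤ.+ e) (ev-neg q n))

  ≗⇒≈P : ∀ {p q} → p ≗ q → p ≈P q
  ≗⇒≈P {p} {q} e = eventually-zero _ 0 λ n _ → ≡.trans (difference p q n) (ℤP.i≡j⇒i-j≡0 (at e n))

  ≈P⇒≗ : ∀ {p q} → p ≈P q → p ≗ q
  ≈P⇒≗ {p} {q} z = pointwise λ n → ℤP.i-j≡0⇒i≡j _ _ (≡.trans (≡.sym (difference p q n)) (zero-ev z n))

  polynomials : CommutativeRing 0ℓ 0ℓ
  polynomials = record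
    { Carrier = Poly ; _≈_ = _≗_ ; _+_ = _+P_ ; _*_ = _*P_ ; -_ = negP ; 0# = [] ; 1# = oneP
    ; isCommutativeRing = record
      { isRing = record
        { +-isAbelianGroup = record
          { isGroup = record
            { isMonoid = record
              { isSemigroup = record
                { isMagma = record
                  { isEquivalence = record { refl = pointwise λ n → ≡.refl ; sym = λ e → pointwise λ n → ≡.sym (at e n) ; trans = λ e f → pointwise λ n → ≡.trans (at e n) (at f n) }
                  ; ∙-cong = λ {p} {p′} {q} {q′} e f → pointwise λ n → sum₂ p q n (sum₂′ p′ q′ n (≡.cong₂ ℤ._+_ (at e n) (at f n))) }
                ; assoc = λ p q r → pointwise λ n → sum₂ (p +P q) r n (sum₂′ p (q +P r) n
                    (≡.trans (≡.cong (ℤ._+ ev r n) (ev-+ p q n)) (≡.trans (ℤP.+-assoc (ev p n) _ _) (≡.cong (λ e → ev p n ℤ.+ e) (≡.sym (ev-+ q r n)))))) }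
              ; identity = (λ p → pointwise λ n → ≡.refl) , λ p → pointwise λ n → sum₂ p [] n (ℤP.+-identityʳ _) }
            ; inverse = (λ p → pointwise λ n → sum₂ (negP p) p n (≡.trans (≡.cong (ℤ._+ ev p n) (ev-neg p n)) (ℤP.+-inverseˡ (ev p n))))
                , λ p → pointwise λ n → ≡.trans (difference p p n) (ℤP.+-inverseʳ (ev p n))
            ; ⁻¹-cong = λ {p} {q} e → pointwise λ n → ≡.trans (ev-neg p n) (≡.trans (≡.cong ℤ.-_ (at e n)) (≡.sym (ev-neg q n))) }
          ; comm = λ p q → pointwise λ n → sum₂ p q n (sum₂′ q p n (ℤP.+-comm (ev p n) (ev q n))) }
        ; *-cong = λ {p} {p′} {q} {q′} e f → pointwise λ n → prod₂ p q n (prod₂′ p′ q′ n (≡.cong₂ ℤ._*_ (at e n) (at f n)))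
        ; *-assoc = λ p q r → pointwise λ n → prod₂ (p *P q) r n (prod₂′ p (q *P r) n
                    (≡.trans (≡.cong (ℤ._* ev r n) (ev-* p q n)) (≡.trans (ℤP.*-assoc (ev p n) _ _) (≡.cong (ev p n ℤ.*_) (≡.sym (ev-* q r n))))))
        ; *-identity = (λ p → pointwise λ n → prod₂ oneP p n (≡.trans (≡.cong (ℤ._* ev p n) (one n)) (ℤP.*-identityˡ _)))
            , λ p → pointwise λ n → prod₂ p oneP n (≡.trans (≡.cong (ev p n ℤ.*_) (one n)) (ℤP.*-identityʳ _))
        ; distrib = (λ p q r → pointwise λ n → prod₂ p (q +P r) n (sum₂′ (p *P q) (p *P r) n
              (≡.trans (≡.cong (ev p n ℤ.*_) (ev-+ q r n)) (≡.trans (ℤP.*-distribˡ-+ (ev p n) _ _) (≡.sym (≡.cong₂ ℤ._+_ (ev-* p q n) (ev-* p r n)))))))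
            , λ p q r → pointwise λ n → prod₂ (q +P r) p n (sum₂′ (q *P p) (r *P p) n
              (≡.trans (≡.cong (ℤ._* ev p n) (ev-+ q r n)) (≡.trans (ℤP.*-distribʳ-+ (ev p n) (ev q n) (ev r n)) (≡.sym (≡.cong₂ ℤ._+_ (ev-* q p n) (ev-* r p n)))))) }
      ; *-comm = λ p q → pointwise λ n → prod₂ p q n (prod₂′ q p n (ℤP.*-comm (ev p n) (ev q n))) } }
    where
    sum₂ : ∀ p q n {x} → ev p n ℤ.+ ev q n ≡ x → ev (p +P q) n ≡ x
    sum₂ p q n = ≡.trans (ev-+ p q n)
    sum₂′ : ∀ p q n {x} → x ≡ ev p n ℤ.+ ev q n → x ≡ ev (p +P q) n
    sum₂′ p q n e = ≡.trans e (≡.sym (ev-+ p q n))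
    prod₂ : ∀ p q n {x} → ev p n ℤ.* ev q n ≡ x → ev (p *P q) n ≡ x
    prod₂ p q n = ≡.trans (ev-* p q n)
    prod₂′ : ∀ p q n {x} → x ≡ ev p n ℤ.* ev q n → x ≡ ev (p *P q) n
    prod₂′ p q n e = ≡.trans e (≡.sym (ev-* p q n))
    one : ∀ n → ev oneP n ≡ + 1
    one n = ≡.trans (≡.cong (λ e → + 1 ℤ.+ e) (ℤP.*-zeroʳ (+ n))) ≡.refl

  product-nonzero : ∀ {p q} → ¬ IsZeroP p → ¬ IsZeroP q → ¬ IsZeroP (p *P q)
  product-nonzero {p} {q} np nq z = let (B , h) = nonvanishing p np ; (B′ , h′) = nonvanishing q nq in
    split (B ℕ.+ B′) (h _ (ℕP.m≤m+n B B′)) (h′ _ (ℕP.m≤n+m B′ B))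
    where
    open import Data.Sum using (inj₁; inj₂)
    split : ∀ n → ev p n ≢ + 0 → ev q n ≢ + 0 → _
    split n hp hq with ℤP.i*j≡0⇒i≡0∨j≡0 (ev p n) (≡.trans (≡.sym (ev-* p q n)) (zero-ev z n))
    ... | inj₁ e = hp e
    ... | inj₂ e = hq e

  -- At every n beyond the roots of `d` the values can be cancelled, and agreement for all large n
  -- is enough.
  *P-cancel : ∀ d {p q} → ¬ IsZeroP d → d *P p ≗ d *P q → p ≗ q
  *P-cancel d {p} {q} nd e = ≈P⇒≗ (let (B , h) = nonvanishing d nd in eventually-zero _ B λ n le → ≡.trans (difference p q n)
    (ℤP.i≡j⇒i-j≡0 (ℤP.*-cancelˡ-≡ (ev d n) _ _ {{ℤ.≢-nonZero (h n le)}} (≡.trans (≡.sym (ev-* d p n)) (≡.trans (at e n) (ev-* d q n))))))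

-- The field of rational functions in α

-- A raw fraction may have denominator zero, which spoils transitivity of `_≈F_`. The relation
-- `x ⇝ c` is meant to carry validity along with the value, so that equations can be moved into a
-- genuine field and back.
record RationalFunctions : Set₁ where
  field
    field-of-fractions : CoeffField
  open CoeffField field-of-fractions
  open FieldFacts field-of-fractions using (linear)
  infix 4 _⇝_
  field
    _⇝_ : RF → Carrier → Set
    ⇝-≈ : ∀ {x c d} → x ⇝ c → c ≈ d → x ⇝ d
    preserve : ∀ {x y c d} → x ⇝ c → y ⇝ d → c ≈ d → x ≈F y
    reflect : ∀ {x y c d} → x ⇝ c → y ⇝ d → x ≈F y → c ≈ d
    ⇝-valid : ∀ x → ValidRF x → Σ Carrier (x ⇝_)
    ⇝-+ : ∀ {x y c d} → x ⇝ c → y ⇝ d → x +F y ⇝ c + d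
    ⇝-* : ∀ {x y c d} → x ⇝ c → y ⇝ d → x *F y ⇝ c * d
    ⇝-0 : 0F ⇝ 0#
    ⇝-1 : 1F ⇝ 1#
    ⇝-α : αF ⇝ α
    ⇝-ℕ : ∀ n → fromℕF n ⇝ ι n
    ⇝-linear : ∀ a b → fromP (linP a b) ⇝ linear a b
    ⇝-product : ∀ {p q c d} → fromP p ⇝ c → fromP q ⇝ d → fromP (p *P q) ⇝ c * d

module Fractions where
  open import Data.Integer using (+_)
  open Evaluation
  open CommutativeRing polynomials using (setoid) renaming (sym to ≗-sym; trans to ≗-trans; *-congˡ to *P-congˡ; *-congʳ to *P-congʳ; +-cong to +P-cong; refl to ≗-refl)
  open IntegerSolver polynomials using (solve; _:=_; _:+_; _:*_; :-_; :0; :1)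

  record _≃_ (x y : RF) : Set where
    constructor crossed
    field cross : num x *P den y ≗ num y *P den x
  open _≃_ public

  F : Set
  F = Σ RF ValidRF

  one-nonzero : ¬ IsZeroP oneP
  one-nonzero (() ∷ _)

  polynomial : Poly → F
  polynomial p = fromP p , one-nonzero

  negate : RF → RF
  negate x = negP (num x) / den x

  field-ring : CommutativeRing 0ℓ 0ℓ
  field-ring = record
    { Carrier = F ; _≈_ = λ x y → proj₁ x ≃ proj₁ y
    ; _+_ = λ x y → proj₁ x +F proj₁ y , product-nonzero (proj₂ x) (proj₂ y)
    ; _*_ = λ x y → proj₁ x *F proj₁ y , product-nonzero (proj₂ x) (proj₂ y)
    ; -_ = λ x → negate (proj₁ x) , proj₂ x ; 0# = 0F , one-nonzero ; 1# = 1F , one-nonzero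
    ; isCommutativeRing = record
      { isRing = record
        { +-isAbelianGroup = record
          { isGroup = record
            { isMonoid = record
              { isSemigroup = record
                { isMagma = record
                  { isEquivalence = record { refl = crossed ≗-refl ; sym = λ e → crossed (≗-sym (cross e)) ; trans = λ {x} {y} {z} → transitive x y z }
                  ; ∙-cong = λ {x} {x′} {y} {y′} e f → crossed (≗-trans
                      (solve 6 (λ a b c d b′ d′ → (a :* d :+ c :* b) :* (b′ :* d′) := (a :* b′) :* (d :* d′) :+ (c :* d′) :* (b :* b′)) ≗-refl (num (proj₁ x)) (den (proj₁ x)) (num (proj₁ y)) (den (proj₁ y)) (den (proj₁ x′)) (den (proj₁ y′)))
                      (≗-trans (+P-cong (*P-congʳ (cross e)) (*P-congʳ (cross f)))
                      (solve 6 (λ a b c d b′ d′ → (a :* b′) :* (d′ :* d) :+ (c :* d′) :* (b′ :* b) := (a :* d :+ c :* b) :* (b′ :* d′)) ≗-refl (num (proj₁ x′)) (den (proj₁ x′)) (num (proj₁ y′)) (den (proj₁ y′)) (den (proj₁ x)) (den (proj₁ y))))) }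
                ; assoc = λ x y z → crossed (solve 6 (λ a b c d e f → ((a :* d :+ c :* b) :* f :+ e :* (b :* d)) :* (b :* (d :* f)) := (a :* (d :* f) :+ (c :* f :+ e :* d) :* b) :* (b :* d :* f)) ≗-refl
                    (num (proj₁ x)) (den (proj₁ x)) (num (proj₁ y)) (den (proj₁ y)) (num (proj₁ z)) (den (proj₁ z))) }
              ; identity = (λ x → crossed (solve 2 (λ a b → (:0 :* b :+ a :* :1) :* b := a :* (:1 :* b)) ≗-refl (num (proj₁ x)) (den (proj₁ x))))
                  , λ x → crossed (solve 2 (λ a b → (a :* :1 :+ :0 :* b) :* b := a :* (b :* :1)) ≗-refl (num (proj₁ x)) (den (proj₁ x))) }
            ; inverse = (λ x → crossed (solve 2 (λ a b → (:- a :* b :+ a :* b) :* :1 := :0 :* (b :* b)) ≗-refl (num (proj₁ x)) (den (proj₁ x))))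
                  , λ x → crossed (solve 2 (λ a b → (a :* b :+ :- a :* b) :* :1 := :0 :* (b :* b)) ≗-refl (num (proj₁ x)) (den (proj₁ x)))
            ; ⁻¹-cong = λ {x} {y} e → crossed (≗-trans (solve 2 (λ a b → :- a :* b := :- (a :* b)) ≗-refl (num (proj₁ x)) (den (proj₁ y)))
                (≗-trans (CommutativeRing.-‿cong polynomials (cross e)) (solve 2 (λ a b → :- (a :* b) := :- a :* b) ≗-refl (num (proj₁ y)) (den (proj₁ x))))) }
          ; comm = λ x y → crossed (solve 4 (λ a b c d → (a :* d :+ c :* b) :* (d :* b) := (c :* b :+ a :* d) :* (b :* d)) ≗-refl (num (proj₁ x)) (den (proj₁ x)) (num (proj₁ y)) (den (proj₁ y))) }
        ; *-cong = λ {x} {x′} {y} {y′} → product-cong x x′ y y′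
        ; *-assoc = λ x y z → crossed (solve 6 (λ a b c d e f → a :* c :* e :* (b :* (d :* f)) := a :* (c :* e) :* (b :* d :* f)) ≗-refl
                    (num (proj₁ x)) (den (proj₁ x)) (num (proj₁ y)) (den (proj₁ y)) (num (proj₁ z)) (den (proj₁ z)))
        ; *-identity = (λ x → crossed (solve 2 (λ a b → :1 :* a :* b := a :* (:1 :* b)) ≗-refl (num (proj₁ x)) (den (proj₁ x))))
            , λ x → crossed (solve 2 (λ a b → a :* :1 :* b := a :* (b :* :1)) ≗-refl (num (proj₁ x)) (den (proj₁ x)))
        ; distrib = (λ x y z → crossed (solve 6 (λ a b c d e f → a :* (c :* f :+ e :* d) :* (b :* d :* (b :* f)) := (a :* c :* (b :* f) :+ a :* e :* (b :* d)) :* (b :* (d :* f))) ≗-refl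
                    (num (proj₁ x)) (den (proj₁ x)) (num (proj₁ y)) (den (proj₁ y)) (num (proj₁ z)) (den (proj₁ z))))
            , λ x y z → crossed (solve 6 (λ a b c d e f → (c :* f :+ e :* d) :* a :* (d :* b :* (f :* b)) := (c :* a :* (f :* b) :+ e :* a :* (d :* b)) :* (d :* f :* b)) ≗-refl
                    (num (proj₁ x)) (den (proj₁ x)) (num (proj₁ y)) (den (proj₁ y)) (num (proj₁ z)) (den (proj₁ z))) }
      ; *-comm = λ x y → crossed (solve 4 (λ a b c d → a :* c :* (d :* b) := c :* a :* (b :* d)) ≗-refl (num (proj₁ x)) (den (proj₁ x)) (num (proj₁ y)) (den (proj₁ y))) } }
    where
    transitive : ∀ (x y z : F) → proj₁ x ≃ proj₁ y → proj₁ y ≃ proj₁ z → proj₁ x ≃ proj₁ z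
    transitive (a / b , _) (c / d , nd) (e / f , _) p q = crossed (*P-cancel d nd (≗-trans (solve 3 (λ d a f → d :* (a :* f) := (a :* d) :* f) ≗-refl d a f)
      (≗-trans (*P-congʳ (cross p)) (≗-trans (solve 3 (λ c b f → c :* b :* f := c :* f :* b) ≗-refl c b f)
        (≗-trans (*P-congʳ (cross q)) (solve 3 (λ e d b → e :* d :* b := d :* (e :* b)) ≗-refl e d b))))))
    product-cong : ∀ (x x′ y y′ : F) → proj₁ x ≃ proj₁ x′ → proj₁ y ≃ proj₁ y′ → (proj₁ x *F proj₁ y) ≃ (proj₁ x′ *F proj₁ y′)
    product-cong (a / b , _) (a′ / b′ , _) (c / d , _) (c′ / d′ , _) p q = crossed (≗-trans (solve 4 (λ a c b d → a :* c :* (b :* d) := (a :* b) :* (c :* d)) ≗-refl a c b′ d′)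
      (≗-trans (CommutativeRing.*-cong polynomials (cross p) (cross q)) (solve 4 (λ a c b d → (a :* b) :* (c :* d) := a :* c :* (b :* d)) ≗-refl a′ c′ b d)))

  module FF = CommutativeRing field-ring
  open Naturals field-ring using (ι)

  ι-value : ∀ n → proj₁ (ι n) ≃ fromℕF n
  ι-value zero = crossed (≈P⇒≗ {[]} (≡.refl ∷ []))
  ι-value (suc k) = FF.trans {ι (suc k)} {FF._+_ FF.1# (polynomial (+ k ∷ []))} {polynomial (+ suc k ∷ [])} (FF.+-congˡ {FF.1#} {ι k} {polynomial (+ k ∷ [])} (ι-value k))
    (crossed (solve 1 (λ k → (:1 :* :1 :+ k :* :1) :* :1 := (:1 :+ k) :* (:1 :* :1)) ≗-refl (+ k ∷ [])))

  X : F
  X = polynomial (+ 0 ∷ + 1 ∷ [])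

  linearF : ℕ → ℕ → F
  linearF a b = FF._+_ (ι a) (FF._*_ (ι b) X)

  linear-value : ∀ a b → proj₁ (linearF a b) ≃ fromP (linP a b)
  linear-value a b = FF.trans {linearF a b} {FF._+_ (polynomial (+ a ∷ [])) (FF._*_ (polynomial (+ b ∷ [])) X)} {polynomial (linP a b)}
    (FF.+-cong {ι a} {polynomial (+ a ∷ [])} {FF._*_ (ι b) X} {FF._*_ (polynomial (+ b ∷ [])) X} (ι-value a) (FF.*-congʳ {X} {ι b} {polynomial (+ b ∷ [])} (ι-value b)))
    (crossed (≗-trans (solve 3 (λ a b x → (a :* (:1 :* :1) :+ b :* x :* :1) :* :1 := (a :+ b :* x) :* (:1 :* (:1 :* :1))) ≗-refl (+ a ∷ []) (+ b ∷ []) (num αF))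
      (*P-congʳ {oneP *P (oneP *P oneP)} combined)))
    where
    combined : (+ a ∷ []) +P (+ b ∷ []) *P num αF ≗ linP a b
    combined = pointwise λ n → ≡.trans (ev-+ (+ a ∷ []) ((+ b ∷ []) *P num αF) n) (≡.trans (≡.cong (λ e → ev (+ a ∷ []) n ℤ.+ e) (ev-* (+ b ∷ []) (num αF) n))
      (Z.solve 3 (λ a b n → (a Z.:+ n Z.:* Z.:0) Z.:+ (b Z.:+ n Z.:* Z.:0) Z.:* (Z.:0 Z.:+ n Z.:* (Z.:1 Z.:+ n Z.:* Z.:0)) Z.:= a Z.:+ n Z.:* (b Z.:+ n Z.:* Z.:0)) ≡.refl (+ a) (+ b) (+ n)))
      where module Z = IntegerSolver ℤP.+-*-commutativeRing

  polynomial-injective : ∀ {p q} → fromP p ≃ fromP q → p ≗ q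
  polynomial-injective {p} {q} e = ≗-trans (solve 1 (λ p → p := p :* :1) ≗-refl p) (≗-trans (cross e) (solve 1 (λ p → p :* :1 := p) ≗-refl q))

  reciprocal : F → F
  reciprocal (x , v) = choose (isZero? (num x))
    where
    choose : Dec (IsZeroP (num x)) → F
    -- A default value at 0, which the law for inverses excludes.
    choose (yes _) = x , v
    choose (no nz) = den x / num x , nz

  rationalFunctions : CoeffField
  rationalFunctions = record
    { commutativeRing = field-ring
    ; _≈?_ = λ x y → decide (proj₁ x) (proj₁ y) (isZero? (num (proj₁ x) *P den (proj₁ y) +P negP (num (proj₁ y) *P den (proj₁ x))))
    ; _⁻¹ = reciprocal
    ; inverse = λ { (x , v) nz → inverts x v nz (isZero? (num x)) ≡.refl }
    ; α = X
    ; independent = λ a b c d e → read a b c d (polynomial-injective (FF.trans {polynomial (linP a b)} {linearF a b} {polynomial (linP c d)}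
        (FF.sym {linearF a b} {polynomial (linP a b)} (linear-value a b)) (FF.trans {linearF a b} {linearF c d} {polynomial (linP c d)} e (linear-value c d)))) }
    where
    decide : ∀ x y → Dec ((num x *P den y) ≈P (num y *P den x)) → Dec (x ≃ y)
    decide x y (yes z) = yes (crossed (≈P⇒≗ z))
    decide x y (no nz) = no λ e → nz (≗⇒≈P (cross e))
    inverts : ∀ x v → ¬ (x ≃ 0F) → ∀ c → isZero? (num x) ≡ c → (x *F proj₁ (reciprocal (x , v))) ≃ 1F
    inverts x v nz (yes z) _ = ⊥-elim (nz (crossed (≗-trans (*P-congʳ {oneP} {num x} {[]} (pointwise (zero-ev z))) ≗-refl)))
    inverts x v nz (no n) eq rewrite eq = crossed (solve 2 (λ a b → a :* b :* :1 := :1 :* (b :* a)) ≗-refl (num x) (den x))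
    -- A linear polynomial is recovered from its values at 0 and 1.
    read : ∀ a b c d → linP a b ≗ linP c d → a ≡ c × b ≡ d
    read a b c d e = a≡c , ℕP.+-cancelˡ-≡ a b d (≡.trans (ℤP.+-injective (≡.trans (at-one a b) (≡.trans (at e 1) (≡.sym (at-one c d))))) (≡.cong (ℕ._+ d) (≡.sym a≡c)))
      where
      at-zero : ∀ a b → ev (linP a b) 0 ≡ + a
      at-zero a b = ℤP.+-identityʳ (+ a)
      at-one : ∀ a b → + a ℤ.+ + b ≡ ev (linP a b) 1
      at-one a b = ≡.cong (λ e → + a ℤ.+ e) (≡.sym (≡.trans (ℤP.*-identityˡ _) (ℤP.+-identityʳ (+ b))))
      a≡c : a ≡ c
      a≡c = ℤP.+-injective (≡.trans (≡.sym (at-zero a b)) (≡.trans (at e 0) (at-zero c d)))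

  realization : RationalFunctions
  realization = record
    { field-of-fractions = rationalFunctions
    ; _⇝_ = λ x c → ValidRF x × x ≃ proj₁ c
    ; ⇝-≈ = λ { {x} {c} {d} (v , e) f → v , FF.trans {x , v} {c} {d} e f }
    ; preserve = λ { {x} {y} {c} {d} (v , e) (w , f) g → ≗⇒≈P (cross (FF.trans {x , v} {c} {y , w} e (FF.trans {c} {d} {y , w} g (FF.sym {y , w} {d} f)))) }
    ; reflect = λ { {x} {y} {c} {d} (v , e) (w , f) g → FF.trans {c} {x , v} {d} (FF.sym {x , v} {c} e) (FF.trans {x , v} {y , w} {d} (crossed (≈P⇒≗ g)) f) }
    ; ⇝-valid = λ x v → (x , v) , v , FF.refl {x , v}
    ; ⇝-+ = λ { {x} {y} {c} {d} (v , e) (w , f) → product-nonzero v w , FF.+-cong {x , v} {c} {y , w} {d} e f }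
    ; ⇝-* = λ { {x} {y} {c} {d} (v , e) (w , f) → product-nonzero v w , FF.*-cong {x , v} {c} {y , w} {d} e f }
    ; ⇝-0 = one-nonzero , FF.refl {FF.0#}
    ; ⇝-1 = one-nonzero , FF.refl {FF.1#}
    ; ⇝-α = one-nonzero , FF.refl {X}
    ; ⇝-ℕ = λ n → one-nonzero , FF.sym {Naturals.ι field-ring n} {polynomial (+ n ∷ [])} (ι-value n)
    ; ⇝-linear = λ a b → one-nonzero , FF.sym {linearF a b} {polynomial (linP a b)} (linear-value a b)
    ; ⇝-product = λ { {p} {q} {c} {d} (v , e) (w , f) → one-nonzero , FF.trans {polynomial (p *P q)} {FF._*_ (polynomial p) (polynomial q)} {FF._*_ c d}
        (crossed (*P-congˡ {p *P q} unit)) (FF.*-cong {polynomial p} {c} {polynomial q} {d} e f) } }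
    where
    unit : oneP *P oneP ≗ oneP
    unit = CommutativeRing.*-identityˡ polynomials oneP

-- Multisets of parts and the constants z

module Multisets where
  open import Data.Nat using (_+_; _*_; _≤_; _<_; _^_; _!)

  data Compare (i x : ℕ) : Bool → Set where
    same  : i ≡ x → Compare i x true
    other : i ≢ x → Compare i x false

  compare : ∀ i x → Compare i x (i ≡ᵇ x)
  compare i x with i ≡ᵇ x in eq
  ... | true  = same (ℕP.≡ᵇ⇒≡ i x (≡.subst T (≡.sym eq) _))
  ... | false = other λ e → ≡.subst T eq (ℕP.≡⇒≡ᵇ i x e)

  remove : ℕ → List ℕ → List ℕ
  remove x []       = []
  remove x (y ∷ ys) = if x ≡ᵇ y then ys else y ∷ remove x ys

  all-remove : ∀ {Q : ℕ → Set} x {v} → All Q v → All Q (remove x v)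
  all-remove x [] = []
  all-remove x {y ∷ v} (p ∷ a) with x ≡ᵇ y
  ... | true  = a
  ... | false = p ∷ all-remove x a

  occ-other : ∀ {i x} v → i ≢ x → occ i (x ∷ v) ≡ occ i v
  occ-other {i} {x} v ne with i ≡ᵇ x | compare i x
  ... | true  | same e = ⊥-elim (ne e)
  ... | false | _      = ≡.refl

  occ-same : ∀ x v → occ x (x ∷ v) ≡ suc (occ x v)
  occ-same x v with x ≡ᵇ x | compare x x
  ... | true  | _ = ≡.refl
  ... | false | other ne = ⊥-elim (ne ≡.refl)

  occ-∷-cong : ∀ i x {u v} → occ i u ≡ occ i v → occ i (x ∷ u) ≡ occ i (x ∷ v)
  occ-∷-cong i x e with i ≡ᵇ x
  ... | true  = ≡.cong suc e
  ... | false = e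

  occ-∷-cancel : ∀ i x {u v} → occ i (x ∷ u) ≡ occ i (x ∷ v) → occ i u ≡ occ i v
  occ-∷-cancel i x e with i ≡ᵇ x
  ... | true  = ℕP.suc-injective e
  ... | false = e

  occ-swap : ∀ i x y v → occ i (x ∷ y ∷ v) ≡ occ i (y ∷ x ∷ v)
  occ-swap i x y v with i ≡ᵇ x | i ≡ᵇ y
  ... | true  | true  = ≡.refl
  ... | true  | false = ≡.refl
  ... | false | true  = ≡.refl
  ... | false | false = ≡.refl

  occ-remove : ∀ x v → occ x v ≢ 0 → ∀ i → occ i v ≡ occ i (x ∷ remove x v)
  occ-remove x [] nz i = ⊥-elim (nz ≡.refl)
  occ-remove x (y ∷ v) nz i with x ≡ᵇ y | compare x y
  ... | true  | same ≡.refl = ≡.refl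
  ... | false | other ne = ≡.trans (occ-∷-cong i y {v} {x ∷ remove x v} (occ-remove x v nz i)) (occ-swap i y x (remove x v))

  occ-beyond : ∀ v {i} → sum v < i → occ i v ≡ 0
  occ-beyond [] _ = ≡.refl
  occ-beyond (x ∷ v) {i} lt = ≡.trans (occ-other v λ { ≡.refl → ℕP.<⇒≱ lt (ℕP.m≤m+n i (sum v)) }) (occ-beyond v (ℕP.≤-<-trans (ℕP.m≤n+m (sum v) x) lt))

  Same : List ℕ → List ℕ → Set
  Same a b = ∀ i → occ i a ≡ occ i b

  and-sound : ∀ n p → T (and (applyUpTo p n)) → ∀ i → i < n → T (p i)
  and-sound (suc n) p t i lt with p 0 in eq
  and-sound (suc n) p t zero _ | true = ≡.subst T (≡.sym eq) _
  and-sound (suc n) p t (suc i) (s≤s lt) | true = and-sound n (λ j → p (suc j)) t i lt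

  and-complete : ∀ n p → (∀ i → T (p i)) → T (and (applyUpTo p n))
  and-complete zero p h = _
  and-complete (suc n) p h with p 0 | h 0
  ... | true | _ = and-complete n (λ i → p (suc i)) λ i → h (suc i)

  data Comparison (a b : List ℕ) : Bool → Set where
    equal   : Same a b → Comparison a b true
    unequal : ¬ Same a b → Comparison a b false

  -- The boolean test looks at finitely many multiplicities. That is enough, because no entry of a
  -- list exceeds its sum.
  comparison : ∀ a b → Comparison a b (sameMultisetᵇ a b)
  comparison a b with sameMultisetᵇ a b in eq
  ... | true = equal everywhere
    where
    bound = suc (sum a + sum b)
    test = λ i → occ i a ≡ᵇ occ i b
    everywhere : Same a b
    everywhere i with ℕP.≤-<-connex bound i
    ... | inj₁ le = ≡.trans (occ-beyond a (ℕP.≤-trans (s≤s (ℕP.m≤m+n _ _)) le)) (≡.sym (occ-beyond b (ℕP.≤-trans (s≤s (ℕP.m≤n+m _ (sum a))) le)))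
    ... | inj₂ lt = ℕP.≡ᵇ⇒≡ _ _ (and-sound bound test (≡.subst (λ l → T (and l)) (ListP.map-upTo test bound) (≡.subst T (≡.sym eq) _)) i lt)
  ... | false = unequal λ s → ≡.subst T eq (≡.subst (λ l → T (and l)) (≡.sym (ListP.map-upTo (λ i → occ i a ≡ᵇ occ i b) (suc (sum a + sum b))))
      (and-complete (suc (sum a + sum b)) _ λ i → ℕP.≡⇒≡ᵇ _ _ (s i)))

  product-cong : ∀ n {f h} → (∀ i → f i ≡ h i) → product (applyUpTo f n) ≡ product (applyUpTo h n)
  product-cong zero e = ≡.refl
  product-cong (suc n) e = ≡.cong₂ _*_ (e 0) (product-cong n λ i → e (suc i))

  product-scale : ∀ n k c {f h} → k < n → f k ≡ c * h k → (∀ i → i ≢ k → f i ≡ h i) → product (applyUpTo f n) ≡ c * product (applyUpTo h n)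
  product-scale (suc n) zero c _ e o = ≡.trans (≡.cong₂ _*_ e (product-cong n λ i → o (suc i) λ ())) (ℕP.*-assoc c _ _)
  product-scale (suc n) (suc k) c {f} {h} (s≤s lt) e o = ≡.trans (≡.cong₂ _*_ (o 0 λ ()) (product-scale n k c lt e λ i ne → o (suc i) λ e → ne (ℕP.suc-injective e)))
    (≡.trans (≡.sym (ℕP.*-assoc (h 0) c _)) (≡.trans (≡.cong (_* product (applyUpTo (λ i → h (suc i)) n)) (ℕP.*-comm (h 0) c)) (ℕP.*-assoc c (h 0) _)))

  product-extend : ∀ {m n f} → m ≤ n → (∀ i → m ≤ i → f i ≡ 1) → product (applyUpTo f n) ≡ product (applyUpTo f m)
  product-extend {n = zero} z≤n _ = ≡.refl
  product-extend {n = suc n} {f} z≤n e = ≡.trans (≡.cong₂ _*_ (e 0 z≤n) (product-extend {n = n} {λ i → f (suc i)} z≤n λ i _ → e (suc i) z≤n)) ≡.refl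
  product-extend {f = f} (s≤s le) e = ≡.cong (f 0 *_) (product-extend le λ i q → e (suc i) (s≤s q))

  -- The factor gained is, up to α, the one that contracting the part k + 1 with its occurrences
  -- produces in the scalar product; this makes the norm of a power sum product an induction.
  zee-∷ : ∀ k v → zee (suc k ∷ v) ≡ suc k * suc (occ (suc k) v) * zee v
  zee-∷ k v = ≡.trans (≡.cong product (ListP.map-upTo (factor (suc k ∷ v)) bound))
    (≡.trans (product-scale bound k (suc k * suc o) (s≤s (ℕP.m≤m+n k (sum v))) at-k λ i ne → ≡.cong (λ m → suc i ^ m * m !) (occ-other v λ e → ne (ℕP.suc-injective e)))
    (≡.cong (suc k * suc o *_) (≡.trans (product-extend (ℕP.m≤n+m (sum v) (suc k)) λ i le → ≡.cong (λ m → suc i ^ m * m !) (occ-beyond v (s≤s le)))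
      (≡.cong product (≡.sym (ListP.map-upTo (factor v) (sum v)))))))
    where
    factor : List ℕ → ℕ → ℕ
    factor v i = suc i ^ occ (suc i) v * occ (suc i) v !
    bound = suc k + sum v
    o = occ (suc k) v
    at-k : factor (suc k ∷ v) k ≡ suc k * suc o * factor v k
    at-k = ≡.trans (≡.cong (λ m → suc k ^ m * m !) (occ-same (suc k) v)) (ℕP.[m*n]*[o*p]≡[m*o]*[n*p] (suc k) (suc k ^ o) (suc o) (o !))

-- Interpretation of formal sums of power sums

module Interpretation (R : RationalFunctions) (A : SymmetricAlgebra (RationalFunctions.field-of-fractions R)) where
  open RationalFunctions R renaming (field-of-fractions to K)
  open CoeffField K
  open FieldFacts K
  open SymmetricFunctions K using (δ; weight)
  open SymmetricAlgebra A
  open AlgebraFacts K A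
  open Generating K A
  open Coefficients K A
  open Multisets hiding (same; other)

  word : List ℕ → Λ
  word []      = 𝟙
  word (a ∷ w) = q (a ∸ 1) ⊗ word w

  Positive : List ℕ → Set
  Positive = All (1 ℕ.≤_)

  infix 4 _↝_
  -- A relation and not a function, since coefficients with denominator zero have no value; `conv`
  -- closes it under equality of symmetric functions.
  data _↝_ : Sym → Λ → Set where
    []   : [] ↝ 𝟘
    term : ∀ {x c w f y} → x ⇝ c → Positive w → f ↝ y → (x , w) ∷ f ↝ con c ⊗ word w ⊕ y
    conv : ∀ {f x y} → x ≐ y → f ↝ x → f ↝ y

  word-++ : ∀ a b → word (a ++ b) ≐ word a ⊗ word b
  word-++ [] b = ≐-sym (L.*-identityˡ _)
  word-++ (x ∷ a) b = ≐-trans (⊗-cong ≐-refl (word-++ a b)) (≐-sym (L.*-assoc _ _ _))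

  ↝-++ : ∀ {f h x y} → f ↝ x → h ↝ y → f ++ h ↝ x ⊕ y
  ↝-++ [] t = conv (≐-sym (L.+-identityˡ _)) t
  ↝-++ (term e p s) t = conv (≐-sym (L.+-assoc _ _ _)) (term e p (↝-++ s t))
  ↝-++ (conv e s) t = conv (⊕-cong e ≐-refl) (↝-++ s t)

  ↝-term : ∀ {k d w h y} → k ⇝ d → Positive w → h ↝ y → map (λ u → (k *F proj₁ u , w ++ proj₂ u)) h ↝ con d ⊗ word w ⊗ y
  ↝-term e p [] = conv (≐-sym (L.zeroʳ _)) []
  ↝-term {d = d} {w} e p (term {c = c} {w′} {y = y} e′ p′ s) = conv (≐-trans (⊕-cong (≐-trans (⊗-cong (con-⊗ d c) (word-++ w w′))
      (solveΛ 4 (λ d c w v → d :⊗ c :⊗ (w :⊗ v) :≐ d :⊗ w :⊗ (c :⊗ v)) ≐-refl _ _ _ _)) ≐-refl) (≐-sym (L.distribˡ _ _ _))) (term (⇝-* e e′) (++⁺ p p′) (↝-term e p s))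
  ↝-term e p (conv f s) = conv (⊗-cong ≐-refl f) (↝-term e p s)

  ↝-⊙ : ∀ {f h x y} → f ↝ x → h ↝ y → f ⊙ h ↝ x ⊗ y
  ↝-⊙ [] t = conv (≐-sym (L.zeroˡ _)) []
  ↝-⊙ (term e p s) t = conv (≐-sym (L.distribʳ _ _ _)) (↝-++ (↝-term e p t) (↝-⊙ s t))
  ↝-⊙ (conv e s) t = conv (⊗-cong e ≐-refl) (↝-⊙ s t)

  ↝-scale : ∀ {k d f x} → k ⇝ d → f ↝ x → scaleS k f ↝ con d ⊗ x
  ↝-scale e [] = conv (≐-sym (L.zeroʳ _)) []
  ↝-scale {d = d} e (term {c = c} e′ p s) = conv (≐-trans (⊕-cong (≐-trans (⊗-cong (con-⊗ d c) ≐-refl) (L.*-assoc _ _ _)) ≐-refl) (≐-sym (L.distribˡ _ _ _))) (term (⇝-* e e′) p (↝-scale e s))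
  ↝-scale e (conv f s) = conv (⊗-cong ≐-refl f) (↝-scale e s)

  interpret : ∀ f → WellFormed f → Σ Λ (f ↝_)
  interpret [] [] = 𝟘 , []
  interpret ((x , w) ∷ f) ((v , p) ∷ wf) = let (c , e) = ⇝-valid x v ; (y , s) = interpret f wf in con c ⊗ word w ⊕ y , term e p s

  data Sums : List RF → Carrier → Set where
    []   : Sums [] 0#
    _∷_  : ∀ {x c l d} → x ⇝ c → Sums l d → Sums (x ∷ l) (c + d)
    conv : ∀ {l c d} → c ≈ d → Sums l c → Sums l d

  sums-++ : ∀ {l m c d} → Sums l c → Sums m d → Sums (l ++ m) (c + d)
  sums-++ [] t = conv (sym (+-identityˡ _)) t
  sums-++ (e ∷ s) t = conv (sym (+-assoc _ _ _)) (e ∷ sums-++ s t)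
  sums-++ (conv e s) t = conv (+-congʳ e) (sums-++ s t)

  sums-value : ∀ {l c} → Sums l c → sumF l ⇝ c
  sums-value [] = ⇝-0
  sums-value (e ∷ s) = ⇝-+ e (sums-value s)
  sums-value (conv e s) = ⇝-≈ (sums-value s) e

  α^_ : ℕ → Carrier
  α^ zero  = 1#
  α^ suc n = α * α^ n

  ⇝-power : ∀ n → powF αF n ⇝ α^ n
  ⇝-power zero = ⇝-1
  ⇝-power (suc n) = ⇝-* ⇝-α (⇝-power n)

  δ-same : ∀ k → δ k k ≈ 1#
  δ-same zero = refl
  δ-same (suc k) = δ-same k

  δ-other : ∀ i j → i ≢ j → δ i j ≈ 0#
  δ-other zero zero ne = ⊥-elim (ne ≡.refl)
  δ-other zero (suc j) ne = refl
  δ-other (suc i) zero ne = refl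
  δ-other (suc i) (suc j) ne = δ-other i j λ e → ne (≡.cong suc e)

  word-remove : ∀ k w → occ (suc k) w ≢ 0 → word w ≐ q k ⊗ word (remove (suc k) w)
  word-remove k [] nz = ⊥-elim (nz ≡.refl)
  word-remove k (y ∷ w) nz with suc k ≡ᵇ y | compare (suc k) y
  ... | true  | Multisets.same ≡.refl = ≐-refl
  ... | false | _ = ≐-trans (⊗-cong ≐-refl (word-remove k w nz)) (solveΛ 3 (λ a b c → a :⊗ (b :⊗ c) :≐ b :⊗ (a :⊗ c)) ≐-refl _ _ _)

  occurrences-word : ∀ k w → con (ι (occ (suc k) w)) ⊗ (q k ⊗ word (remove (suc k) w)) ≐ con (ι (occ (suc k) w)) ⊗ word w
  occurrences-word k w = cases (occ (suc k) w ℕP.≟ 0)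
    where
    cases : Dec (occ (suc k) w ≡ 0) → _
    cases (yes z) = ≐-trans (⊗-cong (≡⇒≐ (≡.cong (λ n → con (ι n)) z)) ≐-refl) (≐-trans (con-0⊗ _) (≐-sym (≐-trans (⊗-cong (≡⇒≐ (≡.cong (λ n → con (ι n)) z)) ≐-refl) (con-0⊗ _))))
    cases (no nz) = ⊗-cong ≐-refl (≐-sym (word-remove k w nz))

  perp-word : ∀ k {w} → Positive w → perp (q k) (word w) ≐ con (weight k) ⊗ (con (ι (occ (suc k) w)) ⊗ word (remove (suc k) w))
  perp-word k [] = ≐-trans (perp-cong ≐-refl (≐-sym con-1)) (≐-trans (perp-q-con k 1#) (≐-sym (≐-trans (⊗-cong ≐-refl (con-0⊗ _)) (L.zeroʳ _))))
  perp-word k {suc j ∷ w} (_ ∷ p) = ≐-trans (perp-q-⊗ k _ _) (≐-trans (⊕-cong (⊗-cong (≐-trans (perp-q-q k j) (con-⊗ _ _)) ≐-refl) (⊗-cong ≐-refl (perp-word k p))) (at (compare (suc k) (suc j))))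
    where
    at : Compare (suc k) (suc j) (suc k ≡ᵇ suc j) → con (weight k) ⊗ con (δ k j) ⊗ word w ⊕ q j ⊗ (con (weight k) ⊗ (con (ι (occ (suc k) w)) ⊗ word (remove (suc k) w)))
      ≐ con (weight k) ⊗ (con (ι (occ (suc k) (suc j ∷ w))) ⊗ word (remove (suc k) (suc j ∷ w)))
    at c with k ≡ᵇ j | c
    ... | true | Multisets.same ≡.refl = ≐-trans (⊕-cong (⊗-cong (⊗-cong ≐-refl (≐-trans (con-cong (δ-same k)) con-1)) ≐-refl)
        (≐-trans (solveΛ 4 (λ a b c d → a :⊗ (b :⊗ (c :⊗ d)) :≐ b :⊗ (c :⊗ (a :⊗ d))) ≐-refl _ _ _ _) (⊗-cong ≐-refl (occurrences-word k w))))
      (≐-trans (solveΛ 3 (λ a c d → a :⊗ :𝟙 :⊗ d :⊕ a :⊗ (c :⊗ d) :≐ a :⊗ ((:𝟙 :⊕ c) :⊗ d)) ≐-refl _ _ _) (⊗-cong ≐-refl (⊗-cong (≐-sym (≐-trans (con-⊕ _ _) (⊕-cong con-1 ≐-refl))) ≐-refl)))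
    ... | false | Multisets.other ne = ≐-trans (⊕-cong (≐-trans (⊗-cong (⊗-cong ≐-refl (≐-trans (con-cong (δ-other k j λ e → ne (≡.cong suc e))) con-0)) ≐-refl)
        (solveΛ 2 (λ a d → a :⊗ :𝟘 :⊗ d :≐ :𝟘) ≐-refl _ _)) ≐-refl)
      (solveΛ 4 (λ a b c d → :𝟘 :⊕ a :⊗ (b :⊗ (c :⊗ d)) :≐ b :⊗ (c :⊗ (a :⊗ d))) ≐-refl _ _ _ _)

  pairing-step : ∀ k a {b} → Positive b → ⟨ word (suc k ∷ a) , word b ⟩ ≈ weight k * (ι (occ (suc k) b) * ⟨ word a , word (remove (suc k) b) ⟩)
  pairing-step k a p = trans (⟨⟩-perpˡ _ _ _) (trans (⟨⟩-congʳ _ (perp-word k p)) (trans (⟨⟩-conʳ _ _ _) (*-congˡ (⟨⟩-conʳ _ _ _))))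

  pairing-distinct : ∀ {a b} → Positive a → Positive b → ¬ Same a b → ⟨ word a , word b ⟩ ≈ 0#
  pairing-distinct [] [] ne = ⊥-elim (ne λ _ → ≡.refl)
  pairing-distinct {b = suc j ∷ b} [] p ne = trans (⟨⟩-comm _ _) (trans (pairing-step j b []) (trans (*-congˡ (zeroˡ _)) (zeroʳ _)))
  pairing-distinct {suc k ∷ a} {b} (_ ∷ p) p′ ne = trans (pairing-step k a p′) (trans (*-congˡ (cases (occ (suc k) b ℕP.≟ 0))) (zeroʳ _))
    where
    cases : Dec (occ (suc k) b ≡ 0) → ι (occ (suc k) b) * ⟨ word a , word (remove (suc k) b) ⟩ ≈ 0#
    cases (yes z) = trans (*-congʳ (reflexive (≡.cong ι z))) (zeroˡ _)
    cases (no nz) = trans (*-congˡ (pairing-distinct p (all-remove (suc k) p′) λ s → ne λ i → ≡.trans (occ-∷-cong i (suc k) {a} {remove (suc k) b} (s i)) (≡.sym (occ-remove (suc k) b nz i)))) (zeroʳ _)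

  -- Both words lose one part at a time: a part of the first is contracted with each of its
  -- occurrences in the second, and `zee-∷` records the same count.
  pairing-same : ∀ {a b} → Positive a → Positive b → Same a b → ⟨ word a , word b ⟩ ≈ ι (zee a) * α^ length a
  pairing-same {b = []} [] [] s = trans ⟨𝟙,𝟙⟩ (solve 0 (:1 := (:1 :+ :0) :* :1) refl)
  pairing-same {b = j ∷ b} [] p s with ≡.trans (s j) (occ-same j b)
  ... | ()
  pairing-same {suc k ∷ a} {b} (_ ∷ p) p′ s = trans (pairing-step k a p′) (trans (*-congˡ (*-cong (reflexive (≡.cong ι count)) (pairing-same p (all-remove (suc k) p′) smaller)))
      (trans (solve 5 (λ α k o z n → α :* k :* (o :* (z :* n)) := k :* o :* z :* (α :* n)) refl α (ι (suc k)) (ι (suc (occ (suc k) a))) (ι (zee a)) (α^ length a))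
      (*-congʳ (sym (trans (reflexive (≡.cong ι (zee-∷ k a))) (trans (ι-* (suc k ℕ.* suc (occ (suc k) a)) (zee a)) (*-congʳ (ι-* (suc k) (suc (occ (suc k) a))))))))))
    where
    count : occ (suc k) b ≡ suc (occ (suc k) a)
    count = ≡.trans (≡.sym (s (suc k))) (occ-same (suc k) a)
    nz : occ (suc k) b ≢ 0
    nz z with ≡.trans (≡.sym count) z
    ... | ()
    smaller : Same a (remove (suc k) b)
    smaller i = occ-∷-cancel i (suc k) {a} {remove (suc k) b} (≡.trans (s i) (occ-remove (suc k) b nz i))

  pairing-value : ∀ {f h x y} → f ↝ x → h ↝ y → ⟪ f , h ⟫ ⇝ ⟨ x , y ⟩
  pairing-value s t = sums-value (rows s t)
    where
    entry : RF × List ℕ → RF × List ℕ → RF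
    entry t u = if sameMultisetᵇ (proj₂ t) (proj₂ u) then proj₁ t *F proj₁ u *F fromℕF (zee (proj₂ t)) *F powF αF (length (proj₂ t)) else 0F
    entry-value : ∀ {x c a x′ c′ a′} → x ⇝ c → Positive a → x′ ⇝ c′ → Positive a′ → entry (x , a) (x′ , a′) ⇝ c * (c′ * ⟨ word a , word a′ ⟩)
    entry-value {c = c} {a} {c′ = c′} {a′} e p e′ p′ with sameMultisetᵇ a a′ | comparison a a′
    ... | true  | equal s = ⇝-≈ (⇝-* (⇝-* (⇝-* e e′) (⇝-ℕ (zee a))) (⇝-power (length a)))
      (trans (solve 4 (λ c d z n → c :* d :* z :* n := c :* (d :* (z :* n))) refl c c′ _ _) (*-congˡ (*-congˡ (sym (pairing-same p p′ s)))))
    ... | false | unequal ne = ⇝-≈ ⇝-0 (sym (trans (*-congˡ (trans (*-congˡ (pairing-distinct p p′ ne)) (zeroʳ _))) (zeroʳ _)))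
    row : ∀ {x c a h y} → x ⇝ c → Positive a → h ↝ y → Sums (map (entry (x , a)) h) (c * ⟨ word a , y ⟩)
    row e p [] = conv (sym (trans (*-congˡ (⟨⟩-𝟘ʳ _)) (zeroʳ _))) []
    row e p (term e′ p′ t) = conv (trans (sym (distribˡ _ _ _)) (*-congˡ (sym (trans (⟨⟩-⊕ʳ _ _ _) (+-congʳ (⟨⟩-conʳ _ _ _)))))) (entry-value e p e′ p′ ∷ row e p t)
    row e p (conv f t) = conv (*-congˡ (⟨⟩-congʳ _ f)) (row e p t)
    rows : ∀ {f h x y} → f ↝ x → h ↝ y → Sums (concatMap (λ t → map (entry t) h) f) ⟨ x , y ⟩
    rows [] t = conv (sym (⟨⟩-𝟘ˡ _)) []
    rows (term e p s) t = conv (sym (trans (⟨⟩-⊕ _ _ _) (+-congʳ (⟨⟩-con _ _ _)))) (sums-++ (row e p t) (rows s t))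
    rows (conv f s) t = conv (⟨⟩-congˡ _ f) (rows s t)

  Σ-G : List (List ℕ) → Λ
  Σ-G []      = 𝟘
  Σ-G (u ∷ l) = G u ⊕ Σ-G l

  Σ-G-∷ : ∀ m l → Σ-G (map (m ∷_) l) ≐ γ m ⊗ Σ-G l
  Σ-G-∷ m [] = ≐-sym (L.zeroʳ _)
  Σ-G-∷ m (u ∷ l) = ≐-trans (⊕-cong ≐-refl (Σ-G-∷ m l)) (≐-sym (L.distribˡ _ _ _))

  -- By the Leibniz rule k + 1 is taken off one exponent in all possible ways, and these ways are
  -- what `placements` enumerates.
  perp-q-G : ∀ k v → perp (q k) (G v) ≐ Σ-G (placements (suc k) v)
  perp-q-G k [] = ≐-trans (perp-cong ≐-refl (≐-sym con-1)) (perp-q-con k 1#)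
  perp-q-G k (m ∷ v) = ≐-trans (perp-q-⊗ k _ _) (≐-trans (⊕-cong (⊗-cong (perp-γ k m) ≐-refl) (≐-trans (⊗-cong ≐-refl (perp-q-G k v)) (≐-sym (Σ-G-∷ m (placements (suc k) v))))) head)
    where
    head : g 1# m (suc k) ⊗ G v ⊕ Σ-G (map (m ∷_) (placements (suc k) v)) ≐ Σ-G (placements (suc k) (m ∷ v))
    head with suc k ≤ᵇ m in eq
    ... | true  = ⊕-cong (⊗-cong (≡⇒≐ (g-inside 1# (ℕP.≤ᵇ⇒≤ (suc k) m (≡.subst T (≡.sym eq) _)))) ≐-refl) ≐-refl
    ... | false = ≐-trans (⊕-cong (≐-trans (⊗-cong (≡⇒≐ (g-outside 1# {m} {suc k} (ℕP.≰⇒> λ le → ≡.subst T eq (ℕP.≤⇒≤ᵇ le)))) ≐-refl) (L.zeroˡ _)) ≐-refl) (L.+-identityˡ _)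

  -- Here the duality between products of g's and monomials meets the counting definition of
  -- coefficients: each power sum of the word moves across as an adjoint and is placed into one
  -- variable.
  C-word : ∀ {w} → Positive w → ∀ v → C v (word w) ≈ ι (countAssign w v)
  C-word [] v = zeros v
    where
    zeros : ∀ v → ⟨ 𝟙 , G v ⟩ ≈ ι (if and (map (_≡ᵇ 0) v) then 1 else 0)
    zeros [] = trans ⟨𝟙,𝟙⟩ (sym (+-identityʳ _))
    zeros (zero ∷ v) = trans (⟨⟩-congʳ _ (L.*-identityˡ _)) (zeros v)
    zeros (suc m ∷ v) = hom-C (suc m ∷ v) hom-𝟙 λ ()
  C-word {suc k ∷ w} (_ ∷ p) v = trans (⟨⟩-perpˡ _ _ _) (trans (⟨⟩-congʳ _ (perp-q-G k v)) (total (placements (suc k) v)))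
    where
    total : ∀ l → ⟨ word w , Σ-G l ⟩ ≈ ι (sum (map (countAssign w) l))
    total [] = ⟨⟩-𝟘ʳ _
    total (u ∷ l) = trans (⟨⟩-⊕ʳ _ _ _) (trans (+-cong (C-word p u) (total l)) (sym (ι-+ (countAssign w u) _)))

  monoCoeff-value : ∀ μ {f x} → f ↝ x → monoCoeff μ f ⇝ C (parts μ) x
  monoCoeff-value μ s = sums-value (terms s)
    where
    terms : ∀ {f x} → f ↝ x → Sums (map (λ t → proj₁ t *F fromℕF (countAssign (proj₂ t) (parts μ))) f) (C (parts μ) x)
    terms [] = conv (sym (⟨⟩-𝟘ˡ _)) []
    terms (term {w = w} e p s) = conv (sym (trans (⟨⟩-⊕ _ _ _) (+-congʳ (trans (⟨⟩-con _ _ _) (*-congˡ (C-word p (parts μ))))))) (⇝-* e (⇝-ℕ (countAssign w (parts μ))) ∷ terms s)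
    terms (conv e s) = conv (⟨⟩-congˡ _ e) (terms s)

-- Products over boxes

module BoxProducts (R : RationalFunctions) where
  open RationalFunctions R renaming (field-of-fractions to K)
  open CoeffField K
  open FieldFacts K
  open HookProducts K
  open Partitions

  data Products : List Poly → Carrier → Set where
    []   : Products [] 1#
    _∷_  : ∀ {p c l d} → fromP p ⇝ c → Products l d → Products (p ∷ l) (c * d)
    conv : ∀ {l c d} → c ≈ d → Products l c → Products l d

  products-++ : ∀ {l m c d} → Products l c → Products m d → Products (l ++ m) (c * d)
  products-++ [] t = conv (sym (*-identityˡ _)) t
  products-++ (e ∷ s) t = conv (sym (*-assoc _ _ _)) (e ∷ products-++ s t)
  products-++ (conv e s) t = conv (*-congʳ e) (products-++ s t)

  products-value : ∀ {l c} → Products l c → fromP (productP l) ⇝ c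
  products-value [] = ⇝-1
  products-value (e ∷ s) = ⇝-product e (products-value s)
  products-value (conv e s) = ⇝-≈ (products-value s) e

  products-row : ∀ n {f : ℕ → Poly} {F : ℕ → Carrier} → (∀ j → j ℕ.< n → fromP (f j) ⇝ F j) → Products (applyUpTo f n) (Π< n F)
  products-row zero e = []
  products-row (suc n) {F = F} e = conv (sym (Π-first n F)) (e 0 (s≤s z≤n) ∷ products-row n λ j lt → e (suc j) (s≤s lt))

  products-boxes : ∀ (f : ℕ × ℕ → Poly) k x σ {F c} → (∀ j → j ℕ.< x → fromP (f (k , suc j)) ⇝ F j) → Products (map f (boxesFrom (suc k) σ)) c →
    Products (map f (boxesFrom k (x ∷ σ))) (Π< x F * c)
  products-boxes f k x σ {F} {c} e s = ≡.subst (λ l → Products l (Π< x F * c))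
    (≡.sym (≡.trans (ListP.map-++ f (map (λ j → k , suc j) (upTo x)) (boxesFrom (suc k) σ)) (≡.cong (_++ map f (boxesFrom (suc k) σ))
      (≡.trans (≡.sym (ListP.map-∘ (upTo x))) (ListP.map-upTo (λ j → f (k , suc j)) x)))))
    (products-++ (products-row x e) s)

  -- σ consists of the rows of l after the first k.
  record Suffix (l : List ℕ) (k m : ℕ) (σ : List ℕ) : Set where
    field
      bounded : Bounded m σ
      columns : ∀ j → j ℕ.≤ m → conjPart l j ≡ k ℕ.+ conjPart σ j
      rows    : ∀ i → part l (suc (k ℕ.+ i)) ≡ part σ (suc i)
  open Suffix

  whole : ∀ {l} → IsPartition l → Suffix l 0 (sum l) l
  whole p = record { bounded = partition⇒bounded p ; columns = λ _ _ → ≡.refl ; rows = λ _ → ≡.refl }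

  conj-row : ∀ {x j} σ → j ℕ.≤ x → conjPart (x ∷ σ) j ≡ suc (conjPart σ j)
  conj-row {x} {j} σ le with j ≤ᵇ x | ℕP.≤⇒≤ᵇ le
  ... | true | _ = ≡.refl

  rest : ∀ {l k m x σ} → Suffix l k m (x ∷ σ) → Suffix l (suc k) x σ
  rest {l} {k} {m} {x} {σ} s with bounded s
  ... | cons _ x≤m b = record
    { bounded = b
    ; columns = λ j le → ≡.trans (columns s j (ℕP.≤-trans le x≤m)) (≡.trans (≡.cong (k ℕ.+_) (conj-row σ le)) (ℕP.+-suc k _))
    ; rows = λ i → ≡.trans (≡.cong (λ n → part l (suc n)) (≡.sym (ℕP.+-suc k i))) (rows s (suc i)) }

  arm-value : ∀ {l k m x σ} → Suffix l k m (x ∷ σ) → ∀ j → arm l (suc k , suc j) ≡ x ∸ suc j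
  arm-value {l} {k} s j = ≡.cong (_∸ suc j) (≡.trans (≡.cong (λ n → part l (suc n)) (≡.sym (ℕP.+-identityʳ k))) (rows s 0))

  leg-value : ∀ {l k m x σ} → Suffix l k m (x ∷ σ) → ∀ {j} → j ℕ.< x → leg l (suc k , suc j) ≡ conjPart σ (suc j)
  leg-value {l} {k} {σ = σ} s {j} lt with bounded s
  ... | cons _ x≤m _ = ≡.trans (≡.cong (_∸ suc k) (≡.trans (columns s (suc j) (ℕP.≤-trans lt x≤m)) (≡.trans (≡.cong (k ℕ.+_) (conj-row σ lt)) (ℕP.+-suc k _)))) (ℕP.m+n∸m≡n (suc k) _)

  linear-≡ : ∀ {a b c d} → a ≡ c → b ≡ d → fromP (linP a b) ⇝ linear c d
  linear-≡ ≡.refl ≡.refl = ⇝-linear _ _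

  hookLower-value : ∀ {l} → IsPartition l → fromP (hookLower l) ⇝ lowerHooks l
  hookLower-value {l} p = products-value (from l (whole p))
    where
    from : ∀ {k m} σ → Suffix l k m σ → Products (map (λ b → linP (suc (leg l b)) (arm l b)) (boxesFrom (suc k) σ)) (lowerHooks σ)
    from [] s = []
    from {k} (x ∷ σ) s = products-boxes _ (suc k) x σ (λ j lt → linear-≡ (≡.cong suc (leg-value s lt)) (arm-value s j)) (from σ (rest s))

  hookUpper-value : ∀ {l} → IsPartition l → fromP (hookUpper l) ⇝ upperHooks l
  hookUpper-value {l} p = products-value (from l (whole p))
    where
    from : ∀ {k m} σ → Suffix l k m σ → Products (map (λ b → linP (leg l b) (suc (arm l b))) (boxesFrom (suc k) σ)) (upperHooks σ)
    from [] s = []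
    from {k} (x ∷ σ) s = products-boxes _ (suc k) x σ (λ j lt → linear-≡ (leg-value s lt) (≡.cong suc (arm-value s j))) (from σ (rest s))

  h₁-value : ∀ r {l} → IsPartition l → fromP (h₁ r l) ⇝ h₁-product r l
  h₁-value r {l} p = products-value (from l (whole p))
    where
    from : ∀ {k m} σ → Suffix l k m σ → Products (map (λ b → linP (conjPart l (proj₂ b) ∸ proj₁ b) (suc r ∸ proj₂ b)) (boxesFrom (suc k) σ)) (h₁-product r σ)
    from [] s = []
    from {k} (x ∷ σ) s = products-boxes _ (suc k) x σ (λ j lt → linear-≡ {b = r ∸ j} (leg-value s lt) ≡.refl) (from σ (rest s))

  h₂-value : ∀ s l → fromP (h₂ s l) ⇝ h₂-product s l
  h₂-value s l = products-value (from 0 l)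
    where
    from : ∀ k σ → Products (map (λ b → linP (suc s ∸ proj₁ b) (proj₂ b ∸ 1)) (boxesFrom (suc k) σ)) (h₂-product (s ∸ k) σ)
    from k [] = []
    from k (x ∷ σ) = products-boxes _ (suc k) x σ (λ j _ → ⇝-linear (s ∸ k) j)
      (conv (reflexive (≡.cong (λ n → h₂-product n σ) (≡.trans (≡.cong (s ∸_) (ℕP.+-comm 1 k)) (≡.sym (ℕP.∸-+-assoc s k 1))))) (from (suc k) σ))

-- Two encodings of partitions and complements

module Translation where
  open Partitions
  open Complements
  open Columns

  valid⇒partition : ∀ l → T (isPartitionᵇ l) → IsPartition l
  valid⇒partition [] _ = []
  valid⇒partition (x ∷ l) v = cons (proj₁ (split x l v)) (proj₂ (split x l v))
    where
    split : ∀ x l → T (isPartitionᵇ (x ∷ l)) → 1 ℕ.≤ x × Bounded x l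
    split x [] v = ℕP.≤ᵇ⇒≤ 1 x v , []
    split x (y ∷ l) v with y ≤ᵇ x in eq
    ... | true = let (1≤y , b) = split y l v ; y≤x = ℕP.≤ᵇ⇒≤ y x (≡.subst T (≡.sym eq) _) in ℕP.≤-trans 1≤y y≤x , cons 1≤y y≤x b

  partition⇒valid : ∀ {l} → IsPartition l → T (isPartitionᵇ l)
  partition⇒valid [] = _
  partition⇒valid (cons 1≤x b) = join 1≤x b
    where
    join : ∀ {x l} → 1 ℕ.≤ x → Bounded x l → T (isPartitionᵇ (x ∷ l))
    join 1≤x [] = ℕP.≤⇒≤ᵇ 1≤x
    join {x} 1≤x (cons {y} 1≤y y≤x b) with y ≤ᵇ x | ℕP.≤⇒≤ᵇ y≤x
    ... | true | _ = join 1≤y b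

  toPartition : ∀ {l} → IsPartition l → Partition
  toPartition {l} p = mkPartition l (partition⇒valid p)

  isPartition : ∀ κ → IsPartition (parts κ)
  isPartition κ = valid⇒partition (parts κ) (valid κ)

  part-zeros : ∀ {v} → Decreasing 0 v → ∀ i → part v i ≡ 0
  part-zeros [] i = ≡.refl
  part-zeros (z≤n ∷ d) zero = ≡.refl
  part-zeros (z≤n ∷ d) (suc zero) = ≡.refl
  part-zeros (z≤n ∷ d) (suc (suc i)) = part-zeros d (suc i)

  part-dropZeros : ∀ {m v} → Decreasing m v → ∀ i → part (dropZeros v) i ≡ part v i
  part-dropZeros [] i = ≡.refl
  part-dropZeros {v = zero ∷ v} (_ ∷ d) i = ≡.trans (≡.cong (λ u → part u i) (dropZeros-empty d)) (≡.sym (part-zeros (z≤n ∷ d) i))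
  part-dropZeros {v = suc x ∷ v} (_ ∷ d) zero = ≡.refl
  part-dropZeros {v = suc x ∷ v} (_ ∷ d) (suc zero) = ≡.refl
  part-dropZeros {v = suc x ∷ v} (_ ∷ d) (suc (suc i)) = part-dropZeros d (suc i)

  part-rect : ∀ r s i → part (rect r s) i ≡ part (replicate s r) i
  part-rect r s = part-dropZeros (replicate-decreasing r s)

  part-bounded : ∀ {r v} → Decreasing r v → ∀ i → part v i ℕ.≤ part (replicate (length v) r) i
  part-bounded [] i = z≤n
  part-bounded (x≤r ∷ d) zero = z≤n
  part-bounded (x≤r ∷ d) (suc zero) = x≤r
  part-bounded (x≤r ∷ d) (suc (suc i)) = part-bounded (decreasing-weaken x≤r d) (suc i)

  fits : ∀ {r s ν} → IsPartition ν → (∀ i → part ν i ℕ.≤ part (replicate s r) i) → length ν ℕ.≤ s × Decreasing r ν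
  fits [] _ = z≤n , []
  fits {s = zero} (cons 1≤x b) h = ⊥-elim (ℕP.<⇒≱ 1≤x (h 1))
  fits {s = suc s} (cons {v = v} 1≤x b) h = s≤s (proj₁ (fits (bounded⇒partition b) λ { zero → below-zero v ; (suc i) → h (suc (suc i)) })) , h 1 ∷ bounded⇒decreasing b
    where
    below-zero : ∀ v {w} → part v zero ℕ.≤ w
    below-zero [] = z≤n
    below-zero (_ ∷ _) = z≤n

  padded : ℕ → List ℕ → List ℕ
  padded s ν = ν ++ replicate (s ∸ length ν) 0

  zeros : ∀ {v} → Decreasing 0 v → v ≡ replicate (length v) 0
  zeros [] = ≡.refl
  zeros (z≤n ∷ d) = ≡.cong (0 ∷_) (zeros d)

  padded-dropZeros : ∀ {m v} → Decreasing m v → padded (length v) (dropZeros v) ≡ v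
  padded-dropZeros [] = ≡.refl
  padded-dropZeros {v = zero ∷ v} (_ ∷ d) = ≡.trans (≡.cong (padded (suc (length v))) (dropZeros-empty d)) (≡.cong (0 ∷_) (≡.sym (zeros d)))
  padded-dropZeros {v = suc x ∷ v} (_ ∷ d) = ≡.cong (suc x ∷_) (padded-dropZeros d)

  dropZeros-padded : ∀ {ν} n → IsPartition ν → dropZeros (ν ++ replicate n 0) ≡ ν
  dropZeros-padded n [] = dropZeros-zeros n
  dropZeros-padded n (cons (s≤s _) b) = ≡.cong (_ ∷_) (dropZeros-padded n (bounded⇒partition b))

  decreasing-padded : ∀ {m v} n → Decreasing m v → Decreasing m (v ++ replicate n 0)
  decreasing-padded n [] = decreasing-weaken z≤n (replicate-decreasing 0 n)
  decreasing-padded n (q ∷ d) = q ∷ decreasing-padded n d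

  complement-flip : ∀ r s ν → complement r s ν ≡ dropZeros (flip r (padded s ν))
  complement-flip r s ν = ≡.cong dropZeros (ListP.reverse-map (r ∸_) (padded s ν))

  -- The rows of ν, padded with zeros to s entries, serve as witness; containment bounds their
  -- number by s and their size by r.
  contained⇒complementary : ∀ {r s} lam μ ν → parts lam ≡ rect r s → ν ⊆ᴾ lam → parts μ ≡ complement r s (parts ν) → Complementary r s (parts μ) (parts ν)
  contained⇒complementary {r} {s} lam μ ν e sub c = complementary {rows = padded s (parts ν)}
      (≡.trans (ListP.length-++ (parts ν)) (≡.trans (≡.cong (length (parts ν) ℕ.+_) (ListP.length-replicate _)) (ℕP.m+[n∸m]≡n (proj₁ inside))))
      (decreasing-padded (s ∸ length (parts ν)) (proj₂ inside)) (≡.sym (dropZeros-padded _ (isPartition ν))) (≡.trans c (complement-flip r s (parts ν)))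
    where
    inside : length (parts ν) ℕ.≤ s × Decreasing r (parts ν)
    inside = fits (isPartition ν) λ i → ℕP.≤-trans (sub i) (ℕP.≤-reflexive (≡.trans (≡.cong (λ l → part l i) e) (part-rect r s i)))

  complementary⇒contained : ∀ {r s} lam μ ν → parts lam ≡ rect r s → Complementary r s (parts μ) (parts ν) → (ν ⊆ᴾ lam) × parts μ ≡ complement r s (parts ν)
  complementary⇒contained {r} lam μ ν e (complementary {w} ≡.refl d right left) =
    (λ i → ℕP.≤-trans (ℕP.≤-reflexive (≡.trans (≡.cong (λ l → part l i) right) (part-dropZeros d i)))
      (ℕP.≤-trans (part-bounded d i) (ℕP.≤-reflexive (≡.trans (≡.sym (part-rect r (length w) i)) (≡.cong (λ l → part l i) (≡.sym e)))))) ,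
    ≡.trans left (≡.sym (≡.trans (complement-flip r (length w) (parts ν)) (≡.cong (λ u → dropZeros (flip r u)) (≡.trans (≡.cong (padded (length w)) right) (padded-dropZeros d)))))

-- Transfer to a given Jack family

module Main (R : RationalFunctions) (A : SymmetricAlgebra (RationalFunctions.field-of-fractions R))
            (family : Partition → Sym) (isJack : IsJackFamily family) where
  open RationalFunctions R renaming (field-of-fractions to K)
  open CoeffField K
  open FieldFacts K
  open SymmetricAlgebra A
  open AlgebraFacts K A
  open Coefficients K A
  open Interpretation R A
  open BoxProducts R
  open HookProducts K
  open Partitions
  open Complements
  open Translation
  private module Family = IsJackFamily isJack

  -- The theory indexes Jack functions by all lists; lists that are not partitions receive the
  -- default value 𝟘.
  choose : ∀ l → Dec (T (isPartitionᵇ l)) → Λ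
  choose l (yes v) = proj₁ (interpret _ (Family.wellFormed (mkPartition l v)))
  choose l (no _)  = 𝟘

  jack : List ℕ → Λ
  jack l = choose l (T? (isPartitionᵇ l))

  jack-value : ∀ κ → family κ ↝ jack (parts κ)
  jack-value (mkPartition l v) = at (T? (isPartitionᵇ l))
    where
    at : ∀ d → family (mkPartition l v) ↝ choose l d
    -- Proofs of validity of one list agree, so the proof found by `T?` can replace the given one.
    at (yes v′) = ≡.subst (λ u → family (mkPartition l u) ↝ choose l (yes v′)) (T-irrelevant v′ v) (proj₂ (interpret _ (Family.wellFormed (mkPartition l v′))))
    at (no n) = ⊥-elim (n v)

  basis : JackBasis K A
  basis = record
    { P = jack
    ; leading = λ p → reflect (monoCoeff-value (toPartition p) (jack-value (toPartition p))) ⇝-1 (Family.leading (toPartition p))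
    ; triangular = λ pκ pμ n → reflect (monoCoeff-value (toPartition pμ) (jack-value (toPartition pκ))) ⇝-0
        (Family.triangular (toPartition pκ) (toPartition pμ) λ { (e , h) → n (dominated e h) })
    ; orthogonal = λ pκ pμ ne → reflect (pairing-value (jack-value (toPartition pκ)) (jack-value (toPartition pμ))) ⇝-0 (Family.orthogonal (toPartition pκ) (toPartition pμ) ne) }

  integral-value : ∀ κ → Jint family κ ↝ con (lowerHooks (parts κ)) ⊗ jack (parts κ)
  integral-value κ = ↝-scale (hookLower-value (isPartition κ)) (jack-value κ)

  module Product (r s : ℕ) (lam μ ν : Partition) (lam≡ : parts lam ≡ rect r s) where
    a = parts μ
    b = parts ν
    c = rect r s
    -- A cutoff above the degrees of all three partitions, which are not yet known to be related, so
    -- that the truncated operators are complete on them.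
    N = suc (sum c ℕ.+ (sum a ℕ.+ sum b))
    pa = isPartition μ
    pb = isPartition ν
    pc = rect-partition r s
    open Expansion K A basis
    open NormFormula K A basis N
    open Selection K A basis N

    bound-c : sum c ℕ.< N
    bound-c = s≤s (ℕP.m≤m+n _ _)
    bound-a : sum a ℕ.< N
    bound-a = s≤s (ℕP.≤-trans (ℕP.m≤m+n _ (sum b)) (ℕP.m≤n+m _ (sum c)))
    bound-b : sum b ℕ.< N
    bound-b = s≤s (ℕP.≤-trans (ℕP.m≤n+m _ (sum a)) (ℕP.m≤n+m _ (sum c)))

    hooks : Carrier
    hooks = lowerHooks a * lowerHooks b * lowerHooks c

    hooks≉0 : ¬ hooks ≈ 0#
    hooks≉0 = product≉0 (product≉0 (lowerHooks≉0 pa bound-a) (lowerHooks≉0 pb bound-b)) (lowerHooks≉0 pc bound-c)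

    entry : Carrier
    entry = structure r s (jack a) (jack b)

    product-value : ⟪ Jint family μ ⊙ Jint family ν , Jint family lam ⟫ ⇝ hooks * entry
    product-value = ⇝-≈ (pairing-value (↝-⊙ (integral-value μ) (integral-value ν)) (≡.subst (λ l → Jint family lam ↝ con (lowerHooks l) ⊗ jack l) lam≡ (integral-value lam)))
      (trans (⟨⟩-conʳ _ _ _) (trans (*-congˡ (trans (⟨⟩-congˡ _ (solveΛ 4 (λ k x l y → k :⊗ x :⊗ (l :⊗ y) :≐ k :⊗ (l :⊗ (x :⊗ y))) ≐-refl _ _ _ _))
        (trans (⟨⟩-con _ _ _) (*-congˡ (⟨⟩-con _ _ _))))) (solve 4 (λ h k l e → h :* (k :* (l :* e)) := k :* l :* h :* e) refl (lowerHooks c) (lowerHooks a) (lowerHooks b) entry)))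

    selection : ¬ (⟪ Jint family μ ⊙ Jint family ν , Jint family lam ⟫ ≈F 0F) → (ν ⊆ᴾ lam) × parts μ ≡ complement r s (parts ν)
    selection nz = complementary⇒contained lam μ ν lam≡ (by-degree (sum a ℕ.+ sum b ℕP.≟ sum c))
      where
      entry≉0 : ¬ entry ≈ 0#
      entry≉0 z = nz (preserve product-value ⇝-0 (trans (*-congˡ z) (zeroʳ _)))
      by-degree : Dec (sum a ℕ.+ sum b ≡ sum c) → Complementary r s a b
      by-degree (yes e) = select (r ℕ.+ s) r s ℕP.≤-refl bound-c pa pb e entry≉0
      by-degree (no ne) = ⊥-elim (entry≉0 (hom-orthogonal (hom-⊗ (hom-P pa) (hom-P pb)) (hom-P pc) ne))

    nonvanishing : ν ⊆ᴾ lam → parts μ ≡ complement r s (parts ν) → ¬ (⟪ Jint family μ ⊙ Jint family ν , Jint family lam ⟫ ≈F 0F)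
    nonvanishing sub e z = product≉0 hooks≉0 (structure≉0 r s bound-c (contained⇒complementary lam μ ν lam≡ sub e)) (reflect product-value ⇝-0 z)

    formula : ν ⊆ᴾ lam → parts μ ≡ complement r s (parts ν) →
      ⟪ Jint family μ ⊙ Jint family ν , Jint family lam ⟫ ≈F fromP (hookLower a *P hookUpper b *P h₁ r a *P h₂ s b)
    formula sub e = preserve product-value
      (⇝-product (⇝-product (⇝-product (hookLower-value pa) (hookUpper-value pb)) (h₁-value r pa)) (h₂-value s b)) (begin
        hooks * entry ≈⟨ solve 4 (λ k l h e → k :* l :* h :* e := k :* l :* (e :* h)) refl (lowerHooks a) (lowerHooks b) (lowerHooks c) entry ⟩
        lowerHooks a * lowerHooks b * (entry * lowerHooks c) ≈⟨ *-congˡ (proj₂ (value (r ℕ.+ s) r s ℕP.≤-refl bound-c (contained⇒complementary lam μ ν lam≡ sub e))) ⟩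
        lowerHooks a * lowerHooks b * (norm b * (h₁-product r a * h₂-product s b))
          ≈⟨ solve 5 (λ k l n x y → k :* l :* (n :* (x :* y)) := k :* (n :* l) :* x :* y) refl (lowerHooks a) (lowerHooks b) (norm b) (h₁-product r a) (h₂-product s b) ⟩
        -- The lower hooks of J_ν cancel the denominator of the norm of P_ν and leave its upper
        -- hooks; those of J_λ were absorbed by `Value`.
        lowerHooks a * (norm b * lowerHooks b) * h₁-product r a * h₂-product s b ≈⟨ *-congʳ (*-congʳ (*-congˡ (norm-formula pb bound-b))) ⟩
        lowerHooks a * upperHooks b * h₁-product r a * h₂-product s b ∎)
      where open FR

theorem4p7 : (P : Partition → Sym) → IsJackFamily P →
    (r s : ℕ) (lam μ ν : Partition) → parts lam ≡ rect r s →
    ((¬ (⟪ Jint P μ ⊙ Jint P ν , Jint P lam ⟫ ≈F 0F))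
        ⇔ ((ν ⊆ᴾ lam) × (parts μ ≡ complement r s (parts ν))))
    × ((ν ⊆ᴾ lam) → parts μ ≡ complement r s (parts ν) →
        ⟪ Jint P μ ⊙ Jint P ν , Jint P lam ⟫
          ≈F fromP (hookLower (parts μ) *P hookUpper (parts ν) *P h₁ r (parts μ) *P h₂ s (parts ν)))
theorem4p7 P isJack r s lam μ ν lam≡ = mk⇔ selection (λ { (sub , e) → nonvanishing sub e }) , formula
  where open Main.Product Fractions.realization (symmetricFunctions _) P isJack r s lam μ ν lam≡
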